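{- There is an absolute constant $C>0$ such that for every integer $n\ge5$ there is a unitary signing $\sigma$ of the complete graph $K_n$ for which $K_n^\sigma$ has probabilistic (Las Vegas) uniform mixing in expected time $O(n^{3/2})$: for every start vertex $u$ there is a measured-walk protocol on $K_n^\sigma$, with generator $H=\frac1nA(K_n^\sigma)$, which starts in the state $e_u$, stops with probability $1$, always stops in a uniform state, and whose expected total evolution time is at most $C\,n^{3/2}$.
   Context: A unitary signing $\sigma$ of a graph $X$ assigns to each edge a complex number of modulus $1$ such that the signed adjacency matrix $A(X^\sigma)$, with $(a,b)$-entry $\sigma(ab)$ if $ab\in E(X)$ and $0$ otherwise, is Hermitian (so $\sigma(ba)=\overline{\sigma(ab)}$). $X^\sigma$ denotes the resulting signed graph. For a graph $Y$ with vertex set $V$, $|V|=N$, states are unit vectors in $\mathbb{C}^V$, and $e_v$ denotes the standard basis vector of $v\in V$. For a Hermitian generator $H$ on $\mathbb{C}^V$ (the adjacency matrix of $Y$ or a positive real multiple of it), evolving for time $t\ge0$ maps $\psi$ to $e^{ -itH}\psi$. The partial measurement relative to a vertex $a$ uses the projections $P_1=e_ae_a^T$ and $P_0=I-e_ae_a^T$: applied to a state $\psi$ it returns outcome $j\in\{0,1\}$ with probability $\|P_j\psi\|^2$, after which the state is $P_j\psi/\|P_j\psi\|$. A measured-walk protocol is an adaptive sequence of steps, each being either an evolution for some chosen time $t\ge 0$ or an (instantaneous) partial measurement relative to some chosen vertex, together with a stopping rule; all choices may depend on the start vertex and on previous measurement outcomes. Its total evolution time is the random variable given by the sum of the durations of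 the evolution steps before stopping. A state $\psi$ is uniform if $|\psi(v)|^2=1/N$ for all $v\in V$. Times are measured with the adjacency matrix scaled by $1/n$ (so that the generator has bounded norm). -}

module Defs where

open import Algebra.Bundles.Raw using (RawMonoid)
import Algebra.Definitions.RawMonoid as RawMonoidDefs
open import Data.Bool.Base using (if_then_else_)
open import Data.Fin.Base using (Fin; zero; suc; toℕ)
import Data.Fin.Properties as Fin
open import Data.Fin.Patterns using (0F; 1F)
open import Data.Integer.Base using (+_)
open import Data.List.Base using (List; []; _∷_)
open import Data.Nat.Base as ℕ using (ℕ; NonZero; _!; _⊔_)
import Data.Nat.Properties as ℕ
open import Data.Product using (Σ; ∃-syntax; _×_; _,_)
open import Data.Rational.Base as ℚ using (ℚ; 0ℚ; 1ℚ; ∣_∣)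
import Data.Rational.Properties as ℚ
open import Data.Rational.Solver using (module +-*-Solver)
open import Data.Unit.Base using (⊤)
open import Data.Vec.Functional using (Vector)
open import Level using (0ℓ)
open import Relation.Binary.Definitions using (Decidable; Symmetric; Irreflexive)
open import Relation.Binary.PropositionalEquality
open import Relation.Nullary using (¬_; does; ¬?)

------------------------------------------------------------------------
-- Real numbers, as Cauchy sequences of rationals. Equality is the relation _≈_
-- below. The Cauchy proofs are abstract to keep normal forms small.

IsCauchy : (ℕ → ℚ) → Set
IsCauchy x = ∀ ε → 0ℚ ℚ.< ε →
  ∃[ N ] (∀ m n → N ℕ.≤ m → N ℕ.≤ n → ∣ x m ℚ.- x n ∣ ℚ.≤ ε)

record ℝ : Set where
  constructor mkℝ
  field
    seq    : ℕ → ℚ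
    cauchy : IsCauchy seq

open ℝ public

private
  half : ℚ → ℚ
  half ε = ℚ.½ ℚ.* ε

  0<half : ∀ {ε} → 0ℚ ℚ.< ε → 0ℚ ℚ.< half ε
  0<half {ε} 0<ε =
    subst (ℚ._< half ε) (ℚ.*-zeroʳ ℚ.½) (ℚ.*-monoʳ-<-pos ℚ.½ 0<ε)

  half+half : ∀ ε → half ε ℚ.+ half ε ≡ ε
  half+half ε = trans (sym (ℚ.*-distribʳ-+ ε ℚ.½ ℚ.½)) (ℚ.*-identityˡ ε)

  ≤⊔ˡ : ∀ {m n o} → m ⊔ n ℕ.≤ o → m ℕ.≤ o
  ≤⊔ˡ {m} {n} = ℕ.≤-trans (ℕ.m≤m⊔n m n)

  ≤⊔ʳ : ∀ {m n o} → m ⊔ n ℕ.≤ o → n ℕ.≤ o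
  ≤⊔ʳ {m} {n} = ℕ.≤-trans (ℕ.m≤n⊔m m n)

  abstract
    const-cauchy : ∀ q → IsCauchy (λ _ → q)
    const-cauchy q ε 0<ε = 0 , λ _ _ _ _ →
      subst (λ r → ∣ r ∣ ℚ.≤ ε) (sym (ℚ.+-inverseʳ q)) (ℚ.<⇒≤ 0<ε)

    neg-cauchy : ∀ {x} → IsCauchy x → IsCauchy (λ n → ℚ.- x n)
    neg-cauchy {x} cx ε 0<ε with cx ε 0<ε
    ... | N , h = N , λ m n N≤m N≤n →
      subst (ℚ._≤ ε)
        (trans (sym (ℚ.∣-p∣≡∣p∣ (x m ℚ.- x n)))
               (cong ∣_∣ (ℚ.neg-distrib-+ (x m) (ℚ.- x n))))
        (h m n N≤m N≤n)

    add-cauchy : ∀ {x y} → IsCauchy x → IsCauchy y → IsCauchy (λ n → x n ℚ.+ y n)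
    add-cauchy {x} {y} cx cy ε 0<ε
      with cx (half ε) (0<half 0<ε) | cy (half ε) (0<half 0<ε)
    ... | M , hx | N , hy = M ⊔ N , λ m n ≤m ≤n → begin
      ∣ (x m ℚ.+ y m) ℚ.- (x n ℚ.+ y n) ∣
        ≡⟨ cong ∣_∣ (rearrange (x m) (y m) (x n) (y n)) ⟩
      ∣ (x m ℚ.- x n) ℚ.+ (y m ℚ.- y n) ∣
        ≤⟨ ℚ.∣p+q∣≤∣p∣+∣q∣ (x m ℚ.- x n) (y m ℚ.- y n) ⟩
      ∣ x m ℚ.- x n ∣ ℚ.+ ∣ y m ℚ.- y n ∣
        ≤⟨ ℚ.+-mono-≤ (hx m n (≤⊔ˡ ≤m) (≤⊔ˡ ≤n))
                      (hy m n (≤⊔ʳ {M} ≤m) (≤⊔ʳ {M} ≤n)) ⟩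
      half ε ℚ.+ half ε
        ≡⟨ half+half ε ⟩
      ε ∎
      where
      open ℚ.≤-Reasoning
      rearrange : ∀ a b c d →
        (a ℚ.+ b) ℚ.- (c ℚ.+ d) ≡ (a ℚ.- c) ℚ.+ (b ℚ.- d)
      rearrange = solve 4 (λ a b c d →
        (a :+ b) :- (c :+ d) := (a :- c) :+ (b :- d)) refl
        where open +-*-Solver

    bounded : ∀ {x} → IsCauchy x →
      ∃[ B ] (ℚ.Positive B × ∃[ N ] (∀ n → N ℕ.≤ n → ∣ x n ∣ ℚ.≤ B))
    bounded {x} cx with cx 1ℚ (ℚ.positive⁻¹ 1ℚ)
    ... | N , h =
      1ℚ ℚ.+ ∣ x N ∣ ,
      ℚ.pos+nonNeg⇒pos 1ℚ ∣ x N ∣ {{ℚ.∣-∣-nonNeg (x N)}} ,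
      N , λ n N≤n → begin
        ∣ x n ∣                        ≡⟨ cong ∣_∣ (split (x n) (x N)) ⟩
        ∣ (x n ℚ.- x N) ℚ.+ x N ∣      ≤⟨ ℚ.∣p+q∣≤∣p∣+∣q∣ (x n ℚ.- x N) (x N) ⟩
        ∣ x n ℚ.- x N ∣ ℚ.+ ∣ x N ∣    ≤⟨ ℚ.+-monoˡ-≤ ∣ x N ∣ (h n N N≤n ℕ.≤-refl) ⟩
        1ℚ ℚ.+ ∣ x N ∣                 ∎
      where
      open ℚ.≤-Reasoning
      split : ∀ a b → a ≡ (a ℚ.- b) ℚ.+ b
      split = solve 2 (λ a b → a := (a :- b) :+ b) refl
        where open +-*-Solver

    product≤ : ∀ p q r s → .{{ℚ.NonNegative r}} →
      ∣ p ∣ ℚ.≤ r → ∣ q ∣ ℚ.≤ s → ∣ p ℚ.* q ∣ ℚ.≤ r ℚ.* s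
    product≤ p q r s p≤r q≤s = begin
      ∣ p ℚ.* q ∣      ≡⟨ ℚ.∣p*q∣≡∣p∣*∣q∣ p q ⟩
      ∣ p ∣ ℚ.* ∣ q ∣  ≤⟨ ℚ.*-monoʳ-≤-nonNeg ∣ q ∣ {{ℚ.∣-∣-nonNeg q}} p≤r ⟩
      r ℚ.* ∣ q ∣      ≤⟨ ℚ.*-monoˡ-≤-nonNeg r q≤s ⟩
      r ℚ.* s          ∎
      where open ℚ.≤-Reasoning

    product-diff≤ : ∀ a b c d A B δ → .{{ℚ.NonNegative A}} → .{{ℚ.NonNegative B}} →
      ∣ a ∣ ℚ.≤ A → ∣ b ℚ.- d ∣ ℚ.≤ δ → ∣ d ∣ ℚ.≤ B → ∣ a ℚ.- c ∣ ℚ.≤ δ →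
      ∣ a ℚ.* b ℚ.- c ℚ.* d ∣ ℚ.≤ (A ℚ.+ B) ℚ.* δ
    product-diff≤ a b c d A B δ a≤A b-d≤δ d≤B a-c≤δ = begin
      ∣ a ℚ.* b ℚ.- c ℚ.* d ∣
        ≡⟨ cong ∣_∣ (rearrange a b c d) ⟩
      ∣ a ℚ.* (b ℚ.- d) ℚ.+ d ℚ.* (a ℚ.- c) ∣
        ≤⟨ ℚ.∣p+q∣≤∣p∣+∣q∣ (a ℚ.* (b ℚ.- d)) (d ℚ.* (a ℚ.- c)) ⟩
      ∣ a ℚ.* (b ℚ.- d) ∣ ℚ.+ ∣ d ℚ.* (a ℚ.- c) ∣
        ≤⟨ ℚ.+-mono-≤ (product≤ a (b ℚ.- d) A δ a≤A b-d≤δ)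
                      (product≤ d (a ℚ.- c) B δ d≤B a-c≤δ) ⟩
      A ℚ.* δ ℚ.+ B ℚ.* δ
        ≡⟨ ℚ.*-distribʳ-+ δ A B ⟨
      (A ℚ.+ B) ℚ.* δ ∎
      where
      open ℚ.≤-Reasoning
      rearrange : ∀ a b c d →
        a ℚ.* b ℚ.- c ℚ.* d ≡ a ℚ.* (b ℚ.- d) ℚ.+ d ℚ.* (a ℚ.- c)
      rearrange = solve 4 (λ a b c d →
        a :* b :- c :* d := a :* (b :- d) :+ d :* (a :- c)) refl
        where open +-*-Solver

    divide : ∀ b ε → ℚ.Positive b → 0ℚ ℚ.< ε → ∃[ δ ] (0ℚ ℚ.< δ × b ℚ.* δ ≡ ε)
    divide b ε pos-b 0<ε = ℚ.1/ b ℚ.* ε , 0<δ , b*δ≡ε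
      where
      instance
        _ : ℚ.Positive b
        _ = pos-b
        _ : ℚ.NonZero b
        _ = ℚ.pos⇒nonZero b
        _ : ℚ.Positive (ℚ.1/ b)
        _ = ℚ.1/pos⇒pos b
      0<δ : 0ℚ ℚ.< ℚ.1/ b ℚ.* ε
      0<δ = subst (ℚ._< ℚ.1/ b ℚ.* ε) (ℚ.*-zeroʳ (ℚ.1/ b))
              (ℚ.*-monoʳ-<-pos (ℚ.1/ b) 0<ε)
      b*δ≡ε : b ℚ.* (ℚ.1/ b ℚ.* ε) ≡ ε
      b*δ≡ε = begin
        b ℚ.* (ℚ.1/ b ℚ.* ε)  ≡⟨ ℚ.*-assoc b (ℚ.1/ b) ε ⟨
        (b ℚ.* ℚ.1/ b) ℚ.* ε  ≡⟨ cong (ℚ._* ε) (ℚ.*-inverseʳ b) ⟩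
        1ℚ ℚ.* ε              ≡⟨ ℚ.*-identityˡ ε ⟩
        ε                     ∎
        where open ≡-Reasoning

    mul-cauchy : ∀ {x y} → IsCauchy x → IsCauchy y → IsCauchy (λ n → x n ℚ.* y n)
    mul-cauchy {x} {y} cx cy ε 0<ε =
      let A , pos-A , M₀ , ∣x∣≤A = bounded cx
          B , pos-B , N₀ , ∣y∣≤B = bounded cy
          δ , 0<δ , AB*δ≡ε =
            divide (A ℚ.+ B) ε (ℚ.pos+pos⇒pos A {{pos-A}} B {{pos-B}}) 0<ε
          M₁ , hx = cx δ 0<δ
          N₁ , hy = cy δ 0<δ
      in (M₀ ⊔ N₀) ⊔ (M₁ ⊔ N₁) , λ m n ≤m ≤n →
        ℚ.≤-trans
          (product-diff≤ (x m) (y m) (x n) (y n) A B δ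
            {{ℚ.pos⇒nonNeg A {{pos-A}}}} {{ℚ.pos⇒nonNeg B {{pos-B}}}}
            (∣x∣≤A m (≤⊔ˡ (≤⊔ˡ ≤m)))
            (hy m n (≤⊔ʳ {M₁} (≤⊔ʳ {M₀ ⊔ N₀} ≤m)) (≤⊔ʳ {M₁} (≤⊔ʳ {M₀ ⊔ N₀} ≤n)))
            (∣y∣≤B n (≤⊔ʳ {M₀} (≤⊔ˡ ≤n)))
            (hx m n (≤⊔ˡ (≤⊔ʳ {M₀ ⊔ N₀} ≤m)) (≤⊔ˡ (≤⊔ʳ {M₀ ⊔ N₀} ≤n))))
          (ℚ.≤-reflexive AB*δ≡ε)

infixl 7 _*_
infixl 6 _+_ _-_
infix  8 -_
infix  4 _≈_ _≤_ _<_ _≉_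

fromℚ : ℚ → ℝ
fromℚ q = mkℝ (λ _ → q) (const-cauchy q)

fromℕ : ℕ → ℝ
fromℕ n = fromℚ (+ n ℚ./ 1)

recip : (n : ℕ) → .{{NonZero n}} → ℝ
recip n = fromℚ (+ 1 ℚ./ n)

0ℝ 1ℝ : ℝ
0ℝ = fromℚ 0ℚ
1ℝ = fromℚ 1ℚ

_+_ _*_ : ℝ → ℝ → ℝ
x + y = mkℝ (λ n → seq x n ℚ.+ seq y n) (add-cauchy {seq x} {seq y} (cauchy x) (cauchy y))
x * y = mkℝ (λ n → seq x n ℚ.* seq y n) (mul-cauchy {seq x} {seq y} (cauchy x) (cauchy y))

-_ : ℝ → ℝ
- x = mkℝ (λ n → ℚ.- seq x n) (neg-cauchy {seq x} (cauchy x))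

_-_ : ℝ → ℝ → ℝ
x - y = x + (- y)

_≈_ _≉_ _≤_ _<_ : ℝ → ℝ → Set
x ≈ y = ∀ ε → 0ℚ ℚ.< ε → ∃[ N ] (∀ n → N ℕ.≤ n → ∣ seq x n ℚ.- seq y n ∣ ℚ.≤ ε)
x ≤ y = ∀ ε → 0ℚ ℚ.< ε → ∃[ N ] (∀ n → N ℕ.≤ n → seq x n ℚ.≤ seq y n ℚ.+ ε)
x < y = ∃[ ε ] (0ℚ ℚ.< ε × ∃[ N ] (∀ n → N ℕ.≤ n → seq x n ℚ.+ ε ℚ.≤ seq y n))
x ≉ y = ¬ (x ≈ y)

-- r = √x
IsSqrt : ℝ → ℝ → Set
IsSqrt x r = 0ℝ ≤ r × r * r ≈ x

infix 4 _⟶_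

_⟶_ : (ℕ → ℝ) → ℝ → Set
x ⟶ l = ∀ ε → 0ℚ ℚ.< ε →
  ∃[ N ] (∀ k → N ℕ.≤ k → l - fromℚ ε ≤ x k × x k ≤ l + fromℚ ε)

+-rawMonoid : RawMonoid 0ℓ 0ℓ
+-rawMonoid = record { Carrier = ℝ ; _≈_ = _≈_ ; _∙_ = _+_ ; ε = 0ℝ }

open RawMonoidDefs +-rawMonoid public using (sum)

IsSeriesSum : (ℕ → ℝ) → ℝ → Set
IsSeriesSum f s = (λ m → sum {m} (λ k → f (toℕ k))) ⟶ s

------------------------------------------------------------------------
-- Complex numbers

infixl 7 _*ᶜ_ _·_
infixl 6 _+ᶜ_ _-ᶜ_
infix  4 _≈ᶜ_

record ℂ : Set where
  constructor _+i_
  field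
    re im : ℝ

open ℂ public

_≈ᶜ_ : ℂ → ℂ → Set
z ≈ᶜ w = re z ≈ re w × im z ≈ im w

0ᶜ 1ᶜ : ℂ
0ᶜ = 0ℝ +i 0ℝ
1ᶜ = 1ℝ +i 0ℝ

_+ᶜ_ _-ᶜ_ _*ᶜ_ : ℂ → ℂ → ℂ
z +ᶜ w = (re z + re w) +i (im z + im w)
z -ᶜ w = (re z - re w) +i (im z - im w)
z *ᶜ w = (re z * re w - im z * im w) +i (re z * im w + im z * re w)

_·_ : ℝ → ℂ → ℂ
r · z = (r * re z) +i (r * im z)

conj : ℂ → ℂ
conj z = re z +i (- im z)

-- |z|²
normSq : ℂ → ℝ
normSq z = re z * re z + im z * im z

HasModulus1 : ℂ → Set
HasModulus1 z = IsSqrt (normSq z) 1ℝ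

+ᶜ-rawMonoid : RawMonoid 0ℓ 0ℓ
+ᶜ-rawMonoid = record { Carrier = ℂ ; _≈_ = _≈ᶜ_ ; _∙_ = _+ᶜ_ ; ε = 0ᶜ }

open RawMonoidDefs +ᶜ-rawMonoid public using () renaming (sum to sumᶜ)

IsSeriesSumᶜ : (ℕ → ℂ) → ℂ → Set
IsSeriesSumᶜ f s =
  IsSeriesSum (λ k → re (f k)) (re s) × IsSeriesSum (λ k → im (f k)) (im s)

------------------------------------------------------------------------
-- Vectors and matrices

Matrix : ℕ → Set
Matrix N = Fin N → Fin N → ℂ

-- the standard basis vector e_v
e : ∀ {N} → Fin N → Vector ℂ N
e v w = if does (v Fin.≟ w) then 1ᶜ else 0ᶜ

-- ‖ψ‖²
‖_‖² : ∀ {N} → Vector ℂ N → ℝ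
‖ ψ ‖² = sum (λ v → normSq (ψ v))

idᴹ : ∀ {N} → Matrix N
idᴹ a b = e a b

infixr 7 _*ᵛ_

_*ᵛ_ : ∀ {N} → Matrix N → Vector ℂ N → Vector ℂ N
(M *ᵛ ψ) a = sumᶜ (λ b → M a b *ᶜ ψ b)

_*ᴹ_ : ∀ {N} → Matrix N → Matrix N → Matrix N
(M *ᴹ L) a b = sumᶜ (λ c → M a c *ᶜ L c b)

_^ᴹ_ : ∀ {N} → Matrix N → ℕ → Matrix N
M ^ᴹ ℕ.zero  = idᴹ
M ^ᴹ ℕ.suc k = M *ᴹ (M ^ᴹ k)

-- E = exp(M), entrywise as the sum of the exponential series
IsExp : ∀ {N} → Matrix N → Matrix N → Set
IsExp M E = ∀ a b →
  IsSeriesSumᶜ (λ k → recip (k !) {{k ℕ.!≢0}} · (M ^ᴹ k) a b) (E a b)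

------------------------------------------------------------------------
-- Graphs and unitary signings

record Graph (N : ℕ) : Set₁ where
  field
    Adj        : Fin N → Fin N → Set
    adj?       : Decidable Adj
    Adj-sym    : Symmetric Adj
    Adj-irrefl : Irreflexive _≡_ Adj

K : ∀ n → Graph n
K n = record
  { Adj        = _≢_
  ; adj?       = λ a b → ¬? (a Fin.≟ b)
  ; Adj-sym    = ≢-sym
  ; Adj-irrefl = λ a≡b a≢b → a≢b a≡b
  }

-- The values of σ off the edges are irrelevant.
record UnitarySigning {N} (X : Graph N) : Set where
  open Graph X using (Adj)
  field
    σ         : Fin N → Fin N → ℂ
    unitary   : ∀ {a b} → Adj a b → HasModulus1 (σ a b)
    hermitian : ∀ {a b} → Adj a b → σ b a ≈ᶜ conj (σ a b)

signedAdjacency : ∀ {N} {X : Graph N} → UnitarySigning X → Matrix N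
signedAdjacency {X = X} S a b =
  if does (Graph.adj? X a b) then UnitarySigning.σ S a b else 0ᶜ

------------------------------------------------------------------------
-- Quantum states, evolution and partial measurement

IsState : ∀ {N} → Vector ℂ N → Set
IsState ψ = ‖ ψ ‖² ≈ 1ℝ

IsUniform : ∀ {N} → .{{NonZero N}} → Vector ℂ N → Set
IsUniform {N} ψ = ∀ v → normSq (ψ v) ≈ recip N

-- φ = e^{-itH} ψ
Evolves : ∀ {N} → Matrix N → ℝ → Vector ℂ N → Vector ℂ N → Set
Evolves {N} H t ψ φ =
  Σ (Matrix N) λ U →
    IsExp (λ a b → (0ℝ +i (- t)) *ᶜ H a b) U × (∀ v → φ v ≈ᶜ (U *ᵛ ψ) v)

Outcome : Set
Outcome = Fin 2

-- P₁ = e_a e_aᵀ and P₀ = I - e_a e_aᵀ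
P : ∀ {N} → Outcome → Fin N → Matrix N
P 1F a v w = e a v *ᶜ e a w
P 0F a v w = idᴹ v w -ᶜ P 1F a v w

-- φ = χ / ‖χ‖, with the division cleared; no constraint when χ = 0
Normalises : ∀ {N} → Vector ℂ N → Vector ℂ N → Set
Normalises χ φ = ∃[ r ] (IsSqrt ‖ χ ‖² r × (∀ v → r · φ v ≈ᶜ χ v))

------------------------------------------------------------------------
-- Measured-walk protocols

data Action (N : ℕ) : Set where
  stop    : Action N
  evolve  : (t : ℝ) → 0ℝ ≤ t → Action N
  measure : (a : Fin N) → Action N

data Event : Set where
  evolved : Event
  outcome : Outcome → Event

-- What has happened so far, most recent event first.
History : Set
History = List Event

Protocol : ℕ → Set
Protocol N = History → Action N

duration : ∀ {N} → Action N → ℝ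
duration stop         = 0ℝ
duration (evolve t _) = t
duration (measure _)  = 0ℝ

elapsed : ∀ {N} → Protocol N → History → ℝ
elapsed π []      = 0ℝ
elapsed π (_ ∷ h) = elapsed π h + duration (π h)

-- The probability that event x results from performing an action in state ψ;
-- it is 0 for events of the wrong kind and after stopping.
eventProb : ∀ {N} → Action N → Vector ℂ N → Event → ℝ
eventProb (evolve _ _) ψ evolved     = 1ℝ
eventProb (measure a)  ψ (outcome j) = ‖ P j a *ᵛ ψ ‖²
eventProb _            ψ _           = 0ℝ

-- The state φ after event x has resulted from performing an action in state ψ.
Transition : ∀ {N} → Matrix N → Action N → Event → Vector ℂ N → Vector ℂ N → Set
Transition H (evolve t _) evolved     ψ φ = Evolves H t ψ φ
Transition H (measure a)  (outcome j) ψ φ = Normalises (P j a *ᵛ ψ) φ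
Transition H _            _           ψ φ = ⊤

-- The states that a protocol passes through. At histories of probability 0
-- (in particular those inconsistent with π) the state is a dummy, and is not
-- referred to by any notion below except with weight 0.
record Run {N} (H : Matrix N) (π : Protocol N) (u : Fin N) : Set where
  field
    state      : History → Vector ℂ N
    isState    : ∀ h → IsState (state h)
    start      : ∀ v → state [] v ≈ᶜ e u v
    transition : ∀ x h → Transition H (π h) x (state h) (state (x ∷ h))

  prob : History → ℝ
  prob []      = 1ℝ
  prob (x ∷ h) = prob h * eventProb (π h) (state h) x

  stopProb : History → ℝ
  stopProb h with π h
  ... | stop = prob h
  ... | _    = 0ℝ

sumHistories : ℕ → (History → ℝ) → ℝ
sumHistories ℕ.zero    f = f []
sumHistories (ℕ.suc k) f = sumHistories k λ h →
  f (evolved ∷ h) + f (outcome 0F ∷ h) + f (outcome 1F ∷ h)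

module _ {N} {H : Matrix N} {π : Protocol N} {u : Fin N} (ρ : Run H π u) where
  open Run ρ

  -- 𝔼[X ; the protocol stops] = s, where X is a function of the history at
  -- which the protocol stops; the series is over the number of steps.
  HasExpectation : (History → ℝ) → ℝ → Set
  HasExpectation X s =
    IsSeriesSum (λ k → sumHistories k (λ h → stopProb h * X h)) s

  StopsAlmostSurely : Set
  StopsAlmostSurely = HasExpectation (λ _ → 1ℝ) 1ℝ

  StopsUniformly : .{{NonZero N}} → Set
  StopsUniformly = ∀ h → stopProb h ≉ 0ℝ → IsUniform (state h)

  -- The total evolution time has an expectation, and it is at most b.
  ExpectedTimeAtMost : ℝ → Set
  ExpectedTimeAtMost b = ∃[ T ] (HasExpectation (elapsed π) T × T ≤ b)

-- Probabilistic (Las Vegas) uniform mixing, in expected time at most b, of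
-- the walk generated by H.
LasVegasUniformMixing : ∀ {N} → .{{NonZero N}} → Matrix N → ℝ → Set
LasVegasUniformMixing {N} H b =
  ∀ (u : Fin N) → Σ (Protocol N) λ π → Σ (Run H π u) λ ρ →
    StopsAlmostSurely ρ × StopsUniformly ρ × ExpectedTimeAtMost ρ b

-- A(X^σ)/N
scaledAdjacency : ∀ {N} → .{{NonZero N}} → {X : Graph N} → UnitarySigning X → Matrix N
scaledAdjacency {N} S a b = recip N · signedAdjacency S a b

-- Let n = m + 1. One vertex, 0, is joined to all others by edges of weight 1, and the other m vertices are
-- signed by the off-diagonal part of v v*, where v is unimodular and orthogonal to the all-ones vector 1.
-- The plane spanned by e₀ and 1 is then invariant, and at a time t₀ = O(√n) the state e₀ has become uniform.
-- From any other vertex one evolves for the time t₀ and measures the vertices 0, 1, 2, … in turn, which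
-- collapses the state to a vertex. By the symmetry of |exp (-i t₀ H)| this vertex is 0 with probability exactly
-- 1 / n, so the expected total time is at most (n + 1) t₀ = O(n^{3/2}). Expected times and survival
-- probabilities are computed with potential functions on the stages of the walk.
--
-- Constructively a state can be normalised only if it is known to be apart from 0, so all entries of
-- exp (-i t₀ H) must be shown to be apart from 0. For distinct i and j other than 0, the (i, j) entry vanishes
-- only if Y + X θ does, where θ = v i / v j and X, Y do not depend on v. Then, with c = Re θ, the quadratic
-- form Y² + X² + 2 c X Y vanishes too. It is affine in c and does not vanish at ±1, so it vanishes for at most
-- one c. For even m one takes v = (1, -1, 1, -1, …), so that c = ±1. For odd m there are two candidates for v
-- with no common value of c other than ±1, and at least one of them works.

module Submission where

open import Algebra.Bundles using (CommutativeRing)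
import Algebra.Properties.CommutativeMonoid.Sum as MonoidSum
import Algebra.Properties.CommutativeSemigroup as CommutativeSemigroupProperties
import Algebra.Properties.Semiring.Sum as SemiringSum
import Algebra.Solver.Ring as RingSolver
import Algebra.Solver.Ring.AlmostCommutativeRing as ACR
open import Data.Bool.Base using (T; if_then_else_)
open import Data.Empty using (⊥-elim)
open import Data.Fin.Base as Fin using (Fin; zero; suc; toℕ)
open import Data.Fin.Patterns using (0F; 1F; 2F; 3F)
import Data.Fin.Properties as Fin
import Data.Integer.Base as ℤ
import Data.Integer.Properties as ℤ
open import Data.List.Base using ([]; _∷_; length)
open import Data.Maybe.Base as Maybe using (Maybe; just; nothing)
open import Data.Nat.Base as ℕ using (ℕ; zero; suc; NonZero; _!; s≤s; z≤n)
import Data.Nat.Properties as ℕ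
open import Data.Product using (Σ; ∃-syntax; _×_; _,_; proj₁; proj₂)
open import Data.Rational.Base as ℚ using (ℚ; mkℚ; 0ℚ; 1ℚ; ½; ∣_∣)
import Data.Rational.Properties as ℚ
import Data.Rational.Solver as ℚSolver
open import Data.Rational.Unnormalised.Base as ℚᵘ using (mkℚᵘ; *≡*)
import Data.Rational.Unnormalised.Properties as ℚᵘ
open import Data.Sum.Base using (_⊎_; inj₁; inj₂)
open import Data.Unit.Base using (tt)
open import Data.Vec.Functional using (Vector)
open import Function.Base using (_∘_)
open import Level using (0ℓ)
open import Relation.Binary.Definitions using (WeaklyDecidable; tri<; tri≈; tri>)
open import Relation.Binary.PropositionalEquality as ≡
  using (_≡_; _≢_; refl; cong; cong₂; subst; subst₂)
import Relation.Binary.Reasoning.Setoid as SetoidReasoning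
open import Relation.Nullary using (¬_; Dec; yes; no; does)
open import Relation.Nullary.Decidable using (dec-true; dec-false; from-yes)

-- In the basis `e₀`, 1/√m of the invariant plane the matrix is ((0, √m), (√m, -1)), with
-- eigenvalues (-1 ± s)/2 where s² = 4m + 1. If the phases of the two eigenvectors differ by 2φ, the
-- amplitude from 0 to any other vertex has modulus 2 sin φ / s. Its square is 1/n exactly when sin²
-- φ = (4n - 3)/(4n), which is below 1 for every n; this is the origin of cos² φ = 3/(4n). The
-- opposite transition has the same modulus, whence the exact success probability 1/n.
--
-- A vector of signs orthogonal to 1 exists only for even m. For odd m other ratios θ occur, and
-- which of the two candidates for v avoids a vanishing entry cannot be decided by computing with
-- real numbers. What is available is cotransitivity: if a sum is bounded away from 0 in the
-- positive direction, so is one of its terms. Applied to an affine relation between values of the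
-- quadratic form, it yields enough disjunctions to choose a candidate. The anchor is the form at
-- ±1, a square of β + γ - 2ρ or of β - γ, where |β| = 1/√n is small against |γ - 2ρ| ≥ 1 and |γ| =
-- 1.

-- Rational inequalities and the decay of geometric sequences.

module Rational where
  open import Data.Rational.Base using (_+_; _*_; _-_; -_; _≤_; _<_)
  open ≡ using (sym; trans; module ≡-Reasoning)
  open import Data.Integer.Base using (+_; -[1+_])
  open ℚSolver.+-*-Solver

  ≤-from : ∀ {a b} d → 0ℚ ≤ d → a + d ≡ b → a ≤ b
  ≤-from {a} d 0≤d refl = subst (_≤ a + d) (ℚ.+-identityʳ a) (ℚ.+-monoʳ-≤ a 0≤d)

  ≤⇒0≤- : ∀ {a b} → a ≤ b → 0ℚ ≤ b - a
  ≤⇒0≤- {a} {b} a≤b = subst (_≤ b - a) (ℚ.+-inverseʳ a) (ℚ.+-monoˡ-≤ (- a) a≤b)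

  <⇒0<- : ∀ {a b} → a < b → 0ℚ < b - a
  <⇒0<- {a} {b} a<b = subst (_< b - a) (ℚ.+-inverseʳ a) (ℚ.+-monoˡ-< (- a) a<b)

  0≤+ : ∀ {a b} → 0ℚ ≤ a → 0ℚ ≤ b → 0ℚ ≤ a + b
  0≤+ = ℚ.+-mono-≤

  0≤* : ∀ {a b} → 0ℚ ≤ a → 0ℚ ≤ b → 0ℚ ≤ a * b
  0≤* {a} {b} 0≤a 0≤b = ℚ.nonNegative⁻¹ (a * b)
    {{ℚ.nonNeg*nonNeg⇒nonNeg a {{ℚ.nonNegative 0≤a}} b {{ℚ.nonNegative 0≤b}}}}

  0<* : ∀ {a b} → 0ℚ < a → 0ℚ < b → 0ℚ < a * b
  0<* {a} {b} 0<a 0<b = ℚ.positive⁻¹ (a * b)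
    {{ℚ.pos*pos⇒pos a {{ℚ.positive 0<a}} b {{ℚ.positive 0<b}}}}

  0<½* : ∀ {a} → 0ℚ < a → 0ℚ < ½ * a
  0<½* = 0<* (ℚ.positive⁻¹ ½)

  0≤sq : ∀ a → 0ℚ ≤ a * a
  0≤sq a with ℚ.≤-total 0ℚ a
  ... | inj₁ 0≤a = 0≤* 0≤a 0≤a
  ... | inj₂ a≤0 = subst (0ℚ ≤_) (solve 1 (λ a → (:- a) :* (:- a) := a :* a) refl a)
                     (0≤* (ℚ.neg-antimono-≤ a≤0) (ℚ.neg-antimono-≤ a≤0))

  *-mono : ∀ {a b c d} → 0ℚ ≤ a → a ≤ b → 0ℚ ≤ c → c ≤ d → a * c ≤ b * d
  *-mono {a} {b} {c} {d} 0≤a a≤b 0≤c c≤d = ≤-from ((b - a) * d + a * (d - c))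
    (0≤+ (0≤* (≤⇒0≤- a≤b) (ℚ.≤-trans 0≤c c≤d)) (0≤* 0≤a (≤⇒0≤- c≤d)))
    (solve 4 (λ a b c d → a :* c :+ ((b :- a) :* d :+ a :* (d :- c)) := b :* d) refl a b c d)

  *-monoˡ : ∀ {a c d} → 0ℚ ≤ a → c ≤ d → a * c ≤ a * d
  *-monoˡ {a} 0≤a = ℚ.*-monoˡ-≤-nonNeg a {{ℚ.nonNegative 0≤a}}

  *-monoʳ : ∀ {a c d} → 0ℚ ≤ a → c ≤ d → c * a ≤ d * a
  *-monoʳ {a} 0≤a = ℚ.*-monoʳ-≤-nonNeg a {{ℚ.nonNegative 0≤a}}

  p≤∣p∣ : ∀ p → p ≤ ∣ p ∣
  p≤∣p∣ p with ℚ.∣p∣≡p∨∣p∣≡-p p | ℚ.≤-total 0ℚ p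
  ... | _ | inj₁ 0≤p = ℚ.≤-reflexive (sym (ℚ.0≤p⇒∣p∣≡p 0≤p))
  ... | _ | inj₂ p≤0 = ℚ.≤-trans p≤0 (ℚ.0≤∣p∣ p)

  -p≤∣p∣ : ∀ p → - p ≤ ∣ p ∣
  -p≤∣p∣ p = subst (- p ≤_) (ℚ.∣-p∣≡∣p∣ p) (p≤∣p∣ (- p))

  ∣∣≤ : ∀ {p q} → p ≤ q → - p ≤ q → ∣ p ∣ ≤ q
  ∣∣≤ {p} {q} p≤q -p≤q with ℚ.∣p∣≡p∨∣p∣≡-p p
  ... | inj₁ eq = subst (_≤ q) (sym eq) p≤q
  ... | inj₂ eq = subst (_≤ q) (sym eq) -p≤q

  ∣p-q∣≡∣q-p∣ : ∀ p q → ∣ p - q ∣ ≡ ∣ q - p ∣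
  ∣p-q∣≡∣q-p∣ p q = trans (sym (ℚ.∣-p∣≡∣p∣ (p - q)))
    (cong ∣_∣ (solve 2 (λ p q → :- (p :- q) := q :- p) refl p q))

  ∣-∣-triangle : ∀ p q r → ∣ p - r ∣ ≤ ∣ p - q ∣ + ∣ q - r ∣
  ∣-∣-triangle p q r = subst (λ x → ∣ x ∣ ≤ ∣ p - q ∣ + ∣ q - r ∣)
    (solve 3 (λ p q r → (p :- q) :+ (q :- r) := p :- r) refl p q r)
    (ℚ.∣p+q∣≤∣p∣+∣q∣ (p - q) (q - r))

  ∣*∣≤ : ∀ {p q a b} → ∣ p ∣ ≤ a → ∣ q ∣ ≤ b → ∣ p * q ∣ ≤ a * b
  ∣*∣≤ {p} {q} {a} {b} p≤a q≤b = subst (_≤ a * b) (sym (ℚ.∣p*q∣≡∣p∣*∣q∣ p q))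
    (*-mono (ℚ.0≤∣p∣ p) p≤a (ℚ.0≤∣p∣ q) q≤b)

  ∣+∣≤ : ∀ {p q a b} → ∣ p ∣ ≤ a → ∣ q ∣ ≤ b → ∣ p + q ∣ ≤ a + b
  ∣+∣≤ {p} {q} p≤a q≤b = ℚ.≤-trans (ℚ.∣p+q∣≤∣p∣+∣q∣ p q) (ℚ.+-mono-≤ p≤a q≤b)

  abstract
    -- Opaque, like `inv` below, so that fractions are never normalised during type checking; `ι≡`
    -- and `inv≡` unfold them on demand.
    ι : ℕ → ℚ
    ι n = + n ℚ./ 1

    ι≡ : ∀ n → ι n ≡ + n ℚ./ 1
    ι≡ n = refl

    ι-0 : ι 0 ≡ 0ℚ
    ι-0 = refl

    ι-1 : ι 1 ≡ 1ℚ
    ι-1 = refl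

    private
      toℚᵘ-ι : ∀ n → ℚ.toℚᵘ (ι n) ℚᵘ.≃ mkℚᵘ (+ n) 0
      toℚᵘ-ι n = ℚ.toℚᵘ-fromℚᵘ (mkℚᵘ (+ n) 0)

    ι-+ : ∀ m n → ι (m ℕ.+ n) ≡ ι m + ι n
    ι-+ m n = ℚ.toℚᵘ-injective (ℚᵘ.≃-trans (toℚᵘ-ι (m ℕ.+ n)) (ℚᵘ.≃-sym
      (ℚᵘ.≃-trans (ℚ.toℚᵘ-homo-+ (ι m) (ι n))
        (ℚᵘ.≃-trans (ℚᵘ.+-cong (toℚᵘ-ι m) (toℚᵘ-ι n))
          (*≡* (cong (ℤ._* + 1) (trans (cong₂ ℤ._+_ (ℤ.*-identityʳ (+ m)) (ℤ.*-identityʳ (+ n)))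
                                     (sym (ℤ.pos-+ m n)))))))))

    ι-* : ∀ m n → ι (m ℕ.* n) ≡ ι m * ι n
    ι-* m n = ℚ.toℚᵘ-injective (ℚᵘ.≃-trans (toℚᵘ-ι (m ℕ.* n)) (ℚᵘ.≃-sym
      (ℚᵘ.≃-trans (ℚ.toℚᵘ-homo-* (ι m) (ι n))
        (ℚᵘ.≃-trans (ℚᵘ.*-cong (toℚᵘ-ι m) (toℚᵘ-ι n))
          (*≡* (cong (ℤ._* + 1) (sym (ℤ.pos-* m n))))))))

    ι-suc : ∀ n → ι (suc n) ≡ 1ℚ + ι n
    ι-suc n = ι-+ 1 n

    0≤ι : ∀ n → 0ℚ ≤ ι n
    0≤ι n = ℚ.nonNegative⁻¹ (ι n) {{ℚ.normalize-nonNeg n 1}}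

    0<ι : ∀ n → 0ℚ < ι (suc n)
    0<ι n = ℚ.positive⁻¹ (ι (suc n)) {{ℚ.normalize-pos (suc n) 1}}

    ι-mono : ∀ {m n} → m ℕ.≤ n → ι m ≤ ι n
    ι-mono {m} {n} m≤n = ≤-from (ι (n ℕ.∸ m)) (0≤ι (n ℕ.∸ m))
      (trans (sym (ι-+ m (n ℕ.∸ m))) (cong ι (ℕ.m+[n∸m]≡n m≤n)))

    archimedean : ∀ q → ∃[ n ] q ≤ ι n
    archimedean q@(mkℚ (+ k) d _) = k , ℚ.toℚᵘ-cancel-≤ (ℚᵘ.≤-trans
      (ℚᵘ.*≤* {ℚ.toℚᵘ q} {mkℚᵘ (+ k) 0} (subst₂ ℤ._≤_ (ℤ.pos-* k 1) (ℤ.pos-* k (suc d))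
        (ℤ.+≤+ (ℕ.*-monoʳ-≤ k (s≤s z≤n)))))
      (ℚᵘ.≤-reflexive (ℚᵘ.≃-sym (toℚᵘ-ι k))))
    archimedean q@(mkℚ (-[1+ k ]) d _) = 0 , ℚ.<⇒≤ (ℚ.negative⁻¹ q)

    inv : ∀ n → .{{NonZero n}} → ℚ
    inv n = + 1 ℚ./ n

    inv≡ : ∀ n .{{_ : NonZero n}} → inv n ≡ + 1 ℚ./ n
    inv≡ n = refl

    inv-inverse : ∀ n .{{_ : NonZero n}} → inv n * ι n ≡ 1ℚ
    inv-inverse (suc n) = ℚ.toℚᵘ-injective (ℚᵘ.≃-trans (ℚ.toℚᵘ-homo-* (inv (suc n)) (ι (suc n)))
      (ℚᵘ.≃-trans (ℚᵘ.*-cong (ℚ.toℚᵘ-fromℚᵘ (mkℚᵘ (+ 1) n)) (toℚᵘ-ι (suc n)))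
        (*≡* (begin
          (+ 1 ℤ.* + suc n) ℤ.* + 1   ≡⟨ ℤ.*-identityʳ _ ⟩
          + 1 ℤ.* + suc n             ≡⟨ ℤ.*-identityˡ (+ suc n) ⟩
          + suc n                     ≡⟨ cong +_ (sym (ℕ.*-identityʳ (suc n))) ⟩
          + (suc n ℕ.* 1)             ≡⟨ sym (ℤ.*-identityˡ _) ⟩
          + 1 ℤ.* + (suc n ℕ.* 1) ∎))))
      where open ≡-Reasoning

    0<inv : ∀ n .{{_ : NonZero n}} → 0ℚ < inv n
    0<inv n = ℚ.positive⁻¹ (inv n) {{ℚ.normalize-pos 1 n}}

    0≤inv : ∀ n .{{_ : NonZero n}} → 0ℚ ≤ inv n
    0≤inv n = ℚ.<⇒≤ (0<inv n)

    inv*inv : ∀ m n .{{_ : NonZero m}} .{{_ : NonZero n}} .{{_ : NonZero (m ℕ.* n)}} →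
      inv (m ℕ.* n) ≡ inv m * inv n
    inv*inv m n = begin
      inv (m ℕ.* n)
        ≡⟨ sym (trans (cong (inv (m ℕ.* n) *_) (cong₂ _*_ (inv-inverse m) (inv-inverse n))) (ℚ.*-identityʳ _)) ⟩
      inv (m ℕ.* n) * ((inv m * ι m) * (inv n * ι n))
        ≡⟨ solve 5 (λ x a b c d → x :* ((a :* b) :* (c :* d)) := (x :* (b :* d)) :* (a :* c)) refl
             (inv (m ℕ.* n)) (inv m) (ι m) (inv n) (ι n) ⟩
      (inv (m ℕ.* n) * (ι m * ι n)) * (inv m * inv n)
        ≡⟨ cong (λ x → (inv (m ℕ.* n) * x) * (inv m * inv n)) (sym (ι-* m n)) ⟩
      (inv (m ℕ.* n) * ι (m ℕ.* n)) * (inv m * inv n)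
        ≡⟨ cong (_* (inv m * inv n)) (inv-inverse (m ℕ.* n)) ⟩
      1ℚ * (inv m * inv n)
        ≡⟨ ℚ.*-identityˡ _ ⟩
      inv m * inv n ∎
      where open ≡-Reasoning

    inv-anti : ∀ m n .{{_ : NonZero m}} .{{_ : NonZero n}} → m ℕ.≤ n → inv n ≤ inv m
    inv-anti m n m≤n = ≤-from (inv m * inv n * (ι n - ι m))
      (0≤* (0≤* (0≤inv m) (0≤inv n)) (≤⇒0≤- (ι-mono m≤n)))
      (begin
        inv n + inv m * inv n * (ι n - ι m)
          ≡⟨ solve 4 (λ a b c d → b :+ a :* b :* (d :- c) := b :+ a :* (b :* d) :- (a :* c) :* b) refl
               (inv m) (inv n) (ι m) (ι n) ⟩
        inv n + inv m * (inv n * ι n) - (inv m * ι m) * inv n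
          ≡⟨ cong₂ (λ x y → inv n + inv m * x - y * inv n) (inv-inverse n) (inv-inverse m) ⟩
        inv n + inv m * 1ℚ - 1ℚ * inv n
          ≡⟨ solve 2 (λ a b → b :+ a :* con 1ℚ :- con 1ℚ :* b := a) refl (inv m) (inv n) ⟩
        inv m ∎)
      where open ≡-Reasoning

  abstract
    reciprocal : ∀ q → 0ℚ < q → ∃[ r ] (0ℚ < r × q * r ≡ 1ℚ)
    reciprocal q 0<q = ℚ.1/ q , ℚ.positive⁻¹ (ℚ.1/ q) {{ℚ.1/pos⇒pos q}} , ℚ.*-inverseʳ q
      where instance
        _ : ℚ.Positive q
        _ = ℚ.positive 0<q
        _ : ℚ.NonZero q
        _ = ℚ.pos⇒nonZero q

    divisor : ∀ b ε → 0ℚ < b → 0ℚ < ε → ∃[ δ ] (0ℚ < δ × b * δ ≡ ε)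
    divisor b ε 0<b 0<ε with reciprocal b 0<b
    ... | r , 0<r , br≡1 = r * ε , 0<* 0<r 0<ε ,
      trans (sym (ℚ.*-assoc b r ε)) (trans (cong (_* ε) br≡1) (ℚ.*-identityˡ ε))

  *-cancelˡ-≤ : ∀ {a b c} → 0ℚ < a → a * b ≤ a * c → b ≤ c
  *-cancelˡ-≤ {a} 0<a = ℚ.*-cancelˡ-≤-pos a {{ℚ.positive 0<a}}

  abstract
    eventually-small : ∀ B ε → 0ℚ < ε → ∃[ N ] (∀ k → N ℕ.≤ k → B ≤ ι k * ε)
    eventually-small B ε 0<ε with reciprocal ε 0<ε
    ... | r , 0<r , εr≡1 with archimedean (B * r)
    ... | N , Br≤N = N , λ k N≤k → ℚ.≤-trans (ℚ.≤-reflexive (begin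
          B            ≡⟨ sym (ℚ.*-identityʳ B) ⟩
          B * 1ℚ       ≡⟨ cong (B *_) (sym εr≡1) ⟩
          B * (ε * r)  ≡⟨ solve 3 (λ B e r → B :* (e :* r) := (B :* r) :* e) refl B ε r ⟩
          (B * r) * ε  ∎)) (*-monoʳ (ℚ.<⇒≤ 0<ε) (ℚ.≤-trans Br≤N (ι-mono N≤k)))
      where open ≡-Reasoning

  infixr 8 _^_
  _^_ : ℚ → ℕ → ℚ
  x ^ zero  = 1ℚ
  x ^ suc k = x * x ^ k

  0≤^ : ∀ {x} → 0ℚ ≤ x → ∀ k → 0ℚ ≤ x ^ k
  0≤^ 0≤x zero    = ℚ.nonNegative⁻¹ 1ℚ
  0≤^ 0≤x (suc k) = 0≤* 0≤x (0≤^ 0≤x k)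

  private
    -- The binomial coefficient k (k - 1) / 2, in the form that suits induction on the exponent.
    triangle : ℕ → ℕ
    triangle zero    = 0
    triangle (suc k) = triangle k ℕ.+ k

  -- The first three terms of the binomial expansion of (1 + x) ^ k.
  quadratic-bernoulli : ∀ {γ x} → 0ℚ ≤ γ → 0ℚ ≤ x → γ * (1ℚ + x) ≤ 1ℚ → ∀ k →
    γ ^ k * (1ℚ + ι k * x + ι (triangle k) * (x * x)) ≤ 1ℚ
  quadratic-bernoulli {γ} {x} 0≤γ 0≤x h zero = ℚ.≤-reflexive
    (trans (cong (λ a → 1ℚ * (1ℚ + a * x + a * (x * x))) ι-0)
      (solve 1 (λ x → con 1ℚ :* (con 1ℚ :+ con 0ℚ :* x :+ con 0ℚ :* (x :* x)) := con 1ℚ) refl x))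
  quadratic-bernoulli {γ} {x} 0≤γ 0≤x h (suc k) = begin
    γ * g * (1ℚ + ι (suc k) * x + ι (t ℕ.+ k) * (x * x))
      ≡⟨ cong₂ (λ a b → γ * g * (1ℚ + a * x + b * (x * x))) (ι-suc k) (ι-+ t k) ⟩
    γ * g * (1ℚ + (1ℚ + ι k) * x + (ι t + ι k) * (x * x))
      ≤⟨ ≤-from (γ * g * (ι t * (x * x) * x))
           (0≤* (0≤* 0≤γ (0≤^ 0≤γ k)) (0≤* (0≤* (0≤ι t) (0≤* 0≤x 0≤x)) 0≤x))
           (solve 5 (λ γ g x k t →
              γ :* g :* (con 1ℚ :+ (con 1ℚ :+ k) :* x :+ (t :+ k) :* (x :* x)) :+ γ :* g :* (t :* (x :* x) :* x)
              := (γ :* (con 1ℚ :+ x)) :* (g :* (con 1ℚ :+ k :* x :+ t :* (x :* x))))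
            refl γ g x (ι k) (ι t)) ⟩
    (γ * (1ℚ + x)) * (g * (1ℚ + ι k * x + ι t * (x * x)))
      ≤⟨ *-mono (0≤* 0≤γ (0≤+ (ℚ.nonNegative⁻¹ 1ℚ) 0≤x)) h
           (0≤* (0≤^ 0≤γ k) (0≤+ (0≤+ (ℚ.nonNegative⁻¹ 1ℚ) (0≤* (0≤ι k) 0≤x)) (0≤* (0≤ι t) (0≤* 0≤x 0≤x))))
           (quadratic-bernoulli 0≤γ 0≤x h k) ⟩
    1ℚ * 1ℚ ≡⟨⟩
    1ℚ ∎
    where
    open ℚ.≤-Reasoning
    g : ℚ
    g = γ ^ k
    t : ℕ
    t = triangle k

  private
    2triangle : ∀ k → ι (triangle k) + ι (triangle k) + ι k ≡ ι k * ι k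
    2triangle zero    = trans (cong (λ a → a + a + a) ι-0) (sym (cong (λ a → a * a) ι-0))
    2triangle (suc k) = begin
      ι (triangle k ℕ.+ k) + ι (triangle k ℕ.+ k) + ι (suc k)
        ≡⟨ cong₂ (λ a b → a + a + b) (ι-+ (triangle k) k) (ι-suc k) ⟩
      (ι (triangle k) + ι k) + (ι (triangle k) + ι k) + (1ℚ + ι k)
        ≡⟨ solve 2 (λ t k → (t :+ k) :+ (t :+ k) :+ (con 1ℚ :+ k)
                         := (t :+ t :+ k) :+ (con 1ℚ :+ (k :+ k))) refl (ι (triangle k)) (ι k) ⟩
      (ι (triangle k) + ι (triangle k) + ι k) + (1ℚ + (ι k + ι k))
        ≡⟨ cong (_+ (1ℚ + (ι k + ι k))) (2triangle k) ⟩
      ι k * ι k + (1ℚ + (ι k + ι k))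
        ≡⟨ solve 1 (λ k → k :* k :+ (con 1ℚ :+ (k :+ k)) := (con 1ℚ :+ k) :* (con 1ℚ :+ k)) refl (ι k) ⟩
      (1ℚ + ι k) * (1ℚ + ι k)
        ≡⟨ cong₂ _*_ (sym (ι-suc k)) (sym (ι-suc k)) ⟩
      ι (suc k) * ι (suc k) ∎
      where open ≡-Reasoning

  abstract
    -- x² k² γᵏ ≤ 2 when x ≤ 1, whence k γᵏ → 0.
    k*γ^k-small : ∀ {γ x} → 0ℚ ≤ γ → 0ℚ < x → x ≤ 1ℚ → γ * (1ℚ + x) ≤ 1ℚ → ∀ ε → 0ℚ < ε →
      ∃[ N ] (∀ k → N ℕ.≤ k → ι k * γ ^ k ≤ ε)
    k*γ^k-small {γ} {x} 0≤γ 0<x x≤1 h ε 0<ε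
      = suc N , small
      where
      open ℚ.≤-Reasoning
      0≤x : 0ℚ ≤ x
      0≤x = ℚ.<⇒≤ 0<x
      N,h : ∃[ N ] (∀ k → N ℕ.≤ k → 1ℚ + 1ℚ ≤ ι k * (x * x * ε))
      N,h = eventually-small (1ℚ + 1ℚ) (x * x * ε) (0<* (0<* 0<x 0<x) 0<ε)
      N : ℕ
      N = proj₁ N,h
      h₂ : ∀ k → N ℕ.≤ k → 1ℚ + 1ℚ ≤ ι k * (x * x * ε)
      h₂ = proj₂ N,h
      bound : ∀ k → x * x * ι k * (ι k * γ ^ k) ≤ 1ℚ + 1ℚ
      bound k = begin
        x * x * ι k * (ι k * γ ^ k)
          ≡⟨ solve 3 (λ x k g → x :* x :* k :* (k :* g) := g :* ((k :* k) :* (x :* x))) refl x (ι k) g ⟩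
        g * ((ι k * ι k) * (x * x))
          ≡⟨ cong (λ y → g * (y * (x * x))) (sym (2triangle k)) ⟩
        g * ((ι t + ι t + ι k) * (x * x))
          ≤⟨ *-monoˡ (0≤^ 0≤γ k) (≤-from (1ℚ + 1ℚ + ι k * x + ι k * x * (1ℚ - x))
               (0≤+ (0≤+ (ℚ.nonNegative⁻¹ (1ℚ + 1ℚ)) (0≤* (0≤ι k) 0≤x))
                    (0≤* (0≤* (0≤ι k) 0≤x) (≤⇒0≤- x≤1)))
               (solve 3 (λ x k t → (t :+ t :+ k) :* (x :* x) :+ (con 1ℚ :+ con 1ℚ :+ k :* x :+ k :* x :* (con 1ℚ :- x))
                  := (con 1ℚ :+ k :* x :+ t :* (x :* x)) :+ (con 1ℚ :+ k :* x :+ t :* (x :* x))) refl x (ι k) (ι t))) ⟩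
        g * ((1ℚ + ι k * x + ι t * (x * x)) + (1ℚ + ι k * x + ι t * (x * x)))
          ≡⟨ solve 2 (λ g y → g :* (y :+ y) := g :* y :+ g :* y) refl g (1ℚ + ι k * x + ι t * (x * x)) ⟩
        g * (1ℚ + ι k * x + ι t * (x * x)) + g * (1ℚ + ι k * x + ι t * (x * x))
          ≤⟨ ℚ.+-mono-≤ (quadratic-bernoulli 0≤γ 0≤x h k) (quadratic-bernoulli 0≤γ 0≤x h k) ⟩
        1ℚ + 1ℚ ∎
        where
        g : ℚ
        g = γ ^ k
        t : ℕ
        t = triangle k
      small : ∀ k → suc N ℕ.≤ k → ι k * γ ^ k ≤ ε
      small (suc k) (s≤s N≤k) = *-cancelˡ-≤ {x * x * ι (suc k)} (0<* {x * x} (0<* 0<x 0<x) (0<ι k)) (begin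
          x * x * ι (suc k) * (ι (suc k) * γ ^ suc k)
            ≤⟨ bound (suc k) ⟩
          1ℚ + 1ℚ
            ≤⟨ h₂ (suc k) (ℕ.m≤n⇒m≤1+n N≤k) ⟩
          ι (suc k) * (x * x * ε)
            ≡⟨ solve 3 (λ k x e → k :* (x :* x :* e) := x :* x :* k :* e) refl (ι (suc k)) x ε ⟩
          x * x * ι (suc k) * ε ∎)

    private
      divisor-bound : ∀ c ε → 0ℚ ≤ c → 0ℚ < ε → ∃[ δ ] (0ℚ < δ × c * δ ≤ ε)
      divisor-bound c ε 0≤c 0<ε =
        let δ , 0<δ , eq = divisor (c + 1ℚ) ε (ℚ.+-mono-≤-< 0≤c (ℚ.positive⁻¹ 1ℚ)) 0<ε
        in δ , 0<δ , ≤-from {c * δ} {ε} δ (ℚ.<⇒≤ 0<δ)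
          (trans (solve 2 (λ c d → c :* d :+ d := (c :+ con 1ℚ) :* d) refl c δ) eq)

    -- The pair of conditions `0 < x` and `γ (1 + x) ≤ 1` expresses γ < 1 quantitatively. From k = 1
    -- on the constant c is absorbed into c k, which reduces the claim to `k*γ^k-small`. The linear
    -- factor is needed both for the error of the Cauchy product and for the expectation of a time
    -- that grows with the number of steps.
    affine*γ^k-small : ∀ {γ x} → 0ℚ ≤ γ → 0ℚ < x → x ≤ 1ℚ → γ * (1ℚ + x) ≤ 1ℚ →
      ∀ c d → 0ℚ ≤ c → 0ℚ ≤ d → ∀ ε → 0ℚ < ε → ∃[ N ] (∀ k → N ℕ.≤ k → (c + d * ι k) * γ ^ k ≤ ε)
    affine*γ^k-small {γ} {x} 0≤γ 0<x x≤1 h c d 0≤c 0≤d ε 0<ε = suc N , bound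
      where
      open ℚ.≤-Reasoning
      δ : ∃[ δ ] (0ℚ < δ × (c + d) * δ ≤ ε)
      δ = divisor-bound (c + d) ε (0≤+ 0≤c 0≤d) 0<ε
      small : ∃[ N ] (∀ k → N ℕ.≤ k → ι k * γ ^ k ≤ proj₁ δ)
      small = k*γ^k-small 0≤γ 0<x x≤1 h (proj₁ δ) (proj₁ (proj₂ δ))
      N : ℕ
      N = proj₁ small
      bound : ∀ k → suc N ℕ.≤ k → (c + d * ι k) * γ ^ k ≤ ε
      bound (suc k) (s≤s N≤k) = begin
        (c + d * ι (suc k)) * γ ^ suc k
          ≤⟨ *-monoʳ {γ ^ suc k} {c + d * ι (suc k)} {(c + d) * ι (suc k)} (0≤^ 0≤γ (suc k))
               (≤-from {c + d * ι (suc k)} {(c + d) * ι (suc k)} (c * ι k) (0≤* 0≤c (0≤ι k))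
                 (subst (λ n → c + d * n + c * ι k ≡ (c + d) * n) (sym (ι-suc k))
                   (solve 3 (λ c d k → c :+ d :* (con 1ℚ :+ k) :+ c :* k := (c :+ d) :* (con 1ℚ :+ k)) refl c d (ι k)))) ⟩
        (c + d) * ι (suc k) * γ ^ suc k
          ≡⟨ ℚ.*-assoc (c + d) (ι (suc k)) (γ ^ suc k) ⟩
        (c + d) * (ι (suc k) * γ ^ suc k)
          ≤⟨ *-monoˡ {c + d} (0≤+ 0≤c 0≤d) (proj₂ small (suc k) (ℕ.m≤n⇒m≤1+n N≤k)) ⟩
        (c + d) * proj₁ δ
          ≤⟨ proj₂ (proj₂ δ) ⟩
        ε ∎

    γ^k-small : ∀ {γ x} → 0ℚ ≤ γ → 0ℚ < x → x ≤ 1ℚ → γ * (1ℚ + x) ≤ 1ℚ →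
      ∀ c → 0ℚ ≤ c → ∀ ε → 0ℚ < ε → ∃[ N ] (∀ k → N ℕ.≤ k → c * γ ^ k ≤ ε)
    γ^k-small {γ} 0≤γ 0<x x≤1 h c 0≤c ε 0<ε = proj₁ small , λ k N≤k → subst (_≤ ε)
      (cong (_* γ ^ k) (trans (cong (λ z → c + z) (ℚ.*-zeroˡ (ι k))) (ℚ.+-identityʳ c))) (proj₂ small k N≤k)
      where
      small : ∃[ N ] (∀ k → N ℕ.≤ k → (c + 0ℚ * ι k) * γ ^ k ≤ ε)
      small = affine*γ^k-small 0≤γ 0<x x≤1 h c 0ℚ 0≤c ℚ.≤-refl ε 0<ε

module R = Rational
module Q = ℚSolver.+-*-Solver

-- Dominated series, Cauchy products and the exponential series over the rationals.

module RationalSeries where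
  open import Data.Rational.Base using (_+_; _*_; _-_; -_; _≤_; _<_)
  open ≡ using (sym; trans; module ≡-Reasoning)
  open Rational
  open ℚSolver.+-*-Solver

  ∑ : ℕ → (ℕ → ℚ) → ℚ
  ∑ zero    f = 0ℚ
  ∑ (suc N) f = f 0 + ∑ N (f ∘ suc)

  ∑-cong : ∀ N {f g : ℕ → ℚ} → (∀ i → f i ≡ g i) → ∑ N f ≡ ∑ N g
  ∑-cong zero    h = refl
  ∑-cong (suc N) h = cong₂ _+_ (h 0) (∑-cong N (h ∘ suc))

  ∑-snoc : ∀ N (f : ℕ → ℚ) → ∑ (suc N) f ≡ ∑ N f + f N
  ∑-snoc zero    f = trans (ℚ.+-identityʳ (f 0)) (sym (ℚ.+-identityˡ (f 0)))
  ∑-snoc (suc N) f = trans (cong (f 0 +_) (∑-snoc N (f ∘ suc)))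
                           (sym (ℚ.+-assoc (f 0) (∑ N (f ∘ suc)) (f (suc N))))

  ∑-+ : ∀ N (f g : ℕ → ℚ) → ∑ N (λ i → f i + g i) ≡ ∑ N f + ∑ N g
  ∑-+ zero    f g = refl
  ∑-+ (suc N) f g = trans (cong (f 0 + g 0 +_) (∑-+ N (f ∘ suc) (g ∘ suc)))
    (solve 4 (λ a b c d → a :+ b :+ (c :+ d) := a :+ c :+ (b :+ d)) refl
      (f 0) (g 0) (∑ N (f ∘ suc)) (∑ N (g ∘ suc)))

  ∑-* : ∀ N c (f : ℕ → ℚ) → ∑ N (λ i → c * f i) ≡ c * ∑ N f
  ∑-* zero    c f = sym (ℚ.*-zeroʳ c)
  ∑-* (suc N) c f = trans (cong (c * f 0 +_) (∑-* N c (f ∘ suc)))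
                          (sym (ℚ.*-distribˡ-+ c (f 0) (∑ N (f ∘ suc))))

  ∑-minus : ∀ N (f g : ℕ → ℚ) → ∑ N (λ i → f i - g i) ≡ ∑ N f - ∑ N g
  ∑-minus N f g = trans (∑-+ N f (λ i → - g i)) (cong (∑ N f +_) (∑-neg N g))
    where
    ∑-neg : ∀ N (g : ℕ → ℚ) → ∑ N (λ i → - g i) ≡ - ∑ N g
    ∑-neg zero    g = refl
    ∑-neg (suc N) g = trans (cong (- g 0 +_) (∑-neg N (g ∘ suc)))
                            (sym (ℚ.neg-distrib-+ (g 0) (∑ N (g ∘ suc))))

  Dominated : ℚ → (ℕ → ℚ) → Set
  Dominated K f = ∀ i → ∣ f i ∣ ≤ K * ½ ^ i

  dominated-suc : ∀ {K f} → Dominated K f → Dominated (K * ½) (f ∘ suc)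
  dominated-suc {K} h i = ℚ.≤-trans (h (suc i)) (ℚ.≤-reflexive (sym (ℚ.*-assoc K ½ (½ ^ i))))

  private
    halves : ∀ K → K + (K * ½ + K * ½) ≡ K + K
    halves = solve 1 (λ K → K :+ (K :* con ½ :+ K :* con ½) := K :+ K) refl

  dominated-∑ : ∀ {K f} → 0ℚ ≤ K → Dominated K f → ∀ N → ∣ ∑ N f ∣ ≤ K + K
  dominated-∑ 0≤K h zero = 0≤+ 0≤K 0≤K
  dominated-∑ {K} {f} 0≤K h (suc N) = ℚ.≤-trans
    (∣+∣≤ {f 0} {∑ N (f ∘ suc)} (subst (∣ f 0 ∣ ≤_) (ℚ.*-identityʳ K) (h 0))
      (dominated-∑ {K * ½} (0≤* 0≤K (ℚ.nonNegative⁻¹ ½)) (dominated-suc {K} {f} h) N))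
    (ℚ.≤-reflexive (halves K))

  dominated-tail : ∀ {K f} → 0ℚ ≤ K → Dominated K f → ∀ {M N} → N ℕ.≤ M →
    ∣ ∑ M f - ∑ N f ∣ ≤ (K + K) * ½ ^ N
  dominated-tail {K} {f} 0≤K h {M} {zero} z≤n =
    subst₂ _≤_ (cong ∣_∣ (sym (ℚ.+-identityʳ (∑ M f)))) (sym (ℚ.*-identityʳ (K + K)))
      (dominated-∑ 0≤K h M)
  dominated-tail {K} {f} 0≤K h {suc M} {suc N} (s≤s N≤M) = subst₂ _≤_
    (cong ∣_∣ (solve 3 (λ a b c → b :- c := a :+ b :- (a :+ c)) refl
      (f 0) (∑ M (f ∘ suc)) (∑ N (f ∘ suc))))
    (solve 2 (λ K p → (K :* con ½ :+ K :* con ½) :* p := (K :+ K) :* (con ½ :* p)) refl K (½ ^ N))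
    (dominated-tail {K * ½} (0≤* 0≤K (ℚ.nonNegative⁻¹ ½)) (dominated-suc {K} {f} h) N≤M)

  conv : (ℕ → ℚ) → (ℕ → ℚ) → ℕ → ℚ
  conv f g zero    = f 0 * g 0
  conv f g (suc k) = f 0 * g (suc k) + conv (f ∘ suc) g k

  conv-cong : ∀ {f f′ g g′ : ℕ → ℚ} → (∀ i → f i ≡ f′ i) → (∀ i → g i ≡ g′ i) →
    ∀ k → conv f g k ≡ conv f′ g′ k
  conv-cong p q zero    = cong₂ _*_ (p 0) (q 0)
  conv-cong p q (suc k) = cong₂ _+_ (cong₂ _*_ (p 0) (q (suc k))) (conv-cong (p ∘ suc) q k)

  conv-+ˡ : ∀ (f f′ g : ℕ → ℚ) k → conv (λ i → f i + f′ i) g k ≡ conv f g k + conv f′ g k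
  conv-+ˡ f f′ g zero    = ℚ.*-distribʳ-+ (g 0) (f 0) (f′ 0)
  conv-+ˡ f f′ g (suc k) = trans (cong ((f 0 + f′ 0) * g (suc k) +_) (conv-+ˡ (f ∘ suc) (f′ ∘ suc) g k))
    (solve 5 (λ a b c d e → (a :+ b) :* c :+ (d :+ e) := a :* c :+ d :+ (b :* c :+ e)) refl
      (f 0) (f′ 0) (g (suc k)) (conv (f ∘ suc) g k) (conv (f′ ∘ suc) g k))

  conv-*ˡ : ∀ c (f g : ℕ → ℚ) k → conv (λ i → c * f i) g k ≡ c * conv f g k
  conv-*ˡ c f g zero    = ℚ.*-assoc c (f 0) (g 0)
  conv-*ˡ c f g (suc k) = trans (cong (c * f 0 * g (suc k) +_) (conv-*ˡ c (f ∘ suc) g k))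
    (solve 4 (λ c a b d → c :* a :* b :+ c :* d := c :* (a :* b :+ d)) refl c (f 0) (g (suc k)) (conv (f ∘ suc) g k))

  conv-*ʳ : ∀ c (f g : ℕ → ℚ) k → conv f (λ i → c * g i) k ≡ c * conv f g k
  conv-*ʳ c f g zero    = solve 3 (λ c a b → a :* (c :* b) := c :* (a :* b)) refl c (f 0) (g 0)
  conv-*ʳ c f g (suc k) = trans (cong (f 0 * (c * g (suc k)) +_) (conv-*ʳ c (f ∘ suc) g k))
    (solve 4 (λ c a b d → a :* (c :* b) :+ c :* d := c :* (a :* b :+ d)) refl c (f 0) (g (suc k)) (conv (f ∘ suc) g k))

  ∑-conv : ∀ N (f g : ℕ → ℚ) →
    ∑ (suc N) (conv f g) ≡ f 0 * ∑ (suc N) g + ∑ N (conv (f ∘ suc) g)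
  ∑-conv N f g = begin
    f 0 * g 0 + ∑ N (λ k → f 0 * g (suc k) + conv (f ∘ suc) g k)
      ≡⟨ cong (f 0 * g 0 +_) (∑-+ N (λ k → f 0 * g (suc k)) (conv (f ∘ suc) g)) ⟩
    f 0 * g 0 + (∑ N (λ k → f 0 * g (suc k)) + ∑ N (conv (f ∘ suc) g))
      ≡⟨ cong (λ x → f 0 * g 0 + (x + ∑ N (conv (f ∘ suc) g))) (∑-* N (f 0) (g ∘ suc)) ⟩
    f 0 * g 0 + (f 0 * ∑ N (g ∘ suc) + ∑ N (conv (f ∘ suc) g))
      ≡⟨ solve 4 (λ a b c d → a :* b :+ (a :* c :+ d) := a :* (b :+ c) :+ d) refl
           (f 0) (g 0) (∑ N (g ∘ suc)) (∑ N (conv (f ∘ suc) g)) ⟩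
    f 0 * ∑ (suc N) g + ∑ N (conv (f ∘ suc) g) ∎
    where open ≡-Reasoning

  -- Peeling off `f 0` leaves the same difference for the shifted series, which is dominated with
  -- half the constant, plus the product of its partial sum with the single term `g N`. Each of the
  -- N peelings contributes an error of order `½ ^ N`, hence the factor N.
  cauchy-product : ∀ {K L f g} → 0ℚ ≤ K → 0ℚ ≤ L → Dominated K f → Dominated L g → ∀ N →
    ∣ ∑ N f * ∑ N g - ∑ N (conv f g) ∣ ≤ (K + K) * L * (ι N * ½ ^ N)
  cauchy-product {K} {L} 0≤K 0≤L hf hg zero = ℚ.≤-reflexive (sym
    (trans (cong (λ x → (K + K) * L * (x * 1ℚ)) ι-0) (ℚ.*-zeroʳ ((K + K) * L))))
  cauchy-product {K} {L} {f} {g} 0≤K 0≤L hf hg (suc N) = begin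
    ∣ (f 0 + F) * ∑ (suc N) g - ∑ (suc N) (conv f g) ∣
      ≡⟨ cong (λ x → ∣ (f 0 + F) * ∑ (suc N) g - x ∣) (∑-conv N f g) ⟩
    ∣ (f 0 + F) * ∑ (suc N) g - (f 0 * ∑ (suc N) g + D) ∣
      ≡⟨ cong (λ x → ∣ (f 0 + F) * x - (f 0 * x + D) ∣) (∑-snoc N g) ⟩
    ∣ (f 0 + F) * (∑ N g + g N) - (f 0 * (∑ N g + g N) + D) ∣
      ≡⟨ cong ∣_∣ (solve 5 (λ a F G b D → (a :+ F) :* (G :+ b) :- (a :* (G :+ b) :+ D) := (F :* G :- D) :+ F :* b)
           refl (f 0) F (∑ N g) (g N) D) ⟩
    ∣ (F * ∑ N g - D) + F * g N ∣
      ≤⟨ ∣+∣≤ {F * ∑ N g - D} {F * g N} (cauchy-product {K * ½} 0≤K½ 0≤L hf′ hg N)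
           (∣*∣≤ {F} {g N} (dominated-∑ 0≤K½ hf′ N) (hg N)) ⟩
    (K * ½ + K * ½) * L * (ι N * ½ ^ N) + (K * ½ + K * ½) * (L * ½ ^ N)
      ≡⟨ solve 4 (λ K L n p → (K :* con ½ :+ K :* con ½) :* L :* (n :* p) :+ (K :* con ½ :+ K :* con ½) :* (L :* p)
                 := (K :+ K) :* L :* ((con 1ℚ :+ n) :* (con ½ :* p))) refl K L (ι N) (½ ^ N) ⟩
    (K + K) * L * ((1ℚ + ι N) * (½ * ½ ^ N))
      ≡⟨ cong (λ x → (K + K) * L * (x * (½ * ½ ^ N))) (sym (ι-suc N)) ⟩
    (K + K) * L * (ι (suc N) * ½ ^ suc N) ∎
    where
    open ℚ.≤-Reasoning
    F = ∑ N (f ∘ suc)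
    D = ∑ N (conv (f ∘ suc) g)
    0≤K½ : 0ℚ ≤ K * ½
    0≤K½ = 0≤* 0≤K (ℚ.nonNegative⁻¹ ½)
    hf′ : Dominated (K * ½) (f ∘ suc)
    hf′ = dominated-suc {K} {f} hf

  deriv : (ℕ → ℚ) → ℕ → ℚ
  deriv f i = ι (suc i) * f (suc i)

  -- The product rule for formal power series, read off coefficient by coefficient; `deriv` is the
  -- formal derivative.
  leibniz : ∀ (f g : ℕ → ℚ) k →
    ι (suc k) * conv f g (suc k) ≡ conv (deriv f) g k + conv f (deriv g) k
  leibniz f g zero = begin
    ι 1 * (f 0 * g 1 + f 1 * g 0)
      ≡⟨ solve 5 (λ i a b c d → i :* (a :* b :+ c :* d) := i :* c :* d :+ a :* (i :* b)) refl (ι 1) (f 0) (g 1) (f 1) (g 0) ⟩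
    ι 1 * f 1 * g 0 + f 0 * (ι 1 * g 1) ∎
    where open ≡-Reasoning
  leibniz f g (suc k) = begin
    ι (2 ℕ.+ k) * (f 0 * g₂ + c₁)
      ≡⟨ cong (_* (f 0 * g₂ + c₁)) (ι-suc (suc k)) ⟩
    (1ℚ + ι (suc k)) * (f 0 * g₂ + c₁)
      ≡⟨ solve 4 (λ i a b c → (con 1ℚ :+ i) :* (a :* b :+ c) := a :* ((con 1ℚ :+ i) :* b) :+ (c :+ i :* c))
           refl (ι (suc k)) (f 0) g₂ c₁ ⟩
    f 0 * ((1ℚ + ι (suc k)) * g₂) + (c₁ + ι (suc k) * c₁)
      ≡⟨ cong₂ (λ x y → f 0 * (x * g₂) + (c₁ + y)) (sym (ι-suc (suc k))) (leibniz (f ∘ suc) g k) ⟩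
    f 0 * (ι (2 ℕ.+ k) * g₂) + (f 1 * g (suc k) + conv (λ i → f (2 ℕ.+ i)) g k + (conv (deriv (f ∘ suc)) g k + cg))
      ≡⟨ solve 6 (λ A a b c d e → A :+ (a :* b :+ c :+ (d :+ e)) := a :* b :+ (c :+ d) :+ (A :+ e)) refl
           (f 0 * (ι (2 ℕ.+ k) * g₂)) (f 1) (g (suc k)) (conv (λ i → f (2 ℕ.+ i)) g k) (conv (deriv (f ∘ suc)) g k) cg ⟩
    f 1 * g (suc k) + (conv (λ i → f (2 ℕ.+ i)) g k + conv (deriv (f ∘ suc)) g k) + (f 0 * (ι (2 ℕ.+ k) * g₂) + cg)
      ≡⟨ cong₂ (λ x y → x + y + (f 0 * (ι (2 ℕ.+ k) * g₂) + cg))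
           (cong (_* g (suc k)) (trans (sym (ℚ.*-identityˡ (f 1))) (cong (_* f 1) (sym ι-1))))
           (trans (sym (conv-+ˡ (λ i → f (2 ℕ.+ i)) (deriv (f ∘ suc)) g k))
             (conv-cong {g = g} (λ i → trans
               (solve 2 (λ n a → a :+ n :* a := (con 1ℚ :+ n) :* a) refl (ι (suc i)) (f (2 ℕ.+ i)))
               (cong (_* f (2 ℕ.+ i)) (sym (ι-suc (suc i))))) (λ _ → refl) k)) ⟩
    ι 1 * f 1 * g (suc k) + conv (deriv f ∘ suc) g k + (f 0 * (ι (2 ℕ.+ k) * g₂) + cg) ∎
    where
    open ≡-Reasoning
    g₂ = g (2 ℕ.+ k)
    c₁ = conv (f ∘ suc) g (suc k)
    cg = conv (f ∘ suc) (deriv g) k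

  e : ℚ → ℕ → ℚ
  e x zero    = 1ℚ
  e x (suc k) = x * e x k * inv (suc k)

  deriv-e : ∀ x k → deriv (e x) k ≡ x * e x k
  deriv-e x k = begin
    ι (suc k) * (x * e x k * inv (suc k))
      ≡⟨ solve 3 (λ i a j → i :* (a :* j) := a :* (j :* i)) refl (ι (suc k)) (x * e x k) (inv (suc k)) ⟩
    x * e x k * (inv (suc k) * ι (suc k))
      ≡⟨ cong (x * e x k *_) (inv-inverse (suc k)) ⟩
    x * e x k * 1ℚ
      ≡⟨ ℚ.*-identityʳ (x * e x k) ⟩
    x * e x k ∎
    where open ≡-Reasoning

  -- Both sides have a formal derivative equal to x + y times themselves, so each coefficient is
  -- determined by the preceding one. The product rule thus takes the place of the binomial theorem.
  conv-e : ∀ x y k → conv (e x) (e y) k ≡ e (x + y) k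
  conv-e x y zero    = refl
  conv-e x y (suc k) = begin
    c
      ≡⟨ sym (ℚ.*-identityˡ c) ⟩
    1ℚ * c
      ≡⟨ cong (_* c) (sym (inv-inverse (suc k))) ⟩
    inv (suc k) * ι (suc k) * c
      ≡⟨ ℚ.*-assoc (inv (suc k)) (ι (suc k)) c ⟩
    inv (suc k) * (ι (suc k) * c)
      ≡⟨ cong (inv (suc k) *_) (leibniz (e x) (e y) k) ⟩
    inv (suc k) * (conv (deriv (e x)) (e y) k + conv (e x) (deriv (e y)) k)
      ≡⟨ cong (inv (suc k) *_) (cong₂ _+_
           (trans (conv-cong {g = e y} (deriv-e x) (λ _ → refl) k) (conv-*ˡ x (e x) (e y) k))
           (trans (conv-cong {f = e x} (λ _ → refl) (deriv-e y) k) (conv-*ʳ y (e x) (e y) k))) ⟩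
    inv (suc k) * (x * conv (e x) (e y) k + y * conv (e x) (e y) k)
      ≡⟨ cong (λ z → inv (suc k) * (x * z + y * z)) (conv-e x y k) ⟩
    inv (suc k) * (x * e (x + y) k + y * e (x + y) k)
      ≡⟨ solve 4 (λ i x y z → i :* (x :* z :+ y :* z) := (x :+ y) :* z :* i) refl (inv (suc k)) x y (e (x + y) k) ⟩
    (x + y) * e (x + y) k * inv (suc k) ∎
    where
    open ≡-Reasoning
    c = conv (e x) (e y) (suc k)

  0≤e : ∀ {B} → 0ℚ ≤ B → ∀ k → 0ℚ ≤ e B k
  0≤e 0≤B zero    = ℚ.nonNegative⁻¹ 1ℚ
  0≤e 0≤B (suc k) = 0≤* (0≤* 0≤B (0≤e 0≤B k)) (0≤inv (suc k))

  private
    ∣inv∣≤ : ∀ k → ∣ inv (suc k) ∣ ≤ inv (suc k)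
    ∣inv∣≤ k = ℚ.≤-reflexive (ℚ.0≤p⇒∣p∣≡p (0≤inv (suc k)))

  ∣e∣≤ : ∀ {x B} → ∣ x ∣ ≤ B → ∀ k → ∣ e x k ∣ ≤ e B k
  ∣e∣≤ h zero    = ℚ.≤-refl
  ∣e∣≤ {x} {B} h (suc k) = ∣*∣≤ {x * e x k} {inv (suc k)} (∣*∣≤ {x} {e x k} h (∣e∣≤ h k)) (∣inv∣≤ k)

  -- The mean value estimate, since the derivative of x^(k+1)/(k+1)! is x^k/k!. In the induction x a
  -- - y b is split as x (a - b) + (x - y) b; the two parts contribute k + 1 and 1 copies of the
  -- next coefficient, which the factor `inv (2 + k)` averages.
  e-lipschitz : ∀ {x y B} → ∣ x ∣ ≤ B → ∣ y ∣ ≤ B → ∀ k →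
    ∣ e x (suc k) - e y (suc k) ∣ ≤ ∣ x - y ∣ * e B k
  e-lipschitz {x} {y} {B} hx hy zero = ℚ.≤-reflexive (begin
    ∣ x * 1ℚ * inv 1 - y * 1ℚ * inv 1 ∣
      ≡⟨ cong (λ i → ∣ x * 1ℚ * i - y * 1ℚ * i ∣)
           (trans (sym (ℚ.*-identityʳ (inv 1))) (trans (cong (inv 1 *_) (sym ι-1)) (inv-inverse 1))) ⟩
    ∣ x * 1ℚ * 1ℚ - y * 1ℚ * 1ℚ ∣
      ≡⟨ cong ∣_∣ (solve 2 (λ x y → x :* con 1ℚ :* con 1ℚ :- y :* con 1ℚ :* con 1ℚ := x :- y) refl x y) ⟩
    ∣ x - y ∣
      ≡⟨ sym (ℚ.*-identityʳ ∣ x - y ∣) ⟩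
    ∣ x - y ∣ * 1ℚ ∎)
    where open ≡-Reasoning
  e-lipschitz {x} {y} {B} hx hy (suc k) = begin
    ∣ x * ex * j - y * ey * j ∣
      ≡⟨ cong ∣_∣ (solve 5 (λ x y a b j → x :* a :* j :- y :* b :* j := (x :* (a :- b) :+ (x :- y) :* b) :* j) refl x y ex ey j) ⟩
    ∣ (x * (ex - ey) + (x - y) * ey) * j ∣
      ≤⟨ ∣*∣≤ {x * (ex - ey) + (x - y) * ey} {j} (∣+∣≤ {x * (ex - ey)} {(x - y) * ey}
           (∣*∣≤ {x} {ex - ey} hx (e-lipschitz hx hy k))
           (∣*∣≤ {x - y} {ey} ℚ.≤-refl (∣e∣≤ hy (suc k)))) (∣inv∣≤ (suc k)) ⟩
    (B * (d * e B k) + d * e B (suc k)) * j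
      ≡⟨ solve 5 (λ B d a b j → (B :* (d :* a) :+ d :* b) :* j := d :* ((B :* a :+ b) :* j)) refl B d (e B k) (e B (suc k)) j ⟩
    d * ((B * e B k + e B (suc k)) * j)
      ≡⟨ cong (λ z → d * ((z + e B (suc k)) * j)) (sym (deriv-e B k)) ⟩
    d * ((ι (suc k) * e B (suc k) + e B (suc k)) * j)
      ≡⟨ solve 4 (λ d n a j → d :* ((n :* a :+ a) :* j) := d :* (a :* (j :* (con 1ℚ :+ n)))) refl d (ι (suc k)) (e B (suc k)) j ⟩
    d * (e B (suc k) * (j * (1ℚ + ι (suc k))))
      ≡⟨ cong (λ z → d * (e B (suc k) * (j * z))) (sym (ι-suc (suc k))) ⟩
    d * (e B (suc k) * (j * ι (2 ℕ.+ k)))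
      ≡⟨ cong (λ z → d * (e B (suc k) * z)) (inv-inverse (2 ℕ.+ k)) ⟩
    d * (e B (suc k) * 1ℚ)
      ≡⟨ cong (d *_) (ℚ.*-identityʳ (e B (suc k))) ⟩
    d * e B (suc k) ∎
    where
    open ℚ.≤-Reasoning
    j = inv (2 ℕ.+ k)
    ex = e x (suc k)
    ey = e y (suc k)
    d = ∣ x - y ∣

  -- The ratio test with ratio ½: every index before `k₀` doubles the constant and adds its own term
  -- to it.
  eventually-halving : ∀ k₀ (f : ℕ → ℚ) → (∀ k → 0ℚ ≤ f k) →
    (∀ k → k₀ ℕ.≤ k → f (suc k) ≤ ½ * f k) → ∃[ K ] (0ℚ ≤ K × (∀ k → f k ≤ K * ½ ^ k))
  eventually-halving zero f 0≤f h = f 0 , 0≤f 0 , bound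
    where
    bound : ∀ k → f k ≤ f 0 * ½ ^ k
    bound zero    = ℚ.≤-reflexive (sym (ℚ.*-identityʳ (f 0)))
    bound (suc k) = ℚ.≤-trans (h k z≤n) (ℚ.≤-trans (*-monoˡ (ℚ.nonNegative⁻¹ ½) (bound k))
      (ℚ.≤-reflexive (solve 3 (λ h a p → h :* (a :* p) := a :* (h :* p)) refl ½ (f 0) (½ ^ k))))
  eventually-halving (suc k₀) f 0≤f h = f 0 + (K + K) , 0≤+ (0≤f 0) (0≤+ 0≤K 0≤K) , bound
    where
    IH : ∃[ K ] (0ℚ ≤ K × (∀ k → f (suc k) ≤ K * ½ ^ k))
    IH = eventually-halving k₀ (f ∘ suc) (0≤f ∘ suc) (λ k k₀≤k → h (suc k) (s≤s k₀≤k))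
    K = proj₁ IH
    0≤K = proj₁ (proj₂ IH)
    bound : ∀ k → f k ≤ (f 0 + (K + K)) * ½ ^ k
    bound zero    = ≤-from (K + K) (0≤+ 0≤K 0≤K) (sym (ℚ.*-identityʳ _))
    bound (suc k) = ℚ.≤-trans (proj₂ (proj₂ IH) k) (≤-from (f 0 * (½ * ½ ^ k))
      (0≤* (0≤f 0) (0≤^ (ℚ.nonNegative⁻¹ ½) (suc k)))
      (solve 3 (λ K p a → K :* p :+ a :* (con ½ :* p) := (a :+ (K :+ K)) :* (con ½ :* p)) refl K (½ ^ k) (f 0)))

  abstract
    e-dominated : ∀ B → 0ℚ ≤ B → ∃[ K ] (0ℚ ≤ K × (∀ k → e B k ≤ K * ½ ^ k))
    e-dominated B 0≤B = eventually-halving k₀ (e B) (0≤e 0≤B) halving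
      where
      -- The ratio of consecutive terms is B/(k + 1), which is at most ½ as soon as k ≥ 2B.
      k₀,h : ∃[ N ] (∀ k → N ℕ.≤ k → B ≤ ι k * ½)
      k₀,h = eventually-small B ½ (ℚ.positive⁻¹ ½)
      k₀ : ℕ
      k₀ = proj₁ k₀,h
      halving : ∀ k → k₀ ℕ.≤ k → e B (suc k) ≤ ½ * e B k
      halving k k₀≤k = begin
        B * e B k * inv (suc k)
          ≤⟨ *-monoʳ (0≤inv (suc k)) (*-monoʳ (0≤e 0≤B k) (proj₂ k₀,h k k₀≤k)) ⟩
        ι k * ½ * e B k * inv (suc k)
          ≤⟨ *-monoʳ (0≤inv (suc k)) (*-monoʳ (0≤e 0≤B k) (*-monoʳ (ℚ.nonNegative⁻¹ ½) (ι-mono (ℕ.n≤1+n k)))) ⟩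
        ι (suc k) * ½ * e B k * inv (suc k)
          ≡⟨ solve 4 (λ n h a j → n :* h :* a :* j := (j :* n) :* (h :* a)) refl (ι (suc k)) ½ (e B k) (inv (suc k)) ⟩
        (inv (suc k) * ι (suc k)) * (½ * e B k)
          ≡⟨ cong (_* (½ * e B k)) (inv-inverse (suc k)) ⟩
        1ℚ * (½ * e B k)
          ≡⟨ ℚ.*-identityˡ (½ * e B k) ⟩
        ½ * e B k ∎
        where open ℚ.≤-Reasoning

-- Partial sums of the cosine and sine series, with addition formulas up to a vanishing error.

module RationalTrigonometry where
  open import Data.Rational.Base using (_+_; _*_; _-_; -_; _≤_; _<_)
  open ≡ using (sym; trans; module ≡-Reasoning)
  open Rational
  open RationalSeries
  open ℚSolver.+-*-Solver

  -- i ^ k = a k + i b k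
  a b : ℕ → ℚ
  a zero    = 1ℚ
  a (suc k) = - b k
  b zero    = 0ℚ
  b (suc k) = a k

  ∣a∣≤1 : ∀ k → ∣ a k ∣ ≤ 1ℚ
  ∣b∣≤1 : ∀ k → ∣ b k ∣ ≤ 1ℚ
  ∣a∣≤1 zero    = ℚ.≤-refl
  ∣a∣≤1 (suc k) = subst (_≤ 1ℚ) (sym (ℚ.∣-p∣≡∣p∣ (b k))) (∣b∣≤1 k)
  ∣b∣≤1 zero    = ℚ.nonNegative⁻¹ 1ℚ
  ∣b∣≤1 (suc k) = ∣a∣≤1 k

  a-+ : ∀ i j → a (i ℕ.+ j) ≡ a i * a j - b i * b j
  b-+ : ∀ i j → b (i ℕ.+ j) ≡ a i * b j + b i * a j
  a-+ zero    j = solve 2 (λ x y → x := con 1ℚ :* x :- con 0ℚ :* y) refl (a j) (b j)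
  a-+ (suc i) j = trans (cong -_ (b-+ i j))
    (solve 4 (λ p q r s → :- (p :* s :+ q :* r) := :- q :* r :- p :* s) refl (a i) (b i) (a j) (b j))
  b-+ zero    j = solve 2 (λ x y → y := con 1ℚ :* y :+ con 0ℚ :* x) refl (a j) (b j)
  b-+ (suc i) j = trans (a-+ i j)
    (solve 4 (λ p q r s → p :* r :- q :* s := :- q :* s :+ p :* r) refl (a i) (b i) (a j) (b j))

  private
    weight-+ : ∀ r k {w : ℕ → ℚ} → w (r ℕ.+ 0 ℕ.+ k) ≡ w (r ℕ.+ k)
    weight-+ r k {w} = cong (λ s → w (s ℕ.+ k)) (ℕ.+-identityʳ r)

    -- The real part of the statement that weighting the coefficients of both factors by powers of i
    -- weights their convolution by the same powers. The offset r makes the induction go through: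
    -- removing the first term of f shifts its weights by one. `conv-b` is the imaginary part.
    conv-a : ∀ r (f g : ℕ → ℚ) k →
      conv (λ i → a (r ℕ.+ i) * f i) (λ j → a j * g j) k - conv (λ i → b (r ℕ.+ i) * f i) (λ j → b j * g j) k
        ≡ a (r ℕ.+ k) * conv f g k
    conv-a r f g zero = begin
      A * f 0 * (1ℚ * g 0) - B * f 0 * (0ℚ * g 0)
        ≡⟨ solve 4 (λ A B f g → A :* f :* (con 1ℚ :* g) :- B :* f :* (con 0ℚ :* g) := A :* (f :* g)) refl A B (f 0) (g 0) ⟩
      A * (f 0 * g 0) ∎
      where
      open ≡-Reasoning
      A = a (r ℕ.+ 0)
      B = b (r ℕ.+ 0)
    conv-a r f g (suc k) = begin
      A * f 0 * (a (suc k) * g (suc k)) + conv (λ i → a (r ℕ.+ suc i) * f (suc i)) ag k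
        - (B * f 0 * (b (suc k) * g (suc k)) + conv (λ i → b (r ℕ.+ suc i) * f (suc i)) bg k)
        ≡⟨ solve 8 (λ A B p q x y c d → A :* x :* (p :* y) :+ c :- (B :* x :* (q :* y) :+ d)
                      := (A :* p :- B :* q) :* (x :* y) :+ (c :- d)) refl
             A B (a (suc k)) (b (suc k)) (f 0) (g (suc k))
             (conv (λ i → a (r ℕ.+ suc i) * f (suc i)) ag k) (conv (λ i → b (r ℕ.+ suc i) * f (suc i)) bg k) ⟩
      (A * a (suc k) - B * b (suc k)) * (f 0 * g (suc k))
        + (conv (λ i → a (r ℕ.+ suc i) * f (suc i)) ag k - conv (λ i → b (r ℕ.+ suc i) * f (suc i)) bg k)
        ≡⟨ cong₂ (λ x y → x * (f 0 * g (suc k)) + y)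
             (trans (sym (a-+ (r ℕ.+ 0) (suc k))) (weight-+ r (suc k) {a}))
             (trans (cong₂ _-_
               (conv-cong {g = ag} (λ i → cong (λ s → a s * f (suc i)) (ℕ.+-suc r i)) (λ _ → refl) k)
               (conv-cong {g = bg} (λ i → cong (λ s → b s * f (suc i)) (ℕ.+-suc r i)) (λ _ → refl) k))
               (trans (conv-a (suc r) (f ∘ suc) g k) (cong (λ s → a s * conv (f ∘ suc) g k) (sym (ℕ.+-suc r k))))) ⟩
      a (r ℕ.+ suc k) * (f 0 * g (suc k)) + a (r ℕ.+ suc k) * conv (f ∘ suc) g k
        ≡⟨ sym (ℚ.*-distribˡ-+ (a (r ℕ.+ suc k)) (f 0 * g (suc k)) (conv (f ∘ suc) g k)) ⟩
      a (r ℕ.+ suc k) * (f 0 * g (suc k) + conv (f ∘ suc) g k) ∎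
      where
      open ≡-Reasoning
      A = a (r ℕ.+ 0)
      B = b (r ℕ.+ 0)
      ag bg : ℕ → ℚ
      ag j = a j * g j
      bg j = b j * g j

    conv-b : ∀ r (f g : ℕ → ℚ) k →
      conv (λ i → a (r ℕ.+ i) * f i) (λ j → b j * g j) k + conv (λ i → b (r ℕ.+ i) * f i) (λ j → a j * g j) k
        ≡ b (r ℕ.+ k) * conv f g k
    conv-b r f g zero = begin
      A * f 0 * (0ℚ * g 0) + B * f 0 * (1ℚ * g 0)
        ≡⟨ solve 4 (λ A B f g → A :* f :* (con 0ℚ :* g) :+ B :* f :* (con 1ℚ :* g) := B :* (f :* g)) refl A B (f 0) (g 0) ⟩
      B * (f 0 * g 0) ∎
      where
      open ≡-Reasoning
      A = a (r ℕ.+ 0)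
      B = b (r ℕ.+ 0)
    conv-b r f g (suc k) = begin
      A * f 0 * (b (suc k) * g (suc k)) + conv (λ i → a (r ℕ.+ suc i) * f (suc i)) bg k
        + (B * f 0 * (a (suc k) * g (suc k)) + conv (λ i → b (r ℕ.+ suc i) * f (suc i)) ag k)
        ≡⟨ solve 8 (λ A B p q x y c d → A :* x :* (q :* y) :+ c :+ (B :* x :* (p :* y) :+ d)
                      := (A :* q :+ B :* p) :* (x :* y) :+ (c :+ d)) refl
             A B (a (suc k)) (b (suc k)) (f 0) (g (suc k))
             (conv (λ i → a (r ℕ.+ suc i) * f (suc i)) bg k) (conv (λ i → b (r ℕ.+ suc i) * f (suc i)) ag k) ⟩
      (A * b (suc k) + B * a (suc k)) * (f 0 * g (suc k))
        + (conv (λ i → a (r ℕ.+ suc i) * f (suc i)) bg k + conv (λ i → b (r ℕ.+ suc i) * f (suc i)) ag k)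
        ≡⟨ cong₂ (λ x y → x * (f 0 * g (suc k)) + y)
             (trans (sym (b-+ (r ℕ.+ 0) (suc k))) (weight-+ r (suc k) {b}))
             (trans (cong₂ _+_
               (conv-cong {g = bg} (λ i → cong (λ s → a s * f (suc i)) (ℕ.+-suc r i)) (λ _ → refl) k)
               (conv-cong {g = ag} (λ i → cong (λ s → b s * f (suc i)) (ℕ.+-suc r i)) (λ _ → refl) k))
               (trans (conv-b (suc r) (f ∘ suc) g k) (cong (λ s → b s * conv (f ∘ suc) g k) (sym (ℕ.+-suc r k))))) ⟩
      b (r ℕ.+ suc k) * (f 0 * g (suc k)) + b (r ℕ.+ suc k) * conv (f ∘ suc) g k
        ≡⟨ sym (ℚ.*-distribˡ-+ (b (r ℕ.+ suc k)) (f 0 * g (suc k)) (conv (f ∘ suc) g k)) ⟩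
      b (r ℕ.+ suc k) * (f 0 * g (suc k) + conv (f ∘ suc) g k) ∎
      where
      open ≡-Reasoning
      A = a (r ℕ.+ 0)
      B = b (r ℕ.+ 0)
      ag bg : ℕ → ℚ
      ag j = a j * g j
      bg j = b j * g j

  cosTerm sinTerm : ℚ → ℕ → ℚ
  cosTerm x k = a k * e x k
  sinTerm x k = b k * e x k

  Cos Sin : ℕ → ℚ → ℚ
  Cos N x = ∑ N (cosTerm x)
  Sin N x = ∑ N (sinTerm x)

  conv-cos : ∀ x y k →
    conv (cosTerm x) (cosTerm y) k - conv (sinTerm x) (sinTerm y) k ≡ cosTerm (x + y) k
  conv-cos x y k = trans (conv-a 0 (e x) (e y) k) (cong (a k *_) (conv-e x y k))

  conv-sin : ∀ x y k →
    conv (cosTerm x) (sinTerm y) k + conv (sinTerm x) (cosTerm y) k ≡ sinTerm (x + y) k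
  conv-sin x y k = trans (conv-b 0 (e x) (e y) k) (cong (b k *_) (conv-e x y k))

  ∣w*e∣≤ : ∀ {w x B} → ∣ w ∣ ≤ 1ℚ → ∣ x ∣ ≤ B → ∀ k → ∣ w * e x k ∣ ≤ e B k
  ∣w*e∣≤ {w} {x} {B} hw hx k = subst (∣ w * e x k ∣ ≤_) (ℚ.*-identityˡ (e B k)) (∣*∣≤ {w} {e x k} hw (∣e∣≤ hx k))

  w*e-lipschitz : ∀ {w x y B} → ∣ w ∣ ≤ 1ℚ → ∣ x ∣ ≤ B → ∣ y ∣ ≤ B → ∀ k →
    ∣ w * e x (suc k) - w * e y (suc k) ∣ ≤ ∣ x - y ∣ * e B k
  w*e-lipschitz {w} {x} {y} {B} hw hx hy k = subst₂ _≤_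
    (cong ∣_∣ (solve 3 (λ w p q → w :* (p :- q) := w :* p :- w :* q) refl w (e x (suc k)) (e y (suc k))))
    (ℚ.*-identityˡ (∣ x - y ∣ * e B k))
    (∣*∣≤ {w} {e x (suc k) - e y (suc k)} hw (e-lipschitz hx hy k))

  module Bounded (B : ℚ) (0≤B : 0ℚ ≤ B) where

    K : ℚ
    K = proj₁ (e-dominated B 0≤B)

    0≤K : 0ℚ ≤ K
    0≤K = proj₁ (proj₂ (e-dominated B 0≤B))

    private
      eB≤ : ∀ k → e B k ≤ K * ½ ^ k
      eB≤ = proj₂ (proj₂ (e-dominated B 0≤B))

    dom-cos : ∀ {x} → ∣ x ∣ ≤ B → Dominated K (cosTerm x)
    dom-cos hx k = ℚ.≤-trans (∣w*e∣≤ {a k} (∣a∣≤1 k) hx k) (eB≤ k)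

    dom-sin : ∀ {x} → ∣ x ∣ ≤ B → Dominated K (sinTerm x)
    dom-sin hx k = ℚ.≤-trans (∣w*e∣≤ {b k} (∣b∣≤1 k) hx k) (eB≤ k)

    Cos-tail : ∀ {x} → ∣ x ∣ ≤ B → ∀ {M N} → N ℕ.≤ M → ∣ Cos M x - Cos N x ∣ ≤ (K + K) * ½ ^ N
    Cos-tail {x} hx = dominated-tail {f = cosTerm x} 0≤K (dom-cos hx)

    Sin-tail : ∀ {x} → ∣ x ∣ ≤ B → ∀ {M N} → N ℕ.≤ M → ∣ Sin M x - Sin N x ∣ ≤ (K + K) * ½ ^ N
    Sin-tail {x} hx = dominated-tail {f = sinTerm x} 0≤K (dom-sin hx)

    private
      ∑-lipschitz : ∀ (w : ℕ → ℚ) → (∀ k → ∣ w k ∣ ≤ 1ℚ) → ∀ N {x y} → ∣ x ∣ ≤ B → ∣ y ∣ ≤ B →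
        ∣ ∑ N (λ k → w k * e x k) - ∑ N (λ k → w k * e y k) ∣ ≤ ∣ x - y ∣ * (K + K)
      ∑-lipschitz w hw zero {x} {y} hx hy = 0≤* (ℚ.0≤∣p∣ (x - y)) (0≤+ 0≤K 0≤K)
      ∑-lipschitz w hw (suc N) {x} {y} hx hy = subst₂ _≤_
        (cong ∣_∣ (trans (∑-minus N (λ k → w (suc k) * e x (suc k)) (λ k → w (suc k) * e y (suc k)))
          (solve 3 (λ p q r → q :- r := p :+ q :- (p :+ r)) refl (w 0 * 1ℚ) X Y)))
        (sym (ℚ.*-distribˡ-+ ∣ x - y ∣ K K))
        (dominated-∑ {∣ x - y ∣ * K} {λ k → w (suc k) * e x (suc k) - w (suc k) * e y (suc k)}
          (0≤* (ℚ.0≤∣p∣ (x - y)) 0≤K)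
          (λ k → ℚ.≤-trans (w*e-lipschitz {w (suc k)} (hw (suc k)) hx hy k)
            (ℚ.≤-trans (*-monoˡ (ℚ.0≤∣p∣ (x - y)) (eB≤ k))
              (ℚ.≤-reflexive (sym (ℚ.*-assoc ∣ x - y ∣ K (½ ^ k)))))) N)
        where
        X = ∑ N (λ k → w (suc k) * e x (suc k))
        Y = ∑ N (λ k → w (suc k) * e y (suc k))

    Cos-lipschitz : ∀ N {x y} → ∣ x ∣ ≤ B → ∣ y ∣ ≤ B → ∣ Cos N x - Cos N y ∣ ≤ ∣ x - y ∣ * (K + K)
    Cos-lipschitz = ∑-lipschitz a ∣a∣≤1

    Sin-lipschitz : ∀ N {x y} → ∣ x ∣ ≤ B → ∣ y ∣ ≤ B → ∣ Sin N x - Sin N y ∣ ≤ ∣ x - y ∣ * (K + K)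
    Sin-lipschitz = ∑-lipschitz b ∣b∣≤1

    private
      E : ℕ → ℚ
      E N = (K + K) * K * (ι N * ½ ^ N)

    Cos-+ : ∀ N {x y} → ∣ x ∣ ≤ B → ∣ y ∣ ≤ B →
      ∣ (Cos N x * Cos N y - Sin N x * Sin N y) - Cos N (x + y) ∣ ≤ E N + E N
    Cos-+ N {x} {y} hx hy = subst (_≤ E N + E N)
      (cong ∣_∣ (begin
        p - ∑ N (conv (cosTerm x) (cosTerm y)) - (q - ∑ N (conv (sinTerm x) (sinTerm y)))
          ≡⟨ solve 4 (λ p q c d → p :- c :- (q :- d) := (p :- q) :- (c :- d)) refl p q
               (∑ N (conv (cosTerm x) (cosTerm y))) (∑ N (conv (sinTerm x) (sinTerm y))) ⟩
        (p - q) - (∑ N (conv (cosTerm x) (cosTerm y)) - ∑ N (conv (sinTerm x) (sinTerm y)))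
          ≡⟨ cong (λ z → (p - q) - z) (trans (sym (∑-minus N (conv (cosTerm x) (cosTerm y)) (conv (sinTerm x) (sinTerm y))))
               (∑-cong N (conv-cos x y))) ⟩
        (p - q) - Cos N (x + y) ∎))
      (ℚ.≤-trans (ℚ.∣p-q∣≤∣p∣+∣q∣ (p - ∑ N (conv (cosTerm x) (cosTerm y))) (q - ∑ N (conv (sinTerm x) (sinTerm y))))
        (ℚ.+-mono-≤ (cauchy-product {f = cosTerm x} {g = cosTerm y} 0≤K 0≤K (dom-cos hx) (dom-cos hy) N)
                    (cauchy-product {f = sinTerm x} {g = sinTerm y} 0≤K 0≤K (dom-sin hx) (dom-sin hy) N)))
      where
      open ≡-Reasoning
      p = Cos N x * Cos N y
      q = Sin N x * Sin N y

    Sin-+ : ∀ N {x y} → ∣ x ∣ ≤ B → ∣ y ∣ ≤ B →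
      ∣ (Cos N x * Sin N y + Sin N x * Cos N y) - Sin N (x + y) ∣ ≤ E N + E N
    Sin-+ N {x} {y} hx hy = subst (_≤ E N + E N)
      (cong ∣_∣ (begin
        p - ∑ N (conv (cosTerm x) (sinTerm y)) + (q - ∑ N (conv (sinTerm x) (cosTerm y)))
          ≡⟨ solve 4 (λ p q c d → p :- c :+ (q :- d) := (p :+ q) :- (c :+ d)) refl p q
               (∑ N (conv (cosTerm x) (sinTerm y))) (∑ N (conv (sinTerm x) (cosTerm y))) ⟩
        (p + q) - (∑ N (conv (cosTerm x) (sinTerm y)) + ∑ N (conv (sinTerm x) (cosTerm y)))
          ≡⟨ cong (λ z → (p + q) - z) (trans (sym (∑-+ N (conv (cosTerm x) (sinTerm y)) (conv (sinTerm x) (cosTerm y))))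
               (∑-cong N (conv-sin x y))) ⟩
        (p + q) - Sin N (x + y) ∎))
      (ℚ.≤-trans (ℚ.∣p+q∣≤∣p∣+∣q∣ (p - ∑ N (conv (cosTerm x) (sinTerm y))) (q - ∑ N (conv (sinTerm x) (cosTerm y))))
        (ℚ.+-mono-≤ (cauchy-product {f = cosTerm x} {g = sinTerm y} 0≤K 0≤K (dom-cos hx) (dom-sin hy) N)
                    (cauchy-product {f = sinTerm x} {g = cosTerm y} 0≤K 0≤K (dom-sin hx) (dom-cos hy) N)))
      where
      open ≡-Reasoning
      p = Cos N x * Sin N y
      q = Sin N x * Cos N y

    error-small : ∀ ε → 0ℚ < ε → ∃[ N ] (∀ k → N ℕ.≤ k → E k + E k ≤ ε)
    error-small ε 0<ε = proj₁ small , λ k N≤k → ℚ.≤-trans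
      (ℚ.≤-reflexive (solve 3 (λ c n p → c :* (n :* p) :+ c :* (n :* p) := (con 0ℚ :+ (c :+ c) :* n) :* p)
        refl c (ι k) (½ ^ k)))
      (proj₂ small k N≤k)
      where
      c : ℚ
      c = (K + K) * K
      0≤c : 0ℚ ≤ c
      0≤c = 0≤* (0≤+ 0≤K 0≤K) 0≤K
      small : ∃[ N ] (∀ k → N ℕ.≤ k → (0ℚ + (c + c) * ι k) * ½ ^ k ≤ ε)
      small = affine*γ^k-small (ℚ.nonNegative⁻¹ ½) (ℚ.positive⁻¹ 1ℚ) ℚ.≤-refl ℚ.≤-refl
        0ℚ (c + c) ℚ.≤-refl (0≤+ 0≤c 0≤c) ε 0<ε

    tail-small : ∀ ε → 0ℚ < ε → ∃[ N ] (∀ k → N ℕ.≤ k → (K + K) * ½ ^ k ≤ ε)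
    tail-small = γ^k-small (ℚ.nonNegative⁻¹ ½) (ℚ.positive⁻¹ 1ℚ) ℚ.≤-refl ℚ.≤-refl (K + K) (0≤+ 0≤K 0≤K)

-- The arcsine as the limit of a contraction.

module RationalArcsine where
  open import Data.Rational.Base using (_+_; _*_; _-_; -_; _≤_; _<_)
  open ≡ using (sym; trans; module ≡-Reasoning)
  open import Data.Integer.Base using (+_)
  open Rational
  open RationalSeries
  open RationalTrigonometry
  open ℚSolver.+-*-Solver

  private
    inv-1 : inv 1 ≡ 1ℚ
    inv-1 = inv≡ 1
    inv-2 : inv 2 ≡ ½
    inv-2 = inv≡ 2
    ⅙ ¹⁄₂₄ ¹⁄₄₈ ¾ ¼ : ℚ
    ⅙ = + 1 ℚ./ 6
    ¹⁄₂₄ = + 1 ℚ./ 24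
    ¹⁄₄₈ = + 1 ℚ./ 48
    ¾ = + 3 ℚ./ 4
    ¼ = + 1 ℚ./ 4

    ≤! : ∀ {p q} {h : T (p ℚ.≤ᵇ q)} → p ≤ q
    ≤! {h = h} = ℚ.≤ᵇ⇒≤ h

    e-1-1 : e 1ℚ 1 ≡ 1ℚ
    e-1-1 = cong (λ i → 1ℚ * 1ℚ * i) inv-1
    e-1-2 : e 1ℚ 2 ≡ ½
    e-1-2 = cong₂ (λ p i → 1ℚ * p * i) e-1-1 inv-2
    e-1-3 : e 1ℚ 3 ≡ ⅙
    e-1-3 = cong₂ (λ p i → 1ℚ * p * i) e-1-2 (inv≡ 3)
    e-1-4 : e 1ℚ 4 ≡ ¹⁄₂₄
    e-1-4 = cong₂ (λ p i → 1ℚ * p * i) e-1-3 (inv≡ 4)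

    -- Beyond the first term the ratio of consecutive values 1/k! is at most ½, so a tail is at most
    -- twice its leading term.
    e-1-halving : ∀ {c} r → e 1ℚ (suc r) ≤ c → ∀ i → e 1ℚ (suc r ℕ.+ i) ≤ c * ½ ^ i
    e-1-halving {c} r h zero = ℚ.≤-trans (ℚ.≤-reflexive (cong (e 1ℚ) (ℕ.+-identityʳ (suc r))))
      (ℚ.≤-trans h (ℚ.≤-reflexive (sym (ℚ.*-identityʳ c))))
    e-1-halving {c} r h (suc i) = begin
      e 1ℚ (suc r ℕ.+ suc i)
        ≡⟨ cong (e 1ℚ) (ℕ.+-suc (suc r) i) ⟩
      1ℚ * E * inv (2 ℕ.+ (r ℕ.+ i))
        ≡⟨ cong (_* inv (2 ℕ.+ (r ℕ.+ i))) (ℚ.*-identityˡ E) ⟩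
      E * inv (2 ℕ.+ (r ℕ.+ i))
        ≤⟨ *-monoˡ (0≤e (ℚ.nonNegative⁻¹ 1ℚ) (suc r ℕ.+ i))
             (ℚ.≤-trans (inv-anti 2 (2 ℕ.+ (r ℕ.+ i)) (s≤s (s≤s z≤n))) (ℚ.≤-reflexive inv-2)) ⟩
      E * ½
        ≤⟨ *-monoʳ (ℚ.nonNegative⁻¹ ½) (e-1-halving r h i) ⟩
      c * ½ ^ i * ½
        ≡⟨ solve 3 (λ c p h → c :* p :* h := c :* (h :* p)) refl c (½ ^ i) ½ ⟩
      c * ½ ^ suc i ∎
      where
      open ℚ.≤-Reasoning
      E = e 1ℚ (suc r ℕ.+ i)

    ∑-bound₃ : ∀ {p q K f} → 0ℚ ≤ p → 0ℚ ≤ q → 0ℚ ≤ K → ∣ f 0 ∣ ≤ p → ∣ f 1 ∣ ≤ q →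
      Dominated K (λ i → f (2 ℕ.+ i)) → ∀ N → ∣ ∑ N f ∣ ≤ p + (q + (K + K))
    ∑-bound₃ 0≤p 0≤q 0≤K hp hq hK zero = 0≤+ 0≤p (0≤+ 0≤q (0≤+ 0≤K 0≤K))
    ∑-bound₃ {p} {q} {K} {f} 0≤p 0≤q 0≤K hp hq hK (suc zero) =
      ∣+∣≤ {f 0} {0ℚ} hp (0≤+ 0≤q (0≤+ 0≤K 0≤K))
    ∑-bound₃ {p} {q} {K} {f} 0≤p 0≤q 0≤K hp hq hK (suc (suc N)) =
      ∣+∣≤ {f 0} {f 1 + ∑ N (λ i → f (2 ℕ.+ i))} hp
        (∣+∣≤ {f 1} {∑ N (λ i → f (2 ℕ.+ i))} hq (dominated-∑ {K} {λ i → f (2 ℕ.+ i)} 0≤K hK N))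

  -- The k terms of the sine series that start with the cubic one, so that `R` is a truncation of
  -- sin x - x.
  R : ℕ → ℚ → ℚ
  R k x = ∑ k (λ i → b (3 ℕ.+ i) * e x (3 ℕ.+ i))

  Sin≡R : ∀ k x → Sin (3 ℕ.+ k) x ≡ x + R k x
  Sin≡R k x = begin
    0ℚ * 1ℚ + (1ℚ * (x * 1ℚ * inv 1) + (- 0ℚ * e x 2 + R k x))
      ≡⟨ cong (λ i → 0ℚ * 1ℚ + (1ℚ * (x * 1ℚ * i) + (- 0ℚ * e x 2 + R k x))) inv-1 ⟩
    0ℚ * 1ℚ + (1ℚ * (x * 1ℚ * 1ℚ) + (- 0ℚ * e x 2 + R k x))
      ≡⟨ solve 3 (λ x p r → con 0ℚ :* con 1ℚ :+ (con 1ℚ :* (x :* con 1ℚ :* con 1ℚ) :+ (con (- 0ℚ) :* p :+ r)) := x :+ r)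
           refl x (e x 2) (R k x) ⟩
    x + R k x ∎
    where open ≡-Reasoning

  -- The cubic and quartic positions contribute at most 1/6 and 1/24, and the tail at most 2 · 1/48,
  -- which add up to 1/4. Together with |s| ≤ 3/4 this keeps the iteration inside [-1, 1].
  ∣R∣≤¼ : ∀ k {x} → ∣ x ∣ ≤ 1ℚ → ∣ R k x ∣ ≤ ¼
  ∣R∣≤¼ k {x} hx = ∑-bound₃ {⅙} {¹⁄₂₄} {¹⁄₄₈} {λ i → b (3 ℕ.+ i) * e x (3 ℕ.+ i)} ≤! ≤! ≤!
    (ℚ.≤-trans (term 3) (ℚ.≤-reflexive e-1-3))
    (ℚ.≤-trans (term 4) (ℚ.≤-reflexive e-1-4))
    (λ i → ℚ.≤-trans (term (5 ℕ.+ i)) (e-1-halving {¹⁄₄₈} 4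
      (ℚ.≤-trans (ℚ.≤-reflexive (cong₂ (λ p i → 1ℚ * p * i) e-1-4 (inv≡ 5))) ≤!) i)) k
    where
    term : ∀ k → ∣ b k * e x k ∣ ≤ e 1ℚ k
    term k = ∣w*e∣≤ {b k} (∣b∣≤1 k) hx k

  -- The derivative is estimated term by term: 1/2 + 1/6 + 2/24 = 3/4, the contraction factor of the
  -- iteration.
  R-lipschitz : ∀ k {x y} → ∣ x ∣ ≤ 1ℚ → ∣ y ∣ ≤ 1ℚ → ∣ R k x - R k y ∣ ≤ ∣ x - y ∣ * ¾
  R-lipschitz k {x} {y} hx hy = subst₂ _≤_
    (cong ∣_∣ (∑-minus k (λ i → b (3 ℕ.+ i) * e x (3 ℕ.+ i)) (λ i → b (3 ℕ.+ i) * e y (3 ℕ.+ i))))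
    (solve 1 (λ d → d :* con ½ :+ (d :* con ⅙ :+ (d :* con ¹⁄₂₄ :+ d :* con ¹⁄₂₄)) := d :* con ¾) refl d)
    (∑-bound₃ {d * ½} {d * ⅙} {d * ¹⁄₂₄} {f} (0≤* 0≤d ≤!) (0≤* 0≤d ≤!) (0≤* 0≤d ≤!)
      (ℚ.≤-trans (term 2) (ℚ.≤-reflexive (cong (d *_) e-1-2)))
      (ℚ.≤-trans (term 3) (ℚ.≤-reflexive (cong (d *_) e-1-3)))
      (λ i → ℚ.≤-trans (term (4 ℕ.+ i)) (ℚ.≤-trans (*-monoˡ 0≤d (e-1-halving {¹⁄₂₄} 3 (ℚ.≤-reflexive e-1-4) i))
        (ℚ.≤-reflexive (sym (ℚ.*-assoc d ¹⁄₂₄ (½ ^ i)))))) k)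
    where
    d = ∣ x - y ∣
    0≤d = ℚ.0≤∣p∣ (x - y)
    f : ℕ → ℚ
    f i = b (3 ℕ.+ i) * e x (3 ℕ.+ i) - b (3 ℕ.+ i) * e y (3 ℕ.+ i)
    term : ∀ k → ∣ b (suc k) * e x (suc k) - b (suc k) * e y (suc k) ∣ ≤ d * e 1ℚ k
    term k = w*e-lipschitz {b (suc k)} (∣b∣≤1 (suc k)) hx hy k

  private
    R-0 : ∀ k r → ∑ k (λ i → b (suc (r ℕ.+ i)) * e 0ℚ (suc (r ℕ.+ i))) ≡ 0ℚ
    R-0 zero    r = refl
    R-0 (suc k) r = trans (cong₂ _+_ (zero-term (r ℕ.+ 0))
      (trans (∑-cong k (λ i → cong (λ s → b (suc s) * e 0ℚ (suc s)) (ℕ.+-suc r i))) (R-0 k (suc r)))) refl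
      where
      zero-term : ∀ s → b (suc s) * e 0ℚ (suc s) ≡ 0ℚ
      zero-term s = solve 3 (λ b p i → b :* (con 0ℚ :* p :* i) := con 0ℚ) refl (b (suc s)) (e 0ℚ s) (inv (suc s))

  -- The equation sin x = s is solved by iterating the contraction x ↦ s + (x - sin x) of [-1, 1].
  module Arcsine (s : ℕ → ℚ) (∣s∣≤¾ : ∀ k → ∣ s k ∣ ≤ ¾)
    (s-cauchy : ∀ ε → 0ℚ < ε → ∃[ N ] (∀ m n → N ℕ.≤ m → N ℕ.≤ n → ∣ s m - s n ∣ ≤ ε)) where

    x : ℕ → ℚ
    x zero    = 0ℚ
    x (suc k) = s k - R k (x k)

    ∣x∣≤1 : ∀ k → ∣ x k ∣ ≤ 1ℚ
    ∣x∣≤1 zero    = ≤!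
    ∣x∣≤1 (suc k) = ℚ.≤-trans (ℚ.∣p-q∣≤∣p∣+∣q∣ (s k) (R k (x k)))
      (ℚ.+-mono-≤ (∣s∣≤¾ k) (∣R∣≤¼ k (∣x∣≤1 k)))

    open Bounded 1ℚ ≤!

    abstract
      private
        tail : ∀ {x} → ∣ x ∣ ≤ 1ℚ → ∀ {k l} → l ℕ.≤ k → ∣ R k x - R l x ∣ ≤ (K + K) * ½ ^ (3 ℕ.+ l)
        tail {x} hx {k} {l} l≤k = subst (_≤ (K + K) * ½ ^ (3 ℕ.+ l))
          (cong ∣_∣ (trans (cong₂ _-_ (Sin≡R k x) (Sin≡R l x))
            (solve 3 (λ x p q → x :+ p :- (x :+ q) := p :- q) refl x (R k x) (R l x))))
          (Sin-tail hx (s≤s (s≤s (s≤s l≤k))))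

        R-close : ∀ δ → 0ℚ < δ → ∃[ N ] (∀ {x} → ∣ x ∣ ≤ 1ℚ → ∀ k l → N ℕ.≤ k → N ℕ.≤ l → ∣ R k x - R l x ∣ ≤ δ)
        R-close δ 0<δ = N , close
          where
          N : ℕ
          N = proj₁ (tail-small δ 0<δ)
          close : ∀ {x} → ∣ x ∣ ≤ 1ℚ → ∀ k l → N ℕ.≤ k → N ℕ.≤ l → ∣ R k x - R l x ∣ ≤ δ
          close {x} hx k l N≤k N≤l = by-order (ℕ.≤-total l k)
            where
            by-order : l ℕ.≤ k ⊎ k ℕ.≤ l → ∣ R k x - R l x ∣ ≤ δ
            by-order (inj₁ l≤k) = ℚ.≤-trans (tail hx l≤k)
              (proj₂ (tail-small δ 0<δ) (3 ℕ.+ l) (ℕ.≤-trans N≤l (ℕ.m≤n+m l 3)))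
            by-order (inj₂ k≤l) = subst (_≤ δ) (∣p-q∣≡∣q-p∣ (R l x) (R k x)) (ℚ.≤-trans (tail hx k≤l)
              (proj₂ (tail-small δ 0<δ) (3 ℕ.+ k) (ℕ.≤-trans N≤k (ℕ.m≤n+m k 3))))

        -- Past N the approximations to s and the truncations of `R` each move by at most δ, so one
        -- step turns a distance D into at most ¾ D + 2δ. The constant 8 solves c = ¾ c + 2, and the
        -- initial distance is at most 2, the length of [-1, 1].
        contract : ∀ δ → 0ℚ < δ → ∃[ N ] (∀ j k l → j ℕ.+ N ℕ.≤ k → j ℕ.+ N ℕ.≤ l →
          ∣ x k - x l ∣ ≤ (1ℚ + 1ℚ) * ¾ ^ j + ι 8 * δ)
        contract δ 0<δ = N , go
          where
          open ℚ.≤-Reasoning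
          N₁ N₂ N : ℕ
          N₁ = proj₁ (s-cauchy δ 0<δ)
          N₂ = proj₁ (R-close δ 0<δ)
          N = N₁ ℕ.⊔ N₂
          go : ∀ j k l → j ℕ.+ N ℕ.≤ k → j ℕ.+ N ℕ.≤ l → ∣ x k - x l ∣ ≤ (1ℚ + 1ℚ) * ¾ ^ j + ι 8 * δ
          go zero k l _ _ = begin
            ∣ x k - x l ∣            ≤⟨ ℚ.∣p-q∣≤∣p∣+∣q∣ (x k) (x l) ⟩
            ∣ x k ∣ + ∣ x l ∣        ≤⟨ ℚ.+-mono-≤ (∣x∣≤1 k) (∣x∣≤1 l) ⟩
            1ℚ + 1ℚ                  ≤⟨ ≤-from (ι 8 * δ) (0≤* (0≤ι 8) (ℚ.<⇒≤ 0<δ)) (cong (_+ ι 8 * δ) (sym (ℚ.*-identityʳ (1ℚ + 1ℚ)))) ⟩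
            (1ℚ + 1ℚ) * 1ℚ + ι 8 * δ ∎
          go (suc j) (suc k) (suc l) (s≤s hk) (s≤s hl) = begin
            ∣ s k - R k (x k) - (s l - R l (x l)) ∣
              ≡⟨ cong ∣_∣ (solve 5 (λ s t p q r → s :- p :- (t :- r) := (s :- t) :+ ((q :- p) :+ (r :- q)))
                   refl (s k) (s l) (R k (x k)) (R k (x l)) (R l (x l))) ⟩
            ∣ (s k - s l) + ((R k (x l) - R k (x k)) + (R l (x l) - R k (x l))) ∣
              ≤⟨ ∣+∣≤ {s k - s l} (proj₂ (s-cauchy δ 0<δ) k l (≥N₁ hk) (≥N₁ hl))
                   (∣+∣≤ {R k (x l) - R k (x k)} {R l (x l) - R k (x l)}
                     (R-lipschitz k (∣x∣≤1 l) (∣x∣≤1 k)) (proj₂ (R-close δ 0<δ) (∣x∣≤1 l) l k (≥N₂ hl) (≥N₂ hk))) ⟩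
            δ + (∣ x l - x k ∣ * ¾ + δ)
              ≡⟨ cong (λ z → δ + (z * ¾ + δ)) (∣p-q∣≡∣q-p∣ (x l) (x k)) ⟩
            δ + (∣ x k - x l ∣ * ¾ + δ)
              ≤⟨ ℚ.+-monoʳ-≤ δ (ℚ.+-monoˡ-≤ δ (*-monoʳ {¾} ≤! (go j k l hk hl))) ⟩
            δ + (((1ℚ + 1ℚ) * ¾ ^ j + ι 8 * δ) * ¾ + δ)
              ≡⟨ cong (λ n → δ + (((1ℚ + 1ℚ) * ¾ ^ j + n * δ) * ¾ + δ)) (ι≡ 8) ⟩
            δ + (((1ℚ + 1ℚ) * ¾ ^ j + (+ 8 ℚ./ 1) * δ) * ¾ + δ)
              ≡⟨ solve 2 (λ d p → d :+ ((con (1ℚ + 1ℚ) :* p :+ con (+ 8 ℚ./ 1) :* d) :* con ¾ :+ d)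
                               := con (1ℚ + 1ℚ) :* (con ¾ :* p) :+ con (+ 8 ℚ./ 1) :* d) refl δ (¾ ^ j) ⟩
            (1ℚ + 1ℚ) * (¾ * ¾ ^ j) + (+ 8 ℚ./ 1) * δ
              ≡⟨ cong (λ n → (1ℚ + 1ℚ) * (¾ * ¾ ^ j) + n * δ) (sym (ι≡ 8)) ⟩
            (1ℚ + 1ℚ) * ¾ ^ suc j + ι 8 * δ ∎
            where
            ≥N₁ : ∀ {k} → j ℕ.+ N ℕ.≤ k → N₁ ℕ.≤ k
            ≥N₁ h = ℕ.≤-trans (ℕ.m≤m⊔n N₁ N₂) (ℕ.≤-trans (ℕ.m≤n+m N j) h)
            ≥N₂ : ∀ {k} → j ℕ.+ N ℕ.≤ k → N₂ ℕ.≤ k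
            ≥N₂ h = ℕ.≤-trans (ℕ.m≤n⊔m N₁ N₂) (ℕ.≤-trans (ℕ.m≤n+m N j) h)

      x-cauchy : ∀ ε → 0ℚ < ε → ∃[ N ] (∀ m n → N ℕ.≤ m → N ℕ.≤ n → ∣ x m - x n ∣ ≤ ε)
      x-cauchy ε 0<ε = j₀ ℕ.+ proj₁ N,h , λ m n hm hn → ℚ.≤-trans (proj₂ N,h j₀ m n hm hn) (begin
          (1ℚ + 1ℚ) * ¾ ^ j₀ + ι 8 * proj₁ δ
            ≤⟨ ℚ.+-mono-≤ (proj₂ jh j₀ ℕ.≤-refl) (ℚ.≤-reflexive (proj₂ (proj₂ δ))) ⟩
          ½ * ε + ½ * ε
            ≡⟨ solve 1 (λ e → con ½ :* e :+ con ½ :* e := e) refl ε ⟩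
          ε ∎)
        where
        open ℚ.≤-Reasoning
        δ : ∃[ δ ] (0ℚ < δ × ι 8 * δ ≡ ½ * ε)
        δ = divisor (ι 8) (½ * ε) (0<ι 7) (0<½* 0<ε)
        N,h : ∃[ N ] (∀ j k l → j ℕ.+ N ℕ.≤ k → j ℕ.+ N ℕ.≤ l →
          ∣ x k - x l ∣ ≤ (1ℚ + 1ℚ) * ¾ ^ j + ι 8 * proj₁ δ)
        N,h = contract (proj₁ δ) (proj₁ (proj₂ δ))
        jh : ∃[ N ] (∀ k → N ℕ.≤ k → (1ℚ + 1ℚ) * ¾ ^ k ≤ ½ * ε)
        jh = γ^k-small {¾} {¼} ≤! (ℚ.positive⁻¹ ¼) ≤! ≤! (1ℚ + 1ℚ) ≤! (½ * ε) (0<½* 0<ε)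
        j₀ : ℕ
        j₀ = proj₁ jh

      -- The defect of `x k` as a solution equals a tail of the sine series plus `x k - x (suc k)`,
      -- and both tend to 0.
      Sin-x→s : ∀ ε → 0ℚ < ε → ∃[ N ] (∀ k → N ℕ.≤ k → ∣ Sin k (x k) - s k ∣ ≤ ε)
      Sin-x→s ε 0<ε = N₁ ℕ.⊔ N₂ , λ k hk → subst (_≤ ε)
          (cong ∣_∣ (trans
            (cong (λ z → (Sin k (x k) - z) + (x k - (s k - R k (x k)))) (Sin≡R k (x k)))
            (solve 4 (λ S x s r → S :- (x :+ r) :+ (x :- (s :- r)) := S :- s) refl (Sin k (x k)) (x k) (s k) (R k (x k)))))
          (ℚ.≤-trans (∣+∣≤ {Sin k (x k) - Sin (3 ℕ.+ k) (x k)} {x k - x (suc k)}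
            (subst (_≤ ½ * ε) (∣p-q∣≡∣q-p∣ (Sin (3 ℕ.+ k) (x k)) (Sin k (x k)))
              (ℚ.≤-trans (Sin-tail (∣x∣≤1 k) (ℕ.m≤n+m k 3)) (proj₂ t k (ℕ.≤-trans (ℕ.m≤m⊔n N₁ N₂) hk))))
            (proj₂ c k (suc k) (≥N₂ hk) (ℕ.m≤n⇒m≤1+n (≥N₂ hk))))
            (ℚ.≤-reflexive (solve 1 (λ e → con ½ :* e :+ con ½ :* e := e) refl ε)))
        where
        t : ∃[ N ] (∀ k → N ℕ.≤ k → (K + K) * ½ ^ k ≤ ½ * ε)
        t = tail-small (½ * ε) (0<½* 0<ε)
        c : ∃[ N ] (∀ m n → N ℕ.≤ m → N ℕ.≤ n → ∣ x m - x n ∣ ≤ ½ * ε)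
        c = x-cauchy (½ * ε) (0<½* 0<ε)
        N₁ N₂ : ℕ
        N₁ = proj₁ t
        N₂ = proj₁ c
        ≥N₂ : ∀ {k} → N₁ ℕ.⊔ N₂ ℕ.≤ k → N₂ ℕ.≤ k
        ≥N₂ = ℕ.≤-trans (ℕ.m≤n⊔m N₁ N₂)

      -- If `x k` is negative, the Lipschitz bound against `R k 0 = 0` gives `x (suc k) ≥ ¾ x k`.
      -- Hence `¼ x k` is at least `x k - x (suc k)`, which the Cauchy property makes as small as
      -- desired.
      0≤x : (∀ k → 0ℚ ≤ s k) → ∀ ε → 0ℚ < ε → ∃[ N ] (∀ k → N ℕ.≤ k → - ε ≤ x k)
      0≤x 0≤s ε 0<ε = proj₁ c , bound
        where
        open ℚ.≤-Reasoning
        c : ∃[ N ] (∀ m n → N ℕ.≤ m → N ℕ.≤ n → ∣ x m - x n ∣ ≤ ¼ * ε)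
        c = x-cauchy (¼ * ε) (0<* (ℚ.positive⁻¹ ¼) 0<ε)
        R≤ : ∀ k {x} → ∣ x ∣ ≤ 1ℚ → x ≤ 0ℚ → R k x ≤ - x * ¾
        R≤ k {x} hx x≤0 = begin
          R k x               ≤⟨ p≤∣p∣ (R k x) ⟩
          ∣ R k x ∣           ≡⟨ cong ∣_∣ (trans (sym (ℚ.+-identityʳ (R k x))) (cong (λ z → R k x - z) (sym (R-0 k 2)))) ⟩
          ∣ R k x - R k 0ℚ ∣  ≤⟨ R-lipschitz k {x} {0ℚ} hx ≤! ⟩
          ∣ x - 0ℚ ∣ * ¾      ≡⟨ cong (λ z → ∣ z ∣ * ¾) (ℚ.+-identityʳ x) ⟩
          ∣ x ∣ * ¾           ≡⟨ cong (_* ¾) (trans (sym (ℚ.∣-p∣≡∣p∣ x)) (ℚ.0≤p⇒∣p∣≡p (ℚ.neg-antimono-≤ x≤0))) ⟩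
          - x * ¾ ∎
        bound : ∀ k → proj₁ c ℕ.≤ k → - ε ≤ x k
        by-sign : ∀ k → proj₁ c ℕ.≤ k → 0ℚ ≤ x k ⊎ x k ≤ 0ℚ → - ε ≤ x k
        bound k hk = by-sign k hk (ℚ.≤-total 0ℚ (x k))
        by-sign k hk (inj₁ 0≤xk) = ℚ.≤-trans (ℚ.neg-antimono-≤ (ℚ.<⇒≤ 0<ε)) 0≤xk
        by-sign k hk (inj₂ xk≤0) = *-cancelˡ-≤ {¼} (ℚ.positive⁻¹ ¼) (begin
          ¼ * - ε
            ≡⟨ solve 1 (λ e → con ¼ :* :- e := :- (con ¼ :* e)) refl ε ⟩
          - (¼ * ε)
            ≤⟨ ℚ.neg-antimono-≤ (ℚ.≤-trans (-p≤∣p∣ (x k - x (suc k))) (proj₂ c k (suc k) hk (ℕ.m≤n⇒m≤1+n hk))) ⟩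
          - - (x k - x (suc k))
            ≤⟨ ≤-from (s k + (- x k * ¾ - R k (x k))) (0≤+ (0≤s k) (≤⇒0≤- (R≤ k (∣x∣≤1 k) xk≤0)))
                 (solve 3 (λ x s r → :- :- (x :- (s :- r)) :+ (s :+ (:- x :* con ¾ :- r)) := con ¼ :* x) refl (x k) (s k) (R k (x k))) ⟩
          ¼ * x k ∎)

-- Rational approximations to square roots.

module RationalSquareRoot where
  open import Data.Rational.Base using (_+_; _*_; _-_; -_; _≤_; _<_)
  open ≡ using (sym; trans; module ≡-Reasoning)
  open Rational
  open ℚSolver.+-*-Solver

  private
    last-true : {P : ℕ → Set} → (∀ k → Dec (P k)) → P 0 → ∀ n → ¬ P n → ∃[ j ] (P j × ¬ P (suc j))
    last-true P? p₀ zero    ¬p = ⊥-elim (¬p p₀)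
    last-true P? p₀ (suc n) ¬p with P? n
    ... | yes p = n , p , ¬p
    ... | no ¬pₙ = last-true P? p₀ n ¬pₙ

  sq-cancel-≤ : ∀ {p q} → 0ℚ ≤ q → p * p ≤ q * q → p ≤ q
  sq-cancel-≤ {p} {q} 0≤q h with ℚ.≤-total p q
  ... | inj₁ p≤q = p≤q
  ... | inj₂ q≤p with p ℚ.≟ q
  ... | yes refl = ℚ.≤-refl
  ... | no p≢q = ⊥-elim (ℚ.<⇒≢ (ℚ.<-≤-trans q²<p² h) refl)
    where
    q<p : q < p
    q<p = ℚ.≰⇒> (λ p≤q → p≢q (ℚ.≤-antisym p≤q q≤p))
    q²<p² : q * q < p * p
    q²<p² = ℚ.≤-<-trans (*-monoˡ 0≤q q≤p)
      (ℚ.*-monoˡ-<-pos p {{ℚ.positive (ℚ.≤-<-trans 0≤q q<p)}} q<p)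

  abstract
    -- A search over integers finds j with j² ≤ |q| (k + 1)² < (j + 1)², and r = j/(k + 1). The
    -- absolute value makes the approximation total, so that a sequence with occasional negative
    -- terms can be fed to it.
    √-approx : ∀ q k → ∃[ r ] (0ℚ ≤ r × r * r ≤ ∣ q ∣ × ∣ q ∣ ≤ (r + inv (suc k)) * (r + inv (suc k)))
    √-approx q k = ι j * i , 0≤* (0≤ι j) (0≤inv (suc k)) , lower , upper
      where
      open ℚ.≤-Reasoning
      κ i : ℚ
      κ = ι (suc k)
      i = inv (suc k)
      X : ℚ
      X = ∣ q ∣ * (κ * κ)
      0≤X : 0ℚ ≤ X
      0≤X = 0≤* (ℚ.0≤∣p∣ q) (0≤sq κ)
      N,h : ∃[ n ] X ≤ ι n
      N,h = archimedean X
      n : ℕ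
      n = proj₁ N,h
      too-big : ¬ (ι (suc n) * ι (suc n) ≤ X)
      too-big h = ℚ.<⇒≢ (ℚ.<-≤-trans lt (ℚ.≤-trans h (proj₂ N,h))) refl
        where
        lt : ι n < ι (suc n) * ι (suc n)
        lt = begin-strict
          ι n                        ≡⟨ sym (ℚ.+-identityˡ (ι n)) ⟩
          0ℚ + ι n                   <⟨ ℚ.+-monoˡ-< (ι n) (ℚ.positive⁻¹ 1ℚ) ⟩
          1ℚ + ι n                   ≤⟨ ≤-from {1ℚ + ι n} (ι n * ι n + ι n) (0≤+ (0≤sq (ι n)) (0≤ι n))
                                          (solve 1 (λ n → con 1ℚ :+ n :+ (n :* n :+ n) := (con 1ℚ :+ n) :* (con 1ℚ :+ n)) refl (ι n)) ⟩
          (1ℚ + ι n) * (1ℚ + ι n)    ≡⟨ cong₂ _*_ (sym (ι-suc n)) (sym (ι-suc n)) ⟩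
          ι (suc n) * ι (suc n)      ∎
      found : ∃[ j ] (ι j * ι j ≤ X × ¬ (ι (suc j) * ι (suc j) ≤ X))
      found = last-true (λ j → (ι j * ι j) ℚ.≤? X)
        (subst (_≤ X) (sym (trans (cong (_* ι 0) ι-0) (ℚ.*-zeroˡ (ι 0)))) 0≤X) (suc n) too-big
      j : ℕ
      j = proj₁ found
      scale : ∀ p → p * (κ * κ) * (i * i) ≡ p
      scale p = begin-equality
        p * (κ * κ) * (i * i)      ≡⟨ solve 3 (λ p a b → p :* (a :* a) :* (b :* b) := p :* ((b :* a) :* (b :* a))) refl p κ i ⟩
        p * ((i * κ) * (i * κ))    ≡⟨ cong (λ z → p * (z * z)) (inv-inverse (suc k)) ⟩
        p * (1ℚ * 1ℚ)              ≡⟨ ℚ.*-identityʳ p ⟩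
        p                          ∎
      lower : ι j * i * (ι j * i) ≤ ∣ q ∣
      lower = begin
        ι j * i * (ι j * i)        ≡⟨ solve 2 (λ j i → j :* i :* (j :* i) := (j :* j) :* (i :* i)) refl (ι j) i ⟩
        (ι j * ι j) * (i * i)      ≤⟨ *-monoʳ (0≤sq i) (proj₁ (proj₂ found)) ⟩
        X * (i * i)                ≡⟨ scale ∣ q ∣ ⟩
        ∣ q ∣                      ∎
      upper : ∣ q ∣ ≤ (ι j * i + i) * (ι j * i + i)
      upper = begin
        ∣ q ∣                                 ≡⟨ sym (scale ∣ q ∣) ⟩
        X * (i * i)                           ≤⟨ *-monoʳ (0≤sq i) (ℚ.<⇒≤ (ℚ.≰⇒> (proj₂ (proj₂ found)))) ⟩
        ι (suc j) * ι (suc j) * (i * i)       ≡⟨ cong (λ z → z * z * (i * i)) (ι-suc j) ⟩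
        (1ℚ + ι j) * (1ℚ + ι j) * (i * i)     ≡⟨ solve 2 (λ j i → (con 1ℚ :+ j) :* (con 1ℚ :+ j) :* (i :* i)
                                                              := (j :* i :+ i) :* (j :* i :+ i)) refl (ι j) i ⟩
        (ι j * i + i) * (ι j * i + i)         ∎

  √ : ℚ → ℕ → ℚ
  √ q k = proj₁ (√-approx q k)

  0≤√ : ∀ q k → 0ℚ ≤ √ q k
  0≤√ q k = proj₁ (proj₂ (√-approx q k))

  √-lower : ∀ q k → √ q k * √ q k ≤ ∣ q ∣
  √-lower q k = proj₁ (proj₂ (proj₂ (√-approx q k)))

  √-upper : ∀ q k → ∣ q ∣ ≤ (√ q k + inv (suc k)) * (√ q k + inv (suc k))
  √-upper q k = proj₂ (proj₂ (proj₂ (√-approx q k)))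

  -- The square root has the modulus of continuity δ² on the whole half-line, including 0, because
  -- |p| ≤ (r + δ)² + δ² ≤ (r + 2δ)². Therefore roots of Cauchy sequences are Cauchy without any
  -- lower bound on the radicands.
  √-modulus : ∀ {p q j k δ} → 0ℚ ≤ δ → ∣ p - q ∣ ≤ δ * δ → inv (suc k) ≤ δ → √ p j ≤ √ q k + (δ + δ)
  √-modulus {p} {q} {j} {k} {δ} 0≤δ pq≤δ² k≤δ = sq-cancel-≤ (0≤+ (0≤√ q k) (0≤+ 0≤δ 0≤δ)) (begin
    √ p j * √ p j
      ≤⟨ √-lower p j ⟩
    ∣ p ∣
      ≡⟨ cong ∣_∣ (solve 2 (λ p q → p := q :+ (p :- q)) refl p q) ⟩
    ∣ q + (p - q) ∣
      ≤⟨ ∣+∣≤ {q} {p - q} (√-upper q k) pq≤δ² ⟩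
    (r + i) * (r + i) + δ * δ
      ≤⟨ ℚ.+-monoˡ-≤ (δ * δ) (*-mono (0≤+ (0≤√ q k) (0≤inv (suc k))) (ℚ.+-monoʳ-≤ r k≤δ)
           (0≤+ (0≤√ q k) (0≤inv (suc k))) (ℚ.+-monoʳ-≤ r k≤δ)) ⟩
    (r + δ) * (r + δ) + δ * δ
      ≤⟨ ≤-from {(r + δ) * (r + δ) + δ * δ} {(r + (δ + δ)) * (r + (δ + δ))} (r * δ + r * δ + (δ * δ + δ * δ))
           (0≤+ (0≤+ (0≤* (0≤√ q k) 0≤δ) (0≤* (0≤√ q k) 0≤δ)) (0≤+ (0≤sq δ) (0≤sq δ)))
           (solve 2 (λ r d → (r :+ d) :* (r :+ d) :+ d :* d :+ (r :* d :+ r :* d :+ (d :* d :+ d :* d))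
              := (r :+ (d :+ d)) :* (r :+ (d :+ d))) refl r δ) ⟩
    (r + (δ + δ)) * (r + (δ + δ)) ∎)
    where
    open ℚ.≤-Reasoning
    r = √ q k
    i = inv (suc k)

  inv-small : ∀ ε → 0ℚ < ε → ∃[ N ] (∀ k → N ℕ.≤ k → inv (suc k) ≤ ε)
  inv-small ε 0<ε = N , λ k N≤k → *-cancelˡ-≤ {ι (suc k)} (0<ι k) (begin
      ι (suc k) * inv (suc k)  ≡⟨ ℚ.*-comm (ι (suc k)) (inv (suc k)) ⟩
      inv (suc k) * ι (suc k)  ≡⟨ inv-inverse (suc k) ⟩
      1ℚ                       ≤⟨ proj₂ (eventually-small 1ℚ ε 0<ε) (suc k) (ℕ.m≤n⇒m≤1+n N≤k) ⟩
      ι (suc k) * ε            ∎)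
    where
    open ℚ.≤-Reasoning
    N : ℕ
    N = proj₁ (eventually-small 1ℚ ε 0<ε)

  module _ (x : ℕ → ℚ)
    (x-cauchy : ∀ ε → 0ℚ < ε → ∃[ N ] (∀ m n → N ℕ.≤ m → N ℕ.≤ n → ∣ x m - x n ∣ ≤ ε)) where

    abstract
      √-cauchy : ∀ ε → 0ℚ < ε → ∃[ N ] (∀ m n → N ℕ.≤ m → N ℕ.≤ n → ∣ √ (x m) m - √ (x n) n ∣ ≤ ε)
      √-cauchy ε 0<ε = N₁ ℕ.⊔ N₂ , λ m n hm hn → ∣∣≤
          (half m n hm hn)
          (subst (_≤ ε) (solve 2 (λ p q → q :- p := :- (p :- q)) refl (√ (x m) m) (√ (x n) n)) (half n m hn hm))
        where
        open ℚ.≤-Reasoning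
        δ : ℚ
        δ = ½ * ε
        0<δ : 0ℚ < δ
        0<δ = 0<½* 0<ε
        N₁ N₂ : ℕ
        N₁ = proj₁ (x-cauchy (δ * δ) (0<* 0<δ 0<δ))
        N₂ = proj₁ (inv-small δ 0<δ)
        half : ∀ m n → N₁ ℕ.⊔ N₂ ℕ.≤ m → N₁ ℕ.⊔ N₂ ℕ.≤ n → √ (x m) m - √ (x n) n ≤ ε
        half m n hm hn = begin
          √ (x m) m - √ (x n) n
            ≤⟨ ℚ.+-monoˡ-≤ (- √ (x n) n) (√-modulus {x m} {x n} {m} {n} (ℚ.<⇒≤ 0<δ)
                 (proj₂ (x-cauchy (δ * δ) (0<* 0<δ 0<δ)) m n (ℕ.≤-trans (ℕ.m≤m⊔n N₁ N₂) hm) (ℕ.≤-trans (ℕ.m≤m⊔n N₁ N₂) hn))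
                 (proj₂ (inv-small δ 0<δ) n (ℕ.≤-trans (ℕ.m≤n⊔m N₁ N₂) hn))) ⟩
          √ (x n) n + (½ * ε + ½ * ε) - √ (x n) n
            ≡⟨ solve 2 (λ r e → r :+ (con ½ :* e :+ con ½ :* e) :- r := e) refl (√ (x n) n) ε ⟩
          ε ∎

      √²→ : ∀ ε → 0ℚ < ε → ∃[ N ] (∀ k → N ℕ.≤ k → ∣ √ (x k) k * √ (x k) k - ∣ x k ∣ ∣ ≤ ε)
      √²→ ε 0<ε = N₁ ℕ.⊔ N₂ , λ k hk → subst (_≤ ε) (∣p-q∣≡∣q-p∣ ∣ x k ∣ (√ (x k) k * √ (x k) k))
          (∣∣≤ (close k (ℕ.≤-trans (ℕ.m≤m⊔n N₁ N₂) hk) (ℕ.≤-trans (ℕ.m≤n⊔m N₁ N₂) hk))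
            (ℚ.≤-trans (≤-from {b = 0ℚ} (∣ x k ∣ - √ (x k) k * √ (x k) k) (≤⇒0≤- (√-lower (x k) k))
              (ℚ.+-inverseˡ (∣ x k ∣ - √ (x k) k * √ (x k) k))) (ℚ.<⇒≤ 0<ε)))
        where
        open ℚ.≤-Reasoning
        N₁ : ℕ
        N₁ = proj₁ (√-cauchy 1ℚ (ℚ.positive⁻¹ 1ℚ))
        B : ℚ
        B = 1ℚ + √ (x N₁) N₁
        0≤B : 0ℚ ≤ B
        0≤B = 0≤+ (ℚ.nonNegative⁻¹ 1ℚ) (0≤√ (x N₁) N₁)
        √≤B : ∀ k → N₁ ℕ.≤ k → √ (x k) k ≤ B
        √≤B k hk = ≤-from {√ (x k) k} {B} (1ℚ - (√ (x k) k - √ (x N₁) N₁))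
          (≤⇒0≤- (ℚ.≤-trans (p≤∣p∣ (√ (x k) k - √ (x N₁) N₁))
            (proj₂ (√-cauchy 1ℚ (ℚ.positive⁻¹ 1ℚ)) k N₁ hk ℕ.≤-refl)))
          (solve 2 (λ p q → p :+ (con 1ℚ :- (p :- q)) := con 1ℚ :+ q) refl (√ (x k) k) (√ (x N₁) N₁))
        δ : ∃[ δ ] (0ℚ < δ × (B + B + 1ℚ) * δ ≡ ε)
        δ = divisor (B + B + 1ℚ) ε (ℚ.+-mono-≤-< (0≤+ 0≤B 0≤B) (ℚ.positive⁻¹ 1ℚ)) 0<ε
        N₂ : ℕ
        N₂ = proj₁ (inv-small (proj₁ δ) (proj₁ (proj₂ δ)))
        close : ∀ k → N₁ ℕ.≤ k → N₂ ℕ.≤ k → ∣ x k ∣ - √ (x k) k * √ (x k) k ≤ ε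
        close k h₁ h₂ = begin
          ∣ x k ∣ - r * r
            ≤⟨ ℚ.+-monoˡ-≤ (- (r * r)) (√-upper (x k) k) ⟩
          (r + i) * (r + i) - r * r
            ≡⟨ solve 2 (λ r i → (r :+ i) :* (r :+ i) :- r :* r := (r :+ r :+ i) :* i) refl r i ⟩
          (r + r + i) * i
            ≤⟨ *-mono (0≤+ (0≤+ (0≤√ (x k) k) (0≤√ (x k) k)) (0≤inv (suc k)))
                 (ℚ.+-mono-≤ (ℚ.+-mono-≤ (√≤B k h₁) (√≤B k h₁)) (ℚ.≤-trans (inv-anti 1 (suc k) (s≤s z≤n)) (ℚ.≤-reflexive (inv≡ 1))))
                 (0≤inv (suc k)) (proj₂ (inv-small (proj₁ δ) (proj₁ (proj₂ δ))) k h₂) ⟩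
          (B + B + 1ℚ) * proj₁ δ
            ≡⟨ proj₂ (proj₂ δ) ⟩
          ε ∎
          where
          r i : ℚ
          r = √ (x k) k
          i = inv (suc k)

-- Proved for an abstract ring, since the components of complex products grow exponentially in the solver.
module RingIdentities (R : CommutativeRing 0ℓ 0ℓ)
  (morphism : ℚ.+-*-rawRing ACR.-Raw-AlmostCommutative⟶ ACR.fromCommutativeRing R) where
  open CommutativeRing R using (Carrier; _≈_; _+_; _*_; _-_; -_; +-cong; *-cong; -‿cong)
    renaming (refl to ≈-refl; sym to ≈-sym; trans to ≈-trans)

  private
    weak≟ : WeaklyDecidable (ACR.Induced-equivalence morphism)
    weak≟ p q with p ℚ.≟ q
    ... | yes ≡.refl = just ≈-refl
    ... | no _       = nothing

  open RingSolver ℚ.+-*-rawRing (ACR.fromCommutativeRing R) morphism weak≟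
  open ACR._-Raw-AlmostCommutative⟶_ morphism using () renaming (⟦_⟧ to c⟦_⟧)

  suc-lemma : ∀ w x → w + x * w ≈ (c⟦ 1ℚ ⟧ + x) * w
  suc-lemma = solve 2 (λ w x → w :+ x :* w := (con 1ℚ :+ x) :* w) ≈-refl

  distribute : ∀ w x y v z d → w * (x + (y * v + z * d)) ≈ w * x + (y * (v * w) + z * (w * d))
  distribute = solve 6 (λ w x y v z d → w :* (x :+ (y :* v :+ z :* d)) := w :* x :+ (y :* (v :* w) :+ z :* (w :* d))) ≈-refl

  split : ∀ a b c d → (a * b - c) * d ≈ a * (b * d) + c⟦ ℚ.- 1ℚ ⟧ * (c * d)
  split = solve 4 (λ a b c d → (a :* b :- c) :* d := a :* (b :* d) :+ con (ℚ.- 1ℚ) :* (c :* d)) ≈-refl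

  negate : ∀ a → c⟦ ℚ.- 1ℚ ⟧ * a ≈ - a
  negate = solve 1 (λ a → con (ℚ.- 1ℚ) :* a := :- a) ≈-refl

  rearrange : ∀ p v w x y z d → p + (v * w - (x + (y * v + z * d)))
    ≈ (p - x) + ((w - y) * v + (c⟦ ℚ.- 1ℚ ⟧ * z) * d)
  rearrange = solve 7 (λ p v w x y z d → p :+ (v :* w :- (x :+ (y :* v :+ z :* d)))
    := (p :- x) :+ ((w :- y) :* v :+ (con (ℚ.- 1ℚ) :* z) :* d)) ≈-refl

  factor : ∀ l x y v z d → l * x + (l * y * v + l * z * d) ≈ l * (x + (y * v + z * d))
  factor = solve 6 (λ l x y v z d → l :* x :+ (l :* y :* v :+ l :* z :* d) := l :* (x :+ (y :* v :+ z :* d))) ≈-refl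

  scale-entry : ∀ t r a x → (t * (r * a)) * x ≈ (t * r) * (a * x)
  scale-entry = solve 4 (λ t r a x → (t :* (r :* a)) :* x := (t :* r) :* (a :* x)) ≈-refl

  -- In this identity and the next two, c₀, ..., c₃ are the phases of the four eigenspaces and the
  -- other variables are entries of the spectral projections. The zeros arise because all
  -- projections are written in one common shape.
  column₀-head : ∀ c₀ c₁ c₂ c₃ p q → c₀ * p + (c₁ * q + (c₂ * c⟦ 0ℚ ⟧ + (c₃ * c⟦ 0ℚ ⟧ + c⟦ 0ℚ ⟧))) ≈ c₀ * p + c₁ * q
  column₀-head = solve 6 (λ c₀ c₁ c₂ c₃ p q → c₀ :* p :+ (c₁ :* q :+ (c₂ :* con 0ℚ :+ (c₃ :* con 0ℚ :+ con 0ℚ)))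
    := c₀ :* p :+ c₁ :* q) ≈-refl

  column₀-tail : ∀ c₀ c₁ c₂ c₃ p q v →
    c₀ * (p + (c⟦ 0ℚ ⟧ * v + c⟦ 0ℚ ⟧ * c⟦ 0ℚ ⟧)) + (c₁ * (q + (c⟦ 0ℚ ⟧ * v + c⟦ 0ℚ ⟧ * c⟦ 0ℚ ⟧))
      + (c₂ * (c⟦ 0ℚ ⟧ + (c⟦ 0ℚ ⟧ * v + c⟦ 0ℚ ⟧ * c⟦ 0ℚ ⟧)) + (c₃ * (c⟦ 0ℚ ⟧ + (c⟦ 0ℚ ⟧ * v + c⟦ 0ℚ ⟧ * c⟦ 0ℚ ⟧)) + c⟦ 0ℚ ⟧)))
    ≈ c₀ * p + c₁ * q
  column₀-tail = solve 7 (λ c₀ c₁ c₂ c₃ p q v →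
    c₀ :* (p :+ (con 0ℚ :* v :+ con 0ℚ :* con 0ℚ)) :+ (c₁ :* (q :+ (con 0ℚ :* v :+ con 0ℚ :* con 0ℚ))
      :+ (c₂ :* (con 0ℚ :+ (con 0ℚ :* v :+ con 0ℚ :* con 0ℚ)) :+ (c₃ :* (con 0ℚ :+ (con 0ℚ :* v :+ con 0ℚ :* con 0ℚ)) :+ con 0ℚ)))
    := c₀ :* p :+ c₁ :* q) ≈-refl

  column-tail : ∀ c₀ c₁ c₂ c₃ p q I y v d →
    c₀ * (I * p + (c⟦ 0ℚ ⟧ * v + c⟦ 0ℚ ⟧ * d)) + (c₁ * (I * q + (c⟦ 0ℚ ⟧ * v + c⟦ 0ℚ ⟧ * d))
      + (c₂ * (c⟦ 0ℚ ⟧ + (I * y * v + c⟦ 0ℚ ⟧ * d)) + (c₃ * (c⟦ ℚ.- 1ℚ ⟧ * I + (c⟦ ℚ.- 1ℚ ⟧ * (I * y) * v + c⟦ 1ℚ ⟧ * d)) + c⟦ 0ℚ ⟧)))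
    ≈ I * ((c₀ * p + c₁ * q - c₃) + (c₂ - c₃) * (v * y)) + c₃ * d
  column-tail = solve 10 (λ c₀ c₁ c₂ c₃ p q I y v d →
    c₀ :* (I :* p :+ (con 0ℚ :* v :+ con 0ℚ :* d)) :+ (c₁ :* (I :* q :+ (con 0ℚ :* v :+ con 0ℚ :* d))
      :+ (c₂ :* (con 0ℚ :+ (I :* y :* v :+ con 0ℚ :* d)) :+ (c₃ :* (con (ℚ.- 1ℚ) :* I :+ (con (ℚ.- 1ℚ) :* (I :* y) :* v :+ con 1ℚ :* d)) :+ con 0ℚ)))
    := I :* ((c₀ :* p :+ c₁ :* q :- c₃) :+ (c₂ :- c₃) :* (v :* y)) :+ c₃ :* d) ≈-refl

  resolve : ∀ I v d y p q → p + q ≈ c⟦ 1ℚ ⟧ →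
    (I * p + (c⟦ 0ℚ ⟧ * v + c⟦ 0ℚ ⟧ * d)) + ((I * q + (c⟦ 0ℚ ⟧ * v + c⟦ 0ℚ ⟧ * d))
      + ((c⟦ 0ℚ ⟧ + (I * y * v + c⟦ 0ℚ ⟧ * d)) + ((c⟦ ℚ.- 1ℚ ⟧ * I + (c⟦ ℚ.- 1ℚ ⟧ * (I * y) * v + c⟦ 1ℚ ⟧ * d)) + c⟦ 0ℚ ⟧)))
    ≈ d
  resolve I v d y p q h = ≈-trans (lem I v d y p q) (≈-trans (+-cong (*-cong ≈-refl h) ≈-refl) (lem′ I d))
    where
    lem : ∀ I v d y p q →
      (I * p + (c⟦ 0ℚ ⟧ * v + c⟦ 0ℚ ⟧ * d)) + ((I * q + (c⟦ 0ℚ ⟧ * v + c⟦ 0ℚ ⟧ * d))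
        + ((c⟦ 0ℚ ⟧ + (I * y * v + c⟦ 0ℚ ⟧ * d)) + ((c⟦ ℚ.- 1ℚ ⟧ * I + (c⟦ ℚ.- 1ℚ ⟧ * (I * y) * v + c⟦ 1ℚ ⟧ * d)) + c⟦ 0ℚ ⟧)))
      ≈ I * (p + q) + (d - I)
    lem = solve 6 (λ I v d y p q →
      (I :* p :+ (con 0ℚ :* v :+ con 0ℚ :* d)) :+ ((I :* q :+ (con 0ℚ :* v :+ con 0ℚ :* d))
        :+ ((con 0ℚ :+ (I :* y :* v :+ con 0ℚ :* d)) :+ ((con (ℚ.- 1ℚ) :* I :+ (con (ℚ.- 1ℚ) :* (I :* y) :* v :+ con 1ℚ :* d)) :+ con 0ℚ)))
      := I :* (p :+ q) :+ (d :- I)) ≈-refl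
    lem′ : ∀ I d → I * c⟦ 1ℚ ⟧ + (d - I) ≈ d
    lem′ = solve 2 (λ I d → I :* con 1ℚ :+ (d :- I) := d) ≈-refl

  v-eigen : ∀ M I w → I * w * M + c⟦ 0ℚ ⟧ * w - I * w ≈ (M + c⟦ ℚ.- 1ℚ ⟧) * (I * w)
  v-eigen = solve 3 (λ M I w → I :* w :* M :+ con 0ℚ :* w :- I :* w := (M :+ con (ℚ.- 1ℚ)) :* (I :* w)) ≈-refl

  zero-eigen : ∀ M D l → c⟦ 0ℚ ⟧ * M + c⟦ 0ℚ ⟧ * D - c⟦ 0ℚ ⟧ ≈ l * c⟦ 0ℚ ⟧
  zero-eigen = solve 3 (λ M D l → con 0ℚ :* M :+ con 0ℚ :* D :- con 0ℚ := l :* con 0ℚ) ≈-refl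

  zero-row : ∀ M D l → M * c⟦ 0ℚ ⟧ + c⟦ 0ℚ ⟧ * D ≈ l * c⟦ 0ℚ ⟧
  zero-row = solve 3 (λ M D l → M :* con 0ℚ :+ con 0ℚ :* D := l :* con 0ℚ) ≈-refl

  zero-diff : ∀ l → c⟦ 0ℚ ⟧ - c⟦ 0ℚ ⟧ ≈ l * c⟦ 0ℚ ⟧
  zero-diff = solve 1 (λ l → con 0ℚ :- con 0ℚ := l :* con 0ℚ) ≈-refl

  zero-scale : ∀ l → c⟦ ℚ.- 1ℚ ⟧ * c⟦ 0ℚ ⟧ ≈ l * c⟦ 0ℚ ⟧
  zero-scale = solve 1 (λ l → con (ℚ.- 1ℚ) :* con 0ℚ := l :* con 0ℚ) ≈-refl

  drop-zero : ∀ x D → x + c⟦ 0ℚ ⟧ * D ≈ x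
  drop-zero = solve 2 (λ x D → x :+ con 0ℚ :* D := x) ≈-refl

  neg-diff : ∀ I → c⟦ 0ℚ ⟧ - c⟦ ℚ.- 1ℚ ⟧ * I ≈ c⟦ ℚ.- 1ℚ ⟧ * (c⟦ ℚ.- 1ℚ ⟧ * I)
  neg-diff = solve 1 (λ I → con 0ℚ :- con (ℚ.- 1ℚ) :* I := con (ℚ.- 1ℚ) :* (con (ℚ.- 1ℚ) :* I)) ≈-refl

  rest-eigen : ∀ M I w → M * I ≈ c⟦ 1ℚ ⟧ →
    c⟦ ℚ.- 1ℚ ⟧ * (I * w) * M + c⟦ 1ℚ ⟧ * w - c⟦ ℚ.- 1ℚ ⟧ * (I * w) ≈ c⟦ ℚ.- 1ℚ ⟧ * (c⟦ ℚ.- 1ℚ ⟧ * (I * w))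
  rest-eigen M I w h = ≈-trans (lem M I w) (≈-trans (+-cong (*-cong ≈-refl h) ≈-refl) (lem′ I w))
    where
    lem : ∀ M I w → c⟦ ℚ.- 1ℚ ⟧ * (I * w) * M + c⟦ 1ℚ ⟧ * w - c⟦ ℚ.- 1ℚ ⟧ * (I * w) ≈ (- w) * (M * I) + (w + I * w)
    lem = solve 3 (λ M I w → con (ℚ.- 1ℚ) :* (I :* w) :* M :+ con 1ℚ :* w :- con (ℚ.- 1ℚ) :* (I :* w)
      := (:- w) :* (M :* I) :+ (w :+ I :* w)) ≈-refl
    lem′ : ∀ I w → (- w) * c⟦ 1ℚ ⟧ + (w + I * w) ≈ c⟦ ℚ.- 1ℚ ⟧ * (c⟦ ℚ.- 1ℚ ⟧ * (I * w))
    lem′ = solve 2 (λ I w → (:- w) :* con 1ℚ :+ (w :+ I :* w) := con (ℚ.- 1ℚ) :* (con (ℚ.- 1ℚ) :* (I :* w))) ≈-refl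

  rest-row : ∀ M I λ′ → M * I ≈ c⟦ 1ℚ ⟧ → M * (c⟦ ℚ.- 1ℚ ⟧ * I) + c⟦ 1ℚ ⟧ * c⟦ 1ℚ ⟧ ≈ λ′ * c⟦ 0ℚ ⟧
  rest-row M I λ′ h = ≈-trans (lem M I) (≈-trans (+-cong (-‿cong h) ≈-refl) (lem′ λ′))
    where
    lem : ∀ M I → M * (c⟦ ℚ.- 1ℚ ⟧ * I) + c⟦ 1ℚ ⟧ * c⟦ 1ℚ ⟧ ≈ - (M * I) + c⟦ 1ℚ ⟧
    lem = solve 2 (λ M I → M :* (con (ℚ.- 1ℚ) :* I) :+ con 1ℚ :* con 1ℚ := :- (M :* I) :+ con 1ℚ) ≈-refl
    lem′ : ∀ l → - c⟦ 1ℚ ⟧ + c⟦ 1ℚ ⟧ ≈ l * c⟦ 0ℚ ⟧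
    lem′ = solve 1 (λ l → :- con 1ℚ :+ con 1ℚ := l :* con 0ℚ) ≈-refl

  resolve₀ : ∀ p q v → p + q ≈ c⟦ 0ℚ ⟧ →
    (p + (c⟦ 0ℚ ⟧ * v + c⟦ 0ℚ ⟧ * c⟦ 0ℚ ⟧)) + ((q + (c⟦ 0ℚ ⟧ * v + c⟦ 0ℚ ⟧ * c⟦ 0ℚ ⟧))
      + ((c⟦ 0ℚ ⟧ + (c⟦ 0ℚ ⟧ * v + c⟦ 0ℚ ⟧ * c⟦ 0ℚ ⟧)) + ((c⟦ 0ℚ ⟧ + (c⟦ 0ℚ ⟧ * v + c⟦ 0ℚ ⟧ * c⟦ 0ℚ ⟧)) + c⟦ 0ℚ ⟧)))
    ≈ c⟦ 0ℚ ⟧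
  resolve₀ p q v h = ≈-trans (lem p q v) h
    where
    lem : ∀ p q v →
      (p + (c⟦ 0ℚ ⟧ * v + c⟦ 0ℚ ⟧ * c⟦ 0ℚ ⟧)) + ((q + (c⟦ 0ℚ ⟧ * v + c⟦ 0ℚ ⟧ * c⟦ 0ℚ ⟧))
        + ((c⟦ 0ℚ ⟧ + (c⟦ 0ℚ ⟧ * v + c⟦ 0ℚ ⟧ * c⟦ 0ℚ ⟧)) + ((c⟦ 0ℚ ⟧ + (c⟦ 0ℚ ⟧ * v + c⟦ 0ℚ ⟧ * c⟦ 0ℚ ⟧)) + c⟦ 0ℚ ⟧)))
      ≈ p + q
    lem = solve 3 (λ p q v →
      (p :+ (con 0ℚ :* v :+ con 0ℚ :* con 0ℚ)) :+ ((q :+ (con 0ℚ :* v :+ con 0ℚ :* con 0ℚ))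
        :+ ((con 0ℚ :+ (con 0ℚ :* v :+ con 0ℚ :* con 0ℚ)) :+ ((con 0ℚ :+ (con 0ℚ :* v :+ con 0ℚ :* con 0ℚ)) :+ con 0ℚ)))
      := p :+ q) ≈-refl

  -- With θ θ̄ = 1 this is a quadratic form that depends on θ only through θ + θ̄.
  form-factor : ∀ x y t t′ c → t′ * t ≈ c⟦ 1ℚ ⟧ → t + t′ ≈ c + c →
    (y + x * t′) * (y + x * t) ≈ y * y + x * x + (c + c) * (x * y)
  form-factor x y t t′ c h k = ≈-trans (lem x y t t′) (+-cong (+-cong ≈-refl (≈-trans (*-cong ≈-refl h) (lem′ x))) (*-cong k ≈-refl))
    where
    lem : ∀ x y t t′ → (y + x * t′) * (y + x * t) ≈ y * y + (x * x) * (t′ * t) + (t + t′) * (x * y)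
    lem = solve 4 (λ x y t t′ → (y :+ x :* t′) :* (y :+ x :* t) := y :* y :+ (x :* x) :* (t′ :* t) :+ (t :+ t′) :* (x :* y)) ≈-refl
    lem′ : ∀ x → x * x * c⟦ 1ℚ ⟧ ≈ x * x
    lem′ = solve 1 (λ x → x :* x :* con 1ℚ := x :* x) ≈-refl

  form-1 : ∀ x y → y * y + x * x + (c⟦ 1ℚ ⟧ + c⟦ 1ℚ ⟧) * (x * y) ≈ (y + x) * (y + x)
  form-1 = solve 2 (λ x y → y :* y :+ x :* x :+ (con 1ℚ :+ con 1ℚ) :* (x :* y) := (y :+ x) :* (y :+ x)) ≈-refl

  form-−1 : ∀ x y → y * y + x * x + (c⟦ ℚ.- 1ℚ ⟧ + c⟦ ℚ.- 1ℚ ⟧) * (x * y) ≈ (y - x) * (y - x)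
  form-−1 = solve 2 (λ x y → y :* y :+ x :* x :+ (con (ℚ.- 1ℚ) :+ con (ℚ.- 1ℚ)) :* (x :* y) := (y :- x) :* (y :- x)) ≈-refl

  form-affine : ∀ x y c c′ l → l * c + (c⟦ 1ℚ ⟧ - l) * c′ ≈ c⟦ 1ℚ ⟧ →
    l * (y * y + x * x + (c + c) * (x * y)) + (c⟦ 1ℚ ⟧ - l) * (y * y + x * x + (c′ + c′) * (x * y))
    ≈ y * y + x * x + (c⟦ 1ℚ ⟧ + c⟦ 1ℚ ⟧) * (x * y)
  form-affine x y c c′ l h = ≈-trans (lem x y c c′ l) (+-cong ≈-refl (*-cong (+-cong h h) ≈-refl))
    where
    lem : ∀ x y c c′ l →
      l * (y * y + x * x + (c + c) * (x * y)) + (c⟦ 1ℚ ⟧ - l) * (y * y + x * x + (c′ + c′) * (x * y))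
      ≈ y * y + x * x + ((l * c + (c⟦ 1ℚ ⟧ - l) * c′) + (l * c + (c⟦ 1ℚ ⟧ - l) * c′)) * (x * y)
    lem = solve 5 (λ x y c c′ l →
      l :* (y :* y :+ x :* x :+ (c :+ c) :* (x :* y)) :+ (con 1ℚ :- l) :* (y :* y :+ x :* x :+ (c′ :+ c′) :* (x :* y))
      := y :* y :+ x :* x :+ ((l :* c :+ (con 1ℚ :- l) :* c′) :+ (l :* c :+ (con 1ℚ :- l) :* c′)) :* (x :* y)) ≈-refl

  diagonal : ∀ I M b g r → M * I ≈ c⟦ 1ℚ ⟧ →
    I * ((b - r) + (g - r) * c⟦ 1ℚ ⟧) + r * c⟦ 1ℚ ⟧ ≈ I * (b + (g + (M + c⟦ ℚ.- (1ℚ ℚ.+ 1ℚ) ⟧) * r))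
  diagonal I M b g r h = ≈-trans (lem₁ I b g r) (≈-trans (+-cong ≈-refl (*-cong (≈-sym h) ≈-refl)) (lem₂ I M b g r))
    where
    lem₁ : ∀ I b g r → I * ((b - r) + (g - r) * c⟦ 1ℚ ⟧) + r * c⟦ 1ℚ ⟧ ≈ I * (b + (g + c⟦ ℚ.- (1ℚ ℚ.+ 1ℚ) ⟧ * r)) + c⟦ 1ℚ ⟧ * r
    lem₁ = solve 4 (λ I b g r → I :* ((b :- r) :+ (g :- r) :* con 1ℚ) :+ r :* con 1ℚ
      := I :* (b :+ (g :+ con (ℚ.- (1ℚ ℚ.+ 1ℚ)) :* r)) :+ con 1ℚ :* r) ≈-refl
    lem₂ : ∀ I M b g r → I * (b + (g + c⟦ ℚ.- (1ℚ ℚ.+ 1ℚ) ⟧ * r)) + M * I * r ≈ I * (b + (g + (M + c⟦ ℚ.- (1ℚ ℚ.+ 1ℚ) ⟧) * r))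
    lem₂ = solve 5 (λ I M b g r → I :* (b :+ (g :+ con (ℚ.- (1ℚ ℚ.+ 1ℚ)) :* r)) :+ M :* I :* r
      := I :* (b :+ (g :+ (M :+ con (ℚ.- (1ℚ ℚ.+ 1ℚ))) :* r))) ≈-refl

  X+Y : ∀ b g r → (b - r) + (g - r) ≈ b + (g + c⟦ ℚ.- (1ℚ ℚ.+ 1ℚ) ⟧ * r)
  X+Y = solve 3 (λ b g r → (b :- r) :+ (g :- r) := b :+ (g :+ con (ℚ.- (1ℚ ℚ.+ 1ℚ)) :* r)) ≈-refl

  Y-X : ∀ b g r → (b - r) - (g - r) ≈ b + c⟦ ℚ.- 1ℚ ⟧ * g
  Y-X = solve 3 (λ b g r → (b :- r) :- (g :- r) := b :+ con (ℚ.- 1ℚ) :* g) ≈-refl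

  off-diagonal : ∀ x r → x + r * c⟦ 0ℚ ⟧ ≈ x
  off-diagonal = solve 2 (λ x r → x :+ r :* con 0ℚ := x) ≈-refl

  split′ : ∀ a b c → (a - b) * c ≈ a * c + c⟦ ℚ.- 1ℚ ⟧ * (b * c)
  split′ = solve 3 (λ a b c → (a :- b) :* c := a :* c :+ con (ℚ.- 1ℚ) :* (b :* c)) ≈-refl

  collapse : ∀ s r z i x d → (s * r) * ((z * (i * x)) * d) ≈ (r * i) * (d * (z * (s * x)))
  collapse = solve 6 (λ s r z i x d → (s :* r) :* ((z :* (i :* x)) :* d) := (r :* i) :* (d :* (z :* (s :* x)))) ≈-refl

  rescale : ∀ s r z i x → (s * r) * (z * (i * x)) ≈ (r * i) * (z * (s * x))
  rescale = solve 5 (λ s r z i x → (s :* r) :* (z :* (i :* x)) := (r :* i) :* (z :* (s :* x))) ≈-refl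

open import Defs

open Rational using (ι; inv)

-- The ordered ring of Cauchy reals: positivity, reciprocals and square roots.

module Reals where
  open ℚSolver.+-*-Solver using (solve; _:=_; _:+_; _:*_; _:-_; :-_; con)

  infix 4 _≃_ _≲_

  -- Records, unlike the relations that they wrap, let Agda infer the numbers being compared.
  record _≃_ (x y : ℝ) : Set where
    constructor mk≃
    field un≃ : x ≈ y
  open _≃_ public

  record _≲_ (x y : ℝ) : Set where
    constructor mk≲
    field un≲ : x ≤ y
  open _≲_ public

  pointwise : ∀ {x y} → (∀ n → seq x n ≡ seq y n) → x ≃ y
  pointwise {x} {y} h = mk≃ λ ε 0<ε → 0 , λ n _ →
    subst (λ z → ∣ z ∣ ℚ.≤ ε) (≡.sym (≡.trans (cong (ℚ._- seq y n) (h n)) (ℚ.+-inverseʳ (seq y n)))) (ℚ.<⇒≤ 0<ε)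

  ≃-refl : ∀ {x} → x ≃ x
  ≃-refl = pointwise (λ n → refl)

  ≃-sym : ∀ {x y} → x ≃ y → y ≃ x
  ≃-sym {x} {y} (mk≃ h) = mk≃ λ ε 0<ε → let N , hN = h ε 0<ε in
    N , λ n N≤n → subst (ℚ._≤ ε) (R.∣p-q∣≡∣q-p∣ (seq x n) (seq y n)) (hN n N≤n)

  ½+½ : ∀ ε → ½ ℚ.* ε ℚ.+ ½ ℚ.* ε ≡ ε
  ½+½ = solve 1 (λ e → con ½ :* e :+ con ½ :* e := e) refl

  ≃-trans : ∀ {x y z} → x ≃ y → y ≃ z → x ≃ z
  ≃-trans {x} {y} {z} (mk≃ h) (mk≃ k) = mk≃ λ ε 0<ε →
    let M , hM = h (½ ℚ.* ε) (R.0<½* 0<ε)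
        N , kN = k (½ ℚ.* ε) (R.0<½* 0<ε)
    in M ℕ.⊔ N , λ n ≤n → ℚ.≤-trans (R.∣-∣-triangle (seq x n) (seq y n) (seq z n))
      (ℚ.≤-trans (ℚ.+-mono-≤ (hM n (ℕ.≤-trans (ℕ.m≤m⊔n M N) ≤n)) (kN n (ℕ.≤-trans (ℕ.m≤n⊔m M N) ≤n)))
        (ℚ.≤-reflexive (½+½ ε)))

  bounded : ∀ x → ∃[ B ] (0ℚ ℚ.< B × ∃[ N ] (∀ n → N ℕ.≤ n → ∣ seq x n ∣ ℚ.≤ B))
  bounded x = let N , h = cauchy x 1ℚ (ℚ.positive⁻¹ 1ℚ) in
    1ℚ ℚ.+ ∣ seq x N ∣ , ℚ.+-mono-<-≤ (ℚ.positive⁻¹ 1ℚ) (ℚ.0≤∣p∣ (seq x N)) , N , λ n N≤n →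
      subst (λ z → ∣ z ∣ ℚ.≤ 1ℚ ℚ.+ ∣ seq x N ∣)
        (solve 2 (λ p q → (p :- q) :+ q := p) refl (seq x n) (seq x N))
        (R.∣+∣≤ {seq x n ℚ.- seq x N} {seq x N} (h n N N≤n ℕ.≤-refl) ℚ.≤-refl)

  +-cong : ∀ {x x′ y y′} → x ≃ x′ → y ≃ y′ → x + y ≃ x′ + y′
  +-cong {x} {x′} {y} {y′} (mk≃ h) (mk≃ k) = mk≃ λ ε 0<ε →
    let M , hM = h (½ ℚ.* ε) (R.0<½* 0<ε)
        N , kN = k (½ ℚ.* ε) (R.0<½* 0<ε)
    in M ℕ.⊔ N , λ n ≤n → subst₂ ℚ._≤_
      (cong ∣_∣ (solve 4 (λ a b c d → (a :- b) :+ (c :- d) := a :+ c :- (b :+ d)) refl (seq x n) (seq x′ n) (seq y n) (seq y′ n)))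
      (½+½ ε)
      (R.∣+∣≤ {seq x n ℚ.- seq x′ n} {seq y n ℚ.- seq y′ n}
        (hM n (ℕ.≤-trans (ℕ.m≤m⊔n M N) ≤n)) (kN n (ℕ.≤-trans (ℕ.m≤n⊔m M N) ≤n)))

  -‿cong : ∀ {x y} → x ≃ y → - x ≃ - y
  -‿cong {x} {y} (mk≃ h) = mk≃ λ ε 0<ε → let N , hN = h ε 0<ε in
    N , λ n N≤n → subst (ℚ._≤ ε) (≡.trans (R.∣p-q∣≡∣q-p∣ (seq x n) (seq y n))
      (cong ∣_∣ (solve 2 (λ p q → q :- p := :- p :- (:- q)) refl (seq x n) (seq y n)))) (hN n N≤n)

  *-comm : ∀ x y → x * y ≃ y * x
  *-comm x y = pointwise (λ n → ℚ.*-comm (seq x n) (seq y n))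

  *-congˡ : ∀ {x y z} → y ≃ z → x * y ≃ x * z
  *-congˡ {x} {y} {z} (mk≃ h) = mk≃ λ ε 0<ε →
    let B , 0<B , M , hM = bounded x
        δ , 0<δ , Bδ≡ε = R.divisor B ε 0<B 0<ε
        N , hN = h δ 0<δ
    in M ℕ.⊔ N , λ n ≤n → subst₂ ℚ._≤_
      (cong ∣_∣ (solve 3 (λ x y z → x :* (y :- z) := x :* y :- x :* z) refl (seq x n) (seq y n) (seq z n)))
      Bδ≡ε
      (R.∣*∣≤ {seq x n} {seq y n ℚ.- seq z n}
        (hM n (ℕ.≤-trans (ℕ.m≤m⊔n M N) ≤n)) (hN n (ℕ.≤-trans (ℕ.m≤n⊔m M N) ≤n)))

  *-cong : ∀ {x x′ y y′} → x ≃ x′ → y ≃ y′ → x * y ≃ x′ * y′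
  *-cong {x} {x′} {y} {y′} h k = ≃-trans (*-congˡ {x} k)
    (≃-trans (*-comm x y′) (≃-trans (*-congˡ {y′} h) (*-comm y′ x′)))

  ℝ-commutativeRing : CommutativeRing 0ℓ 0ℓ
  ℝ-commutativeRing = record
    { Carrier = ℝ ; _≈_ = _≃_ ; _+_ = _+_ ; _*_ = _*_ ; -_ = -_ ; 0# = 0ℝ ; 1# = 1ℝ
    ; isCommutativeRing = record
      { isRing = record
        { +-isAbelianGroup = record
          { isGroup = record
            { isMonoid = record
              { isSemigroup = record
                { isMagma = record
                  { isEquivalence = record { refl = ≃-refl ; sym = ≃-sym ; trans = ≃-trans }
                  ; ∙-cong = +-cong }
                ; assoc = λ x y z → pointwise (λ n → ℚ.+-assoc (seq x n) (seq y n) (seq z n)) }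
              ; identity = (λ x → pointwise (λ n → ℚ.+-identityˡ (seq x n)))
                         , (λ x → pointwise (λ n → ℚ.+-identityʳ (seq x n))) }
            ; inverse = (λ x → pointwise (λ n → ℚ.+-inverseˡ (seq x n)))
                      , (λ x → pointwise (λ n → ℚ.+-inverseʳ (seq x n)))
            ; ⁻¹-cong = -‿cong }
          ; comm = λ x y → pointwise (λ n → ℚ.+-comm (seq x n) (seq y n)) }
        ; *-cong = *-cong
        ; *-assoc = λ x y z → pointwise (λ n → ℚ.*-assoc (seq x n) (seq y n) (seq z n))
        ; *-identity = (λ x → pointwise (λ n → ℚ.*-identityˡ (seq x n)))
                     , (λ x → pointwise (λ n → ℚ.*-identityʳ (seq x n)))
        ; distrib = (λ x y z → pointwise (λ n → ℚ.*-distribˡ-+ (seq x n) (seq y n) (seq z n)))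
                  , (λ x y z → pointwise (λ n → ℚ.*-distribʳ-+ (seq x n) (seq y n) (seq z n))) }
      ; *-comm = *-comm } }

  module ℝ-Ring = CommutativeRing ℝ-commutativeRing
  module ≃-Reasoning = SetoidReasoning ℝ-Ring.setoid
  module ℝ-Sum where
    open MonoidSum ℝ-Ring.+-commutativeMonoid public using (∑-distrib-+; sum-cong-≋)
    open SemiringSum ℝ-Ring.semiring public using (*-distribˡ-sum; *-distribʳ-sum)

  private
    ℚ⟶ℝ : ℚ.+-*-rawRing ACR.-Raw-AlmostCommutative⟶ ACR.fromCommutativeRing ℝ-commutativeRing
    ℚ⟶ℝ = record
      { ⟦_⟧ = fromℚ ; +-homo = λ p q → pointwise (λ n → refl) ; *-homo = λ p q → pointwise (λ n → refl)
      ; -‿homo = λ p → pointwise (λ n → refl) ; 0-homo = ≃-refl ; 1-homo = ≃-refl }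

    weak≟ : ∀ p q → Maybe (fromℚ p ≃ fromℚ q)
    weak≟ p q with p ℚ.≟ q
    ... | yes refl = just ≃-refl
    ... | no _     = nothing

  module ℝ-Solver = RingSolver ℚ.+-*-rawRing (ACR.fromCommutativeRing ℝ-commutativeRing) ℚ⟶ℝ weak≟

  ≃⇒≲ : ∀ {x y} → x ≃ y → x ≲ y
  ≃⇒≲ {x} {y} (mk≃ h) = mk≲ λ ε 0<ε → let N , hN = h ε 0<ε in
    N , λ n N≤n → R.≤-from {seq x n} {seq y n ℚ.+ ε} (ε ℚ.- (seq x n ℚ.- seq y n))
      (R.≤⇒0≤- (ℚ.≤-trans (R.p≤∣p∣ (seq x n ℚ.- seq y n)) (hN n N≤n)))
      (solve 3 (λ x y e → x :+ (e :- (x :- y)) := y :+ e) refl (seq x n) (seq y n) ε)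

  ≲-refl : ∀ {x} → x ≲ x
  ≲-refl = ≃⇒≲ ≃-refl

  ≲-trans : ∀ {x y z} → x ≲ y → y ≲ z → x ≲ z
  ≲-trans {x} {y} {z} (mk≲ h) (mk≲ k) = mk≲ λ ε 0<ε →
    let M , hM = h (½ ℚ.* ε) (R.0<½* 0<ε)
        N , kN = k (½ ℚ.* ε) (R.0<½* 0<ε)
    in M ℕ.⊔ N , λ n ≤n → ℚ.≤-trans (hM n (ℕ.≤-trans (ℕ.m≤m⊔n M N) ≤n))
      (ℚ.≤-trans (ℚ.+-monoˡ-≤ (½ ℚ.* ε) (kN n (ℕ.≤-trans (ℕ.m≤n⊔m M N) ≤n)))
        (ℚ.≤-reflexive (≡.trans (ℚ.+-assoc (seq z n) (½ ℚ.* ε) (½ ℚ.* ε)) (cong (seq z n ℚ.+_) (½+½ ε)))))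

  eventually-≲ : ∀ {x y} N → (∀ n → N ℕ.≤ n → seq x n ℚ.≤ seq y n) → x ≲ y
  eventually-≲ {x} {y} N h = mk≲ λ ε 0<ε → N , λ n N≤n →
    ℚ.≤-trans (h n N≤n) (R.≤-from {seq y n} ε (ℚ.<⇒≤ 0<ε) refl)

  pointwise-≲ : ∀ {x y} → (∀ n → seq x n ℚ.≤ seq y n) → x ≲ y
  pointwise-≲ h = eventually-≲ 0 (λ n _ → h n)

  fromℚ-mono : ∀ {p q} → p ℚ.≤ q → fromℚ p ≲ fromℚ q
  fromℚ-mono h = pointwise-≲ (λ _ → h)

  +-mono : ∀ {x x′ y y′} → x ≲ x′ → y ≲ y′ → x + y ≲ x′ + y′
  +-mono {x} {x′} {y} {y′} (mk≲ h) (mk≲ k) = mk≲ λ ε 0<ε →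
    let M , hM = h (½ ℚ.* ε) (R.0<½* 0<ε)
        N , kN = k (½ ℚ.* ε) (R.0<½* 0<ε)
    in M ℕ.⊔ N , λ n ≤n → ℚ.≤-trans
      (ℚ.+-mono-≤ (hM n (ℕ.≤-trans (ℕ.m≤m⊔n M N) ≤n)) (kN n (ℕ.≤-trans (ℕ.m≤n⊔m M N) ≤n)))
      (ℚ.≤-reflexive (solve 3 (λ a b e → a :+ con ½ :* e :+ (b :+ con ½ :* e) := a :+ b :+ e) refl (seq x′ n) (seq y′ n) ε))

  ≲⇒0≲- : ∀ {x y} → x ≲ y → 0ℝ ≲ y - x
  ≲⇒0≲- {x} {y} h = ≲-trans (≃⇒≲ (≃-sym (ℝ-Ring.-‿inverseʳ x))) (+-mono h (≲-refl { - x}))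

  ≲-from : ∀ {x y} d → 0ℝ ≲ d → x + d ≃ y → x ≲ y
  ≲-from {x} {y} d 0≲d h = ≲-trans (≃⇒≲ (≃-sym (ℝ-Ring.+-identityʳ x))) (≲-trans (+-mono (≲-refl {x}) 0≲d) (≃⇒≲ h))

  0≲sq : ∀ x → 0ℝ ≲ x * x
  0≲sq x = pointwise-≲ (λ n → R.0≤sq (seq x n))

  0≲+ : ∀ {x y} → 0ℝ ≲ x → 0ℝ ≲ y → 0ℝ ≲ x + y
  0≲+ {x} {y} h k = ≲-trans (≃⇒≲ (≃-sym (ℝ-Ring.+-identityˡ 0ℝ))) (+-mono h k)

  -- At a fixed index nonnegativity holds only up to some δ, so the terms may have any signs. With
  -- bounds B and C on the terms, each of the four sign patterns leaves the product at least -(B +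
  -- C) δ.
  0≲* : ∀ {x y} → 0ℝ ≲ x → 0ℝ ≲ y → 0ℝ ≲ x * y
  0≲* {x} {y} (mk≲ h) (mk≲ k) = mk≲ λ ε 0<ε →
    let B , 0<B , L , hB = bounded x
        C , 0<C , M , hC = bounded y
        δ , 0<δ , BCδ≡ε = R.divisor (B ℚ.+ C) ε (ℚ.+-mono-< 0<B 0<C) 0<ε
        N , hN = h δ 0<δ
        O , kO = k δ 0<δ
        P = (L ℕ.⊔ M) ℕ.⊔ (N ℕ.⊔ O)
    in P , λ n ≤n → subst (λ z → 0ℚ ℚ.≤ seq x n ℚ.* seq y n ℚ.+ z) BCδ≡ε
      (lower (seq x n) (seq y n) B C δ (ℚ.<⇒≤ 0<δ)
        (ℚ.≤-trans (R.p≤∣p∣ (seq x n)) (hB n (ℕ.≤-trans (ℕ.m≤m⊔n L M) (ℕ.≤-trans (ℕ.m≤m⊔n (L ℕ.⊔ M) (N ℕ.⊔ O)) ≤n))))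
        (ℚ.≤-trans (R.p≤∣p∣ (seq y n)) (hC n (ℕ.≤-trans (ℕ.m≤n⊔m L M) (ℕ.≤-trans (ℕ.m≤m⊔n (L ℕ.⊔ M) (N ℕ.⊔ O)) ≤n))))
        (ℚ.<⇒≤ 0<B) (ℚ.<⇒≤ 0<C)
        (hN n (ℕ.≤-trans (ℕ.m≤m⊔n N O) (ℕ.≤-trans (ℕ.m≤n⊔m (L ℕ.⊔ M) (N ℕ.⊔ O)) ≤n)))
        (kO n (ℕ.≤-trans (ℕ.m≤n⊔m N O) (ℕ.≤-trans (ℕ.m≤n⊔m (L ℕ.⊔ M) (N ℕ.⊔ O)) ≤n))))
    where
    lower : ∀ x y B C δ → 0ℚ ℚ.≤ δ → x ℚ.≤ B → y ℚ.≤ C → 0ℚ ℚ.≤ B → 0ℚ ℚ.≤ C → 0ℚ ℚ.≤ x ℚ.+ δ → 0ℚ ℚ.≤ y ℚ.+ δ →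
      0ℚ ℚ.≤ x ℚ.* y ℚ.+ (B ℚ.+ C) ℚ.* δ
    lower x y B C δ 0≤δ x≤B y≤C 0≤B 0≤C hx hy with ℚ.≤-total 0ℚ x | ℚ.≤-total 0ℚ y
    ... | inj₁ 0≤x | inj₁ 0≤y = R.0≤+ (R.0≤* 0≤x 0≤y) (R.0≤* (R.0≤+ 0≤B 0≤C) 0≤δ)
    ... | inj₁ 0≤x | inj₂ y≤0 = R.≤-from {0ℚ}
      (x ℚ.* (y ℚ.+ δ) ℚ.+ ((B ℚ.- x) ℚ.* δ ℚ.+ C ℚ.* δ))
      (R.0≤+ (R.0≤* 0≤x hy) (R.0≤+ (R.0≤* (R.≤⇒0≤- x≤B) 0≤δ) (R.0≤* 0≤C 0≤δ)))
      (solve 5 (λ x y B C d → con 0ℚ :+ (x :* (y :+ d) :+ ((B :- x) :* d :+ C :* d)) := x :* y :+ (B :+ C) :* d) refl x y B C δ)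
    ... | inj₂ x≤0 | inj₁ 0≤y = R.≤-from {0ℚ}
      (y ℚ.* (x ℚ.+ δ) ℚ.+ ((C ℚ.- y) ℚ.* δ ℚ.+ B ℚ.* δ))
      (R.0≤+ (R.0≤* 0≤y hx) (R.0≤+ (R.0≤* (R.≤⇒0≤- y≤C) 0≤δ) (R.0≤* 0≤B 0≤δ)))
      (solve 5 (λ x y B C d → con 0ℚ :+ (y :* (x :+ d) :+ ((C :- y) :* d :+ B :* d)) := x :* y :+ (B :+ C) :* d) refl x y B C δ)
    ... | inj₂ x≤0 | inj₂ y≤0 = R.≤-from {0ℚ}
      ((ℚ.- x) ℚ.* (ℚ.- y) ℚ.+ (B ℚ.+ C) ℚ.* δ)
      (R.0≤+ (R.0≤* (ℚ.neg-antimono-≤ x≤0) (ℚ.neg-antimono-≤ y≤0)) (R.0≤* (R.0≤+ 0≤B 0≤C) 0≤δ))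
      (solve 5 (λ x y B C d → con 0ℚ :+ ((:- x) :* (:- y) :+ (B :+ C) :* d) := x :* y :+ (B :+ C) :* d) refl x y B C δ)

  *-monoˡ : ∀ {x y z} → 0ℝ ≲ x → y ≲ z → x * y ≲ x * z
  *-monoˡ {x} {y} {z} 0≲x y≲z = ≲-from {x * y} {x * z} (x * (z - y)) (0≲* 0≲x (≲⇒0≲- y≲z))
    (pointwise (λ n → solve 3 (λ x y z → x :* y :+ x :* (z :- y) := x :* z) refl (seq x n) (seq y n) (seq z n)))

  *-monoʳ : ∀ {x y z} → 0ℝ ≲ x → y ≲ z → y * x ≲ z * x
  *-monoʳ {x} {y} {z} 0≲x y≲z = ≲-trans (≃⇒≲ (*-comm y x)) (≲-trans (*-monoˡ 0≲x y≲z) (≃⇒≲ (*-comm x z)))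

  record Positive (x : ℝ) : Set where
    constructor positive
    field
      {bound}  : ℚ
      0<bound  : 0ℚ ℚ.< bound
      {index}  : ℕ
      bound≤   : ∀ n → index ℕ.≤ n → bound ℚ.≤ seq x n

  positive-fromℚ : ∀ {q} → 0ℚ ℚ.< q → Positive (fromℚ q)
  positive-fromℚ 0<q = positive 0<q {0} (λ _ _ → ℚ.≤-refl)

  positive-mono : ∀ {x y} → Positive x → x ≲ y → Positive y
  positive-mono {x} {y} (positive {q} 0<q {M} h) (mk≲ k) =
    let N , kN = k (½ ℚ.* q) (R.0<½* 0<q) in
    positive {bound = ½ ℚ.* q} (R.0<½* 0<q) {M ℕ.⊔ N} λ n ≤n →
      R.≤-from {½ ℚ.* q} {seq y n} ((seq x n ℚ.- q) ℚ.+ (seq y n ℚ.+ ½ ℚ.* q ℚ.- seq x n))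
        (R.0≤+ (R.≤⇒0≤- (h n (ℕ.≤-trans (ℕ.m≤m⊔n M N) ≤n))) (R.≤⇒0≤- (kN n (ℕ.≤-trans (ℕ.m≤n⊔m M N) ≤n))))
        (solve 3 (λ x y q → con ½ :* q :+ ((x :- q) :+ (y :+ con ½ :* q :- x)) := y) refl (seq x n) (seq y n) q)

  positive-cong : ∀ {x y} → x ≃ y → Positive x → Positive y
  positive-cong x≃y h = positive-mono h (≃⇒≲ x≃y)

  positive⇒0≲ : ∀ {x} → Positive x → 0ℝ ≲ x
  positive⇒0≲ {x} (positive 0<q {N} h) = eventually-≲ N (λ n N≤n → ℚ.≤-trans (ℚ.<⇒≤ 0<q) (h n N≤n))

  positive-* : ∀ {x y} → Positive x → Positive y → Positive (x * y)
  positive-* (positive 0<p {M} h) (positive 0<q {N} k) = positive (R.0<* 0<p 0<q) {M ℕ.⊔ N} λ n ≤n →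
    R.*-mono (ℚ.<⇒≤ 0<p) (h n (ℕ.≤-trans (ℕ.m≤m⊔n M N) ≤n)) (ℚ.<⇒≤ 0<q) (k n (ℕ.≤-trans (ℕ.m≤n⊔m M N) ≤n))

  -- Cotransitivity of the order.
  positive-split : ∀ {x y} → Positive (x + y) → Positive x ⊎ Positive y
  positive-split {x} {y} (positive {q} 0<q {M} h) = decide (ℚ.≤-total (½ ℚ.* q) (seq x k))
    where
    δ : ℚ
    δ = ½ ℚ.* (½ ℚ.* q)
    0<δ : 0ℚ ℚ.< δ
    0<δ = R.0<½* (R.0<½* 0<q)
    cx = cauchy x δ 0<δ
    cy = cauchy y δ 0<δ
    k = M ℕ.⊔ (proj₁ cx ℕ.⊔ proj₁ cy)
    ≥x : proj₁ cx ℕ.≤ k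
    ≥x = ℕ.≤-trans (ℕ.m≤m⊔n (proj₁ cx) (proj₁ cy)) (ℕ.m≤n⊔m M _)
    ≥y : proj₁ cy ℕ.≤ k
    ≥y = ℕ.≤-trans (ℕ.m≤n⊔m (proj₁ cx) (proj₁ cy)) (ℕ.m≤n⊔m M _)
    witness : ∀ z (c : ∃[ N ] (∀ m n → N ℕ.≤ m → N ℕ.≤ n → ∣ seq z m ℚ.- seq z n ∣ ℚ.≤ δ)) → proj₁ c ℕ.≤ k →
      ½ ℚ.* q ℚ.≤ seq z k → Positive z
    witness z (N , c) N≤k h′ = positive 0<δ {N} λ n N≤n →
      R.≤-from {δ} {seq z n} ((seq z k ℚ.- ½ ℚ.* q) ℚ.+ (δ ℚ.- (seq z k ℚ.- seq z n)))
        (R.0≤+ (R.≤⇒0≤- h′) (R.≤⇒0≤- (ℚ.≤-trans (R.p≤∣p∣ (seq z k ℚ.- seq z n)) (c k n N≤k N≤n))))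
        (solve 3 (λ q z z′ → con ½ :* (con ½ :* q) :+ ((z :- con ½ :* q) :+ (con ½ :* (con ½ :* q) :- (z :- z′))) := z′)
          refl q (seq z k) (seq z n))
    decide : ½ ℚ.* q ℚ.≤ seq x k ⊎ seq x k ℚ.≤ ½ ℚ.* q → Positive x ⊎ Positive y
    decide (inj₁ h′) = inj₁ (witness x cx ≥x h′)
    decide (inj₂ h′) = inj₂ (witness y cy ≥y
      (R.≤-from {½ ℚ.* q} {seq y k} ((½ ℚ.* q ℚ.- seq x k) ℚ.+ (seq x k ℚ.+ seq y k ℚ.- q))
        (R.0≤+ (R.≤⇒0≤- h′) (R.≤⇒0≤- (h k (ℕ.m≤m⊔n M _))))
        (solve 3 (λ q x y → con ½ :* q :+ ((con ½ :* q :- x) :+ (x :+ y :- q)) := y) refl q (seq x k) (seq y k))))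

  -- Transfers a positive lower bound from a product to a factor known to be nonnegative, whatever
  -- the sign of x. If |x| ≤ B and x y ≥ B δ, then y ≥ δ when y ≥ 0; otherwise y lies between -δ/2
  -- and 0, so that x y ≤ B δ/2, a contradiction.
  positive-factor : ∀ {x y} → Positive (x * y) → 0ℝ ≲ y → Positive y
  positive-factor {x} {y} (positive {q} 0<q {M} h) (mk≲ 0≤y) =
    let B , 0<B , L , hB = bounded x
        δ , 0<δ , Bδ≡q = R.divisor B q 0<B 0<q
        N , hN = 0≤y (½ ℚ.* δ) (R.0<½* 0<δ)
    in positive {bound = δ} 0<δ {M ℕ.⊔ (L ℕ.⊔ N)} λ n ≤n →
      factor (seq x n) (seq y n) B δ 0<B 0<δ
        (hB n (ℕ.≤-trans (ℕ.≤-trans (ℕ.m≤m⊔n L N) (ℕ.m≤n⊔m M _)) ≤n))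
        (subst (ℚ._≤ seq x n ℚ.* seq y n) (≡.sym Bδ≡q) (h n (ℕ.≤-trans (ℕ.m≤m⊔n M _) ≤n)))
        (hN n (ℕ.≤-trans (ℕ.≤-trans (ℕ.m≤n⊔m L N) (ℕ.m≤n⊔m M _)) ≤n))
    where
    factor : ∀ x y B δ → 0ℚ ℚ.< B → 0ℚ ℚ.< δ → ∣ x ∣ ℚ.≤ B → B ℚ.* δ ℚ.≤ x ℚ.* y → 0ℚ ℚ.≤ y ℚ.+ ½ ℚ.* δ → δ ℚ.≤ y
    factor x y B δ 0<B 0<δ ∣x∣≤B Bδ≤xy hy with ℚ.≤-total 0ℚ y
    ... | inj₁ 0≤y = R.*-cancelˡ-≤ {B} 0<B (ℚ.≤-trans Bδ≤xy (R.*-monoʳ 0≤y (ℚ.≤-trans (R.p≤∣p∣ x) ∣x∣≤B)))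
    ... | inj₂ y≤0 = ⊥-elim (ℚ.<⇒≢ contradiction′ refl)
      where
      open ℚ.≤-Reasoning
      -y≤½δ : ℚ.- y ℚ.≤ ½ ℚ.* δ
      -y≤½δ = R.≤-from {ℚ.- y} (y ℚ.+ ½ ℚ.* δ) hy (solve 2 (λ y d → :- y :+ (y :+ d) := d) refl y (½ ℚ.* δ))
      contradiction′ : B ℚ.* δ ℚ.< B ℚ.* δ
      contradiction′ = begin-strict
        B ℚ.* δ                  ≤⟨ Bδ≤xy ⟩
        x ℚ.* y                  ≡⟨ solve 2 (λ x y → x :* y := :- x :* :- y) refl x y ⟩
        (ℚ.- x) ℚ.* (ℚ.- y)      ≤⟨ R.*-monoʳ (ℚ.neg-antimono-≤ y≤0) (ℚ.≤-trans (R.-p≤∣p∣ x) ∣x∣≤B) ⟩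
        B ℚ.* (ℚ.- y)            ≤⟨ R.*-monoˡ (ℚ.<⇒≤ 0<B) -y≤½δ ⟩
        B ℚ.* (½ ℚ.* δ)          ≡⟨ ≡.sym (ℚ.+-identityʳ _) ⟩
        B ℚ.* (½ ℚ.* δ) ℚ.+ 0ℚ   <⟨ ℚ.+-monoʳ-< (B ℚ.* (½ ℚ.* δ)) (R.0<* 0<B (R.0<½* 0<δ)) ⟩
        B ℚ.* (½ ℚ.* δ) ℚ.+ B ℚ.* (½ ℚ.* δ)
          ≡⟨ solve 2 (λ B d → B :* (con ½ :* d) :+ B :* (con ½ :* d) := B :* d) refl B δ ⟩
        B ℚ.* δ ∎

  private
    -- The default 0 is taken only at rationals that are not positive. A positive real has such
    -- approximations only before its `index`, where they do not affect the limit.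
    qinv : ℚ → ℚ
    qinv p with 0ℚ ℚ.<? p
    ... | yes 0<p = proj₁ (R.reciprocal p 0<p)
    ... | no _    = 0ℚ

    qinv-spec : ∀ {q p} → 0ℚ ℚ.< q → q ℚ.≤ p → p ℚ.* qinv p ≡ 1ℚ × 0ℚ ℚ.≤ qinv p × q ℚ.* qinv p ℚ.≤ 1ℚ
    qinv-spec {q} {p} 0<q q≤p with 0ℚ ℚ.<? p
    ... | no ¬0<p = ⊥-elim (¬0<p (ℚ.<-≤-trans 0<q q≤p))
    ... | yes 0<p with R.reciprocal p 0<p
    ... | r , 0<r , pr≡1 = pr≡1 , ℚ.<⇒≤ 0<r , ℚ.≤-trans (R.*-monoʳ (ℚ.<⇒≤ 0<r) q≤p) (ℚ.≤-reflexive pr≡1)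

  abstract
    reciprocalʳ : ∀ {x} → Positive x → ∃[ y ] (x * y ≃ 1ℝ × 0ℝ ≲ y)
    reciprocalʳ {x} (positive {q} 0<q {M} h) = y , mk≃ (λ ε 0<ε → M , λ n M≤n →
        subst (λ z → ∣ z ℚ.- 1ℚ ∣ ℚ.≤ ε) (≡.sym (proj₁ (spec n M≤n))) (ℚ.<⇒≤ 0<ε)) ,
        eventually-≲ M (λ n M≤n → proj₁ (proj₂ (spec n M≤n)))
      where
      open ℚ.≤-Reasoning
      i : ℕ → ℚ
      i n = qinv (seq x n)
      spec : ∀ n → M ℕ.≤ n → seq x n ℚ.* i n ≡ 1ℚ × 0ℚ ℚ.≤ i n × q ℚ.* i n ℚ.≤ 1ℚ
      spec n M≤n = qinv-spec 0<q (h n M≤n)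
      y : ℝ
      y = mkℝ i λ ε 0<ε →
        -- The difference of two reciprocals is the difference of the numbers divided by their
        -- product, and that product is at least q².
        let N , c = cauchy x (q ℚ.* q ℚ.* ε) (R.0<* (R.0<* 0<q 0<q) 0<ε) in
        M ℕ.⊔ N , λ m n ≤m ≤n →
          close m n ε 0<ε (spec m (ℕ.≤-trans (ℕ.m≤m⊔n M N) ≤m)) (spec n (ℕ.≤-trans (ℕ.m≤m⊔n M N) ≤n))
            (c n m (ℕ.≤-trans (ℕ.m≤n⊔m M N) ≤n) (ℕ.≤-trans (ℕ.m≤n⊔m M N) ≤m))
        where
        close : ∀ m n ε → 0ℚ ℚ.< ε →
          seq x m ℚ.* i m ≡ 1ℚ × 0ℚ ℚ.≤ i m × q ℚ.* i m ℚ.≤ 1ℚ →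
          seq x n ℚ.* i n ≡ 1ℚ × 0ℚ ℚ.≤ i n × q ℚ.* i n ℚ.≤ 1ℚ →
          ∣ seq x n ℚ.- seq x m ∣ ℚ.≤ q ℚ.* q ℚ.* ε → ∣ i m ℚ.- i n ∣ ℚ.≤ ε
        close m n ε 0<ε (em , 0≤im , qim≤1) (en , 0≤in , qin≤1) c = begin
          ∣ i m ℚ.- i n ∣
            ≡⟨ cong ∣_∣ (≡.sym (cong₂ ℚ._-_ (≡.trans (cong (i m ℚ.*_) en) (ℚ.*-identityʳ (i m)))
                 (≡.trans (cong (i n ℚ.*_) em) (ℚ.*-identityʳ (i n))))) ⟩
          ∣ i m ℚ.* (seq x n ℚ.* i n) ℚ.- i n ℚ.* (seq x m ℚ.* i m) ∣
            ≡⟨ cong ∣_∣ (solve 4 (λ a b x y → a :* (y :* b) :- b :* (x :* a) := (y :- x) :* (a :* b)) refl (i m) (i n) (seq x m) (seq x n)) ⟩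
          ∣ (seq x n ℚ.- seq x m) ℚ.* (i m ℚ.* i n) ∣
            ≤⟨ R.∣*∣≤ {seq x n ℚ.- seq x m} {i m ℚ.* i n} c (ℚ.≤-reflexive (ℚ.0≤p⇒∣p∣≡p (R.0≤* 0≤im 0≤in))) ⟩
          q ℚ.* q ℚ.* ε ℚ.* (i m ℚ.* i n)
            ≡⟨ solve 4 (λ q e a b → q :* q :* e :* (a :* b) := e :* ((q :* a) :* (q :* b))) refl q ε (i m) (i n) ⟩
          ε ℚ.* ((q ℚ.* i m) ℚ.* (q ℚ.* i n))
            ≤⟨ R.*-monoˡ (ℚ.<⇒≤ 0<ε) (R.*-mono (R.0≤* (ℚ.<⇒≤ 0<q) 0≤im) qim≤1 (R.0≤* (ℚ.<⇒≤ 0<q) 0≤in) qin≤1) ⟩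
          ε ℚ.* (1ℚ ℚ.* 1ℚ)
            ≡⟨ ℚ.*-identityʳ ε ⟩
          ε ∎

  -- A diagonal choice: the n-th rational is rooted to precision 1/(n + 1). The function is total
  -- because the rational approximation uses absolute values.
  sqrt : ℝ → ℝ
  sqrt x = mkℝ (λ n → RationalSquareRoot.√ (seq x n) n) (RationalSquareRoot.√-cauchy (seq x) (cauchy x))

  0≲sqrt : ∀ x → 0ℝ ≲ sqrt x
  0≲sqrt x = pointwise-≲ (λ n → RationalSquareRoot.0≤√ (seq x n) n)

  abstract
    sqrt² : ∀ {x} → 0ℝ ≲ x → sqrt x * sqrt x ≃ x
    sqrt² {x} (mk≲ 0≤x) = mk≃ λ ε 0<ε →
      let M , hM = RationalSquareRoot.√²→ (seq x) (cauchy x) (½ ℚ.* ε) (R.0<½* 0<ε)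
          N , hN = 0≤x (½ ℚ.* (½ ℚ.* ε)) (R.0<½* (R.0<½* 0<ε))
      in M ℕ.⊔ N , λ n ≤n → let r = RationalSquareRoot.√ (seq x n) n in
        ℚ.≤-trans (R.∣-∣-triangle (r ℚ.* r) ∣ seq x n ∣ (seq x n))
          (ℚ.≤-trans (ℚ.+-mono-≤ (hM n (ℕ.≤-trans (ℕ.m≤m⊔n M N) ≤n))
            (close (seq x n) ε 0<ε (hN n (ℕ.≤-trans (ℕ.m≤n⊔m M N) ≤n)))) (ℚ.≤-reflexive (½+½ ε)))
      where
      close : ∀ p ε → 0ℚ ℚ.< ε → 0ℚ ℚ.≤ p ℚ.+ ½ ℚ.* (½ ℚ.* ε) → ∣ ∣ p ∣ ℚ.- p ∣ ℚ.≤ ½ ℚ.* ε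
      close p ε 0<ε h with ℚ.≤-total 0ℚ p
      ... | inj₁ 0≤p = subst (λ z → ∣ z ∣ ℚ.≤ ½ ℚ.* ε)
        (≡.sym (≡.trans (cong (ℚ._- p) (ℚ.0≤p⇒∣p∣≡p 0≤p)) (ℚ.+-inverseʳ p))) (ℚ.<⇒≤ (R.0<½* 0<ε))
      ... | inj₂ p≤0 = ℚ.≤-trans
        (ℚ.≤-reflexive (≡.trans (cong (λ z → ∣ z ℚ.- p ∣) (≡.trans (≡.sym (ℚ.∣-p∣≡∣p∣ p)) (ℚ.0≤p⇒∣p∣≡p 0≤-p)))
          (ℚ.0≤p⇒∣p∣≡p (R.0≤+ 0≤-p 0≤-p))))
        (R.≤-from {ℚ.- p ℚ.- p} ((p ℚ.+ ½ ℚ.* (½ ℚ.* ε)) ℚ.+ (p ℚ.+ ½ ℚ.* (½ ℚ.* ε))) (R.0≤+ h h)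
          (solve 2 (λ p e → :- p :- p :+ ((p :+ con ½ :* (con ½ :* e)) :+ (p :+ con ½ :* (con ½ :* e))) := con ½ :* e) refl p ε))
        where
        0≤-p : 0ℚ ℚ.≤ ℚ.- p
        0≤-p = ℚ.neg-antimono-≤ p≤0

  positive-sqrt : ∀ {x} → Positive x → Positive (sqrt x)
  positive-sqrt {x} h = positive-factor {sqrt x} {sqrt x}
    (positive-cong (≃-sym (sqrt² (positive⇒0≲ h))) h) (0≲sqrt x)

open Reals

-- Limits of real sequences, and cosine, sine and arcsine on the reals.

module RealTrigonometry where
  open ℚSolver.+-*-Solver using (solve; _:=_; _:+_; _:*_; _:-_; :-_; con)
  private
    module T = RationalTrigonometry

  infix 4 _⇝_

  record _⇝_ (x : ℕ → ℝ) (l : ℝ) : Set where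
    constructor mk⇝
    field un⇝ : ∀ ε → 0ℚ ℚ.< ε → ∃[ N ] (∀ k → N ℕ.≤ k → x k ≲ l + fromℚ ε × l ≲ x k + fromℚ ε)
  open _⇝_ public

  ⇝⇒⟶ : ∀ {x l} → x ⇝ l → x ⟶ l
  ⇝⇒⟶ {x} {l} (mk⇝ h) ε 0<ε = let N , hN = h ε 0<ε in
    N , λ k N≤k → un≲ {l - fromℚ ε} {x k} (≲-trans (+-mono (proj₂ (hN k N≤k)) (≲-refl { - fromℚ ε}))
                        (≃⇒≲ (pointwise λ n → solve 2 (λ a e → a :+ e :- e := a) refl (seq (x k) n) ε)))
                , un≲ {x k} {l + fromℚ ε} (proj₁ (hN k N≤k))

  ⇝-cong : ∀ {x y l m} → (∀ k → x k ≃ y k) → l ≃ m → x ⇝ l → y ⇝ m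
  ⇝-cong x≃y l≃m (mk⇝ h) = mk⇝ λ ε 0<ε → let N , hN = h ε 0<ε in
    N , λ k N≤k → ≲-trans (≃⇒≲ (≃-sym (x≃y k))) (≲-trans (proj₁ (hN k N≤k)) (+-mono (≃⇒≲ l≃m) ≲-refl))
                , ≲-trans (≃⇒≲ (≃-sym l≃m)) (≲-trans (proj₂ (hN k N≤k)) (+-mono (≃⇒≲ (x≃y k)) ≲-refl))

  ⇝-+ : ∀ {x y l m} → x ⇝ l → y ⇝ m → (λ k → x k + y k) ⇝ l + m
  ⇝-+ {x} {y} {l} {m} (mk⇝ h) (mk⇝ g) = mk⇝ λ ε 0<ε →
    let M , hM = h (½ ℚ.* ε) (R.0<½* 0<ε)
        N , gN = g (½ ℚ.* ε) (R.0<½* 0<ε)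
    in M ℕ.⊔ N , λ k ≤k →
      let hk = hM k (ℕ.≤-trans (ℕ.m≤m⊔n M N) ≤k)
          gk = gN k (ℕ.≤-trans (ℕ.m≤n⊔m M N) ≤k)
      in ≲-trans (+-mono (proj₁ hk) (proj₁ gk)) (≃⇒≲ (regroup l m ε))
       , ≲-trans (+-mono (proj₂ hk) (proj₂ gk)) (≃⇒≲ (regroup (x k) (y k) ε))
    where
    regroup : ∀ a b ε → a + fromℚ (½ ℚ.* ε) + (b + fromℚ (½ ℚ.* ε)) ≃ a + b + fromℚ ε
    regroup a b ε = pointwise λ n →
      solve 3 (λ a b e → a :+ con ½ :* e :+ (b :+ con ½ :* e) := a :+ b :+ e) refl (seq a n) (seq b n) ε

  private
    -- A bound on a product by bounds on absolute values without a case distinction on signs: B δ -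
    -- c d is half the sum of (B - c)(δ + d) and (B + c)(δ - d).
    *-bound : ∀ c d B δ → c ≲ B → - c ≲ B → d ≲ δ → - d ≲ δ → c * d ≲ B * δ
    *-bound c d B δ h₁ h₂ h₃ h₄ = ≲-from {c * d} {B * δ}
      (fromℚ ½ * ((B - c) * (δ - - d)) + fromℚ ½ * ((B - - c) * (δ - d)))
      (0≲+ (0≲* (fromℚ-mono (ℚ.nonNegative⁻¹ ½)) (0≲* (≲⇒0≲- h₁) (≲⇒0≲- h₄)))
           (0≲* (fromℚ-mono (ℚ.nonNegative⁻¹ ½)) (0≲* (≲⇒0≲- h₂) (≲⇒0≲- h₃))))
      (pointwise λ n → solve 4 (λ c d B e → c :* d :+ (con ½ :* ((B :- c) :* (e :- :- d)) :+ con ½ :* ((B :- :- c) :* (e :- d)))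
         := B :* e) refl (seq c n) (seq d n) (seq B n) (seq δ n))

  ⇝-* : ∀ {x l} c → x ⇝ l → (λ k → c * x k) ⇝ c * l
  ⇝-* {x} {l} c (mk⇝ h) = mk⇝ λ ε 0<ε →
    let B , 0<B , M , hB = bounded c
        δ , 0<δ , Bδ≡ε = R.divisor B ε 0<B 0<ε
        N , hN = h δ 0<δ
        c≲B : c ≲ fromℚ B
        c≲B = eventually-≲ M (λ n M≤n → ℚ.≤-trans (R.p≤∣p∣ (seq c n)) (hB n M≤n))
        -c≲B : - c ≲ fromℚ B
        -c≲B = eventually-≲ M (λ n M≤n → ℚ.≤-trans (R.-p≤∣p∣ (seq c n)) (hB n M≤n))
    in N , λ k N≤k →
      let d≲δ : x k - l ≲ fromℚ δ
          d≲δ = ≲-trans (+-mono (proj₁ (hN k N≤k)) (≲-refl { - l}))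
            (≃⇒≲ (pointwise λ n → solve 2 (λ l e → l :+ e :- l := e) refl (seq l n) δ))
          -d≲δ : - (x k - l) ≲ fromℚ δ
          -d≲δ = ≲-trans (≃⇒≲ (pointwise {y = l - x k} λ n → solve 2 (λ x l → :- (x :- l) := l :- x) refl (seq (x k) n) (seq l n)))
            (≲-trans (+-mono (proj₂ (hN k N≤k)) (≲-refl { - x k}))
              (≃⇒≲ (pointwise λ n → solve 2 (λ l e → l :+ e :- l := e) refl (seq (x k) n) δ)))
          Bδ≃ε : fromℚ B * fromℚ δ ≃ fromℚ ε
          Bδ≃ε = pointwise (λ _ → Bδ≡ε)
      in ≲-from {c * x k} {c * l + fromℚ ε} (fromℚ ε - c * (x k - l))
           (≲⇒0≲- (≲-trans (*-bound c (x k - l) (fromℚ B) (fromℚ δ) c≲B -c≲B d≲δ -d≲δ) (≃⇒≲ Bδ≃ε)))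
           (pointwise λ n → solve 4 (λ c x l e → c :* x :+ (e :- c :* (x :- l)) := c :* l :+ e) refl (seq c n) (seq (x k) n) (seq l n) ε)
       , ≲-from {c * l} {c * x k + fromℚ ε} (fromℚ ε - c * - (x k - l))
           (≲⇒0≲- (≲-trans (*-bound c (- (x k - l)) (fromℚ B) (fromℚ δ) c≲B -c≲B -d≲δ
             (≲-trans (≃⇒≲ (pointwise {y = x k - l} λ n → solve 1 (λ a → :- :- a := a) refl (seq (x k - l) n))) d≲δ)) (≃⇒≲ Bδ≃ε)))
           (pointwise λ n → solve 4 (λ c x l e → c :* l :+ (e :- c :* :- (x :- l)) := c :* x :+ e) refl (seq c n) (seq (x k) n) (seq l n) ε)

  series : (ℕ → ℝ) → ℕ → ℝ
  series f m = sum {m} (λ k → f (toℕ k))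

  seq-series : ∀ m (f : ℕ → ℝ) n → seq (series f m) n ≡ RationalSeries.∑ m (λ k → seq (f k) n)
  seq-series zero    f n = refl
  seq-series (suc m) f n = cong (seq (f 0) n ℚ.+_) (seq-series m (f ∘ suc) n)

  -- A Lipschitz constant common to all partial sums controls a change of the argument, and uniform
  -- convergence controls a change of the truncation. Together they make the diagonal sequence
  -- `F n (seq x n)` Cauchy, so the limit function extends from rational to real arguments.
  record LocallyUniform (F : ℕ → ℚ → ℚ) : Set where
    field
      lipschitz : ∀ B → 0ℚ ℚ.≤ B → ∃[ L ] (0ℚ ℚ.< L × (∀ N {x y} → ∣ x ∣ ℚ.≤ B → ∣ y ∣ ℚ.≤ B →
        ∣ F N x ℚ.- F N y ∣ ℚ.≤ ∣ x ℚ.- y ∣ ℚ.* L))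
      uniform : ∀ B → 0ℚ ℚ.≤ B → ∀ ε → 0ℚ ℚ.< ε → ∃[ N ] (∀ {x} → ∣ x ∣ ℚ.≤ B → ∀ m n → N ℕ.≤ m → N ℕ.≤ n →
        ∣ F m x ℚ.- F n x ∣ ℚ.≤ ε)

  private
    case-total : ∀ (f : ℕ → ℚ) {m n ε} → (n ℕ.≤ m → ∣ f m ℚ.- f n ∣ ℚ.≤ ε) → (m ℕ.≤ n → ∣ f n ℚ.- f m ∣ ℚ.≤ ε) →
      ∣ f m ℚ.- f n ∣ ℚ.≤ ε
    case-total f {m} {n} {ε} h k with ℕ.≤-total n m
    ... | inj₁ n≤m = h n≤m
    ... | inj₂ m≤n = subst (ℚ._≤ ε) (R.∣p-q∣≡∣q-p∣ (f n) (f m)) (k m≤n)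

  abstract
    cos-uniform : LocallyUniform T.Cos
    cos-uniform = record
      { lipschitz = λ B 0≤B → let open T.Bounded B 0≤B renaming (K to κ) in κ ℚ.+ κ ℚ.+ 1ℚ , ℚ.+-mono-≤-< (R.0≤+ 0≤K 0≤K) (ℚ.positive⁻¹ 1ℚ) ,
          λ N {x} {y} hx hy → ℚ.≤-trans (Cos-lipschitz N hx hy)
            (R.*-monoˡ (ℚ.0≤∣p∣ (x ℚ.- y)) (R.≤-from {κ ℚ.+ κ} 1ℚ (ℚ.nonNegative⁻¹ 1ℚ) refl))
      ; uniform = λ B 0≤B ε 0<ε → let open T.Bounded B 0≤B in proj₁ (tail-small ε 0<ε) , λ {x} hx m n N≤m N≤n →
          case-total (λ n → T.Cos n x) {m} {n} (λ n≤m → ℚ.≤-trans (Cos-tail hx n≤m) (proj₂ (tail-small ε 0<ε) n N≤n))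
                             (λ m≤n → ℚ.≤-trans (Cos-tail hx m≤n) (proj₂ (tail-small ε 0<ε) m N≤m)) }

    sin-uniform : LocallyUniform T.Sin
    sin-uniform = record
      { lipschitz = λ B 0≤B → let open T.Bounded B 0≤B renaming (K to κ) in κ ℚ.+ κ ℚ.+ 1ℚ , ℚ.+-mono-≤-< (R.0≤+ 0≤K 0≤K) (ℚ.positive⁻¹ 1ℚ) ,
          λ N {x} {y} hx hy → ℚ.≤-trans (Sin-lipschitz N hx hy)
            (R.*-monoˡ (ℚ.0≤∣p∣ (x ℚ.- y)) (R.≤-from {κ ℚ.+ κ} 1ℚ (ℚ.nonNegative⁻¹ 1ℚ) refl))
      ; uniform = λ B 0≤B ε 0<ε → let open T.Bounded B 0≤B in proj₁ (tail-small ε 0<ε) , λ {x} hx m n N≤m N≤n →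
          case-total (λ n → T.Sin n x) {m} {n} (λ n≤m → ℚ.≤-trans (Sin-tail hx n≤m) (proj₂ (tail-small ε 0<ε) n N≤n))
                             (λ m≤n → ℚ.≤-trans (Sin-tail hx m≤n) (proj₂ (tail-small ε 0<ε) m N≤m)) }

  module Limit (F : ℕ → ℚ → ℚ) (F-uniform : LocallyUniform F) where
    open LocallyUniform F-uniform

    abstract
      F-cauchy : ∀ x → IsCauchy (λ n → F n (seq x n))
      F-cauchy x ε 0<ε =
        let B , 0<B , M , hB = bounded x
            L , 0<L , hL = lipschitz B (ℚ.<⇒≤ 0<B)
            δ , 0<δ , Lδ≡ = R.divisor L (½ ℚ.* ε) 0<L (R.0<½* 0<ε)
            N , hN = cauchy x δ 0<δ
            O , hO = uniform B (ℚ.<⇒≤ 0<B) (½ ℚ.* ε) (R.0<½* 0<ε)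
        in M ℕ.⊔ (N ℕ.⊔ O) , λ m n ≤m ≤n →
          let ≥M : ∀ {k} → M ℕ.⊔ (N ℕ.⊔ O) ℕ.≤ k → M ℕ.≤ k
              ≥M = ℕ.≤-trans (ℕ.m≤m⊔n M _)
              ≥N : ∀ {k} → M ℕ.⊔ (N ℕ.⊔ O) ℕ.≤ k → N ℕ.≤ k
              ≥N = ℕ.≤-trans (ℕ.≤-trans (ℕ.m≤m⊔n N O) (ℕ.m≤n⊔m M _))
              ≥O : ∀ {k} → M ℕ.⊔ (N ℕ.⊔ O) ℕ.≤ k → O ℕ.≤ k
              ≥O = ℕ.≤-trans (ℕ.≤-trans (ℕ.m≤n⊔m N O) (ℕ.m≤n⊔m M _))
          in ℚ.≤-trans (R.∣-∣-triangle (F m (seq x m)) (F m (seq x n)) (F n (seq x n)))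
            (ℚ.≤-trans (ℚ.+-mono-≤
              (ℚ.≤-trans (hL m (hB m (≥M ≤m)) (hB n (≥M ≤n)))
                (ℚ.≤-trans (R.*-monoʳ (ℚ.<⇒≤ 0<L) (hN m n (≥N ≤m) (≥N ≤n)))
                  (ℚ.≤-reflexive (≡.trans (ℚ.*-comm δ L) Lδ≡))))
              (hO (hB n (≥M ≤n)) m n (≥O ≤m) (≥O ≤n)))
              (ℚ.≤-reflexive (½+½ ε)))

    lim : ℝ → ℝ
    lim x = mkℝ (λ n → F n (seq x n)) (F-cauchy x)

    abstract
      lim-cong : ∀ {x y} → x ≃ y → lim x ≃ lim y
      lim-cong {x} {y} (mk≃ h) = mk≃ λ ε 0<ε →
        let B , 0<B , M , hB = bounded x
            C , 0<C , M′ , hC = bounded y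
            L , 0<L , hL = lipschitz (B ℚ.+ C) (R.0≤+ (ℚ.<⇒≤ 0<B) (ℚ.<⇒≤ 0<C))
            δ , 0<δ , Lδ≡ = R.divisor L ε 0<L 0<ε
            N , hN = h δ 0<δ
        in N ℕ.⊔ (M ℕ.⊔ M′) , λ n ≤n → ℚ.≤-trans
          (hL n (ℚ.≤-trans (hB n (ℕ.≤-trans (ℕ.≤-trans (ℕ.m≤m⊔n M M′) (ℕ.m≤n⊔m N _)) ≤n)) (R.≤-from {B} C (ℚ.<⇒≤ 0<C) refl))
                (ℚ.≤-trans (hC n (ℕ.≤-trans (ℕ.≤-trans (ℕ.m≤n⊔m M M′) (ℕ.m≤n⊔m N _)) ≤n)) (R.≤-from {C} B (ℚ.<⇒≤ 0<B) (ℚ.+-comm C B))))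
          (ℚ.≤-trans (R.*-monoʳ (ℚ.<⇒≤ 0<L) (hN n (ℕ.≤-trans (ℕ.m≤m⊔n N _) ≤n)))
            (ℚ.≤-reflexive (≡.trans (ℚ.*-comm δ L) Lδ≡)))

      lim-⇝ : ∀ x (f : ℕ → ℝ) → (∀ m n → seq (f m) n ≡ F m (seq x n)) → f ⇝ lim x
      lim-⇝ x f f≡F = mk⇝ λ ε 0<ε →
        let B , 0<B , M , hB = bounded x
            N , hN = uniform B (ℚ.<⇒≤ 0<B) ε 0<ε
        in N , λ k N≤k →
          let close : ∀ n → M ℕ.⊔ N ℕ.≤ n → ∣ seq (f k) n ℚ.- F n (seq x n) ∣ ℚ.≤ ε
              close n ≤n = subst (λ z → ∣ z ℚ.- F n (seq x n) ∣ ℚ.≤ ε) (≡.sym (f≡F k n))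
                (hN (hB n (ℕ.≤-trans (ℕ.m≤m⊔n M N) ≤n)) k n N≤k (ℕ.≤-trans (ℕ.m≤n⊔m M N) ≤n))
          in eventually-≲ (M ℕ.⊔ N) (λ n ≤n → R.≤-from {seq (f k) n} {F n (seq x n) ℚ.+ ε} (ε ℚ.- (seq (f k) n ℚ.- F n (seq x n)))
               (R.≤⇒0≤- (ℚ.≤-trans (R.p≤∣p∣ (seq (f k) n ℚ.- F n (seq x n))) (close n ≤n)))
               (solve 3 (λ a b e → a :+ (e :- (a :- b)) := b :+ e) refl (seq (f k) n) (F n (seq x n)) ε))
           , eventually-≲ (M ℕ.⊔ N) (λ n ≤n → R.≤-from {F n (seq x n)} {seq (f k) n ℚ.+ ε} (ε ℚ.- ℚ.- (seq (f k) n ℚ.- F n (seq x n)))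
               (R.≤⇒0≤- (ℚ.≤-trans (R.-p≤∣p∣ (seq (f k) n ℚ.- F n (seq x n))) (close n ≤n)))
               (solve 3 (λ a b e → b :+ (e :- :- (a :- b)) := a :+ e) refl (seq (f k) n) (F n (seq x n)) ε))

  open Limit T.Cos cos-uniform public using () renaming (lim to cos; lim-cong to cos-cong; lim-⇝ to cos-⇝)
  open Limit T.Sin sin-uniform public using () renaming (lim to sin; lim-⇝ to sin-⇝)

  eᵣ : ℝ → ℕ → ℝ
  eᵣ x zero    = 1ℝ
  eᵣ x (suc k) = x * eᵣ x k * fromℚ (inv (suc k))

  seq-eᵣ : ∀ x k n → seq (eᵣ x k) n ≡ RationalSeries.e (seq x n) k
  seq-eᵣ x zero    n = refl
  seq-eᵣ x (suc k) n = cong (λ z → seq x n ℚ.* z ℚ.* inv (suc k)) (seq-eᵣ x k n)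

  cos-series : ∀ x → series (λ k → fromℚ (T.a k) * eᵣ x k) ⇝ cos x
  cos-series x = cos-⇝ x (series (λ k → fromℚ (T.a k) * eᵣ x k)) λ m n →
    ≡.trans (seq-series m (λ k → fromℚ (T.a k) * eᵣ x k) n) (RationalSeries.∑-cong m (λ k → cong (T.a k ℚ.*_) (seq-eᵣ x k n)))

  sin-series : ∀ x → series (λ k → fromℚ (T.b k) * eᵣ x k) ⇝ sin x
  sin-series x = sin-⇝ x (series (λ k → fromℚ (T.b k) * eᵣ x k)) λ m n →
    ≡.trans (seq-series m (λ k → fromℚ (T.b k) * eᵣ x k) n) (RationalSeries.∑-cong m (λ k → cong (T.b k ℚ.*_) (seq-eᵣ x k n)))

  abstract
    cos-+ : ∀ x y → cos x * cos y - sin x * sin y ≃ cos (x + y)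
    cos-+ x y = mk≃ λ ε 0<ε →
      let B , 0<B , M , hB = bounded x
          C , 0<C , M′ , hC = bounded y
          open T.Bounded (B ℚ.+ C) (R.0≤+ (ℚ.<⇒≤ 0<B) (ℚ.<⇒≤ 0<C))
          N , hN = error-small ε 0<ε
      in N ℕ.⊔ (M ℕ.⊔ M′) , λ n ≤n → ℚ.≤-trans
        (Cos-+ n
          (ℚ.≤-trans (hB n (ℕ.≤-trans (ℕ.≤-trans (ℕ.m≤m⊔n M M′) (ℕ.m≤n⊔m N _)) ≤n)) (R.≤-from {B} C (ℚ.<⇒≤ 0<C) refl))
          (ℚ.≤-trans (hC n (ℕ.≤-trans (ℕ.≤-trans (ℕ.m≤n⊔m M M′) (ℕ.m≤n⊔m N _)) ≤n)) (R.≤-from {C} B (ℚ.<⇒≤ 0<B) (ℚ.+-comm C B))))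
        (hN n (ℕ.≤-trans (ℕ.m≤m⊔n N _) ≤n))

    sin-+ : ∀ x y → cos x * sin y + sin x * cos y ≃ sin (x + y)
    sin-+ x y = mk≃ λ ε 0<ε →
      let B , 0<B , M , hB = bounded x
          C , 0<C , M′ , hC = bounded y
          open T.Bounded (B ℚ.+ C) (R.0≤+ (ℚ.<⇒≤ 0<B) (ℚ.<⇒≤ 0<C))
          N , hN = error-small ε 0<ε
      in N ℕ.⊔ (M ℕ.⊔ M′) , λ n ≤n → ℚ.≤-trans
        (Sin-+ n
          (ℚ.≤-trans (hB n (ℕ.≤-trans (ℕ.≤-trans (ℕ.m≤m⊔n M M′) (ℕ.m≤n⊔m N _)) ≤n)) (R.≤-from {B} C (ℚ.<⇒≤ 0<C) refl))
          (ℚ.≤-trans (hC n (ℕ.≤-trans (ℕ.≤-trans (ℕ.m≤n⊔m M M′) (ℕ.m≤n⊔m N _)) ≤n)) (R.≤-from {C} B (ℚ.<⇒≤ 0<B) (ℚ.+-comm C B))))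
        (hN n (ℕ.≤-trans (ℕ.m≤m⊔n N _) ≤n))

  private
    open RationalSeries using (∑; ∑-cong; ∑-*) renaming (e to E)

    -- Cosine terms are even and sine terms odd. The two facts are proved together because the
    -- recursion for the powers of i interchanges `a` and `b`.
    a-neg : ∀ x k → T.a k ℚ.* E (ℚ.- x) k ≡ T.a k ℚ.* E x k
    b-neg : ∀ x k → T.b k ℚ.* E (ℚ.- x) k ≡ ℚ.- 1ℚ ℚ.* (T.b k ℚ.* E x k)
    a-neg x zero    = refl
    a-neg x (suc k) = ≡.trans
      (solve 4 (λ b x e i → :- b :* (:- x :* e :* i) := x :* i :* (b :* e)) refl (T.b k) x (E (ℚ.- x) k) (inv (suc k)))
      (≡.trans (cong (x ℚ.* inv (suc k) ℚ.*_) (b-neg x k))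
        (solve 4 (λ b x e i → x :* i :* (con (ℚ.- 1ℚ) :* (b :* e)) := :- b :* (x :* e :* i)) refl (T.b k) x (E x k) (inv (suc k))))
    b-neg x zero    = refl
    b-neg x (suc k) = ≡.trans
      (solve 4 (λ a x e i → a :* (:- x :* e :* i) := :- (x :* i) :* (a :* e)) refl (T.a k) x (E (ℚ.- x) k) (inv (suc k)))
      (≡.trans (cong (ℚ.- (x ℚ.* inv (suc k)) ℚ.*_) (a-neg x k))
        (solve 4 (λ a x e i → :- (x :* i) :* (a :* e) := con (ℚ.- 1ℚ) :* (a :* (x :* e :* i))) refl (T.a k) x (E x k) (inv (suc k))))

    w*e-0 : ∀ (w : ℕ → ℚ) N → ∑ N (λ k → w k ℚ.* E 0ℚ (suc k)) ≡ 0ℚ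
    w*e-0 w zero    = refl
    w*e-0 w (suc N) = ≡.trans (cong₂ ℚ._+_ (solve 3 (λ w e i → w :* (con 0ℚ :* e :* i) := con 0ℚ) refl (w 0) (E 0ℚ 0) (inv 1))
      (tail-0 (w ∘ suc) 1 N)) refl
      where
      tail-0 : ∀ (w : ℕ → ℚ) r N → ∑ N (λ k → w k ℚ.* E 0ℚ (suc (r ℕ.+ k))) ≡ 0ℚ
      tail-0 w r zero    = refl
      tail-0 w r (suc N) = ≡.trans (cong₂ ℚ._+_
        (solve 3 (λ w e i → w :* (con 0ℚ :* e :* i) := con 0ℚ) refl (w 0) (E 0ℚ (r ℕ.+ 0)) (inv (suc (r ℕ.+ 0))))
        (≡.trans (∑-cong N (λ k → cong (λ s → w (suc k) ℚ.* E 0ℚ (suc s)) (ℕ.+-suc r k))) (tail-0 (w ∘ suc) (suc r) N))) refl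

  cos-neg : ∀ x → cos (- x) ≃ cos x
  cos-neg x = pointwise λ n → ∑-cong n (a-neg (seq x n))

  sin-neg : ∀ x → sin (- x) ≃ - sin x
  sin-neg x = pointwise λ n → ≡.trans (∑-cong n (b-neg (seq x n)))
    (≡.trans (∑-* n (ℚ.- 1ℚ) (T.sinTerm (seq x n))) (solve 1 (λ s → con (ℚ.- 1ℚ) :* s := :- s) refl (T.Sin n (seq x n))))

  cos-0 : cos 0ℝ ≃ 1ℝ
  cos-0 = mk≃ λ ε 0<ε → 1 , λ { (suc n) _ →
    subst (λ z → ∣ 1ℚ ℚ.* 1ℚ ℚ.+ z ℚ.- 1ℚ ∣ ℚ.≤ ε) (≡.sym (w*e-0 (T.a ∘ suc) n)) (ℚ.<⇒≤ 0<ε) }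

  cos²+sin² : ∀ x → cos x * cos x + sin x * sin x ≃ 1ℝ
  cos²+sin² x = begin
    cos x * cos x + sin x * sin x
      ≈⟨ ℝ-Solver.solve 2 (λ c s → c ℝ-Solver.:* c ℝ-Solver.:+ s ℝ-Solver.:* s
           ℝ-Solver.:= c ℝ-Solver.:* c ℝ-Solver.:- s ℝ-Solver.:* (ℝ-Solver.:- s)) ≃-refl (cos x) (sin x) ⟩
    cos x * cos x - sin x * - sin x
      ≈⟨ +-cong (*-congˡ {cos x} (cos-neg x)) (-‿cong (*-congˡ {sin x} (sin-neg x))) ⟨
    cos x * cos (- x) - sin x * sin (- x)
      ≈⟨ cos-+ x (- x) ⟩
    cos (x - x)
      ≈⟨ cos-cong (ℝ-Ring.-‿inverseʳ x) ⟩
    cos 0ℝ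
      ≈⟨ cos-0 ⟩
    1ℝ ∎
    where open ≃-Reasoning

  arcsine : ∀ s → (∀ k → 0ℚ ℚ.≤ seq s k) → (∀ k → seq s k ℚ.≤ ½ ℚ.+ ½ ℚ.* ½) →
    ∃[ x ] (sin x ≃ s × 0ℝ ≲ x × x ≲ 1ℝ)
  arcsine s 0≤s s≤¾ = mkℝ A.x A.x-cauchy
    , mk≃ A.Sin-x→s
    , mk≲ (λ ε 0<ε → let N , h = A.0≤x 0≤s ε 0<ε in N , λ n N≤n →
        R.≤-from {0ℚ} (A.x n ℚ.- ℚ.- ε) (R.≤⇒0≤- (h n N≤n)) (solve 2 (λ x e → con 0ℚ :+ (x :- :- e) := x :+ e) refl (A.x n) ε))
    , pointwise-≲ (λ n → ℚ.≤-trans (R.p≤∣p∣ (A.x n)) (A.∣x∣≤1 n))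
    where
    module A = RationalArcsine.Arcsine (seq s)
      (λ k → ℚ.≤-trans (ℚ.≤-reflexive (ℚ.0≤p⇒∣p∣≡p (0≤s k))) (s≤¾ k)) (cauchy s)

open RealTrigonometry

open ℝ-Solver using (solve; _:=_; _:+_; _:*_; _:-_; :-_; con)

-- Complex numbers, complex series and the exponential of a matrix with known spectral
-- decomposition.

module Complex where

  infix 4 _≃ᶜ_

  record _≃ᶜ_ (z w : ℂ) : Set where
    constructor mk≃ᶜ
    field
      re≃ : re z ≃ re w
      im≃ : im z ≃ im w
  open _≃ᶜ_ public

  un≃ᶜ : ∀ {z w} → z ≃ᶜ w → z ≈ᶜ w
  un≃ᶜ (mk≃ᶜ h k) = un≃ h , un≃ k

  fromℝ : ℝ → ℂ
  fromℝ x = x +i 0ℝ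

  ℂ-commutativeRing : CommutativeRing 0ℓ 0ℓ
  ℂ-commutativeRing = record
    { Carrier = ℂ ; _≈_ = _≃ᶜ_ ; _+_ = _+ᶜ_ ; _*_ = _*ᶜ_ ; -_ = λ z → (- re z) +i (- im z) ; 0# = 0ᶜ ; 1# = 1ᶜ
    ; isCommutativeRing = record
      { isRing = record
        { +-isAbelianGroup = record
          { isGroup = record
            { isMonoid = record
              { isSemigroup = record
                { isMagma = record
                  { isEquivalence = record
                    { refl = mk≃ᶜ ≃-refl ≃-refl
                    ; sym = λ (mk≃ᶜ h k) → mk≃ᶜ (≃-sym h) (≃-sym k)
                    ; trans = λ (mk≃ᶜ h k) (mk≃ᶜ h′ k′) → mk≃ᶜ (≃-trans h h′) (≃-trans k k′) }
                  ; ∙-cong = λ (mk≃ᶜ h k) (mk≃ᶜ h′ k′) → mk≃ᶜ (+-cong h h′) (+-cong k k′) }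
                ; assoc = λ x y z → mk≃ᶜ (ℝ-Ring.+-assoc (re x) (re y) (re z)) (ℝ-Ring.+-assoc (im x) (im y) (im z)) }
              ; identity = (λ x → mk≃ᶜ (ℝ-Ring.+-identityˡ (re x)) (ℝ-Ring.+-identityˡ (im x)))
                         , (λ x → mk≃ᶜ (ℝ-Ring.+-identityʳ (re x)) (ℝ-Ring.+-identityʳ (im x))) }
            ; inverse = (λ x → mk≃ᶜ (ℝ-Ring.-‿inverseˡ (re x)) (ℝ-Ring.-‿inverseˡ (im x)))
                      , (λ x → mk≃ᶜ (ℝ-Ring.-‿inverseʳ (re x)) (ℝ-Ring.-‿inverseʳ (im x)))
            ; ⁻¹-cong = λ (mk≃ᶜ h k) → mk≃ᶜ (-‿cong h) (-‿cong k) }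
          ; comm = λ x y → mk≃ᶜ (ℝ-Ring.+-comm (re x) (re y)) (ℝ-Ring.+-comm (im x) (im y)) }
        ; *-cong = λ (mk≃ᶜ h k) (mk≃ᶜ h′ k′) → mk≃ᶜ
            (+-cong (*-cong h h′) (-‿cong (*-cong k k′))) (+-cong (*-cong h k′) (*-cong k h′))
        ; *-assoc = λ x y z → mk≃ᶜ
            (solve 6 (λ a b c d e f → (a :* c :- b :* d) :* e :- (a :* d :+ b :* c) :* f
                                   := a :* (c :* e :- d :* f) :- b :* (c :* f :+ d :* e))
              ≃-refl (re x) (im x) (re y) (im y) (re z) (im z))
            (solve 6 (λ a b c d e f → (a :* c :- b :* d) :* f :+ (a :* d :+ b :* c) :* e
                                   := a :* (c :* f :+ d :* e) :+ b :* (c :* e :- d :* f))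
              ≃-refl (re x) (im x) (re y) (im y) (re z) (im z))
        ; *-identity = (λ x → mk≃ᶜ (solve 2 (λ a b → con 1ℚ :* a :- con 0ℚ :* b := a) ≃-refl (re x) (im x))
                                   (solve 2 (λ a b → con 1ℚ :* b :+ con 0ℚ :* a := b) ≃-refl (re x) (im x)))
                     , (λ x → mk≃ᶜ (solve 2 (λ a b → a :* con 1ℚ :- b :* con 0ℚ := a) ≃-refl (re x) (im x))
                                   (solve 2 (λ a b → a :* con 0ℚ :+ b :* con 1ℚ := b) ≃-refl (re x) (im x)))
        ; distrib = (λ x y z → mk≃ᶜ
            (solve 6 (λ a b c d e f → a :* (c :+ e) :- b :* (d :+ f) := (a :* c :- b :* d) :+ (a :* e :- b :* f))
              ≃-refl (re x) (im x) (re y) (im y) (re z) (im z))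
            (solve 6 (λ a b c d e f → a :* (d :+ f) :+ b :* (c :+ e) := (a :* d :+ b :* c) :+ (a :* f :+ b :* e))
              ≃-refl (re x) (im x) (re y) (im y) (re z) (im z)))
          , (λ x y z → mk≃ᶜ
            (solve 6 (λ a b c d e f → (c :+ e) :* a :- (d :+ f) :* b := (c :* a :- d :* b) :+ (e :* a :- f :* b))
              ≃-refl (re x) (im x) (re y) (im y) (re z) (im z))
            (solve 6 (λ a b c d e f → (c :+ e) :* b :+ (d :+ f) :* a := (c :* b :+ d :* a) :+ (e :* b :+ f :* a))
              ≃-refl (re x) (im x) (re y) (im y) (re z) (im z))) }
      ; *-comm = λ x y → mk≃ᶜ
          (solve 4 (λ a b c d → a :* c :- b :* d := c :* a :- d :* b) ≃-refl (re x) (im x) (re y) (im y))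
          (solve 4 (λ a b c d → a :* d :+ b :* c := c :* b :+ d :* a) ≃-refl (re x) (im x) (re y) (im y)) } }

  module ℂ-Ring = CommutativeRing ℂ-commutativeRing
  open ℂ-Ring public using () renaming
    (refl to ≃ᶜ-refl; sym to ≃ᶜ-sym; trans to ≃ᶜ-trans; +-cong to +ᶜ-cong; *-cong to *ᶜ-cong)
  module ℂ-* = CommutativeSemigroupProperties ℂ-Ring.*-commutativeSemigroup
  module ≃ᶜ-Reasoning = SetoidReasoning ℂ-Ring.setoid
  module ℂ-Sum where
    open MonoidSum ℂ-Ring.+-commutativeMonoid public using (∑-distrib-+; ∑-comm; sum-cong-≋)
    open SemiringSum ℂ-Ring.semiring public using (*-distribˡ-sum; *-distribʳ-sum)

  *ᶜ-congˡ : ∀ x {y z} → y ≃ᶜ z → x *ᶜ y ≃ᶜ x *ᶜ z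
  *ᶜ-congˡ x h = *ᶜ-cong (≃ᶜ-refl {x}) h

  *ᶜ-congʳ : ∀ x {y z} → y ≃ᶜ z → y *ᶜ x ≃ᶜ z *ᶜ x
  *ᶜ-congʳ x h = *ᶜ-cong h (≃ᶜ-refl {x})

  fromℝ-cong : ∀ {x y} → x ≃ y → fromℝ x ≃ᶜ fromℝ y
  fromℝ-cong h = mk≃ᶜ h ≃-refl

  ·≃ : ∀ r z → r · z ≃ᶜ fromℝ r *ᶜ z
  ·≃ r z = mk≃ᶜ (solve 3 (λ r a b → r :* a := r :* a :- con 0ℚ :* b) ≃-refl r (re z) (im z))
                (solve 3 (λ r a b → r :* b := r :* b :+ con 0ℚ :* a) ≃-refl r (re z) (im z))

  private
    ℚ⟶ℂ : ℚ.+-*-rawRing ACR.-Raw-AlmostCommutative⟶ ACR.fromCommutativeRing ℂ-commutativeRing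
    ℚ⟶ℂ = record { ⟦_⟧ = λ q → fromℝ (fromℚ q)
      ; +-homo = λ p q → mk≃ᶜ (pointwise λ n → refl) (pointwise λ n → refl)
      ; *-homo = λ p q → mk≃ᶜ
          (≃-trans (pointwise {y = fromℚ p * fromℚ q} λ n → refl)
            (solve 2 (λ p q → p :* q := p :* q :- con 0ℚ :* con 0ℚ) ≃-refl (fromℚ p) (fromℚ q)))
          (solve 2 (λ p q → con 0ℚ := p :* con 0ℚ :+ con 0ℚ :* q) ≃-refl (fromℚ p) (fromℚ q))
      ; -‿homo = λ p → mk≃ᶜ (pointwise λ n → refl) (pointwise λ n → refl)
      ; 0-homo = ≃ᶜ-refl ; 1-homo = ≃ᶜ-refl }

  module ℂ-Identities = RingIdentities ℂ-commutativeRing ℚ⟶ℂ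

  normSq-cong : ∀ {z w} → z ≃ᶜ w → normSq z ≃ normSq w
  normSq-cong (mk≃ᶜ h k) = +-cong (*-cong h h) (*-cong k k)

  normSq-* : ∀ z w → normSq (z *ᶜ w) ≃ normSq z * normSq w
  normSq-* z w = solve 4 (λ a b c d →
      (a :* c :- b :* d) :* (a :* c :- b :* d) :+ (a :* d :+ b :* c) :* (a :* d :+ b :* c)
      := (a :* a :+ b :* b) :* (c :* c :+ d :* d)) ≃-refl (re z) (im z) (re w) (im w)

  normSq-fromℝ : ∀ x → normSq (fromℝ x) ≃ x * x
  normSq-fromℝ = solve 1 (λ x → x :* x :+ con 0ℚ :* con 0ℚ := x :* x) ≃-refl

  0≲normSq : ∀ z → 0ℝ ≲ normSq z
  0≲normSq z = 0≲+ (0≲sq (re z)) (0≲sq (im z))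

  cis : ℝ → ℂ
  cis x = cos x +i sin x

  normSq-cis : ∀ x → normSq (cis x) ≃ 1ℝ
  normSq-cis = cos²+sin²

  cis-+ : ∀ x y → cis x *ᶜ cis y ≃ᶜ cis (x + y)
  cis-+ x y = mk≃ᶜ (cos-+ x y) (sin-+ x y)

  cis-neg : ∀ x → cis (- x) ≃ᶜ conj (cis x)
  cis-neg x = mk≃ᶜ (cos-neg x) (sin-neg x)

  re-sum : ∀ {n} (f : Fin n → ℂ) → re (sumᶜ f) ≡ sum (λ k → re (f k))
  re-sum {zero}  f = refl
  re-sum {suc n} f = cong (re (f zero) +_) (re-sum (f ∘ suc))

  im-sum : ∀ {n} (f : Fin n → ℂ) → im (sumᶜ f) ≡ sum (λ k → im (f k))
  im-sum {zero}  f = refl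
  im-sum {suc n} f = cong (im (f zero) +_) (im-sum (f ∘ suc))

  record _sumsTo_ (f : ℕ → ℂ) (s : ℂ) : Set where
    constructor mkSum
    field
      re⇝ : series (λ k → re (f k)) ⇝ re s
      im⇝ : series (λ k → im (f k)) ⇝ im s

  sumsTo⇒ : ∀ {f s} → f sumsTo s → IsSeriesSumᶜ f s
  sumsTo⇒ (mkSum h k) = ⇝⇒⟶ h , ⇝⇒⟶ k

  series-cong : ∀ {f g : ℕ → ℝ} → (∀ k → f k ≃ g k) → ∀ m → series f m ≃ series g m
  series-cong h m = ℝ-Sum.sum-cong-≋ {m} (λ k → h (toℕ k))

  series-+ : ∀ (f g : ℕ → ℝ) m → series (λ k → f k + g k) m ≃ series f m + series g m
  series-+ f g m = ℝ-Sum.∑-distrib-+ {m} (λ k → f (toℕ k)) (λ k → g (toℕ k))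

  series-* : ∀ c (f : ℕ → ℝ) m → series (λ k → c * f k) m ≃ c * series f m
  series-* c f m = ≃-sym (ℝ-Sum.*-distribˡ-sum {m} c (λ k → f (toℕ k)))

  sumsTo-cong : ∀ {f g s t} → (∀ k → f k ≃ᶜ g k) → s ≃ᶜ t → f sumsTo s → g sumsTo t
  sumsTo-cong h (mk≃ᶜ p q) (mkSum a b) = mkSum
    (⇝-cong (series-cong (λ k → re≃ (h k))) p a) (⇝-cong (series-cong (λ k → im≃ (h k))) q b)

  sumsTo-+ : ∀ {f g s t} → f sumsTo s → g sumsTo t → (λ k → f k +ᶜ g k) sumsTo (s +ᶜ t)
  sumsTo-+ {f} {g} (mkSum a b) (mkSum c d) = mkSum
    (⇝-cong (λ m → ≃-sym (series-+ (re ∘ f) (re ∘ g) m)) ≃-refl (⇝-+ a c))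
    (⇝-cong (λ m → ≃-sym (series-+ (im ∘ f) (im ∘ g) m)) ≃-refl (⇝-+ b d))

  private
    ⇝-linear : ∀ {f g : ℕ → ℝ} {l m} c d → series f ⇝ l → series g ⇝ m →
      series (λ k → c * f k + d * g k) ⇝ c * l + d * m
    ⇝-linear {f} {g} c d h k = ⇝-cong
      (λ n → ≃-trans (+-cong (≃-sym (series-* c f n)) (≃-sym (series-* d g n)))
                     (≃-sym (series-+ (λ k → c * f k) (λ k → d * g k) n))) ≃-refl
      (⇝-+ (⇝-* c h) (⇝-* d k))

  sumsTo-* : ∀ {f s} w → f sumsTo s → (λ k → f k *ᶜ w) sumsTo (s *ᶜ w)
  sumsTo-* {f} {s} w (mkSum a b) = mkSum
    (⇝-cong (series-cong (λ k → lem₁ (re (f k)) (im (f k)) (re w) (im w))) (lem₁ (re s) (im s) (re w) (im w))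
      (⇝-linear {re ∘ f} {im ∘ f} (re w) (- im w) a b))
    (⇝-cong (series-cong (λ k → lem₂ (re (f k)) (im (f k)) (re w) (im w))) (lem₂ (re s) (im s) (re w) (im w))
      (⇝-linear {re ∘ f} {im ∘ f} (im w) (re w) a b))
    where
    lem₁ : ∀ a b c d → c * a + - d * b ≃ a * c - b * d
    lem₁ = solve 4 (λ a b c d → c :* a :+ (:- d) :* b := a :* c :- b :* d) ≃-refl
    lem₂ : ∀ a b c d → d * a + c * b ≃ a * d + b * c
    lem₂ = solve 4 (λ a b c d → d :* a :+ c :* b := a :* d :+ b :* c) ≃-refl

  sumsTo-sum : ∀ r {f : Fin r → ℕ → ℂ} {s : Fin r → ℂ} → (∀ j → f j sumsTo s j) →
    (λ k → sumᶜ (λ j → f j k)) sumsTo sumᶜ s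
  sumsTo-sum zero    h = mkSum zeros zeros
    where
    zeros : series (λ _ → 0ℝ) ⇝ 0ℝ
    -- The zero series is obtained as 0 times the cosine series at 0, which is already known to
    -- converge.
    zeros = ⇝-cong (λ m → ≃-trans (ℝ-Ring.zeroˡ _) (≃-trans (≃-sym (ℝ-Ring.zeroˡ (series (λ _ → 0ℝ) m)))
              (≃-sym (≃-trans (series-cong {λ _ → 0ℝ} {λ _ → 0ℝ * 0ℝ} (λ _ → ≃-sym (ℝ-Ring.zeroˡ 0ℝ)) m) (series-* 0ℝ (λ _ → 0ℝ) m)))))
              (ℝ-Ring.zeroˡ (cos 0ℝ)) (⇝-* 0ℝ (cos-series 0ℝ))
  sumsTo-sum (suc r) h = sumsTo-+ (h zero) (sumsTo-sum r (h ∘ suc))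

  infixr 8 _^ᶜ_
  _^ᶜ_ : ℂ → ℕ → ℂ
  z ^ᶜ zero  = 1ᶜ
  z ^ᶜ suc k = z *ᶜ z ^ᶜ k

  recip≃ : ∀ n .{{_ : NonZero n}} → recip n ≃ fromℚ (inv n)
  recip≃ n = pointwise λ _ → ≡.sym (Rational.inv≡ n)

  private
    module T = RationalTrigonometry

    cisTerm : ℝ → ℕ → ℂ
    cisTerm x k = (fromℚ (T.a k) * eᵣ x k) +i (fromℚ (T.b k) * eᵣ x k)

    -- Multiplying by iκ/(k + 1) turns one term of the exponential series into the next, and
    -- multiplication by i takes (a, b) to (-b, a), which is the recursion that defines these
    -- weights.
    power-term : ∀ κ k → fromℝ (recip (k !) {{k ℕ.!≢0}}) *ᶜ (0ℝ +i κ) ^ᶜ k ≃ᶜ cisTerm κ k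
    power-term κ zero = mk≃ᶜ
      (≃-trans (solve 2 (λ r s → r :* con 1ℚ :- con 0ℚ :* con 0ℚ := r) ≃-refl (recip 1) (recip 1)) (≃-sym (ℝ-Ring.*-identityʳ 1ℝ)))
      (solve 1 (λ r → r :* con 0ℚ :+ con 0ℚ :* con 1ℚ := con 0ℚ :* con 1ℚ) ≃-refl (recip 1))
    power-term κ (suc k) = begin
      fromℝ (recip (suc k !) {{suc k ℕ.!≢0}}) *ᶜ (z *ᶜ z ^ᶜ k)
        ≈⟨ *ᶜ-congʳ (z *ᶜ z ^ᶜ k) (fromℝ-cong recip-suc) ⟩
      fromℝ (r * recip (k !) {{k ℕ.!≢0}}) *ᶜ (z *ᶜ z ^ᶜ k)
        ≈⟨ *ᶜ-congʳ (z *ᶜ z ^ᶜ k) (mk≃ᶜ (solve 2 (λ r s → r :* s := r :* s :- con 0ℚ :* con 0ℚ) ≃-refl r (recip (k !) {{k ℕ.!≢0}}))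
             (solve 2 (λ r s → con 0ℚ := r :* con 0ℚ :+ con 0ℚ :* s) ≃-refl r (recip (k !) {{k ℕ.!≢0}}))) ⟩
      (fromℝ r *ᶜ fromℝ (recip (k !) {{k ℕ.!≢0}})) *ᶜ (z *ᶜ z ^ᶜ k)
        ≈⟨ ℂ-*.interchange (fromℝ r) (fromℝ (recip (k !) {{k ℕ.!≢0}})) z (z ^ᶜ k) ⟩
      (fromℝ r *ᶜ z) *ᶜ (fromℝ (recip (k !) {{k ℕ.!≢0}}) *ᶜ z ^ᶜ k)
        ≈⟨ *ᶜ-congˡ (fromℝ r *ᶜ z) (power-term κ k) ⟩
      (fromℝ r *ᶜ z) *ᶜ cisTerm κ k
        ≈⟨ mk≃ᶜ
             (≃-trans (solve 5 (λ r x a b e → (r :* con 0ℚ :- con 0ℚ :* x) :* (a :* e) :- (r :* x :+ con 0ℚ :* con 0ℚ) :* (b :* e)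
                 := (:- b) :* (x :* e :* r)) ≃-refl r κ (fromℚ (T.a k)) (fromℚ (T.b k)) (eᵣ κ k))
               (*-cong {x = - fromℚ (T.b k)} {x′ = fromℚ (ℚ.- T.b k)} (pointwise λ _ → refl) (≃-refl {κ * eᵣ κ k * r})))
             (solve 5 (λ r x a b e → (r :* con 0ℚ :- con 0ℚ :* x) :* (b :* e) :+ (r :* x :+ con 0ℚ :* con 0ℚ) :* (a :* e)
                 := a :* (x :* e :* r)) ≃-refl r κ (fromℚ (T.a k)) (fromℚ (T.b k)) (eᵣ κ k)) ⟩
      cisTerm κ (suc k) ∎
      where
      open ≃ᶜ-Reasoning
      z : ℂ
      z = 0ℝ +i κ
      r : ℝ
      r = fromℚ (inv (suc k))
      recip-suc : recip (suc k !) {{suc k ℕ.!≢0}} ≃ r * recip (k !) {{k ℕ.!≢0}}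
      recip-suc = pointwise λ _ → ≡.trans (≡.sym (Rational.inv≡ (suc k !) {{suc k ℕ.!≢0}}))
        (≡.trans (Rational.inv*inv (suc k) (k !) {{_}} {{k ℕ.!≢0}} {{suc k ℕ.!≢0}})
          (cong (inv (suc k) ℚ.*_) (Rational.inv≡ (k !) {{k ℕ.!≢0}})))

    cis-sumsTo : ∀ κ → cisTerm κ sumsTo cis κ
    cis-sumsTo κ = mkSum (cos-series κ) (sin-series κ)

  sumᶜ-cong : ∀ {n} {f g : Fin n → ℂ} → (∀ k → f k ≃ᶜ g k) → sumᶜ f ≃ᶜ sumᶜ g
  sumᶜ-cong = ℂ-Sum.sum-cong-≋

  module _ {N r} (M : Matrix N) (κ : Fin r → ℝ) (E : Fin r → Matrix N)
    (resolution : ∀ a b → sumᶜ (λ j → E j a b) ≃ᶜ idᴹ a b)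
    (eigen : ∀ j a b → (M *ᴹ E j) a b ≃ᶜ (0ℝ +i κ j) *ᶜ E j a b) where

    private
      power : ∀ k a b → (M ^ᴹ k) a b ≃ᶜ sumᶜ (λ j → (0ℝ +i κ j) ^ᶜ k *ᶜ E j a b)
      power zero    a b = ≃ᶜ-trans (≃ᶜ-sym (resolution a b)) (sumᶜ-cong λ j → ≃ᶜ-sym (ℂ-Ring.*-identityˡ (E j a b)))
      power (suc k) a b = begin
        sumᶜ (λ c → M a c *ᶜ (M ^ᴹ k) c b)
          ≈⟨ sumᶜ-cong (λ c → *ᶜ-congˡ (M a c) (power k c b)) ⟩
        sumᶜ (λ c → M a c *ᶜ sumᶜ (λ j → (0ℝ +i κ j) ^ᶜ k *ᶜ E j c b))
          ≈⟨ sumᶜ-cong (λ c → ℂ-Sum.*-distribˡ-sum (M a c) (λ j → (0ℝ +i κ j) ^ᶜ k *ᶜ E j c b)) ⟩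
        sumᶜ (λ c → sumᶜ (λ j → M a c *ᶜ ((0ℝ +i κ j) ^ᶜ k *ᶜ E j c b)))
          ≈⟨ ℂ-Sum.∑-comm (λ c j → M a c *ᶜ ((0ℝ +i κ j) ^ᶜ k *ᶜ E j c b)) ⟩
        sumᶜ (λ j → sumᶜ (λ c → M a c *ᶜ ((0ℝ +i κ j) ^ᶜ k *ᶜ E j c b)))
          ≈⟨ sumᶜ-cong (λ j → ≃ᶜ-trans
               (sumᶜ-cong λ c → ℂ-*.x∙yz≈y∙xz (M a c) ((0ℝ +i κ j) ^ᶜ k) (E j c b))
               (≃ᶜ-sym (ℂ-Sum.*-distribˡ-sum ((0ℝ +i κ j) ^ᶜ k) (λ c → M a c *ᶜ E j c b)))) ⟩
        sumᶜ (λ j → (0ℝ +i κ j) ^ᶜ k *ᶜ (M *ᴹ E j) a b)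
          ≈⟨ sumᶜ-cong (λ j → *ᶜ-congˡ ((0ℝ +i κ j) ^ᶜ k) (eigen j a b)) ⟩
        sumᶜ (λ j → (0ℝ +i κ j) ^ᶜ k *ᶜ ((0ℝ +i κ j) *ᶜ E j a b))
          ≈⟨ sumᶜ-cong (λ j → ℂ-*.x∙yz≈yx∙z ((0ℝ +i κ j) ^ᶜ k) (0ℝ +i κ j) (E j a b)) ⟩
        sumᶜ (λ j → (0ℝ +i κ j) ^ᶜ suc k *ᶜ E j a b) ∎
        where open ≃ᶜ-Reasoning

    -- From ∑ E_j = 1 and M E_j = i κ_j E_j, induction gives M^k = ∑ (i κ_j)^k E_j. Each entry of
    -- the exponential series is thus a finite combination of scalar series that sum to `cis (κ j)`.
    spectral-exponential : IsExp M (λ a b → sumᶜ (λ j → cis (κ j) *ᶜ E j a b))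
    spectral-exponential a b = sumsTo⇒ (sumsTo-cong (λ k → ≃ᶜ-sym (term k)) ≃ᶜ-refl
      (sumsTo-sum r (λ j → sumsTo-* (E j a b) (cis-sumsTo (κ j)))))
      where
      term : ∀ k → recip (k !) {{k ℕ.!≢0}} · (M ^ᴹ k) a b ≃ᶜ sumᶜ (λ j → cisTerm (κ j) k *ᶜ E j a b)
      term k = begin
        ρ · (M ^ᴹ k) a b
          ≈⟨ ·≃ ρ ((M ^ᴹ k) a b) ⟩
        fromℝ ρ *ᶜ (M ^ᴹ k) a b
          ≈⟨ *ᶜ-congˡ (fromℝ ρ) (power k a b) ⟩
        fromℝ ρ *ᶜ sumᶜ (λ j → (0ℝ +i κ j) ^ᶜ k *ᶜ E j a b)
          ≈⟨ ℂ-Sum.*-distribˡ-sum (fromℝ ρ) (λ j → (0ℝ +i κ j) ^ᶜ k *ᶜ E j a b) ⟩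
        sumᶜ (λ j → fromℝ ρ *ᶜ ((0ℝ +i κ j) ^ᶜ k *ᶜ E j a b))
          ≈⟨ sumᶜ-cong (λ j → ≃ᶜ-trans (≃ᶜ-sym (ℂ-Ring.*-assoc (fromℝ ρ) ((0ℝ +i κ j) ^ᶜ k) (E j a b)))
               (*ᶜ-congʳ (E j a b) (power-term (κ j) k))) ⟩
        sumᶜ (λ j → cisTerm (κ j) k *ᶜ E j a b) ∎
        where
        open ≃ᶜ-Reasoning
        ρ : ℝ
        ρ = recip (k !) {{k ℕ.!≢0}}

open Complex

module ComplexSums where
  open ℂ-Identities

  fromℚᶜ : ℚ → ℂ
  fromℚᶜ q = fromℝ (fromℚ q)

  conj-* : ∀ z w → conj (z *ᶜ w) ≃ᶜ conj z *ᶜ conj w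
  conj-* z w = mk≃ᶜ
    (solve 4 (λ a b c d → a :* c :- b :* d
       := a :* c :- (:- b) :* (:- d)) ≃-refl (re z) (im z) (re w) (im w))
    (solve 4 (λ a b c d → :- (a :* d :+ b :* c)
       := a :* (:- d) :+ (:- b) :* c) ≃-refl (re z) (im z) (re w) (im w))

  conj-cong : ∀ {z w} → z ≃ᶜ w → conj z ≃ᶜ conj w
  conj-cong (mk≃ᶜ h k) = mk≃ᶜ h (-‿cong k)

  z*conj : ∀ z → z *ᶜ conj z ≃ᶜ fromℝ (normSq z)
  z*conj z = mk≃ᶜ
    (solve 2 (λ a b → a :* a :- b :* (:- b)
       := a :* a :+ b :* b) ≃-refl (re z) (im z))
    (solve 2 (λ a b → a :* (:- b) :+ b :* a
       := con 0ℚ) ≃-refl (re z) (im z))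

  sumᶜ-conj : ∀ {n} (f : Fin n → ℂ) → sumᶜ (λ k → conj (f k)) ≃ᶜ conj (sumᶜ f)
  sumᶜ-conj {zero}  f = mk≃ᶜ ≃-refl (solve 0 (con 0ℚ := :- con 0ℚ) ≃-refl)
  sumᶜ-conj {suc n} f = ≃ᶜ-trans (+ᶜ-cong (≃ᶜ-refl {conj (f zero)}) (sumᶜ-conj (f ∘ suc)))
    (mk≃ᶜ ≃-refl (solve 2 (λ a b → (:- a) :+ (:- b) := :- (a :+ b))
      ≃-refl (im (f zero)) (im (sumᶜ (f ∘ suc)))))

  fromℚᶜ-cong : ∀ {p q} → p ≡ q → fromℚᶜ p ≃ᶜ fromℚᶜ q
  fromℚᶜ-cong refl = ≃ᶜ-refl

  fromℚᶜ-+ : ∀ p q → fromℚᶜ (p ℚ.+ q) ≃ᶜ fromℚᶜ p +ᶜ fromℚᶜ q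
  fromℚᶜ-+ p q = mk≃ᶜ (pointwise λ _ → refl) (pointwise λ _ → refl)

  fromℝ-* : ∀ x y → fromℝ (x * y) ≃ᶜ fromℝ x *ᶜ fromℝ y
  fromℝ-* x y = mk≃ᶜ
    (solve 2 (λ x y → x :* y := x :* y :- con 0ℚ :* con 0ℚ) ≃-refl x y)
    (solve 2 (λ x y → con 0ℚ := x :* con 0ℚ :+ con 0ℚ :* y) ≃-refl x y)

  sumᶜ-const : ∀ n w → sumᶜ {n} (λ _ → w) ≃ᶜ fromℚᶜ (ι n) *ᶜ w
  sumᶜ-const zero    w = ≃ᶜ-sym (≃ᶜ-trans (*ᶜ-congʳ w (fromℚᶜ-cong Rational.ι-0)) (ℂ-Ring.zeroˡ w))
  sumᶜ-const (suc n) w = ≃ᶜ-trans (+ᶜ-cong (≃ᶜ-refl {w}) (sumᶜ-const n w))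
    (≃ᶜ-trans (suc-lemma w (fromℚᶜ (ι n)))
      (*ᶜ-congʳ w (≃ᶜ-trans (≃ᶜ-sym (fromℚᶜ-+ 1ℚ (ι n))) (fromℚᶜ-cong (≡.sym (Rational.ι-suc n))))))

  sumᶜ-zero : ∀ {n} (f : Fin n → ℂ) → (∀ k → f k ≃ᶜ 0ᶜ) → sumᶜ f ≃ᶜ 0ᶜ
  sumᶜ-zero {zero}  f h = ≃ᶜ-refl
  sumᶜ-zero {suc n} f h = ≃ᶜ-trans (+ᶜ-cong (h zero) (sumᶜ-zero (f ∘ suc) (h ∘ suc))) (ℂ-Ring.+-identityˡ 0ᶜ)

  sumᶜ-e : ∀ {n} (u : Fin n) (f : Fin n → ℂ) → sumᶜ (λ k → e u k *ᶜ f k) ≃ᶜ f u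
  sumᶜ-e zero    f = ≃ᶜ-trans (+ᶜ-cong (ℂ-Ring.*-identityˡ (f zero)) (sumᶜ-zero (λ k → 0ᶜ *ᶜ f (suc k)) (λ k → ℂ-Ring.zeroˡ (f (suc k)))))
                       (ℂ-Ring.+-identityʳ (f zero))
  sumᶜ-e (suc u) f = ≃ᶜ-trans (+ᶜ-cong (ℂ-Ring.zeroˡ (f zero)) (sumᶜ-e u (f ∘ suc))) (ℂ-Ring.+-identityˡ (f (suc u)))

  sumᶜ-+ : ∀ {n} (f g : Fin n → ℂ) → sumᶜ (λ k → f k +ᶜ g k) ≃ᶜ sumᶜ f +ᶜ sumᶜ g
  sumᶜ-+ = ℂ-Sum.∑-distrib-+

  sumᶜ-*ˡ : ∀ {n} w (f : Fin n → ℂ) → sumᶜ (λ k → w *ᶜ f k) ≃ᶜ w *ᶜ sumᶜ f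
  sumᶜ-*ˡ w f = ≃ᶜ-sym (ℂ-Sum.*-distribˡ-sum w f)

  sumᶜ-*ʳ : ∀ {n} w (f : Fin n → ℂ) → sumᶜ (λ k → f k *ᶜ w) ≃ᶜ sumᶜ f *ᶜ w
  sumᶜ-*ʳ w f = ≃ᶜ-sym (ℂ-Sum.*-distribʳ-sum w f)

open ComplexSums

-- The signed adjacency matrix and its action on the span of `e₀`, 1, `v` and a further vector.

module Signing (m : ℕ) (v : Fin m → ℂ) (∣v∣≡1 : ∀ k → normSq (v k) ≃ 1ℝ) (∑v≡0 : sumᶜ v ≃ᶜ 0ᶜ) where
  open ℂ-Identities

  private
    σ₀ : Fin (suc m) → Fin (suc m) → ℂ
    σ₀ zero    _       = 1ᶜ
    σ₀ (suc j) zero    = 1ᶜ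
    σ₀ (suc j) (suc k) = v j *ᶜ conj (v k)

    0≤1 : 0ℝ ≲ 1ℝ
    0≤1 = fromℚ-mono (ℚ.nonNegative⁻¹ 1ℚ)

    modulus1 : ∀ z → normSq z ≃ 1ℝ → HasModulus1 z
    modulus1 z h = un≲ 0≤1 , un≃ (≃-trans (ℝ-Ring.*-identityˡ 1ℝ) (≃-sym h))

    normSq-conj : ∀ z → normSq (conj z) ≃ normSq z
    normSq-conj z = solve 2 (λ a b → a :* a :+ (:- b) :* (:- b)
      := a :* a :+ b :* b) ≃-refl (re z) (im z)

    normSq-1 : normSq 1ᶜ ≃ 1ℝ
    normSq-1 = ≃-trans (normSq-fromℝ 1ℝ) (ℝ-Ring.*-identityˡ 1ℝ)

    unitary₀ : ∀ a b → normSq (σ₀ a b) ≃ 1ℝ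
    unitary₀ zero    _       = normSq-1
    unitary₀ (suc j) zero    = normSq-1
    unitary₀ (suc j) (suc k) = ≃-trans (normSq-* (v j) (conj (v k)))
      (≃-trans (*-cong (∣v∣≡1 j) (≃-trans (normSq-conj (v k)) (∣v∣≡1 k))) (ℝ-Ring.*-identityˡ 1ℝ))

    conj-1 : 1ᶜ ≃ᶜ conj 1ᶜ
    conj-1 = mk≃ᶜ ≃-refl (solve 0 (con 0ℚ := :- con 0ℚ) ≃-refl)

    conj-conj : ∀ z → conj (conj z) ≃ᶜ z
    conj-conj z = mk≃ᶜ ≃-refl (solve 1 (λ a → :- (:- a) := a) ≃-refl (im z))

    hermitian₀ : ∀ a b → σ₀ b a ≃ᶜ conj (σ₀ a b)
    hermitian₀ zero    zero    = conj-1
    hermitian₀ zero    (suc k) = conj-1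
    hermitian₀ (suc j) zero    = conj-1
    hermitian₀ (suc j) (suc k) = ≃ᶜ-trans (ℂ-Ring.*-comm (v k) (conj (v j)))
      (≃ᶜ-trans (*ᶜ-congˡ (conj (v j)) (≃ᶜ-sym (conj-conj (v k)))) (≃ᶜ-sym (conj-* (v j) (conj (v k)))))

  signing : UnitarySigning (K (suc m))
  signing = record
    { σ = σ₀
    ; unitary = λ {a} {b} _ → modulus1 (σ₀ a b) (unitary₀ a b)
    ; hermitian = λ {a} {b} _ → un≃ᶜ (hermitian₀ a b)
    }

  A : Matrix (suc m)
  A = signedAdjacency signing

  abstract
    -- On the diagonal both sides vanish because |v j| = 1. Away from vertex 0 the matrix is
    -- therefore v v* - I, a rank-one perturbation of a scalar.
    A-entry : ∀ j k → A (suc j) (suc k) ≃ᶜ v j *ᶜ conj (v k) -ᶜ e j k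
    A-entry j k with j Fin.≟ k
    ... | yes refl = ≃ᶜ-sym (≃ᶜ-trans (+ᶜ-cong (≃ᶜ-trans (z*conj (v j)) (fromℝ-cong (∣v∣≡1 j))) ≃ᶜ-refl)
                       (mk≃ᶜ (ℝ-Ring.-‿inverseʳ 1ℝ) (ℝ-Ring.-‿inverseʳ 0ℝ)))
    ... | no _     = ≃ᶜ-sym (mk≃ᶜ (solve 1 (λ x → x :- con 0ℚ := x) ≃-refl (re (v j *ᶜ conj (v k))))
                                  (solve 1 (λ x → x :- con 0ℚ := x) ≃-refl (im (v j *ᶜ conj (v k)))))

  module _ (p x y z : ℂ) (d : Fin m → ℂ) where
    -- p e₀ + x 1 + y v + z d, where 1, v and d live on the vertices other than 0.
    combination : Fin (suc m) → ℂ
    combination zero    = p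
    combination (suc k) = x +ᶜ (y *ᶜ v k +ᶜ z *ᶜ d k)

    private
      ∑1 : sumᶜ (λ k → combination (suc k)) ≃ᶜ fromℚᶜ (ι m) *ᶜ x +ᶜ z *ᶜ sumᶜ d
      ∑1 = begin
        sumᶜ (λ k → x +ᶜ (y *ᶜ v k +ᶜ z *ᶜ d k))
          ≈⟨ sumᶜ-+ (λ _ → x) (λ k → y *ᶜ v k +ᶜ z *ᶜ d k) ⟩
        sumᶜ {m} (λ _ → x) +ᶜ sumᶜ (λ k → y *ᶜ v k +ᶜ z *ᶜ d k)
          ≈⟨ +ᶜ-cong (sumᶜ-const m x) (≃ᶜ-trans (sumᶜ-+ (λ k → y *ᶜ v k) (λ k → z *ᶜ d k))
               (+ᶜ-cong (≃ᶜ-trans (sumᶜ-*ˡ y v) (≃ᶜ-trans (*ᶜ-congˡ y ∑v≡0) (ℂ-Ring.zeroʳ y))) (sumᶜ-*ˡ z d))) ⟩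
        fromℚᶜ (ι m) *ᶜ x +ᶜ (0ᶜ +ᶜ z *ᶜ sumᶜ d)
          ≈⟨ +ᶜ-cong ≃ᶜ-refl (ℂ-Ring.+-identityˡ (z *ᶜ sumᶜ d)) ⟩
        fromℚᶜ (ι m) *ᶜ x +ᶜ z *ᶜ sumᶜ d ∎
        where open ≃ᶜ-Reasoning

      ∑v̄ : sumᶜ (λ k → conj (v k) *ᶜ combination (suc k)) ≃ᶜ y *ᶜ fromℚᶜ (ι m) +ᶜ z *ᶜ sumᶜ (λ k → conj (v k) *ᶜ d k)
      ∑v̄ = begin
        sumᶜ (λ k → conj (v k) *ᶜ (x +ᶜ (y *ᶜ v k +ᶜ z *ᶜ d k)))
          ≈⟨ sumᶜ-cong (λ k → distribute (conj (v k)) x y (v k) z (d k)) ⟩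
        sumᶜ (λ k → conj (v k) *ᶜ x +ᶜ (y *ᶜ (v k *ᶜ conj (v k)) +ᶜ z *ᶜ (conj (v k) *ᶜ d k)))
          ≈⟨ ≃ᶜ-trans (sumᶜ-+ (λ k → conj (v k) *ᶜ x) _) (+ᶜ-cong (sumᶜ-*ʳ x (λ k → conj (v k)))
               (≃ᶜ-trans (sumᶜ-+ (λ k → y *ᶜ (v k *ᶜ conj (v k))) (λ k → z *ᶜ (conj (v k) *ᶜ d k)))
                 (+ᶜ-cong (sumᶜ-*ˡ y (λ k → v k *ᶜ conj (v k))) (sumᶜ-*ˡ z (λ k → conj (v k) *ᶜ d k))))) ⟩
        sumᶜ (λ k → conj (v k)) *ᶜ x +ᶜ (y *ᶜ sumᶜ (λ k → v k *ᶜ conj (v k)) +ᶜ z *ᶜ dv)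
          ≈⟨ +ᶜ-cong (≃ᶜ-trans (*ᶜ-congʳ x (≃ᶜ-trans (sumᶜ-conj v) (conj-cong ∑v≡0))) conj0*)
               (+ᶜ-cong (*ᶜ-congˡ y (≃ᶜ-trans (sumᶜ-cong (λ k → ≃ᶜ-trans (z*conj (v k)) (fromℝ-cong (∣v∣≡1 k))))
                 (≃ᶜ-trans (sumᶜ-const m 1ᶜ) (ℂ-Ring.*-identityʳ (fromℚᶜ (ι m)))))) ≃ᶜ-refl) ⟩
        0ᶜ +ᶜ (y *ᶜ fromℚᶜ (ι m) +ᶜ z *ᶜ dv)
          ≈⟨ ℂ-Ring.+-identityˡ _ ⟩
        y *ᶜ fromℚᶜ (ι m) +ᶜ z *ᶜ dv ∎
        where
        open ≃ᶜ-Reasoning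
        dv : ℂ
        dv = sumᶜ (λ k → conj (v k) *ᶜ d k)
        conj0* : conj 0ᶜ *ᶜ x ≃ᶜ 0ᶜ
        conj0* = mk≃ᶜ (solve 2 (λ a b → con 0ℚ :* a :- (:- con 0ℚ) :* b := con 0ℚ) ≃-refl (re x) (im x))
                      (solve 2 (λ a b → con 0ℚ :* b :+ (:- con 0ℚ) :* a := con 0ℚ) ≃-refl (re x) (im x))

    A-zero : (A *ᵛ combination) zero ≃ᶜ fromℚᶜ (ι m) *ᶜ x +ᶜ z *ᶜ sumᶜ d
    A-zero = ≃ᶜ-trans (+ᶜ-cong (ℂ-Ring.zeroˡ p) (sumᶜ-cong (λ k → ℂ-Ring.*-identityˡ (combination (suc k)))))
      (≃ᶜ-trans (ℂ-Ring.+-identityˡ _) ∑1)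

    A-suc : ∀ j → (A *ᵛ combination) (suc j) ≃ᶜ
      p +ᶜ (v j *ᶜ (y *ᶜ fromℚᶜ (ι m) +ᶜ z *ᶜ sumᶜ (λ k → conj (v k) *ᶜ d k)) -ᶜ combination (suc j))
    A-suc j = +ᶜ-cong (ℂ-Ring.*-identityˡ p) (begin
        sumᶜ (λ k → A (suc j) (suc k) *ᶜ ψ k)
          ≈⟨ sumᶜ-cong (λ k → ≃ᶜ-trans (*ᶜ-congʳ (ψ k) (A-entry j k)) (split (v j) (conj (v k)) (e j k) (ψ k))) ⟩
        sumᶜ (λ k → v j *ᶜ (conj (v k) *ᶜ ψ k) +ᶜ fromℚᶜ (ℚ.- 1ℚ) *ᶜ (e j k *ᶜ ψ k))
          ≈⟨ ≃ᶜ-trans (sumᶜ-+ (λ k → v j *ᶜ (conj (v k) *ᶜ ψ k)) (λ k → fromℚᶜ (ℚ.- 1ℚ) *ᶜ (e j k *ᶜ ψ k)))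
               (+ᶜ-cong (sumᶜ-*ˡ (v j) (λ k → conj (v k) *ᶜ ψ k)) (sumᶜ-*ˡ (fromℚᶜ (ℚ.- 1ℚ)) (λ k → e j k *ᶜ ψ k))) ⟩
        v j *ᶜ sumᶜ (λ k → conj (v k) *ᶜ ψ k) +ᶜ fromℚᶜ (ℚ.- 1ℚ) *ᶜ sumᶜ (λ k → e j k *ᶜ ψ k)
          ≈⟨ +ᶜ-cong (*ᶜ-congˡ (v j) ∑v̄) (≃ᶜ-trans (*ᶜ-congˡ (fromℚᶜ (ℚ.- 1ℚ)) (sumᶜ-e j ψ)) (negate (ψ j))) ⟩
        v j *ᶜ (y *ᶜ fromℚᶜ (ι m) +ᶜ z *ᶜ sumᶜ (λ k → conj (v k) *ᶜ d k)) -ᶜ ψ j ∎)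
      where
      open ≃ᶜ-Reasoning
      ψ : Fin m → ℂ
      ψ k = combination (suc k)

    -- The four conditions compare the value at vertex 0 and the coefficients of 1, v and d. Since v
    -- is orthogonal to 1, the coefficient of v does not enter the conditions for `e₀` and 1, nor
    -- theirs the one for v.
    A-eigen : ∀ λ′ → fromℚᶜ (ι m) *ᶜ x +ᶜ z *ᶜ sumᶜ d ≃ᶜ λ′ *ᶜ p → p -ᶜ x ≃ᶜ λ′ *ᶜ x →
      y *ᶜ fromℚᶜ (ι m) +ᶜ z *ᶜ sumᶜ (λ k → conj (v k) *ᶜ d k) -ᶜ y ≃ᶜ λ′ *ᶜ y →
      fromℚᶜ (ℚ.- 1ℚ) *ᶜ z ≃ᶜ λ′ *ᶜ z →
      ∀ a → (A *ᵛ combination) a ≃ᶜ λ′ *ᶜ combination a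
    A-eigen λ′ h₀ hx hy hz zero    = ≃ᶜ-trans A-zero h₀
    A-eigen λ′ h₀ hx hy hz (suc j) = begin
      (A *ᵛ combination) (suc j)
        ≈⟨ A-suc j ⟩
      p +ᶜ (v j *ᶜ w -ᶜ (x +ᶜ (y *ᶜ v j +ᶜ z *ᶜ d j)))
        ≈⟨ rearrange p (v j) w x y z (d j) ⟩
      (p -ᶜ x) +ᶜ ((w -ᶜ y) *ᶜ v j +ᶜ (fromℚᶜ (ℚ.- 1ℚ) *ᶜ z) *ᶜ d j)
        ≈⟨ +ᶜ-cong hx (+ᶜ-cong (*ᶜ-congʳ (v j) hy) (*ᶜ-congʳ (d j) hz)) ⟩
      λ′ *ᶜ x +ᶜ (λ′ *ᶜ y *ᶜ v j +ᶜ λ′ *ᶜ z *ᶜ d j)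
        ≈⟨ factor λ′ x y (v j) z (d j) ⟩
      λ′ *ᶜ (x +ᶜ (y *ᶜ v j +ᶜ z *ᶜ d j)) ∎
      where
      open ≃ᶜ-Reasoning
      w : ℂ
      w = y *ᶜ fromℚᶜ (ι m) +ᶜ z *ᶜ sumᶜ (λ k → conj (v k) *ᶜ d k)

-- The angle φ with cos² φ = 3 / 4n, obtained as φ = 2 δ where sin² δ = (1 - cos φ) / 2.
module Angle (m : ℕ) where
  private
    n q : ℕ
    n = suc m
    q = suc (4 ℕ.* m)

    2ℚ 3ℚ 4ℚ ¼ : ℚ
    2ℚ = 1ℚ ℚ.+ 1ℚ
    3ℚ = 2ℚ ℚ.+ 1ℚ
    4ℚ = 2ℚ ℚ.+ 2ℚ
    ¼ = ½ ℚ.* ½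

    I J ¾I : ℚ
    I = inv n
    J = inv q
    ¾I = 3ℚ ℚ.* ¼ ℚ.* I

    0≤I : 0ℚ ℚ.≤ I
    0≤I = R.0≤inv n

    I≤1 : I ℚ.≤ 1ℚ
    I≤1 = ℚ.≤-trans (R.inv-anti 1 n (s≤s z≤n)) (ℚ.≤-reflexive (R.inv≡ 1))

    0≤¾I : 0ℚ ℚ.≤ ¾I
    0≤¾I = R.0≤* (ℚ.nonNegative⁻¹ (3ℚ ℚ.* ¼)) 0≤I

    ¾I≤1 : ¾I ℚ.≤ 1ℚ
    ¾I≤1 = ℚ.≤-trans (R.*-monoˡ (ℚ.nonNegative⁻¹ (3ℚ ℚ.* ¼)) I≤1) (ℚ.≤ᵇ⇒≤ _)

    ι4 : ι 4 ≡ 4ℚ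
    ι4 = R.ι≡ 4

    ιq : ι q ≡ 1ℚ ℚ.+ 4ℚ ℚ.* ι m
    ιq = ≡.trans (R.ι-suc (4 ℕ.* m)) (cong (1ℚ ℚ.+_) (≡.trans (R.ι-* 4 m) (cong (ℚ._* ι m) ι4)))

  s s′ : ℝ
  s = sqrt (fromℚ (ι q))
  s′ = s * fromℚ J

  s² : s * s ≃ fromℚ (ι q)
  s² = sqrt² (fromℚ-mono (R.0≤ι q))

  s²≃1+4m : s * s ≃ fromℚ (1ℚ ℚ.+ 4ℚ ℚ.* ι m)
  s²≃1+4m = ≃-trans s² (pointwise λ _ → ιq)

  s′*s : s′ * s ≃ 1ℝ
  s′*s = ≃-trans (solve 2 (λ s j → s :* j :* s := j :* (s :* s)) ≃-refl s (fromℚ J))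
    (≃-trans (*-congˡ {fromℚ J} s²) (pointwise λ _ → R.inv-inverse q))

  private
    s′² : s′ * s′ ≃ fromℚ J
    s′² = ≃-trans (≃-sym (ℝ-Ring.*-assoc s′ s (fromℚ J))) (≃-trans (*-cong s′*s (≃-refl {fromℚ J})) (ℝ-Ring.*-identityˡ (fromℚ J)))

    c y S : ℝ
    c = sqrt (fromℚ ¾I)
    y = fromℚ ½ * (1ℝ - c)
    S = sqrt y

    c² : c * c ≃ fromℚ ¾I
    c² = sqrt² (fromℚ-mono 0≤¾I)

    c≤1 : ∀ k → seq c k ℚ.≤ 1ℚ
    c≤1 k = RationalSquareRoot.sq-cancel-≤ (ℚ.nonNegative⁻¹ 1ℚ)
      (ℚ.≤-trans (RationalSquareRoot.√-lower ¾I k) (ℚ.≤-trans (ℚ.≤-reflexive (ℚ.0≤p⇒∣p∣≡p 0≤¾I)) ¾I≤1))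

    0≤y : ∀ k → 0ℚ ℚ.≤ seq y k
    0≤y k = R.0≤* (ℚ.nonNegative⁻¹ ½) (R.≤⇒0≤- (c≤1 k))

    y≤½ : ∀ k → seq y k ℚ.≤ ½
    y≤½ k = R.≤-from {seq y k} (½ ℚ.* seq c k) (R.0≤* (ℚ.nonNegative⁻¹ ½) (RationalSquareRoot.0≤√ ¾I k))
      (Q.solve 1 (λ c → Q.con ½ Q.:* (Q.con 1ℚ Q.:- c) Q.:+ Q.con ½ Q.:* c Q.:= Q.con ½) refl (seq c k))

    S² : S * S ≃ y
    S² = sqrt² (pointwise-≲ 0≤y)

    -- This is the reason for halving the angle. The angle φ itself may be close to π/2, outside the
    -- interval [-1, 1] on which the arcsine iteration runs, whereas sin² δ ≤ ½ < (¾)².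
    S≤¾ : ∀ k → seq S k ℚ.≤ ½ ℚ.+ ½ ℚ.* ½
    S≤¾ k = RationalSquareRoot.sq-cancel-≤ (ℚ.nonNegative⁻¹ (½ ℚ.+ ½ ℚ.* ½))
      (ℚ.≤-trans (RationalSquareRoot.√-lower (seq y k) k)
        (ℚ.≤-trans (ℚ.≤-reflexive (ℚ.0≤p⇒∣p∣≡p (0≤y k))) (ℚ.≤-trans (y≤½ k) (ℚ.≤ᵇ⇒≤ _))))

    arc : ∃[ x ] (sin x ≃ S × 0ℝ ≲ x × x ≲ 1ℝ)
    arc = arcsine S (λ k → RationalSquareRoot.0≤√ (seq y k) k) S≤¾

  abstract
    δ : ℝ
    δ = proj₁ arc

    0≲δ : 0ℝ ≲ δ
    0≲δ = proj₁ (proj₂ (proj₂ arc))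

    δ≲1 : δ ≲ 1ℝ
    δ≲1 = proj₂ (proj₂ (proj₂ arc))

    private
      sinδ : sin δ ≃ S
      sinδ = proj₁ (proj₂ arc)

  φ : ℝ
  φ = δ + δ

  private
    cosφ : cos φ ≃ c
    cosφ = begin
      cos (δ + δ)
        ≈⟨ cos-+ δ δ ⟨
      cos δ * cos δ - sin δ * sin δ
        ≈⟨ solve 2 (λ c s → c :* c :- s :* s := (c :* c :+ s :* s) :- (s :* s :+ s :* s)) ≃-refl (cos δ) (sin δ) ⟩
      (cos δ * cos δ + sin δ * sin δ) - (sin δ * sin δ + sin δ * sin δ)
        ≈⟨ +-cong (cos²+sin² δ) (-‿cong (+-cong sin²δ sin²δ)) ⟩
      1ℝ - (y + y)
        ≈⟨ solve 1 (λ c → con 1ℚ :- (con ½ :* (con 1ℚ :- c) :+ con ½ :* (con 1ℚ :- c)) := c) ≃-refl c ⟩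
      c ∎
      where
      open ≃-Reasoning
      sin²δ : sin δ * sin δ ≃ y
      sin²δ = ≃-trans (*-cong sinδ sinδ) S²

    cos²φ : cos φ * cos φ ≃ fromℚ ¾I
    cos²φ = ≃-trans (*-cong cosφ cosφ) c²

    sin²φ : sin φ * sin φ ≃ fromℚ (1ℚ ℚ.- ¾I)
    sin²φ = begin
      sin φ * sin φ
        ≈⟨ solve 2 (λ c s → s :* s := (c :* c :+ s :* s) :- c :* c) ≃-refl (cos φ) (sin φ) ⟩
      (cos φ * cos φ + sin φ * sin φ) - cos φ * cos φ
        ≈⟨ +-cong (cos²+sin² φ) (-‿cong cos²φ) ⟩
      1ℝ - fromℚ ¾I
        ≈⟨ pointwise (λ _ → refl) ⟩
      fromℚ (1ℚ ℚ.- ¾I) ∎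
      where open ≃-Reasoning

    -- Rests on 4n - 3 = 4m + 1 = s², so that sin² φ / s² = 1/(4n).
    J*sin² : J ℚ.* (1ℚ ℚ.- ¾I) ≡ ¼ ℚ.* I
    J*sin² = begin
      J ℚ.* (1ℚ ℚ.- 3ℚ ℚ.* ¼ ℚ.* I)
        ≡⟨ cong (λ z → J ℚ.* (z ℚ.- 3ℚ ℚ.* ¼ ℚ.* I)) (≡.sym (R.inv-inverse n)) ⟩
      J ℚ.* (I ℚ.* ι n ℚ.- 3ℚ ℚ.* ¼ ℚ.* I)
        ≡⟨ cong (λ z → J ℚ.* (I ℚ.* z ℚ.- 3ℚ ℚ.* ¼ ℚ.* I)) (R.ι-suc m) ⟩
      J ℚ.* (I ℚ.* (1ℚ ℚ.+ ι m) ℚ.- 3ℚ ℚ.* ¼ ℚ.* I)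
        ≡⟨ Q.solve 3 (λ j i m → j Q.:* (i Q.:* (Q.con 1ℚ Q.:+ m) Q.:- Q.con 3ℚ Q.:* Q.con ¼ Q.:* i)
             Q.:= Q.con ¼ Q.:* i Q.:* (j Q.:* (Q.con 1ℚ Q.:+ Q.con 4ℚ Q.:* m))) refl J I (ι m) ⟩
      ¼ ℚ.* I ℚ.* (J ℚ.* (1ℚ ℚ.+ 4ℚ ℚ.* ι m))
        ≡⟨ cong (λ z → ¼ ℚ.* I ℚ.* (J ℚ.* z)) (≡.sym ιq) ⟩
      ¼ ℚ.* I ℚ.* (J ℚ.* ι q)
        ≡⟨ cong (¼ ℚ.* I ℚ.*_) (R.inv-inverse q) ⟩
      ¼ ℚ.* I ℚ.* 1ℚ
        ≡⟨ ℚ.*-identityʳ (¼ ℚ.* I) ⟩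
      ¼ ℚ.* I ∎
      where open ≡.≡-Reasoning

    s′sin² : (s′ * sin φ) * (s′ * sin φ) ≃ fromℚ (¼ ℚ.* I)
    s′sin² = ≃-trans (solve 2 (λ s x → (s :* x) :* (s :* x) := (s :* s) :* (x :* x)) ≃-refl s′ (sin φ))
      (≃-trans (*-cong s′² sin²φ) (pointwise λ _ → J*sin²))

  abstract
    -- `2 s′ sin φ` is, up to sign, the modulus of the amplitude between 0 and any other vertex. The
    -- companion `cos²+s′sin²` is the squared modulus of the amplitude of return to 0.
    2s′sin² : (fromℚ 2ℚ * (s′ * sin φ)) * (fromℚ 2ℚ * (s′ * sin φ)) ≃ recip n
    2s′sin² = ≃-trans (solve 1 (λ x → (con 2ℚ :* x) :* (con 2ℚ :* x) := con 4ℚ :* (x :* x)) ≃-refl (s′ * sin φ))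
      (≃-trans (*-congˡ {fromℚ 4ℚ} s′sin²)
        (pointwise λ _ → ≡.trans (≡.sym (ℚ.*-assoc 4ℚ ¼ I)) (≡.trans (ℚ.*-identityˡ I) (R.inv≡ n))))

    cos²+s′sin² : cos φ * cos φ + (s′ * sin φ) * (s′ * sin φ) ≃ recip n
    cos²+s′sin² = ≃-trans (+-cong cos²φ s′sin²)
      (pointwise λ _ → ≡.trans (≡.sym (ℚ.*-distribʳ-+ I (3ℚ ℚ.* ¼) ¼)) (≡.trans (ℚ.*-identityˡ I) (R.inv≡ n)))

  -- With t₀ = 2 n α the eigenvalues (-1 ± s)/2 of A acquire the phases α ∓ α s = α ∓ φ, a common
  -- phase α and a rotation by φ.
  α t₀ : ℝ
  α = φ * s′
  t₀ = fromℚ (2ℚ ℚ.* ι n) * α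

  α*s : α * s ≃ φ
  α*s = ≃-trans (ℝ-Ring.*-assoc φ s′ s) (≃-trans (*-congˡ {φ} s′*s) (ℝ-Ring.*-identityʳ φ))

  private
    0≲s′ : 0ℝ ≲ s′
    0≲s′ = 0≲* (0≲sqrt (fromℚ (ι q))) (fromℚ-mono (R.0≤inv q))

    0≲φ : 0ℝ ≲ φ
    0≲φ = 0≲+ 0≲δ 0≲δ

  abstract
    0≲t₀ : 0ℝ ≲ t₀
    0≲t₀ = 0≲* (fromℚ-mono (R.0≤* (ℚ.nonNegative⁻¹ 2ℚ) (R.0≤ι n))) (0≲* 0≲φ 0≲s′)

  √n : ℝ
  √n = sqrt (fromℚ (ι n))

  √n² : √n * √n ≃ fromℚ (ι n)
  √n² = sqrt² (fromℚ-mono (R.0≤ι n))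

  0≲√n : 0ℝ ≲ √n
  0≲√n = 0≲sqrt (fromℚ (ι n))

  private
    5ℚ 10ℚ : ℚ
    5ℚ = 4ℚ ℚ.+ 1ℚ
    10ℚ = 5ℚ ℚ.+ 5ℚ

    -- From 2 s √n ≤ s² + n ≤ 5 n.
    s≲ : fromℚ 2ℚ * s ≲ fromℚ 5ℚ * √n
    s≲ = ≲-trans (≃⇒≲ scale) (≲-trans (*-monoˡ {fromℚ I * √n} (0≲* (fromℚ-mono 0≤I) 0≲√n)
      (≲-trans amgm (≲-trans (≃⇒≲ (+-cong s²≃1+4m √n²)) (pointwise-≲ {y = fromℚ (5ℚ ℚ.* ι n)} λ _ →
        (R.≤-from {1ℚ ℚ.+ 4ℚ ℚ.* ι m ℚ.+ ι n} {5ℚ ℚ.* ι n} 3ℚ (ℚ.nonNegative⁻¹ 3ℚ)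
          (≡.trans (cong (λ z → 1ℚ ℚ.+ 4ℚ ℚ.* ι m ℚ.+ z ℚ.+ 3ℚ) (R.ι-suc m))
            (≡.trans (Q.solve 1 (λ m → Q.con 1ℚ Q.:+ Q.con 4ℚ Q.:* m Q.:+ (Q.con 1ℚ Q.:+ m) Q.:+ Q.con 3ℚ Q.:= Q.con 5ℚ Q.:* (Q.con 1ℚ Q.:+ m)) refl (ι m))
              (cong (5ℚ ℚ.*_) (≡.sym (R.ι-suc m)))))))))) (≃⇒≲ unscale))
      where
      amgm : fromℚ 2ℚ * (s * √n) ≲ s * s + √n * √n
      amgm = ≲-from {fromℚ 2ℚ * (s * √n)} ((s - √n) * (s - √n)) (0≲sq (s - √n))
        (solve 2 (λ s w → con 2ℚ :* (s :* w) :+ (s :- w) :* (s :- w) := s :* s :+ w :* w) ≃-refl s √n)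
      In≃1 : fromℚ I * fromℚ (ι n) ≃ 1ℝ
      In≃1 = pointwise λ _ → R.inv-inverse n
      scale : fromℚ 2ℚ * s ≃ fromℚ I * √n * (fromℚ 2ℚ * (s * √n))
      scale = ≃-sym (≃-trans (solve 3 (λ i w s → i :* w :* (con 2ℚ :* (s :* w)) := (i :* (w :* w)) :* (con 2ℚ :* s)) ≃-refl (fromℚ I) √n s)
        (≃-trans (*-cong (≃-trans (*-congˡ {fromℚ I} √n²) In≃1) (≃-refl {fromℚ 2ℚ * s})) (ℝ-Ring.*-identityˡ (fromℚ 2ℚ * s))))
      unscale : fromℚ I * √n * fromℚ (5ℚ ℚ.* ι n) ≃ fromℚ 5ℚ * √n
      unscale = ≃-trans (*-congˡ {fromℚ I * √n} (pointwise {y = fromℚ 5ℚ * fromℚ (ι n)} λ _ → refl))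
        (≃-trans (solve 3 (λ i w n → i :* w :* (con 5ℚ :* n) := (i :* n) :* (con 5ℚ :* w)) ≃-refl (fromℚ I) √n (fromℚ (ι n)))
          (≃-trans (*-cong In≃1 (≃-refl {fromℚ 5ℚ * √n})) (ℝ-Ring.*-identityˡ (fromℚ 5ℚ * √n))))

    nJ≤1 : ι n ℚ.* J ℚ.≤ 1ℚ
    nJ≤1 = ℚ.≤-trans (R.*-monoʳ (R.0≤inv q) (R.ι-mono {n} {q} (s≤s (ℕ.m≤n*m m 4))))
      (ℚ.≤-reflexive (≡.trans (ℚ.*-comm (ι q) J) (R.inv-inverse q)))

  abstract
    t₀≲10√n : t₀ ≲ fromℚ 10ℚ * √n
    -- As φ ≤ 2, t₀ is at most 4n/s = 4s · n/(4m + 1). The last fraction is at most 1, and 2s ≤ 5√n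
    -- gives the constant 10.
    t₀≲10√n = ≲-trans (*-monoˡ (fromℚ-mono (R.0≤* (ℚ.nonNegative⁻¹ 2ℚ) (R.0≤ι n)))
        (*-monoʳ 0≲s′ (+-mono δ≲1 δ≲1)))
      (≲-trans (≃⇒≲ regroup)
        (≲-trans (*-mono′ (0≲* (fromℚ-mono (ℚ.nonNegative⁻¹ 2ℚ)) (0≲* (fromℚ-mono (ℚ.nonNegative⁻¹ 2ℚ)) (0≲sqrt (fromℚ (ι q)))))
          (fromℚ-mono nJ≤1)) (≲-trans (≃⇒≲ (ℝ-Ring.*-identityʳ _)) (≲-trans (*-monoˡ (fromℚ-mono (ℚ.nonNegative⁻¹ 2ℚ)) s≲)
            (≃⇒≲ (solve 1 (λ w → con 2ℚ :* (con 5ℚ :* w) := con 10ℚ :* w) ≃-refl √n))))))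
      where
      *-mono′ : ∀ {x a b} → 0ℝ ≲ x → a ≲ b → x * a ≲ x * b
      *-mono′ = *-monoˡ
      regroup : fromℚ (2ℚ ℚ.* ι n) * ((1ℝ + 1ℝ) * s′) ≃ (fromℚ 2ℚ * (fromℚ 2ℚ * s)) * fromℚ (ι n ℚ.* J)
      regroup = ≃-trans (*-cong {fromℚ (2ℚ ℚ.* ι n)} {fromℚ 2ℚ * fromℚ (ι n)} (pointwise λ _ → refl) (≃-refl {(1ℝ + 1ℝ) * s′}))
        (≃-trans (solve 3 (λ n s j → con 2ℚ :* n :* ((con 1ℚ :+ con 1ℚ) :* (s :* j)) := con 2ℚ :* (con 2ℚ :* s) :* (n :* j)) ≃-refl (fromℚ (ι n)) s (fromℚ J))
          (*-congˡ {fromℚ 2ℚ * (fromℚ 2ℚ * s)} (pointwise {fromℚ (ι n) * fromℚ J} λ _ → refl)))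

-- Eigenvalues, phases and the moduli of the resulting amplitudes.

module Phases (m : ℕ) where
  open Angle m public

  2ℚ : ℚ
  2ℚ = 1ℚ ℚ.+ 1ℚ

  -- In the basis `e₀`, 1/√m of the plane the two spectral projections have the diagonals (a₀, b₀)
  -- and (b₀, a₀) and the off-diagonal entries ±√m/s.
  a₀ b₀ μ : ℝ
  a₀ = fromℚ ½ * (1ℝ + s′)
  b₀ = fromℚ ½ * (1ℝ - s′)
  μ = fromℚ (ι m)

  -- phase j is - t₀ / n times eigenvalue j.
  eigenvalue phase : Fin 4 → ℝ
  eigenvalue 0F = fromℚ ½ * (s - 1ℝ)
  eigenvalue 1F = fromℚ ½ * (- s - 1ℝ)
  eigenvalue 2F = μ + fromℚ (ℚ.- 1ℚ)
  eigenvalue 3F = fromℚ (ℚ.- 1ℚ)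
  phase 0F = α - φ
  phase 1F = α + φ
  phase 2F = fromℚ (ℚ.- 2ℚ) * α * (μ + fromℚ (ℚ.- 1ℚ))
  phase 3F = fromℚ 2ℚ * α

  phase≃ : ∀ j → fromℚ (ℚ.- 2ℚ) * α * eigenvalue j ≃ phase j
  phase≃ 0F = ≃-trans (solve 2 (λ a s → con (ℚ.- 2ℚ) :* a :* (con ½ :* (s :- con 1ℚ)) := a :- a :* s) ≃-refl α s)
    (+-cong ≃-refl (-‿cong α*s))
  phase≃ 1F = ≃-trans (solve 2 (λ a s → con (ℚ.- 2ℚ) :* a :* (con ½ :* (:- s :- con 1ℚ)) := a :+ a :* s) ≃-refl α s)
    (+-cong ≃-refl α*s)
  phase≃ 2F = ≃-refl
  phase≃ 3F = solve 1 (λ a → con (ℚ.- 2ℚ) :* a :* con (ℚ.- 1ℚ) := con 2ℚ :* a) ≃-refl α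

  abstract
    -- γ is the phase of v, ρ the phase of the vectors orthogonal to `e₀`, 1 and v, and β the
    -- diagonal entry of the evolution at the unit vector 1/√m. They are opaque, since only their
    -- moduli and algebraic relations are wanted.
    γ ρ β : ℂ
    γ = cis (phase 2F)
    ρ = cis (phase 3F)
    β = cis (phase 0F) *ᶜ fromℝ b₀ +ᶜ cis (phase 1F) *ᶜ fromℝ a₀

    γ≡ : γ ≡ cis (phase 2F)
    γ≡ = refl

    ρ≡ : ρ ≡ cis (phase 3F)
    ρ≡ = refl

    β≡ : β ≡ cis (phase 0F) *ᶜ fromℝ b₀ +ᶜ cis (phase 1F) *ᶜ fromℝ a₀
    β≡ = refl

  X Y : ℂ
  X = γ -ᶜ ρ
  Y = β -ᶜ ρ

  abstract
    -- After the common phase `cis α` is split off, x e^(-iφ) + y e^(iφ) has real part (x + y) cos φ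
    -- and imaginary part (y - x) sin φ.
    normSq-mix : ∀ x y → normSq (cis (phase 0F) *ᶜ fromℝ x +ᶜ cis (phase 1F) *ᶜ fromℝ y)
      ≃ ((x + y) * cos φ) * ((x + y) * cos φ) + ((y - x) * sin φ) * ((y - x) * sin φ)
    normSq-mix x y = begin
      normSq (cis (α - φ) *ᶜ fromℝ x +ᶜ cis (α + φ) *ᶜ fromℝ y)
        ≈⟨ normSq-cong (+ᶜ-cong (*ᶜ-congʳ (fromℝ x) (≃ᶜ-trans (≃ᶜ-sym (cis-+ α (- φ))) (*ᶜ-congˡ (cis α) (cis-neg φ))))
             (*ᶜ-congʳ (fromℝ y) (≃ᶜ-sym (cis-+ α φ)))) ⟩
      normSq (cis α *ᶜ conj (cis φ) *ᶜ fromℝ x +ᶜ cis α *ᶜ cis φ *ᶜ fromℝ y)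
        ≈⟨ normSq-cong {w = cis α *ᶜ w} (mk≃ᶜ
             (solve 6 (λ a b c s x y →
               ((a :* c :- b :* (:- s)) :* x :- (a :* (:- s) :+ b :* c) :* con 0ℚ) :+ ((a :* c :- b :* s) :* y :- (a :* s :+ b :* c) :* con 0ℚ)
               := a :* ((x :+ y) :* c) :- b :* ((y :- x) :* s)) ≃-refl (cos α) (sin α) (cos φ) (sin φ) x y)
             (solve 6 (λ a b c s x y →
               ((a :* c :- b :* (:- s)) :* con 0ℚ :+ (a :* (:- s) :+ b :* c) :* x) :+ ((a :* c :- b :* s) :* con 0ℚ :+ (a :* s :+ b :* c) :* y)
               := a :* ((y :- x) :* s) :+ b :* ((x :+ y) :* c)) ≃-refl (cos α) (sin α) (cos φ) (sin φ) x y)) ⟩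
      normSq (cis α *ᶜ w)
        ≈⟨ normSq-* (cis α) w ⟩
      normSq (cis α) * normSq w
        ≈⟨ *-cong (normSq-cis α) ≃-refl ⟩
      1ℝ * normSq w
        ≈⟨ ℝ-Ring.*-identityˡ (normSq w) ⟩
      normSq w ∎
      where
      open ≃-Reasoning
      w : ℂ
      w = ((x + y) * cos φ) +i ((y - x) * sin φ)

    normSq-β : normSq β ≃ recip (suc m)
    normSq-β = ≃-trans (normSq-mix b₀ a₀) (≃-trans
      (solve 3 (λ t c s → let a = con ½ :* (con 1ℚ :+ t); b = con ½ :* (con 1ℚ :- t) in
        ((b :+ a) :* c) :* ((b :+ a) :* c) :+ ((a :- b) :* s) :* ((a :- b) :* s) := c :* c :+ (t :* s) :* (t :* s)) ≃-refl s′ (cos φ) (sin φ))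
      cos²+s′sin²)

    normSq-β′ : normSq (cis (phase 0F) *ᶜ fromℝ a₀ +ᶜ cis (phase 1F) *ᶜ fromℝ b₀) ≃ recip (suc m)
    normSq-β′ = ≃-trans (normSq-mix a₀ b₀) (≃-trans
      (solve 3 (λ t c s → let a = con ½ :* (con 1ℚ :+ t); b = con ½ :* (con 1ℚ :- t) in
        ((a :+ b) :* c) :* ((a :+ b) :* c) :+ ((b :- a) :* s) :* ((b :- a) :* s) := c :* c :+ (t :* s) :* (t :* s)) ≃-refl s′ (cos φ) (sin φ))
      cos²+s′sin²)

    normSq-transfer : normSq (cis (phase 0F) *ᶜ fromℝ s′ +ᶜ cis (phase 1F) *ᶜ fromℝ (- s′)) ≃ recip (suc m)
    normSq-transfer = ≃-trans (normSq-mix s′ (- s′)) (≃-trans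
      (solve 3 (λ t c s → ((t :- t) :* c) :* ((t :- t) :* c) :+ ((:- t :- t) :* s) :* ((:- t :- t) :* s)
        := (con 2ℚ :* (t :* s)) :* (con 2ℚ :* (t :* s))) ≃-refl s′ (cos φ) (sin φ))
      2s′sin²)

    normSq-γ : normSq γ ≃ 1ℝ
    normSq-γ = normSq-cis (phase 2F)

    normSq-ρ : normSq ρ ≃ 1ℝ
    normSq-ρ = normSq-cis (phase 3F)

  a₀+b₀ : a₀ + b₀ ≃ 1ℝ
  a₀+b₀ = solve 1 (λ t → con ½ :* (con 1ℚ :+ t) :+ con ½ :* (con 1ℚ :- t) := con 1ℚ) ≃-refl s′

  private
    ¼ 4ℚ : ℚ
    ¼ = ½ ℚ.* ½
    4ℚ = 2ℚ ℚ.+ 2ℚ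

    s*s′ : s * s′ ≃ 1ℝ
    s*s′ = ≃-trans (*-comm s s′) s′*s

    -- From s² = 1 + 4 m.
    μs′ : μ * s′ ≃ fromℚ ¼ * (s - s′)
    μs′ = ≃-sym (begin
      fromℚ ¼ * (s - s′)
        ≈⟨ *-congˡ {fromℚ ¼} (+-cong (≃-trans (≃-sym (ℝ-Ring.*-identityʳ s)) (*-congˡ {s} (≃-sym s*s′))) ≃-refl) ⟩
      fromℚ ¼ * (s * (s * s′) - s′)
        ≈⟨ solve 2 (λ s t → con ¼ :* (s :* (s :* t) :- t) := con ¼ :* ((s :* s) :* t :- t)) ≃-refl s s′ ⟩
      fromℚ ¼ * ((s * s) * s′ - s′)
        ≈⟨ *-congˡ {fromℚ ¼} (+-cong (*-cong (≃-trans s²≃1+4m (pointwise {y = 1ℝ + fromℚ 4ℚ * μ} λ _ → refl)) ≃-refl) ≃-refl) ⟩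
      fromℚ ¼ * ((1ℝ + fromℚ 4ℚ * μ) * s′ - s′)
        ≈⟨ solve 2 (λ μ t → con ¼ :* ((con 1ℚ :+ con 4ℚ :* μ) :* t :- t) := μ :* t) ≃-refl μ s′ ⟩
      μ * s′ ∎)
      where open ≃-Reasoning

  -- Each equation below is a polynomial identity modulo s s′ = 1 and μs′.
  module Block where
    private
      mod-ss′ : ∀ x y z → x ≃ y + z * (s * s′) → x ≃ y + z
      mod-ss′ x y z h = ≃-trans h (+-cong ≃-refl (≃-trans (*-congˡ {z} s*s′) (ℝ-Ring.*-identityʳ z)))

    b₀≃ : b₀ ≃ eigenvalue 0F * s′
    b₀≃ = ≃-sym (≃-trans (mod-ss′ (eigenvalue 0F * s′) (- (fromℚ ½ * s′)) (fromℚ ½)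
      (solve 2 (λ s t → con ½ :* (s :- con 1ℚ) :* t := :- (con ½ :* t) :+ con ½ :* (s :* t)) ≃-refl s s′))
      (solve 1 (λ t → :- (con ½ :* t) :+ con ½ := con ½ :* (con 1ℚ :- t)) ≃-refl s′))

    a₀≃ : a₀ ≃ eigenvalue 1F * - s′
    a₀≃ = ≃-sym (≃-trans (mod-ss′ (eigenvalue 1F * - s′) (fromℚ ½ * s′) (fromℚ ½)
      (solve 2 (λ s t → con ½ :* (:- s :- con 1ℚ) :* (:- t) := con ½ :* t :+ con ½ :* (s :* t)) ≃-refl s s′))
      (solve 1 (λ t → con ½ :* t :+ con ½ := con ½ :* (con 1ℚ :+ t)) ≃-refl s′))

    a₀-s′ : a₀ - s′ ≃ eigenvalue 0F * s′
    a₀-s′ = ≃-trans (solve 1 (λ t → con ½ :* (con 1ℚ :+ t) :- t := con ½ :* (con 1ℚ :- t)) ≃-refl s′) b₀≃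

    b₀+s′ : b₀ - - s′ ≃ eigenvalue 1F * - s′
    b₀+s′ = ≃-trans (solve 1 (λ t → con ½ :* (con 1ℚ :- t) :- :- t := con ½ :* (con 1ℚ :+ t)) ≃-refl s′) a₀≃

    μs′≃₀ : μ * s′ ≃ eigenvalue 0F * a₀
    μs′≃₀ = ≃-trans μs′ (≃-sym (≃-trans (mod-ss′ (eigenvalue 0F * a₀) (fromℚ ¼ * (s - 1ℝ - s′)) (fromℚ ¼)
      (solve 2 (λ s t → con ½ :* (s :- con 1ℚ) :* (con ½ :* (con 1ℚ :+ t)) := con ¼ :* (s :- con 1ℚ :- t) :+ con ¼ :* (s :* t)) ≃-refl s s′))
      (solve 2 (λ s t → con ¼ :* (s :- con 1ℚ :- t) :+ con ¼ := con ¼ :* (s :- t)) ≃-refl s s′)))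

    μs′≃₁ : μ * - s′ ≃ eigenvalue 1F * b₀
    μs′≃₁ = ≃-trans (solve 2 (λ μ t → μ :* :- t := :- (μ :* t)) ≃-refl μ s′) (≃-trans (-‿cong {μ * s′} {fromℚ ¼ * (s - s′)} μs′)
      (≃-sym (≃-trans (mod-ss′ (eigenvalue 1F * b₀) (fromℚ ¼ * (- s - 1ℝ + s′)) (fromℚ ¼)
      (solve 2 (λ s t → con ½ :* (:- s :- con 1ℚ) :* (con ½ :* (con 1ℚ :- t)) := con ¼ :* (:- s :- con 1ℚ :+ t) :+ con ¼ :* (s :* t)) ≃-refl s s′))
      (solve 2 (λ s t → con ¼ :* (:- s :- con 1ℚ :+ t) :+ con ¼ := :- (con ¼ :* (s :- t))) ≃-refl s s′))))

    μs′≃₂ : (1ℝ + eigenvalue 0F) * b₀ ≃ μ * s′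
    μs′≃₂ = ≃-trans (mod-ss′ ((1ℝ + eigenvalue 0F) * b₀) (fromℚ ¼ * (s + 1ℝ - s′)) (- fromℚ ¼)
      (solve 2 (λ s t → (con 1ℚ :+ con ½ :* (s :- con 1ℚ)) :* (con ½ :* (con 1ℚ :- t)) := con ¼ :* (s :+ con 1ℚ :- t) :+ (:- con ¼) :* (s :* t)) ≃-refl s s′))
      (≃-trans (solve 2 (λ s t → con ¼ :* (s :+ con 1ℚ :- t) :+ (:- con ¼) := con ¼ :* (s :- t)) ≃-refl s s′) (≃-sym μs′))

    μs′≃₃ : (1ℝ + eigenvalue 1F) * a₀ ≃ μ * - s′
    μs′≃₃ = ≃-trans (mod-ss′ ((1ℝ + eigenvalue 1F) * a₀) (fromℚ ¼ * (- s + 1ℝ + s′)) (- fromℚ ¼)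
      (solve 2 (λ s t → (con 1ℚ :+ con ½ :* (:- s :- con 1ℚ)) :* (con ½ :* (con 1ℚ :+ t)) := con ¼ :* (:- s :+ con 1ℚ :+ t) :+ (:- con ¼) :* (s :* t)) ≃-refl s s′))
      (≃-trans (solve 2 (λ s t → con ¼ :* (:- s :+ con 1ℚ :+ t) :+ (:- con ¼) := :- (con ¼ :* (s :- t))) ≃-refl s s′)
        (≃-trans (-‿cong (≃-sym μs′)) (solve 2 (λ μ t → :- (μ :* t) := μ :* :- t) ≃-refl μ s′)))

e-sym : ∀ {n} (a b : Fin n) → e a b ≡ e b a
e-sym zero    zero    = refl
e-sym zero    (suc b) = refl
e-sym (suc a) zero    = refl
e-sym (suc a) (suc b) = e-sym a b

e-diagonal : ∀ {n} (u : Fin n) → e u u ≡ 1ᶜ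
e-diagonal zero    = refl
e-diagonal (suc u) = e-diagonal u

e-off : ∀ {n} (u i : Fin n) → i ≢ u → e u i ≡ 0ᶜ
e-off zero    zero    i≢u = ⊥-elim (i≢u refl)
e-off zero    (suc i) i≢u = refl
e-off (suc u) zero    i≢u = refl
e-off (suc u) (suc i) i≢u = e-off u i (i≢u ∘ cong suc)

-- The spectral projections of the signed adjacency matrix and the entries of the evolution
-- operator.

module Evolution (m : ℕ) .{{_ : NonZero m}} (v : Fin m → ℂ) (∣v∣≡1 : ∀ k → normSq (v k) ≃ 1ℝ) (∑v≡0 : sumᶜ v ≃ᶜ 0ᶜ) where
  open Phases m public
  open Signing m v ∣v∣≡1 ∑v≡0 public
  open ℂ-Identities

  I : ℂ
  I = fromℚᶜ (inv m)

  θ : Fin m → Fin m → ℂ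
  θ i u = v i *ᶜ conj (v u)

  private
    N : ℕ
    N = suc m

    −1ᶜ : ℂ
    −1ᶜ = fromℚᶜ (ℚ.- 1ℚ)

    M : ℂ
    M = fromℚᶜ (ι m)

    MI : M *ᶜ I ≃ᶜ 1ᶜ
    MI = ≃ᶜ-trans (≃ᶜ-sym (fromℝ-* (fromℚ (ι m)) (fromℚ (inv m))))
      (fromℝ-cong (pointwise λ _ → ≡.trans (ℚ.*-comm (ι m) (inv m)) (Rational.inv-inverse m)))

    w : Fin m → ℂ
    w u = conj (v u)

    d : Fin N → Fin m → ℂ
    d zero    _ = 0ᶜ
    d (suc u) i = e u i

    -- Coordinates of the columns of the projections. The indices 0 and 1 give the projections of
    -- the plane, 2 gives v v*/m, and 3 gives the identity on the vertices other than 0 minus the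
    -- projections onto 1 and v. The identity enters through `z = 1` and the basis vector `d`.
    p x y z : Fin 4 → Fin N → ℂ
    p 0F zero    = fromℝ a₀
    p 0F (suc _) = fromℝ s′
    p 1F zero    = fromℝ b₀
    p 1F (suc _) = fromℝ (- s′)
    p 2F _       = 0ᶜ
    p 3F _       = 0ᶜ
    x 0F zero    = fromℝ s′
    x 0F (suc _) = I *ᶜ fromℝ b₀
    x 1F zero    = fromℝ (- s′)
    x 1F (suc _) = I *ᶜ fromℝ a₀
    x 2F _       = 0ᶜ
    x 3F zero    = 0ᶜ
    x 3F (suc _) = −1ᶜ *ᶜ I
    y 0F _       = 0ᶜ
    y 1F _       = 0ᶜ
    y 2F zero    = 0ᶜ
    y 2F (suc u) = I *ᶜ w u
    y 3F zero    = 0ᶜ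
    y 3F (suc u) = −1ᶜ *ᶜ (I *ᶜ w u)
    z 0F _       = 0ᶜ
    z 1F _       = 0ᶜ
    z 2F _       = 0ᶜ
    z 3F zero    = 0ᶜ
    z 3F (suc _) = 1ᶜ

    -- The spectral projections of A.
    E : Fin 4 → Matrix N
    E j a b = combination (p j b) (x j b) (y j b) (z j b) (d b) a

    λᶜ : Fin 4 → ℂ
    λᶜ j = fromℝ (eigenvalue j)

    ∑d ∑v̄d : Fin N → ℂ
    ∑d b = sumᶜ (d b)
    ∑v̄d b = sumᶜ (λ k → conj (v k) *ᶜ d b k)

    ∑d-suc : ∀ u → ∑d (suc u) ≃ᶜ 1ᶜ
    ∑d-suc u = ≃ᶜ-trans (sumᶜ-cong (λ k → ≃ᶜ-sym (ℂ-Ring.*-identityʳ (e u k)))) (sumᶜ-e u (λ _ → 1ᶜ))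

    ∑v̄d-suc : ∀ u → ∑v̄d (suc u) ≃ᶜ w u
    ∑v̄d-suc u = ≃ᶜ-trans (sumᶜ-cong (λ k → ℂ-Ring.*-comm (conj (v k)) (e u k))) (sumᶜ-e u w)

    minus : ∀ {a b c d} → a ≃ᶜ b → c ≃ᶜ d → a -ᶜ c ≃ᶜ b -ᶜ d
    minus (mk≃ᶜ h k) (mk≃ᶜ h′ k′) = mk≃ᶜ (+-cong h (-‿cong h′)) (+-cong k (-‿cong k′))

    fromℝ-minus : ∀ a b → fromℝ (a - b) ≃ᶜ fromℝ a -ᶜ fromℝ b
    fromℝ-minus a b = mk≃ᶜ ≃-refl (solve 0 (con 0ℚ := con 0ℚ :- con 0ℚ) ≃-refl)

    I*fromℝ : ∀ r → I *ᶜ fromℝ r ≃ᶜ fromℝ (fromℚ (inv m) * r)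
    I*fromℝ r = ≃ᶜ-sym (fromℝ-* (fromℚ (inv m)) r)

    μI : ∀ r → μ * (fromℚ (inv m) * r) ≃ r
    μI r = ≃-trans (≃-sym (ℝ-Ring.*-assoc μ (fromℚ (inv m)) r))
      (≃-trans (*-cong {μ * fromℚ (inv m)} {1ℝ} (pointwise λ _ → ≡.trans (ℚ.*-comm (ι m) (inv m)) (Rational.inv-inverse m)) ≃-refl)
        (ℝ-Ring.*-identityˡ r))

    block-p : ∀ {xᶜ} pᵣ xᵣ l D → xᶜ ≃ᶜ fromℝ xᵣ → μ * xᵣ ≃ l * pᵣ → M *ᶜ xᶜ +ᶜ 0ᶜ *ᶜ D ≃ᶜ fromℝ l *ᶜ fromℝ pᵣ
    block-p {xᶜ} pᵣ xᵣ l D h k = ≃ᶜ-trans (drop-zero (M *ᶜ xᶜ) D) (≃ᶜ-trans (*ᶜ-congˡ M h)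
      (≃ᶜ-trans (≃ᶜ-sym (fromℝ-* μ xᵣ)) (≃ᶜ-trans (fromℝ-cong k) (fromℝ-* l pᵣ))))

    block-x : ∀ {xᶜ} pᵣ xᵣ l → xᶜ ≃ᶜ fromℝ xᵣ → pᵣ - xᵣ ≃ l * xᵣ → fromℝ pᵣ -ᶜ xᶜ ≃ᶜ fromℝ l *ᶜ xᶜ
    block-x pᵣ xᵣ l h k = ≃ᶜ-trans (minus (≃ᶜ-refl {fromℝ pᵣ}) h) (≃ᶜ-trans (≃ᶜ-sym (fromℝ-minus pᵣ xᵣ))
      (≃ᶜ-trans (fromℝ-cong k) (≃ᶜ-trans (fromℝ-* l xᵣ) (*ᶜ-congˡ (fromℝ l) (≃ᶜ-sym h)))))

    lower-eigen : ∀ r t l → (1ℝ + l) * r ≃ μ * t → t - fromℚ (inv m) * r ≃ l * (fromℚ (inv m) * r)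
    lower-eigen r t l h = ≃-trans (+-cong (≃-trans (≃-sym (μI t)) (≃-trans
        (solve 3 (λ μ i t → μ :* (i :* t) := i :* (μ :* t)) ≃-refl μ (fromℚ (inv m)) t)
        (*-congˡ {fromℚ (inv m)} (≃-sym h)))) ≃-refl)
      (solve 3 (λ i l r → i :* ((con 1ℚ :+ l) :* r) :- i :* r
        := l :* (i :* r)) ≃-refl (fromℚ (inv m)) l r)

    row-p : ∀ j b → M *ᶜ x j b +ᶜ z j b *ᶜ ∑d b ≃ᶜ λᶜ j *ᶜ p j b
    row-p 0F zero    = block-p a₀ s′ (eigenvalue 0F) (∑d zero) ≃ᶜ-refl Block.μs′≃₀
    row-p 1F zero    = block-p b₀ (- s′) (eigenvalue 1F) (∑d zero) ≃ᶜ-refl Block.μs′≃₁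
    row-p 2F zero    = zero-row M (∑d zero) (λᶜ 2F)
    row-p 3F zero    = zero-row M (∑d zero) (λᶜ 3F)
    row-p 0F (suc u) = block-p s′ (fromℚ (inv m) * b₀) (eigenvalue 0F) (∑d (suc u)) (I*fromℝ b₀) (≃-trans (μI b₀) Block.b₀≃)
    row-p 1F (suc u) = block-p (- s′) (fromℚ (inv m) * a₀) (eigenvalue 1F) (∑d (suc u)) (I*fromℝ a₀) (≃-trans (μI a₀) Block.a₀≃)
    row-p 2F (suc u) = zero-row M (∑d (suc u)) (λᶜ 2F)
    row-p 3F (suc u) = ≃ᶜ-trans (+ᶜ-cong (≃ᶜ-refl {M *ᶜ (−1ᶜ *ᶜ I)}) (*ᶜ-congˡ 1ᶜ (∑d-suc u))) (rest-row M I (λᶜ 3F) MI)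

    row-x : ∀ j b → p j b -ᶜ x j b ≃ᶜ λᶜ j *ᶜ x j b
    row-x 0F zero    = block-x a₀ s′ (eigenvalue 0F) ≃ᶜ-refl Block.a₀-s′
    row-x 1F zero    = block-x b₀ (- s′) (eigenvalue 1F) ≃ᶜ-refl Block.b₀+s′
    row-x 0F (suc u) = block-x s′ (fromℚ (inv m) * b₀) (eigenvalue 0F) (I*fromℝ b₀) (lower-eigen b₀ s′ (eigenvalue 0F) Block.μs′≃₂)
    row-x 1F (suc u) = block-x (- s′) (fromℚ (inv m) * a₀) (eigenvalue 1F) (I*fromℝ a₀) (lower-eigen a₀ (- s′) (eigenvalue 1F) Block.μs′≃₃)
    row-x 2F b       = zero-diff (λᶜ 2F)
    row-x 3F zero    = zero-diff (λᶜ 3F)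
    row-x 3F (suc u) = neg-diff I

    row-y : ∀ j b → y j b *ᶜ M +ᶜ z j b *ᶜ ∑v̄d b -ᶜ y j b ≃ᶜ λᶜ j *ᶜ y j b
    row-y 0F b       = zero-eigen M (∑v̄d b) (λᶜ 0F)
    row-y 1F b       = zero-eigen M (∑v̄d b) (λᶜ 1F)
    row-y 2F zero    = zero-eigen M (∑v̄d zero) (λᶜ 2F)
    row-y 3F zero    = zero-eigen M (∑v̄d zero) (λᶜ 3F)
    row-y 2F (suc u) =
      ≃ᶜ-trans (minus (+ᶜ-cong (≃ᶜ-refl {I *ᶜ w u *ᶜ M}) (*ᶜ-congˡ 0ᶜ (∑v̄d-suc u))) (≃ᶜ-refl {I *ᶜ w u}))
        (≃ᶜ-trans (v-eigen M I (w u)) (*ᶜ-congʳ (I *ᶜ w u) (mk≃ᶜ ≃-refl (ℝ-Ring.+-identityˡ 0ℝ))))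
    row-y 3F (suc u) =
      ≃ᶜ-trans (minus (+ᶜ-cong (≃ᶜ-refl {−1ᶜ *ᶜ (I *ᶜ w u) *ᶜ M}) (*ᶜ-congˡ 1ᶜ (∑v̄d-suc u))) (≃ᶜ-refl {−1ᶜ *ᶜ (I *ᶜ w u)}))
        (rest-eigen M I (w u) MI)

    row-z : ∀ j b → −1ᶜ *ᶜ z j b ≃ᶜ λᶜ j *ᶜ z j b
    row-z 0F b       = zero-scale (λᶜ 0F)
    row-z 1F b       = zero-scale (λᶜ 1F)
    row-z 2F b       = zero-scale (λᶜ 2F)
    row-z 3F zero    = zero-scale (λᶜ 3F)
    row-z 3F (suc u) = ≃ᶜ-refl

    A-E : ∀ j b a → (A *ᵛ (λ c → E j c b)) a ≃ᶜ λᶜ j *ᶜ E j a b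
    A-E j b = A-eigen (p j b) (x j b) (y j b) (z j b) (d b) (λᶜ j) (row-p j b) (row-x j b) (row-y j b) (row-z j b)

    resolution : ∀ a b → sumᶜ (λ j → E j a b) ≃ᶜ idᴹ a b
    resolution zero    zero    = mk≃ᶜ
      (≃-trans (solve 2 (λ a b → a :+ (b :+ (con 0ℚ :+ (con 0ℚ :+ con 0ℚ))) := a :+ b) ≃-refl a₀ b₀) a₀+b₀)
      (solve 0 (let o = con 0ℚ in o :+ (o :+ (o :+ (o :+ o))) := o) ≃-refl)
    resolution zero    (suc u) = mk≃ᶜ
      (solve 1 (λ a → a :+ ((:- a) :+ (con 0ℚ :+ (con 0ℚ :+ con 0ℚ))) := con 0ℚ) ≃-refl s′)
      (solve 0 (let o = con 0ℚ in o :+ (o :+ (o :+ (o :+ o))) := o) ≃-refl)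
    resolution (suc i) zero    = resolve₀ (fromℝ s′) (fromℝ (- s′)) (v i)
      (mk≃ᶜ (ℝ-Ring.-‿inverseʳ s′) (ℝ-Ring.+-identityˡ 0ℝ))
    resolution (suc i) (suc u) = ≃ᶜ-trans
      (resolve I (v i) (e u i) (w u) (fromℝ b₀) (fromℝ a₀)
        (mk≃ᶜ (≃-trans (ℝ-Ring.+-comm b₀ a₀) a₀+b₀) (ℝ-Ring.+-identityˡ 0ℝ)))
      (≡⇒≃ᶜ (e-sym u i))
      where
      ≡⇒≃ᶜ : ∀ {z w} → z ≡ w → z ≃ᶜ w
      ≡⇒≃ᶜ refl = ≃ᶜ-refl

  H : Matrix N
  H = scaledAdjacency signing

  private
    generator : Matrix N
    generator a b = (0ℝ +i (- t₀)) *ᶜ H a b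

    t₀/n : (0ℝ +i (- t₀)) *ᶜ fromℝ (recip N) ≃ᶜ 0ℝ +i (fromℚ (ℚ.- 2ℚ) * α)
    t₀/n = mk≃ᶜ
      (solve 2 (λ t r → con 0ℚ :* r :- (:- t) :* con 0ℚ := con 0ℚ) ≃-refl t₀ (recip N))
      (begin
        0ℝ * 0ℝ + (- t₀) * recip N
          ≈⟨ +-cong (≃-refl {0ℝ * 0ℝ}) (*-cong (-‿cong {t₀} {fromℚ 2ℚ * fromℚ (ι N) * α} (*-cong {fromℚ (2ℚ ℚ.* ι N)} (pointwise λ _ → refl) ≃-refl)) (recip≃ N)) ⟩
        0ℝ * 0ℝ + (- (fromℚ 2ℚ * fromℚ (ι N) * α)) * fromℚ (inv N)
          ≈⟨ solve 3 (λ n a i → con 0ℚ :* con 0ℚ :+ (:- (con 2ℚ :* n :* a)) :* i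
               := (i :* n) :* (con (ℚ.- 2ℚ) :* a)) ≃-refl (fromℚ (ι N)) α (fromℚ (inv N)) ⟩
        (fromℚ (inv N) * fromℚ (ι N)) * (fromℚ (ℚ.- 2ℚ) * α)
          ≈⟨ *-cong {fromℚ (inv N) * fromℚ (ι N)} {1ℝ} (pointwise λ _ → Rational.inv-inverse N) ≃-refl ⟩
        1ℝ * (fromℚ (ℚ.- 2ℚ) * α)
          ≈⟨ ℝ-Ring.*-identityˡ _ ⟩
        fromℚ (ℚ.- 2ℚ) * α ∎)
      where open ≃-Reasoning

    generator-entry : ∀ a b ψ → generator a b *ᶜ ψ ≃ᶜ (0ℝ +i (fromℚ (ℚ.- 2ℚ) * α)) *ᶜ (A a b *ᶜ ψ)
    generator-entry a b ψ = ≃ᶜ-trans (*ᶜ-congʳ ψ (*ᶜ-congˡ (0ℝ +i (- t₀)) (·≃ (recip N) (A a b))))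
      (≃ᶜ-trans (scale-entry (0ℝ +i (- t₀)) (fromℝ (recip N)) (A a b) ψ) (*ᶜ-congʳ (A a b *ᶜ ψ) t₀/n))

    generator-E : ∀ j a b → (generator *ᴹ E j) a b ≃ᶜ (0ℝ +i phase j) *ᶜ E j a b
    generator-E j a b = begin
      sumᶜ (λ c → generator a c *ᶜ E j c b)
        ≈⟨ sumᶜ-cong (λ c → generator-entry a c (E j c b)) ⟩
      sumᶜ (λ c → τ *ᶜ (A a c *ᶜ E j c b))
        ≈⟨ sumᶜ-*ˡ τ (λ c → A a c *ᶜ E j c b) ⟩
      τ *ᶜ (A *ᵛ (λ c → E j c b)) a
        ≈⟨ *ᶜ-congˡ τ (A-E j b a) ⟩
      τ *ᶜ (λᶜ j *ᶜ E j a b)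
        ≈⟨ ≃ᶜ-sym (ℂ-Ring.*-assoc τ (λᶜ j) (E j a b)) ⟩
      τ *ᶜ λᶜ j *ᶜ E j a b
        ≈⟨ *ᶜ-congʳ (E j a b) (mk≃ᶜ
             (solve 2 (λ t l → con 0ℚ :* l :- t :* con 0ℚ := con 0ℚ) ≃-refl (im τ) (eigenvalue j))
             (≃-trans (solve 2 (λ t l → con 0ℚ :* con 0ℚ :+ t :* l := t :* l) ≃-refl (im τ) (eigenvalue j)) (phase≃ j))) ⟩
      (0ℝ +i phase j) *ᶜ E j a b ∎
      where
      open ≃ᶜ-Reasoning
      τ : ℂ
      τ = 0ℝ +i (fromℚ (ℚ.- 2ℚ) * α)

  abstract
    U : Matrix N
    U a b = sumᶜ (λ j → cis (phase j) *ᶜ E j a b)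

    U-exp : IsExp (λ a b → (0ℝ +i (- t₀)) *ᶜ H a b) U
    U-exp = spectral-exponential generator phase E resolution generator-E

    U-00 : normSq (U zero zero) ≃ recip N
    U-00 = ≃-trans (normSq-cong (column₀-head (cis (phase 0F)) (cis (phase 1F)) (cis (phase 2F)) (cis (phase 3F)) (fromℝ a₀) (fromℝ b₀))) normSq-β′

    U-0suc : ∀ u → normSq (U zero (suc u)) ≃ recip N
    U-0suc u = ≃-trans (normSq-cong (column₀-head (cis (phase 0F)) (cis (phase 1F)) (cis (phase 2F)) (cis (phase 3F)) (fromℝ s′) (fromℝ (- s′)))) normSq-transfer

    U-suc0 : ∀ i → normSq (U (suc i) zero) ≃ recip N
    U-suc0 i = ≃-trans (normSq-cong (column₀-tail (cis (phase 0F)) (cis (phase 1F)) (cis (phase 2F)) (cis (phase 3F)) (fromℝ s′) (fromℝ (- s′)) (v i))) normSq-transfer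

    U-suc : ∀ i u → U (suc i) (suc u) ≃ᶜ I *ᶜ (Y +ᶜ X *ᶜ θ i u) +ᶜ ρ *ᶜ e u i
    U-suc i u = subst (λ b → U (suc i) (suc u) ≃ᶜ I *ᶜ ((b -ᶜ ρ) +ᶜ X *ᶜ θ i u) +ᶜ ρ *ᶜ e u i) (≡.sym β≡)
      (subst₂ (λ g r → U (suc i) (suc u) ≃ᶜ I *ᶜ ((b -ᶜ r) +ᶜ (g -ᶜ r) *ᶜ θ i u) +ᶜ r *ᶜ e u i) (≡.sym γ≡) (≡.sym ρ≡)
        (column-tail (cis (phase 0F)) (cis (phase 1F)) (cis (phase 2F)) (cis (phase 3F)) (fromℝ b₀) (fromℝ a₀) I (w u) (v i) (e u i)))
      where
      b : ℂ
      b = cis (phase 0F) *ᶜ fromℝ b₀ +ᶜ cis (phase 1F) *ᶜ fromℝ a₀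

-- Finite sums of reals.

module RealSums where

  sum-cong : ∀ {n} {f g : Fin n → ℝ} → (∀ k → f k ≃ g k) → sum f ≃ sum g
  sum-cong = ℝ-Sum.sum-cong-≋

  sum-const : ∀ n x → sum {n} (λ _ → x) ≃ fromℚ (ι n) * x
  sum-const zero    x = ≃-sym (≃-trans (*-cong (pointwise {y = 0ℝ} λ _ → Rational.ι-0) ≃-refl) (ℝ-Ring.zeroˡ x))
  sum-const (suc n) x = ≃-trans (+-cong (≃-refl {x}) (sum-const n x))
    (≃-trans (solve 2 (λ n x → x :+ n :* x := (con 1ℚ :+ n) :* x) ≃-refl (fromℚ (ι n)) x)
      (*-cong {1ℝ + fromℚ (ι n)} (pointwise λ _ → ≡.sym (Rational.ι-suc n)) ≃-refl))

  sum-update : ∀ {n} (u : Fin n) (f g : Fin n → ℝ) → (∀ i → i ≢ u → f i ≃ g i) → sum f ≃ sum g + (f u - g u)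
  sum-update zero f g h = ≃-trans (+-cong (≃-refl {f zero}) (sum-cong (λ i → h (suc i) (λ ()))))
    (solve 3 (λ a b c → a :+ c := b :+ c :+ (a :- b)) ≃-refl (f zero) (g zero) (sum (λ i → g (suc i))))
  sum-update (suc u) f g h = ≃-trans (+-cong (h zero (λ ())) (sum-update u (f ∘ suc) (g ∘ suc) (λ i i≢u → h (suc i) (i≢u ∘ Fin.suc-injective))))
    (≃-sym (ℝ-Ring.+-assoc (g zero) (sum (λ i → g (suc i))) (f (suc u) - g (suc u))))

  0≲sum : ∀ {n} (f : Fin n → ℝ) → (∀ k → 0ℝ ≲ f k) → 0ℝ ≲ sum f
  0≲sum {zero}  f h = ≲-refl
  0≲sum {suc n} f h = 0≲+ (h zero) (0≲sum (f ∘ suc) (h ∘ suc))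

  term≲sum : ∀ {n} (f : Fin n → ℝ) → (∀ k → 0ℝ ≲ f k) → ∀ k → f k ≲ sum f
  term≲sum f h zero    = ≲-from {f zero} (sum (f ∘ suc)) (0≲sum (f ∘ suc) (h ∘ suc)) ≃-refl
  term≲sum f h (suc k) = ≲-trans (term≲sum (f ∘ suc) (h ∘ suc) k)
    (≲-from {sum (f ∘ suc)} (f zero) (h zero) (ℝ-Ring.+-comm (sum (f ∘ suc)) (f zero)))

open RealSums

-- Entries of U on the vertices other than 0 are, up to a factor, Y + X θ with X = γ - ρ, Y = β - ρ and |θ| = 1.
module NonVanishing (m : ℕ) (4≤m : 4 ℕ.≤ m) where
  open Phases m
  open ℂ-Identities

  private
    r : ℝ
    r = recip (suc m)

    r≤⅖ : fromℚ 2ℚ * r ≲ fromℚ (ℚ.½ ℚ.+ ℚ.½ ℚ.- inv 5)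
    r≤⅖ = pointwise-≲ λ _ → ℚ.≤-trans (Rational.*-monoˡ (ℚ.nonNegative⁻¹ 2ℚ)
      (subst (ℚ._≤ inv 5) (Rational.inv≡ (suc m)) (Rational.inv-anti 5 (suc m) (s≤s 4≤m))))
      (subst (λ z → 2ℚ ℚ.* z ℚ.≤ ℚ.½ ℚ.+ ℚ.½ ℚ.- z) (≡.sym (Rational.inv≡ 5)) (ℚ.≤ᵇ⇒≤ _))

  -- 2 |β + D|² = |D|² - 2 |β|² + |2 β + D|², and |β|² = 1 / n.
  positive-β+ : ∀ D → 1ℝ ≲ normSq D → Positive (normSq (β +ᶜ D))
  positive-β+ D 1≲D = positive-factor {fromℚ 2ℚ} {normSq (β +ᶜ D)}
    (positive-mono (positive-fromℚ (Rational.0<inv 5)) (≲-trans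
      (≲-from {fromℚ (inv 5)} {normSq D - fromℚ 2ℚ * normSq β}
        ((normSq D - 1ℝ) + (fromℚ (ℚ.½ ℚ.+ ℚ.½ ℚ.- inv 5) - fromℚ 2ℚ * normSq β))
        (0≲+ (≲⇒0≲- 1≲D) (≲⇒0≲- (≲-trans (≃⇒≲ (*-congˡ {fromℚ 2ℚ} normSq-β)) r≤⅖)))
        (≃-trans (+-cong (≃-refl {fromℚ (inv 5)}) (+-cong ≃-refl (+-cong (pointwise {y = 1ℝ - fromℚ (inv 5)} λ _ → refl) ≃-refl)))
          (solve 3 (λ i d b → i :+ ((d :- con 1ℚ) :+ ((con 1ℚ :- i) :- b)) := d :- b) ≃-refl (fromℚ (inv 5)) (normSq D) (fromℚ 2ℚ * normSq β))))
      (≲-from {normSq D - fromℚ 2ℚ * normSq β} (normSq (fromℝ (fromℚ 2ℚ) *ᶜ β +ᶜ D)) (0≲normSq (fromℝ (fromℚ 2ℚ) *ᶜ β +ᶜ D))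
        (solve 4 (λ a b c d →
          (c :* c :+ d :* d) :- con 2ℚ :* (a :* a :+ b :* b)
            :+ (((con 2ℚ :* a :- con 0ℚ :* b) :+ c) :* ((con 2ℚ :* a :- con 0ℚ :* b) :+ c)
              :+ ((con 2ℚ :* b :+ con 0ℚ :* a) :+ d) :* ((con 2ℚ :* b :+ con 0ℚ :* a) :+ d))
          := con 2ℚ :* ((a :+ c) :* (a :+ c) :+ (b :+ d) :* (b :+ d))) ≃-refl (re β) (im β) (re D) (im D)))))
    (0≲normSq (β +ᶜ D))

  private
    normSq-γ+κρ : ∀ κ → normSq (γ +ᶜ fromℝ κ *ᶜ ρ) ≃ normSq γ + κ * κ * normSq ρ + κ * (normSq (γ +ᶜ ρ) - normSq γ - normSq ρ)
    normSq-γ+κρ κ = solve 5 (λ k a b c d →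
      (a :+ (k :* c :- con 0ℚ :* d)) :* (a :+ (k :* c :- con 0ℚ :* d)) :+ (b :+ (k :* d :+ con 0ℚ :* c)) :* (b :+ (k :* d :+ con 0ℚ :* c))
      := (a :* a :+ b :* b) :+ k :* k :* (c :* c :+ d :* d)
         :+ k :* (((a :+ c) :* (a :+ c) :+ (b :+ d) :* (b :+ d)) :- (a :* a :+ b :* b) :- (c :* c :+ d :* d)))
      ≃-refl κ (re γ) (im γ) (re ρ) (im ρ)

    simplify : ∀ κ {g p} → normSq γ ≃ 1ℝ → normSq ρ ≃ 1ℝ → g ≃ normSq γ + κ * κ * normSq ρ + κ * (p - normSq γ - normSq ρ) →
      g ≃ 1ℝ + κ * κ * 1ℝ + κ * (p - 1ℝ - 1ℝ)
    simplify κ hγ hρ h = ≃-trans h (+-cong (+-cong hγ (*-congˡ {κ * κ} hρ)) (*-congˡ {κ} (+-cong (+-cong ≃-refl (-‿cong hγ)) (-‿cong hρ))))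

    parallelogram : ∀ z w → normSq (z +ᶜ w) + normSq (z -ᶜ w) ≃ fromℚ 2ℚ * (normSq z + normSq w)
    parallelogram z w = solve 4 (λ a b c d → (a :+ c) :* (a :+ c) :+ (b :+ d) :* (b :+ d) :+ ((a :- c) :* (a :- c) :+ (b :- d) :* (b :- d))
      := con 2ℚ :* ((a :* a :+ b :* b) :+ (c :* c :+ d :* d))) ≃-refl (re z) (im z) (re w) (im w)

  -- |γ - 2 ρ|² = 1 + 2 |γ - ρ|²
  1≲γ-2ρ : 1ℝ ≲ normSq (γ +ᶜ fromℝ (fromℚ (ℚ.- 2ℚ)) *ᶜ ρ)
  1≲γ-2ρ = ≲-from {1ℝ} (fromℚ 2ℚ * normSq (γ -ᶜ ρ)) (0≲* (fromℚ-mono (ℚ.nonNegative⁻¹ 2ℚ)) (0≲normSq (γ -ᶜ ρ)))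
    (≃-sym (≃-trans (simplify (fromℚ (ℚ.- 2ℚ)) normSq-γ normSq-ρ (normSq-γ+κρ (fromℚ (ℚ.- 2ℚ))))
      (≃-trans (solve 2 (λ p q → con 1ℚ :+ con (ℚ.- 2ℚ) :* con (ℚ.- 2ℚ) :* con 1ℚ :+ con (ℚ.- 2ℚ) :* (p :- con 1ℚ :- con 1ℚ)
          := con 1ℚ :+ con 2ℚ :* q :+ con 2ℚ :* (con 2ℚ :* (con 1ℚ :+ con 1ℚ) :- (p :+ q))) ≃-refl (normSq (γ +ᶜ ρ)) (normSq (γ -ᶜ ρ)))
        (≃-trans (+-cong (≃-refl {1ℝ + fromℚ 2ℚ * normSq (γ -ᶜ ρ)}) (*-congˡ {fromℚ 2ℚ} (≃-trans
            (+-cong (≃-sym (≃-trans (parallelogram γ ρ) (*-congˡ {fromℚ 2ℚ} (+-cong normSq-γ normSq-ρ)))) ≃-refl)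
            (ℝ-Ring.-‿inverseʳ (normSq (γ +ᶜ ρ) + normSq (γ -ᶜ ρ))))))
          (solve 1 (λ x → x :+ con 2ℚ :* con 0ℚ := x) ≃-refl (1ℝ + fromℚ 2ℚ * normSq (γ -ᶜ ρ)))))))

  -- |γ + κ ρ|² = (κ - 1)² + κ |γ + ρ|²
  1≲γ+κρ : ∀ {κ} → 2ℚ ℚ.≤ κ → 1ℝ ≲ normSq (γ +ᶜ fromℝ (fromℚ κ) *ᶜ ρ)
  1≲γ+κρ {κ} 2≤κ = ≲-from {1ℝ} ((fromℚ κ - fromℚ 2ℚ) * fromℚ κ + fromℚ κ * normSq (γ +ᶜ ρ))
    (0≲+ (0≲* (pointwise-≲ λ _ → Rational.≤⇒0≤- 2≤κ) (fromℚ-mono 0≤κ)) (0≲* (fromℚ-mono 0≤κ) (0≲normSq (γ +ᶜ ρ))))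
    (≃-sym (≃-trans (simplify (fromℚ κ) normSq-γ normSq-ρ (normSq-γ+κρ (fromℚ κ)))
      (solve 2 (λ k p → con 1ℚ :+ k :* k :* con 1ℚ :+ k :* (p :- con 1ℚ :- con 1ℚ)
        := con 1ℚ :+ ((k :- con 2ℚ) :* k :+ k :* p)) ≃-refl (fromℚ κ) (normSq (γ +ᶜ ρ)))))
    where
    0≤κ : 0ℚ ℚ.≤ κ
    0≤κ = ℚ.≤-trans (ℚ.nonNegative⁻¹ 2ℚ) 2≤κ

  form : ℚ → ℂ
  form c = Y *ᶜ Y +ᶜ X *ᶜ X +ᶜ (fromℚᶜ c +ᶜ fromℚᶜ c) *ᶜ (X *ᶜ Y)

  abstract
    -- At c = 1 the form is the square of X + Y = β + (γ - 2ρ), and |γ - 2ρ| ≥ 1 outweighs |β| =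
    -- 1/√n.
    positive-form-1 : Positive (normSq (form 1ℚ))
    positive-form-1 = positive-cong (≃-sym (≃-trans (normSq-cong (≃ᶜ-trans (form-1 X Y) (*ᶜ-cong (X+Y β γ ρ) (X+Y β γ ρ)))) (normSq-* z z))) (positive-* h h)
      where
      z : ℂ
      z = β +ᶜ (γ +ᶜ fromℝ (fromℚ (ℚ.- 2ℚ)) *ᶜ ρ)
      h : Positive (normSq z)
      h = positive-β+ (γ +ᶜ fromℝ (fromℚ (ℚ.- 2ℚ)) *ᶜ ρ) 1≲γ-2ρ

    -- At c = -1 the form is the square of Y - X = β - γ, with |γ| = 1 against |β| = 1/√n.
    positive-form-−1 : Positive (normSq (form (ℚ.- 1ℚ)))
    positive-form-−1 = positive-cong (≃-sym (≃-trans (normSq-cong (≃ᶜ-trans (form-−1 X Y) (*ᶜ-cong (Y-X β γ ρ) (Y-X β γ ρ)))) (normSq-* z z))) (positive-* h h)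
      where
      z : ℂ
      z = β +ᶜ fromℚᶜ (ℚ.- 1ℚ) *ᶜ γ
      h : Positive (normSq z)
      h = positive-β+ (fromℚᶜ (ℚ.- 1ℚ) *ᶜ γ) (≃⇒≲ (≃-sym (≃-trans (normSq-* (fromℚᶜ (ℚ.- 1ℚ)) γ)
        (≃-trans (*-cong (normSq-fromℝ (fromℚ (ℚ.- 1ℚ))) normSq-γ) (solve 0 (con (ℚ.- 1ℚ) :* con (ℚ.- 1ℚ) :* con 1ℚ := con 1ℚ) ≃-refl)))))

    -- The form at Re θ factors as (Y + X θ̄)(Y + X θ), so a positive lower bound for its modulus
    -- passes to the second factor.
    positive-entry : ∀ θ c → normSq θ ≃ 1ℝ → re θ ≃ fromℚ c → Positive (normSq (form c)) → Positive (normSq (Y +ᶜ X *ᶜ θ))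
    positive-entry θ c ∣θ∣≡1 θ≃c h = positive-factor {normSq (Y +ᶜ X *ᶜ conj θ)} {normSq (Y +ᶜ X *ᶜ θ)}
      (positive-cong (≃-trans (normSq-cong (≃ᶜ-sym (form-factor X Y θ (conj θ) (fromℚᶜ c)
          (≃ᶜ-trans (ℂ-Ring.*-comm (conj θ) θ) (≃ᶜ-trans (z*conj θ) (fromℝ-cong ∣θ∣≡1)))
          (mk≃ᶜ (+-cong θ≃c θ≃c) (≃-trans (ℝ-Ring.-‿inverseʳ (im θ)) (≃-sym (ℝ-Ring.+-identityˡ 0ℝ))))))) (normSq-* (Y +ᶜ X *ᶜ conj θ) (Y +ᶜ X *ᶜ θ))) h)
      (0≲normSq (Y +ᶜ X *ᶜ θ))

    -- form is affine in c and does not vanish at 1, hence it vanishes at most once.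
    form-separates : ∀ c c′ → c′ ℚ.< c → Positive (normSq (form c)) ⊎ Positive (normSq (form c′))
    form-separates c c′ c′<c = case-split (positive-split {fromℚ 2ℚ * normSq z} {fromℚ 2ℚ * normSq z′}
        (positive-mono positive-form-1 (≲-trans (≃⇒≲ (normSq-cong (≃ᶜ-sym (form-affine X Y (fromℚᶜ c) (fromℚᶜ c′) (fromℚᶜ l) affine)))) triangle)))
      where
      ρ′ : ∃[ ρ′ ] (0ℚ ℚ.< ρ′ × (c ℚ.- c′) ℚ.* ρ′ ≡ 1ℚ)
      ρ′ = Rational.reciprocal (c ℚ.- c′) (Rational.<⇒0<- c′<c)
      l : ℚ
      l = (1ℚ ℚ.- c′) ℚ.* proj₁ ρ′
      affine : fromℚᶜ l *ᶜ fromℚᶜ c +ᶜ (fromℚᶜ 1ℚ -ᶜ fromℚᶜ l) *ᶜ fromℚᶜ c′ ≃ᶜ fromℚᶜ 1ℚ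
      affine = mk≃ᶜ
        (≃-trans (solve 3 (λ l c d → (l :* c :- con 0ℚ :* con 0ℚ) :+ ((con 1ℚ :- l) :* d :- (con 0ℚ :- con 0ℚ) :* con 0ℚ) := l :* c :+ (con 1ℚ :- l) :* d)
            ≃-refl (fromℚ l) (fromℚ c) (fromℚ c′))
          (pointwise λ _ → ≡.trans
            (Q.solve 3 (λ c d r → (Q.con 1ℚ Q.:- d) Q.:* r Q.:* c Q.:+ (Q.con 1ℚ Q.:- (Q.con 1ℚ Q.:- d) Q.:* r) Q.:* d
              Q.:= d Q.:+ (Q.con 1ℚ Q.:- d) Q.:* ((c Q.:- d) Q.:* r)) refl c c′ (proj₁ ρ′))
            (≡.trans (cong (λ x → c′ ℚ.+ (1ℚ ℚ.- c′) ℚ.* x) (proj₂ (proj₂ ρ′)))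
              (Q.solve 1 (λ d → d Q.:+ (Q.con 1ℚ Q.:- d) Q.:* Q.con 1ℚ Q.:= Q.con 1ℚ) refl c′))))
        (solve 3 (λ l c d → (l :* con 0ℚ :+ con 0ℚ :* c) :+ ((con 1ℚ :- l) :* con 0ℚ :+ (con 0ℚ :- con 0ℚ) :* d) := con 0ℚ)
          ≃-refl (fromℚ l) (fromℚ c) (fromℚ c′))
      z z′ : ℂ
      z = fromℚᶜ l *ᶜ form c
      z′ = (fromℚᶜ 1ℚ -ᶜ fromℚᶜ l) *ᶜ form c′
      triangle : normSq (z +ᶜ z′) ≲ fromℚ 2ℚ * normSq z + fromℚ 2ℚ * normSq z′
      triangle = ≲-from {normSq (z +ᶜ z′)} (normSq (z -ᶜ z′)) (0≲normSq (z -ᶜ z′))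
        (≃-trans (parallelogram z z′) (ℝ-Ring.distribˡ (fromℚ 2ℚ) (normSq z) (normSq z′)))
      factor-out : ∀ k f → Positive (fromℚ 2ℚ * normSq (k *ᶜ f)) → Positive (normSq f)
      factor-out k f h = positive-factor {fromℚ 2ℚ * normSq k} {normSq f}
        (positive-cong (≃-trans (*-congˡ {fromℚ 2ℚ} (normSq-* k f)) (≃-sym (ℝ-Ring.*-assoc (fromℚ 2ℚ) (normSq k) (normSq f)))) h) (0≲normSq f)
      case-split : Positive (fromℚ 2ℚ * normSq z) ⊎ Positive (fromℚ 2ℚ * normSq z′) → Positive (normSq (form c)) ⊎ Positive (normSq (form c′))
      case-split (inj₁ h) = inj₁ (factor-out (fromℚᶜ l) (form c) h)
      case-split (inj₂ h) = inj₂ (factor-out (fromℚᶜ 1ℚ -ᶜ fromℚᶜ l) (form c′) h)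

-- All entries of the evolution operator are apart from zero, and its columns are unit vectors.

module Columns (m : ℕ) .{{m≢0 : NonZero m}} (4≤m : 4 ℕ.≤ m) (v : Fin m → ℂ) (∣v∣≡1 : ∀ k → normSq (v k) ≃ 1ℝ) (∑v≡0 : sumᶜ v ≃ᶜ 0ᶜ)
  (nonvanishing : ∀ i u → i ≢ u → Positive (normSq (Phases.Y m +ᶜ Phases.X m *ᶜ (v i *ᶜ conj (v u))))) where
  open Evolution m v ∣v∣≡1 ∑v≡0 public
  open NonVanishing m 4≤m
  open ℂ-Identities

  private
    N : ℕ
    N = suc m
    ι⁻¹ r : ℝ
    ι⁻¹ = fromℚ (inv m)
    r = recip N

    θ-diagonal : ∀ u → θ u u ≃ᶜ 1ᶜ
    θ-diagonal u = ≃ᶜ-trans (z*conj (v u)) (fromℝ-cong (∣v∣≡1 u))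

    normSq-θ : ∀ i u → normSq (θ i u) ≃ 1ℝ
    normSq-θ i u = ≃-trans (normSq-* (v i) (conj (v u))) (≃-trans (*-cong (∣v∣≡1 i)
      (≃-trans (solve 2 (λ a b → a :* a :+ (:- b) :* (:- b) := a :* a :+ b :* b) ≃-refl (re (v u)) (im (v u))) (∣v∣≡1 u)))
      (ℝ-Ring.*-identityˡ 1ℝ))

    ∑θ : ∀ u → sumᶜ (λ i → θ i u) ≃ᶜ 0ᶜ
    ∑θ u = ≃ᶜ-trans (sumᶜ-*ʳ (conj (v u)) v) (≃ᶜ-trans (*ᶜ-congʳ (conj (v u)) ∑v≡0) (ℂ-Ring.zeroˡ (conj (v u))))

    U-off : ∀ i u → i ≢ u → normSq (U (suc i) (suc u)) ≃ normSq (I *ᶜ (Y +ᶜ X *ᶜ θ i u))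
    U-off i u i≢u = normSq-cong (≃ᶜ-trans (U-suc i u) (≃ᶜ-trans (+ᶜ-cong (≃ᶜ-refl {I *ᶜ (Y +ᶜ X *ᶜ θ i u)}) (≡⇒ (cong (ρ *ᶜ_) (e-off u i i≢u))))
      (off-diagonal (I *ᶜ (Y +ᶜ X *ᶜ θ i u)) ρ)))
      where
      ≡⇒ : ∀ {z w} → z ≡ w → z ≃ᶜ w
      ≡⇒ refl = ≃ᶜ-refl

    U-diagonal : ∀ u → U (suc u) (suc u) ≃ᶜ I *ᶜ (Y +ᶜ X *ᶜ 1ᶜ) +ᶜ ρ *ᶜ 1ᶜ
    U-diagonal u = ≃ᶜ-trans (U-suc u u) (+ᶜ-cong (*ᶜ-congˡ I (+ᶜ-cong (≃ᶜ-refl {Y}) (*ᶜ-congˡ X (θ-diagonal u)))) (≡⇒ (cong (ρ *ᶜ_) (e-diagonal u))))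
      where
      ≡⇒ : ∀ {z w} → z ≡ w → z ≃ᶜ w
      ≡⇒ refl = ≃ᶜ-refl

    μι⁻¹ : μ * ι⁻¹ ≃ 1ℝ
    μι⁻¹ = pointwise λ _ → ≡.trans (ℚ.*-comm (ι m) (inv m)) (Rational.inv-inverse m)

    MI : fromℚᶜ (ι m) *ᶜ I ≃ᶜ 1ᶜ
    MI = ≃ᶜ-trans (≃ᶜ-sym (fromℝ-* μ ι⁻¹)) (fromℝ-cong μι⁻¹)

    positive-ι⁻¹² : Positive (ι⁻¹ * ι⁻¹)
    positive-ι⁻¹² = positive-* (positive-fromℚ (Rational.0<inv m)) (positive-fromℚ (Rational.0<inv m))

    normSq-I : ∀ z → normSq (I *ᶜ z) ≃ ι⁻¹ * ι⁻¹ * normSq z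
    normSq-I z = ≃-trans (normSq-* I z) (*-cong (normSq-fromℝ ι⁻¹) ≃-refl)

    2≤m-2 : 2ℚ ℚ.≤ ι m ℚ.- 2ℚ
    2≤m-2 = Rational.≤-from {2ℚ} {ι m ℚ.- 2ℚ} (ι m ℚ.- ι 4) (Rational.≤⇒0≤- (Rational.ι-mono 4≤m))
      (≡.trans (cong (λ x → 2ℚ ℚ.+ (ι m ℚ.- x)) (Rational.ι≡ 4))
        (Q.solve 1 (λ m → Q.con 2ℚ Q.:+ (m Q.:- Q.con (2ℚ ℚ.+ 2ℚ)) Q.:= m Q.:- Q.con 2ℚ) refl (ι m)))

    positive-r : Positive r
    positive-r = positive-cong (≃-sym (recip≃ N)) (positive-fromℚ (Rational.0<inv N))

  abstract
    positive-U : ∀ a b → Positive (normSq (U a b))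
    positive-U zero    zero    = positive-cong (≃-sym U-00) positive-r
    positive-U zero    (suc u) = positive-cong (≃-sym (U-0suc u)) positive-r
    positive-U (suc i) zero    = positive-cong (≃-sym (U-suc0 i)) positive-r
    positive-U (suc i) (suc u) with i Fin.≟ u
    ... | no i≢u   = positive-cong (≃-sym (≃-trans (U-off i u i≢u) (normSq-I (Y +ᶜ X *ᶜ θ i u)))) (positive-* positive-ι⁻¹² (nonvanishing i u i≢u))
    -- The diagonal entry is (β + γ + (m - 2) ρ)/m. As m - 2 ≥ 2, the sum γ + (m - 2) ρ has modulus
    -- at least 1, and β is too small to cancel it.
    ... | yes refl = positive-cong (≃-sym (≃-trans (normSq-cong entry) (normSq-I (β +ᶜ (γ +ᶜ fromℝ κ *ᶜ ρ)))))
      (positive-* positive-ι⁻¹² (positive-β+ (γ +ᶜ fromℝ κ *ᶜ ρ) (1≲γ+κρ 2≤m-2)))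
      where
      κ : ℝ
      κ = fromℚ (ι m ℚ.- 2ℚ)
      entry : U (suc u) (suc u) ≃ᶜ I *ᶜ (β +ᶜ (γ +ᶜ fromℝ κ *ᶜ ρ))
      entry = ≃ᶜ-trans (U-diagonal u) (≃ᶜ-trans (diagonal I (fromℚᶜ (ι m)) β γ ρ MI) (*ᶜ-congˡ I (+ᶜ-cong (≃ᶜ-refl {β})
        (+ᶜ-cong (≃ᶜ-refl {γ}) (*ᶜ-congʳ ρ (≃ᶜ-sym (fromℚᶜ-+ (ι m) (ℚ.- 2ℚ))))))))

  private
    expand : ∀ z w t → normSq (z +ᶜ w *ᶜ t) ≃ normSq z + normSq w * normSq t + re (fromℚᶜ 2ℚ *ᶜ (conj z *ᶜ w) *ᶜ t)
    expand z w t = solve 6 (λ a b c d e f →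
      (a :+ (c :* e :- d :* f)) :* (a :+ (c :* e :- d :* f)) :+ (b :+ (c :* f :+ d :* e)) :* (b :+ (c :* f :+ d :* e))
      := (a :* a :+ b :* b) :+ (c :* c :+ d :* d) :* (e :* e :+ f :* f)
         :+ ((con 2ℚ :* (a :* c :- (:- b) :* d) :- con 0ℚ :* (a :* d :+ (:- b) :* c)) :* e
            :- (con 2ℚ :* (a :* d :+ (:- b) :* c) :+ con 0ℚ :* (a :* c :- (:- b) :* d)) :* f))
      ≃-refl (re z) (im z) (re w) (im w) (re t) (im t)

    S : ℝ
    S = normSq Y + normSq X

    -- The cross term of |Y + X θ|² is linear in θ, and the θ of one column sum to 0 because the
    -- entries of v do.
    ∑-off : ∀ u → sum (λ i → normSq (I *ᶜ (Y +ᶜ X *ᶜ θ i u))) ≃ ι⁻¹ * S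
    ∑-off u = begin
      sum (λ i → normSq (I *ᶜ (Y +ᶜ X *ᶜ θ i u)))
        ≈⟨ sum-cong (λ i → ≃-trans (normSq-I (Y +ᶜ X *ᶜ θ i u)) (*-congˡ {ι⁻¹ * ι⁻¹} (≃-trans (expand Y X (θ i u))
             (+-cong (+-cong ≃-refl (≃-trans (*-congˡ {normSq X} (normSq-θ i u)) (ℝ-Ring.*-identityʳ (normSq X)))) ≃-refl)))) ⟩
      sum (λ i → ι⁻¹ * ι⁻¹ * (S + re (κ *ᶜ θ i u)))
        ≈⟨ ℝ-Sum.*-distribˡ-sum (ι⁻¹ * ι⁻¹) (λ i → S + re (κ *ᶜ θ i u)) ⟨
      ι⁻¹ * ι⁻¹ * sum (λ i → S + re (κ *ᶜ θ i u))
        ≈⟨ *-congˡ {ι⁻¹ * ι⁻¹} (≃-trans (ℝ-Sum.∑-distrib-+ (λ _ → S) (λ i → re (κ *ᶜ θ i u))) (+-cong (sum-const m S)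
             (≃-trans (≡⇒≃ (≡.sym (re-sum (λ i → κ *ᶜ θ i u)))) (re≃ (≃ᶜ-trans (sumᶜ-*ˡ κ (λ i → θ i u)) (≃ᶜ-trans (*ᶜ-congˡ κ (∑θ u)) (ℂ-Ring.zeroʳ κ))))))) ⟩
      ι⁻¹ * ι⁻¹ * (μ * S + 0ℝ)
        ≈⟨ solve 3 (λ i μ s → i :* i :* (μ :* s :+ con 0ℚ) := (μ :* i) :* (i :* s)) ≃-refl ι⁻¹ μ S ⟩
      (μ * ι⁻¹) * (ι⁻¹ * S)
        ≈⟨ *-cong μι⁻¹ ≃-refl ⟩
      1ℝ * (ι⁻¹ * S)
        ≈⟨ ℝ-Ring.*-identityˡ (ι⁻¹ * S) ⟩
      ι⁻¹ * S ∎
      where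
      open ≃-Reasoning
      κ : ℂ
      κ = fromℚᶜ 2ℚ *ᶜ (conj Y *ᶜ X)
      ≡⇒≃ : ∀ {x y : ℝ} → x ≡ y → x ≃ y
      ≡⇒≃ refl = ≃-refl

    r-identity : r + μ * r ≃ 1ℝ
    r-identity = ≃-trans (+-cong (recip≃ N) (*-congˡ {μ} (recip≃ N))) (pointwise λ _ → ≡.trans
      (≡.trans (Q.solve 2 (λ i m → i Q.:+ m Q.:* i Q.:= i Q.:* (Q.con 1ℚ Q.:+ m)) refl (inv N) (ι m))
        (cong (inv N ℚ.*_) (≡.sym (Rational.ι-suc m)))) (Rational.inv-inverse N))

    inner : ℂ → ℂ → ℝ
    inner z w = re z * re w + im z * im w

    expand-diagonal : ∀ i z w → normSq (fromℝ i *ᶜ z +ᶜ w *ᶜ 1ᶜ) - normSq (fromℝ i *ᶜ z) ≃ normSq w + i * (fromℚ 2ℚ * inner z w)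
    expand-diagonal i z w = ≃-trans (+-cong (normSq-cong {w = ((i * re z) + re w) +i ((i * im z) + im w)}
        (mk≃ᶜ (solve 5 (λ i a b c d → (i :* a :- con 0ℚ :* b) :+ (c :* con 1ℚ :- d :* con 0ℚ) := i :* a :+ c) ≃-refl i (re z) (im z) (re w) (im w))
              (solve 5 (λ i a b c d → (i :* b :+ con 0ℚ :* a) :+ (c :* con 0ℚ :+ d :* con 1ℚ) := i :* b :+ d) ≃-refl i (re z) (im z) (re w) (im w))))
      (-‿cong (normSq-cong {w = (i * re z) +i (i * im z)}
        (mk≃ᶜ (solve 3 (λ i a b → i :* a :- con 0ℚ :* b := i :* a) ≃-refl i (re z) (im z))
              (solve 3 (λ i a b → i :* b :+ con 0ℚ :* a := i :* b) ≃-refl i (re z) (im z))))))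
      (solve 5 (λ i a b c d → ((i :* a :+ c) :* (i :* a :+ c) :+ (i :* b :+ d) :* (i :* b :+ d)) :- ((i :* a) :* (i :* a) :+ (i :* b) :* (i :* b))
        := (c :* c :+ d :* d) :+ i :* (con 2ℚ :* (a :* c :+ b :* d))) ≃-refl i (re z) (im z) (re w) (im w))

    inner-identity : ∀ b g p → normSq (b -ᶜ p) + normSq (g -ᶜ p) + fromℚ 2ℚ * inner ((b -ᶜ p) +ᶜ (g -ᶜ p) *ᶜ 1ᶜ) p
      ≃ normSq b + normSq g - normSq p - normSq p
    inner-identity b g p = solve 6 (λ a b c d e f →
      ((a :- e) :* (a :- e) :+ (b :- f) :* (b :- f)) :+ ((c :- e) :* (c :- e) :+ (d :- f) :* (d :- f))
        :+ con 2ℚ :* (((a :- e) :+ ((c :- e) :* con 1ℚ :- (d :- f) :* con 0ℚ)) :* e :+ ((b :- f) :+ ((c :- e) :* con 0ℚ :+ (d :- f) :* con 1ℚ)) :* f)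
      := (a :* a :+ b :* b) :+ (c :* c :+ d :* d) :- (e :* e :+ f :* f) :- (e :* e :+ f :* f))
      ≃-refl (re b) (im b) (re g) (im g) (re p) (im p)

    -- The sum in `∑-off` omits the summand ρ of the diagonal entry; restoring it changes the
    -- squared norm by |ρ|² and a cross term with X + Y. By `inner-identity` the cross term combines
    -- with |X|² + |Y|² to |β|² + |γ|² - 2|ρ|².
    diagonal-defect : ι⁻¹ * S + (normSq (I *ᶜ (Y +ᶜ X *ᶜ 1ᶜ) +ᶜ ρ *ᶜ 1ᶜ) - normSq (I *ᶜ (Y +ᶜ X *ᶜ 1ᶜ)))
      ≃ ι⁻¹ * (normSq β + normSq γ - normSq ρ - normSq ρ) + normSq ρ
    diagonal-defect = ≃-trans (+-cong (≃-refl {ι⁻¹ * S}) (expand-diagonal ι⁻¹ (Y +ᶜ X *ᶜ 1ᶜ) ρ))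
      (≃-trans (solve 4 (λ i s n k → i :* s :+ (n :+ i :* k) := i :* (s :+ k) :+ n) ≃-refl ι⁻¹ S (normSq ρ) (fromℚ 2ℚ * inner (Y +ᶜ X *ᶜ 1ᶜ) ρ))
        (+-cong (*-congˡ {ι⁻¹} (inner-identity β γ ρ)) ≃-refl))

  abstract
    -- Evaluated from the explicit entries. For a vertex other than 0 the total is r + (r - 1)/m + 1
    -- with r = 1/n, and 1 - r = m r.
    U-column : ∀ b → ‖ (λ a → U a b) ‖² ≃ 1ℝ
    U-column zero = ≃-trans (+-cong U-00 (≃-trans (sum-cong U-suc0) (sum-const m r))) r-identity
    U-column (suc u) = begin
      normSq (U zero (suc u)) + sum (λ i → normSq (U (suc i) (suc u)))
        ≈⟨ +-cong (U-0suc u) (sum-update u (λ i → normSq (U (suc i) (suc u))) (λ i → normSq (I *ᶜ (Y +ᶜ X *ᶜ θ i u))) (λ i → U-off i u)) ⟩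
      r + (sum (λ i → normSq (I *ᶜ (Y +ᶜ X *ᶜ θ i u))) + (normSq (U (suc u) (suc u)) - normSq (I *ᶜ (Y +ᶜ X *ᶜ θ u u))))
        ≈⟨ +-cong ≃-refl (+-cong (∑-off u) (+-cong (normSq-cong (U-diagonal u)) (-‿cong (normSq-cong
             (*ᶜ-congˡ I (+ᶜ-cong (≃ᶜ-refl {Y}) (*ᶜ-congˡ X (θ-diagonal u)))))))) ⟩
      r + (ι⁻¹ * S + (normSq (I *ᶜ (Y +ᶜ X *ᶜ 1ᶜ) +ᶜ ρ *ᶜ 1ᶜ) - normSq (I *ᶜ (Y +ᶜ X *ᶜ 1ᶜ))))
        ≈⟨ +-cong ≃-refl diagonal-defect ⟩
      r + (ι⁻¹ * (normSq β + normSq γ - normSq ρ - normSq ρ) + normSq ρ)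
        ≈⟨ +-cong ≃-refl (+-cong (*-congˡ {ι⁻¹} (+-cong (+-cong (+-cong normSq-β normSq-γ) (-‿cong normSq-ρ)) (-‿cong normSq-ρ))) normSq-ρ) ⟩
      r + (ι⁻¹ * (r + 1ℝ - 1ℝ - 1ℝ) + 1ℝ)
        ≈⟨ solve 2 (λ i r → r :+ (i :* (r :+ con 1ℚ :- con 1ℚ :- con 1ℚ) :+ con 1ℚ) := r :+ i :* (r :- con 1ℚ) :+ con 1ℚ) ≃-refl ι⁻¹ r ⟩
      r + ι⁻¹ * (r - 1ℝ) + 1ℝ
        ≈⟨ +-cong (+-cong ≃-refl (*-congˡ {ι⁻¹} (+-cong ≃-refl (-‿cong (≃-sym r-identity))))) ≃-refl ⟩
      r + ι⁻¹ * (r - (r + μ * r)) + 1ℝ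
        ≈⟨ solve 3 (λ i r μ → r :+ i :* (r :- (r :+ μ :* r)) :+ con 1ℚ := (con 1ℚ :- μ :* i) :* r :+ con 1ℚ) ≃-refl ι⁻¹ r μ ⟩
      (1ℝ - μ * ι⁻¹) * r + 1ℝ
        ≈⟨ +-cong (*-cong (+-cong ≃-refl (-‿cong μι⁻¹)) ≃-refl) ≃-refl ⟩
      (1ℝ - 1ℝ) * r + 1ℝ
        ≈⟨ solve 1 (λ r → (con 1ℚ :- con 1ℚ) :* r :+ con 1ℚ := con 1ℚ) ≃-refl r ⟩
      1ℝ ∎
      where open ≃-Reasoning

≡⇒≃ᶜ : ∀ {z w} → z ≡ w → z ≃ᶜ w
≡⇒≃ᶜ refl = ≃ᶜ-refl

normSq-0 : ∀ {z} → z ≃ᶜ 0ᶜ → normSq z ≃ 0ℝ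
normSq-0 h = ≃-trans (normSq-cong h) (≃-trans (normSq-fromℝ 0ℝ) (ℝ-Ring.zeroˡ 0ℝ))

-- The two projections of a partial measurement and their norms.

module Measurement {N : ℕ} where

  ‖‖²-cong : ∀ {ψ φ : Vector ℂ N} → (∀ w → ψ w ≃ᶜ φ w) → ‖ ψ ‖² ≃ ‖ φ ‖²
  ‖‖²-cong h = sum-cong (λ w → normSq-cong (h w))

  ‖‖²-* : ∀ z (ψ : Vector ℂ N) → ‖ (λ w → z *ᶜ ψ w) ‖² ≃ normSq z * ‖ ψ ‖²
  ‖‖²-* z ψ = ≃-trans (sum-cong (λ w → normSq-* z (ψ w))) (≃-sym (ℝ-Sum.*-distribˡ-sum (normSq z) (λ w → normSq (ψ w))))

  0≲‖‖² : ∀ (ψ : Vector ℂ N) → 0ℝ ≲ ‖ ψ ‖²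
  0≲‖‖² ψ = 0≲sum (λ w → normSq (ψ w)) (λ w → 0≲normSq (ψ w))

  P₁ : ∀ j (ψ : Vector ℂ N) w → (P 1F j *ᵛ ψ) w ≃ᶜ e j w *ᶜ ψ j
  P₁ j ψ w = ≃ᶜ-trans (sumᶜ-cong (λ b → ℂ-Ring.*-assoc (e j w) (e j b) (ψ b)))
    (≃ᶜ-trans (sumᶜ-*ˡ (e j w) (λ b → e j b *ᶜ ψ b)) (*ᶜ-congˡ (e j w) (sumᶜ-e j ψ)))

  P₁-same : ∀ j (ψ : Vector ℂ N) → (P 1F j *ᵛ ψ) j ≃ᶜ ψ j
  P₁-same j ψ = ≃ᶜ-trans (P₁ j ψ j) (≃ᶜ-trans (*ᶜ-congʳ (ψ j) (≡⇒≃ᶜ (e-diagonal j))) (ℂ-Ring.*-identityˡ (ψ j)))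

  P₁-other : ∀ j (ψ : Vector ℂ N) w → w ≢ j → (P 1F j *ᵛ ψ) w ≃ᶜ 0ᶜ
  P₁-other j ψ w w≢j = ≃ᶜ-trans (P₁ j ψ w) (≃ᶜ-trans (*ᶜ-congʳ (ψ j) (≡⇒≃ᶜ (e-off j w w≢j))) (ℂ-Ring.zeroˡ (ψ j)))

  P₀ : ∀ j (ψ : Vector ℂ N) w → (P 0F j *ᵛ ψ) w ≃ᶜ ψ w -ᶜ (P 1F j *ᵛ ψ) w
  P₀ j ψ w = begin
    sumᶜ (λ b → (e w b -ᶜ P 1F j w b) *ᶜ ψ b)
      ≈⟨ sumᶜ-cong (λ b → distribute′ (e w b) (P 1F j w b) (ψ b)) ⟩
    sumᶜ (λ b → e w b *ᶜ ψ b +ᶜ fromℚᶜ (ℚ.- 1ℚ) *ᶜ (P 1F j w b *ᶜ ψ b))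
      ≈⟨ ≃ᶜ-trans (sumᶜ-+ (λ b → e w b *ᶜ ψ b) (λ b → fromℚᶜ (ℚ.- 1ℚ) *ᶜ (P 1F j w b *ᶜ ψ b)))
           (+ᶜ-cong (sumᶜ-e w ψ) (≃ᶜ-trans (sumᶜ-*ˡ (fromℚᶜ (ℚ.- 1ℚ)) (λ b → P 1F j w b *ᶜ ψ b)) (ℂ-Identities.negate _))) ⟩
    ψ w -ᶜ (P 1F j *ᵛ ψ) w ∎
    where
    open ≃ᶜ-Reasoning
    distribute′ : ∀ a b c → (a -ᶜ b) *ᶜ c ≃ᶜ a *ᶜ c +ᶜ fromℚᶜ (ℚ.- 1ℚ) *ᶜ (b *ᶜ c)
    distribute′ = ℂ-Identities.split′

  private
    minus : ∀ {a b c d} → a ≃ᶜ b → c ≃ᶜ d → a -ᶜ c ≃ᶜ b -ᶜ d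
    minus (mk≃ᶜ h k) (mk≃ᶜ h′ k′) = mk≃ᶜ (+-cong h (-‿cong h′)) (+-cong k (-‿cong k′))

  P₀-same : ∀ j (ψ : Vector ℂ N) → (P 0F j *ᵛ ψ) j ≃ᶜ 0ᶜ
  P₀-same j ψ = ≃ᶜ-trans (P₀ j ψ j) (≃ᶜ-trans (minus (≃ᶜ-refl {ψ j}) (P₁-same j ψ))
    (mk≃ᶜ (ℝ-Ring.-‿inverseʳ (re (ψ j))) (ℝ-Ring.-‿inverseʳ (im (ψ j)))))

  P₀-other : ∀ j (ψ : Vector ℂ N) w → w ≢ j → (P 0F j *ᵛ ψ) w ≃ᶜ ψ w
  P₀-other j ψ w w≢j = ≃ᶜ-trans (P₀ j ψ w) (≃ᶜ-trans (minus (≃ᶜ-refl {ψ w}) (P₁-other j ψ w w≢j))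
    (mk≃ᶜ (solve 1 (λ a → a :- con 0ℚ := a) ≃-refl (re (ψ w))) (solve 1 (λ a → a :- con 0ℚ := a) ≃-refl (im (ψ w)))))

  ‖P₁‖² : ∀ j (ψ : Vector ℂ N) → ‖ P 1F j *ᵛ ψ ‖² ≃ normSq (ψ j)
  ‖P₁‖² j ψ = ≃-trans (sum-update j (λ w → normSq ((P 1F j *ᵛ ψ) w)) (λ _ → 0ℝ) (λ w w≢j → normSq-0 (P₁-other j ψ w w≢j)))
    (≃-trans (+-cong (≃-trans (sum-const N 0ℝ) (ℝ-Ring.zeroʳ (fromℚ (ι N)))) (+-cong (normSq-cong (P₁-same j ψ)) ≃-refl))
      (solve 1 (λ x → con 0ℚ :+ (x :- con 0ℚ) := x) ≃-refl (normSq (ψ j))))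

  ‖P₀‖²+‖P₁‖² : ∀ j (ψ : Vector ℂ N) → ‖ P 0F j *ᵛ ψ ‖² + ‖ P 1F j *ᵛ ψ ‖² ≃ ‖ ψ ‖²
  ‖P₀‖²+‖P₁‖² j ψ = ≃-trans (+-cong
    (sum-update j (λ w → normSq ((P 0F j *ᵛ ψ) w)) (λ w → normSq (ψ w)) (λ w w≢j → normSq-cong (P₀-other j ψ w w≢j))) (‖P₁‖² j ψ))
    (≃-trans (+-cong (+-cong (≃-refl {‖ ψ ‖²}) (+-cong (normSq-0 (P₀-same j ψ)) ≃-refl)) ≃-refl)
      (solve 2 (λ s x → s :+ (con 0ℚ :- x) :+ x := s) ≃-refl ‖ ψ ‖² (normSq (ψ j))))

  ‖e‖² : ∀ (u : Fin N) → ‖ e u ‖² ≃ 1ℝ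
  ‖e‖² u = ≃-trans (sum-update u (λ w → normSq (e u w)) (λ _ → 0ℝ) (λ w w≢u → normSq-0 (≡⇒≃ᶜ (e-off u w w≢u))))
    (≃-trans (+-cong (≃-trans (sum-const N 0ℝ) (ℝ-Ring.zeroʳ (fromℚ (ι N)))) (+-cong (normSq-cong (≡⇒≃ᶜ (e-diagonal u))) ≃-refl))
      (solve 0 (con 0ℚ :+ ((con 1ℚ :* con 1ℚ :+ con 0ℚ :* con 0ℚ) :- con 0ℚ) := con 1ℚ) ≃-refl))

-- The stages of the walk, its protocol and its states.

after : ∀ {m} → Fin (suc m) → Maybe (Fin (suc m))
after {zero}  _       = nothing
after {suc m} zero    = just (suc zero)
after {suc m} (suc j) = Maybe.map suc (after j)

after-just : ∀ {m} (j : Fin (suc m)) {k} → after j ≡ just k → toℕ k ≡ suc (toℕ j)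
after-just {suc m} zero    refl = refl
after-just {suc m} (suc j) eq with after j in eq′
after-just {suc m} (suc j) refl | just k = cong suc (after-just j eq′)

after-nothing : ∀ {m} (j : Fin (suc m)) → after j ≡ nothing → toℕ j ≡ m
after-nothing {zero}  zero    refl = refl
after-nothing {suc m} (suc j) eq with after j in eq′
after-nothing {suc m} (suc j) refl | nothing = cong suc (after-nothing j eq′)

data Stage (N : ℕ) : Set where
  -- the state is e_v, up to a phase
  at : (v : Fin N) → Stage N
  -- the walk has evolved from v, and the vertices before j have been measured without success
  spread : (v j : Fin N) → Stage N
  done dead : Stage N

continue : ∀ {m} → Fin (suc m) → Maybe (Fin (suc m)) → Stage (suc m)
continue v (just k) = spread v k
continue v nothing  = dead

-- The stage `dead` collects what happens with probability 0: events that do not fit the action, and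
-- failure at the last vertex after all others have failed.
next : ∀ {m} → Event → Stage (suc m) → Stage (suc m)
next evolved      (at zero)      = done
next evolved      (at (suc k))   = spread (suc k) zero
next (outcome 1F) (spread v j)   = at j
next (outcome 0F) (spread v j)   = continue v (after j)
next _            _              = dead

stage : ∀ {m} → Fin (suc m) → History → Stage (suc m)
stage u []      = at u
stage u (x ∷ h) = next x (stage u h)

record IsMixingStep (m : ℕ) (H : Matrix (suc m)) (t : ℝ) (U : Matrix (suc m)) : Set where
  field
    0≲t         : 0ℝ ≲ t
    exponential : IsExp (λ a b → (0ℝ +i (- t)) *ᶜ H a b) U
    column      : ∀ b → ‖ (λ a → U a b) ‖² ≃ 1ℝ
    nonzero     : ∀ a b → Positive (normSq (U a b))
    row-0       : ∀ b → normSq (U zero b) ≃ recip (suc m)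
    column-0    : ∀ a → normSq (U a zero) ≃ recip (suc m)

module Walk {m : ℕ} {H : Matrix (suc m)} {t : ℝ} {U : Matrix (suc m)} (step : IsMixingStep m H t U) where
  open IsMixingStep step
  open Measurement

  private
    N : ℕ
    N = suc m

  truncate : Fin N → Vector ℂ N → Vector ℂ N
  truncate j ψ w = if does (toℕ j ℕ.≤? toℕ w) then ψ w else 0ᶜ

  truncate-≤ : ∀ j ψ w → toℕ j ℕ.≤ toℕ w → truncate j ψ w ≡ ψ w
  truncate-≤ j ψ w j≤w = cong (λ b → if b then ψ w else 0ᶜ) (dec-true (toℕ j ℕ.≤? toℕ w) j≤w)

  truncate-> : ∀ j ψ w → toℕ w ℕ.< toℕ j → truncate j ψ w ≡ 0ᶜ
  truncate-> j ψ w w<j = cong (λ b → if b then ψ w else 0ᶜ) (dec-false (toℕ j ℕ.≤? toℕ w) (ℕ.<⇒≱ w<j))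

  image : Fin N → Vector ℂ N
  image v w = U w v

  mass : Fin N → Fin N → ℝ
  mass v j = ‖ truncate j (image v) ‖²

  abstract
    -- Every truncation retains the last vertex, and the entry there is apart from 0.
    positive-mass : ∀ v j → Positive (mass v j)
    positive-mass v j = positive-mono (positive-cong (normSq-cong (≡⇒≃ᶜ (≡.sym (truncate-≤ j (image v) (Fin.fromℕ m) j≤m)))) (nonzero (Fin.fromℕ m) v))
      (term≲sum (λ w → normSq (truncate j (image v) w)) (λ w → 0≲normSq (truncate j (image v) w)) (Fin.fromℕ m))
      where
      j≤m : toℕ j ℕ.≤ toℕ (Fin.fromℕ m)
      j≤m = subst (toℕ j ℕ.≤_) (≡.sym (Fin.toℕ-fromℕ m)) (Fin.toℕ≤pred[n] j)

    -- At `zero` nothing has been removed and the column has norm 1. The clause with 1 spares a root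
    -- there, since the state right after an evolution has to be the image itself.
    root scale : Fin N → Fin N → ℝ
    root v zero      = 1ℝ
    root v j@(suc _) = sqrt (mass v j)
    scale v zero      = 1ℝ
    scale v j@(suc _) = proj₁ (reciprocalʳ (positive-sqrt (positive-mass v j)))

    scale-zero : ∀ v → scale v zero ≡ 1ℝ
    scale-zero v = refl

    0≲root : ∀ v j → 0ℝ ≲ root v j
    0≲root v zero    = fromℚ-mono (ℚ.nonNegative⁻¹ 1ℚ)
    0≲root v (suc j) = 0≲sqrt (mass v (suc j))

    0≲scale : ∀ v j → 0ℝ ≲ scale v j
    0≲scale v zero      = fromℚ-mono (ℚ.nonNegative⁻¹ 1ℚ)
    0≲scale v j@(suc _) = proj₂ (proj₂ (reciprocalʳ (positive-sqrt (positive-mass v j))))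

    root² : ∀ v j → root v j * root v j ≃ mass v j
    root² v zero    = ≃-trans (ℝ-Ring.*-identityˡ 1ℝ) (≃-sym (column v))
    root² v (suc j) = sqrt² (positive⇒0≲ (positive-mass v (suc j)))

    root*scale : ∀ v j → root v j * scale v j ≃ 1ℝ
    root*scale v zero      = ℝ-Ring.*-identityˡ 1ℝ
    root*scale v j@(suc _) = proj₁ (proj₂ (reciprocalʳ (positive-sqrt (positive-mass v j))))

    modulus 1/modulus : Fin N → Fin N → ℝ
    modulus a b = sqrt (normSq (U a b))
    1/modulus a b = proj₁ (reciprocalʳ (positive-sqrt (nonzero a b)))

    0≲modulus : ∀ a b → 0ℝ ≲ modulus a b
    0≲modulus a b = 0≲sqrt (normSq (U a b))

    modulus² : ∀ a b → modulus a b * modulus a b ≃ normSq (U a b)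
    modulus² a b = sqrt² (0≲normSq (U a b))

    modulus*1/modulus : ∀ a b → modulus a b * 1/modulus a b ≃ 1ℝ
    modulus*1/modulus a b = proj₁ (proj₂ (reciprocalʳ (positive-sqrt (nonzero a b))))

  scale²*mass : ∀ v j → scale v j * scale v j * mass v j ≃ 1ℝ
  scale²*mass v j = ≃-trans (*-congˡ {scale v j * scale v j} (≃-sym (root² v j)))
    (≃-trans (solve 2 (λ s r → s :* s :* (r :* r) := (r :* s) :* (r :* s)) ≃-refl (scale v j) (root v j))
      (≃-trans (*-cong (root*scale v j) (root*scale v j)) (ℝ-Ring.*-identityˡ 1ℝ)))

  unit : Fin N → Fin N → ℂ
  unit a b = fromℝ (1/modulus a b) *ᶜ U a b

  normSq-unit : ∀ a b → normSq (unit a b) ≃ 1ℝ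
  normSq-unit a b = ≃-trans (normSq-* (fromℝ (1/modulus a b)) (U a b))
    (≃-trans (*-cong (normSq-fromℝ (1/modulus a b)) (≃-sym (modulus² a b)))
      (≃-trans (solve 2 (λ s r → s :* s :* (r :* r) := (r :* s) :* (r :* s)) ≃-refl (1/modulus a b) (modulus a b))
        (≃-trans (*-cong (modulus*1/modulus a b) (modulus*1/modulus a b)) (ℝ-Ring.*-identityˡ 1ℝ))))

  canonical : Stage N → Vector ℂ N
  canonical (at v)       w = e v w
  canonical (spread v j) w = fromℝ (scale v j) *ᶜ truncate j (image v) w
  canonical done         w = image zero w
  canonical dead         w = e zero w

  -- Normalisation divides by a nonnegative real, so a collapse onto j leaves `e j` multiplied by
  -- the phase of `U j v`. Extracting that phase is where a nonzero entry is indispensable. The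
  -- accumulated factor ζ has modulus 1 and affects no probability.
  phase-change : Event → Stage N → ℂ
  phase-change (outcome 1F) (spread v j) = unit j v
  phase-change _            _            = 1ᶜ

  normSq-phase-change : ∀ x s → normSq (phase-change x s) ≃ 1ℝ
  normSq-phase-change evolved      s            = ≃-trans (normSq-fromℝ 1ℝ) (ℝ-Ring.*-identityˡ 1ℝ)
  normSq-phase-change (outcome 0F) s            = ≃-trans (normSq-fromℝ 1ℝ) (ℝ-Ring.*-identityˡ 1ℝ)
  normSq-phase-change (outcome 1F) (at v)       = ≃-trans (normSq-fromℝ 1ℝ) (ℝ-Ring.*-identityˡ 1ℝ)
  normSq-phase-change (outcome 1F) (spread v j) = normSq-unit j v
  normSq-phase-change (outcome 1F) done         = ≃-trans (normSq-fromℝ 1ℝ) (ℝ-Ring.*-identityˡ 1ℝ)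
  normSq-phase-change (outcome 1F) dead         = ≃-trans (normSq-fromℝ 1ℝ) (ℝ-Ring.*-identityˡ 1ℝ)

  vector : ℂ → Stage N → Vector ℂ N
  vector ζ s w = ζ *ᶜ canonical s w

  ‖canonical‖² : ∀ s → ‖ canonical s ‖² ≃ 1ℝ
  ‖canonical‖² (at v)       = ‖e‖² v
  ‖canonical‖² (spread v j) = ≃-trans (‖‖²-* (fromℝ (scale v j)) (truncate j (image v)))
    (≃-trans (*-cong (normSq-fromℝ (scale v j)) ≃-refl) (scale²*mass v j))
  ‖canonical‖² done         = column zero
  ‖canonical‖² dead         = ‖e‖² {N} zero

  ‖vector‖² : ∀ {ζ} → normSq ζ ≃ 1ℝ → ∀ s → ‖ vector ζ s ‖² ≃ 1ℝ
  ‖vector‖² {ζ} h s = ≃-trans (‖‖²-* ζ (canonical s)) (≃-trans (*-cong h (‖canonical‖² s)) (ℝ-Ring.*-identityˡ 1ℝ))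

  act : Stage N → Action N
  act (at v)       = evolve t (un≲ 0≲t)
  act (spread v j) = measure j
  act done         = stop
  act dead         = stop

  private
    U*vector : ∀ ζ v w → (U *ᵛ vector ζ (at v)) w ≃ᶜ ζ *ᶜ U w v
    U*vector ζ v w = ≃ᶜ-trans (sumᶜ-cong (λ b → ≃ᶜ-trans (ℂ-*.x∙yz≈y∙xz (U w b) ζ (e v b)) (*ᶜ-congˡ ζ (ℂ-Ring.*-comm (U w b) (e v b)))))
      (≃ᶜ-trans (sumᶜ-*ˡ ζ (λ b → e v b *ᶜ U w b)) (*ᶜ-congˡ ζ (sumᶜ-e v (λ b → U w b))))

    ζ*1 : ∀ ζ x → (ζ *ᶜ 1ᶜ) *ᶜ x ≃ᶜ ζ *ᶜ x
    ζ*1 ζ x = *ᶜ-congʳ x (ℂ-Ring.*-identityʳ ζ)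

    normalises : ∀ {χ φ : Vector ℂ N} r → 0ℝ ≲ r → r * r ≃ ‖ χ ‖² → (∀ w → fromℝ r *ᶜ φ w ≃ᶜ χ w) → Normalises χ φ
    normalises {χ} {φ} r 0≲r r²≃ h = r , (un≲ 0≲r , un≃ r²≃) , λ w → un≃ᶜ (≃ᶜ-trans (·≃ r (φ w)) (h w))

    success : ∀ ζ → normSq ζ ≃ 1ℝ → ∀ v j → Normalises (P 1F j *ᵛ vector ζ (spread v j)) (vector (ζ *ᶜ unit j v) (at j))
    success ζ ∣ζ∣≡1 v j = normalises {P 1F j *ᵛ vector ζ (spread v j)} {vector (ζ *ᶜ unit j v) (at j)} (scale v j * modulus j v) (0≲* (0≲scale v j) (0≲modulus j v)) norm entries
      where
      ψ : Vector ℂ N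
      ψ = vector ζ (spread v j)
      ψj : ψ j ≃ᶜ ζ *ᶜ (fromℝ (scale v j) *ᶜ U j v)
      ψj = *ᶜ-congˡ ζ (*ᶜ-congˡ (fromℝ (scale v j)) (≡⇒≃ᶜ (truncate-≤ j (image v) j ℕ.≤-refl)))
      norm : scale v j * modulus j v * (scale v j * modulus j v) ≃ ‖ P 1F j *ᵛ ψ ‖²
      norm = ≃-sym (begin
        ‖ P 1F j *ᵛ ψ ‖²
          ≈⟨ ‖P₁‖² j ψ ⟩
        normSq (ψ j)
          ≈⟨ ≃-trans (normSq-cong ψj) (normSq-* ζ (fromℝ (scale v j) *ᶜ U j v)) ⟩
        normSq ζ * normSq (fromℝ (scale v j) *ᶜ U j v)
          ≈⟨ *-cong ∣ζ∣≡1 (≃-trans (normSq-* (fromℝ (scale v j)) (U j v)) (*-cong (normSq-fromℝ (scale v j)) (≃-sym (modulus² j v)))) ⟩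
        1ℝ * (scale v j * scale v j * (modulus j v * modulus j v))
          ≈⟨ solve 2 (λ s r → con 1ℚ :* (s :* s :* (r :* r)) := s :* r :* (s :* r)) ≃-refl (scale v j) (modulus j v) ⟩
        scale v j * modulus j v * (scale v j * modulus j v) ∎)
        where open ≃-Reasoning
      entries : ∀ w → fromℝ (scale v j * modulus j v) *ᶜ ((ζ *ᶜ unit j v) *ᶜ e j w) ≃ᶜ (P 1F j *ᵛ ψ) w
      entries w = begin
        fromℝ (scale v j * modulus j v) *ᶜ ((ζ *ᶜ unit j v) *ᶜ e j w)
          ≈⟨ *ᶜ-congʳ ((ζ *ᶜ unit j v) *ᶜ e j w) (fromℝ-* (scale v j) (modulus j v)) ⟩
        (fromℝ (scale v j) *ᶜ fromℝ (modulus j v)) *ᶜ ((ζ *ᶜ (fromℝ (1/modulus j v) *ᶜ U j v)) *ᶜ e j w)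
          ≈⟨ ℂ-Identities.collapse (fromℝ (scale v j)) (fromℝ (modulus j v)) ζ (fromℝ (1/modulus j v)) (U j v) (e j w) ⟩
        (fromℝ (modulus j v) *ᶜ fromℝ (1/modulus j v)) *ᶜ (e j w *ᶜ (ζ *ᶜ (fromℝ (scale v j) *ᶜ U j v)))
          ≈⟨ *ᶜ-congʳ (e j w *ᶜ (ζ *ᶜ (fromℝ (scale v j) *ᶜ U j v)))
               (≃ᶜ-trans (≃ᶜ-sym (fromℝ-* (modulus j v) (1/modulus j v))) (fromℝ-cong (modulus*1/modulus j v))) ⟩
        1ᶜ *ᶜ (e j w *ᶜ (ζ *ᶜ (fromℝ (scale v j) *ᶜ U j v)))
          ≈⟨ ℂ-Ring.*-identityˡ (e j w *ᶜ (ζ *ᶜ (fromℝ (scale v j) *ᶜ U j v))) ⟩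
        e j w *ᶜ (ζ *ᶜ (fromℝ (scale v j) *ᶜ U j v))
          ≈⟨ *ᶜ-congˡ (e j w) ψj ⟨
        e j w *ᶜ ψ j
          ≈⟨ P₁ j ψ w ⟨
        (P 1F j *ᵛ ψ) w ∎
        where open ≃ᶜ-Reasoning

    failure-entries : ∀ ζ v j k → toℕ k ≡ suc (toℕ j) → ∀ w →
      (P 0F j *ᵛ vector ζ (spread v j)) w ≃ᶜ ζ *ᶜ (fromℝ (scale v j) *ᶜ truncate k (image v) w)
    failure-entries ζ v j k k≡1+j w = by-cases (w Fin.≟ j)
      where
      same : w ≢ j → truncate j (image v) w ≡ truncate k (image v) w
      same w≢j with ℕ.<-cmp (toℕ w) (toℕ j)
      ... | tri< w<j _ _ = ≡.trans (truncate-> j (image v) w w<j)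
        (≡.sym (truncate-> k (image v) w (subst (toℕ w ℕ.<_) (≡.sym k≡1+j) (ℕ.m<n⇒m<1+n w<j))))
      ... | tri≈ _ w≡j _ = ⊥-elim (w≢j (Fin.toℕ-injective w≡j))
      ... | tri> _ _ j<w = ≡.trans (truncate-≤ j (image v) w (ℕ.<⇒≤ j<w))
        (≡.sym (truncate-≤ k (image v) w (subst (ℕ._≤ toℕ w) (≡.sym k≡1+j) j<w)))
      by-cases : Dec (w ≡ j) → (P 0F j *ᵛ vector ζ (spread v j)) w ≃ᶜ ζ *ᶜ (fromℝ (scale v j) *ᶜ truncate k (image v) w)
      by-cases (yes refl) = ≃ᶜ-trans (P₀-same j (vector ζ (spread v j))) (≃ᶜ-sym
        (≃ᶜ-trans (*ᶜ-congˡ ζ (≃ᶜ-trans (*ᶜ-congˡ (fromℝ (scale v j)) (≡⇒≃ᶜ (truncate-> k (image v) j (subst (toℕ j ℕ.<_) (≡.sym k≡1+j) ℕ.≤-refl))))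
          (ℂ-Ring.zeroʳ (fromℝ (scale v j))))) (ℂ-Ring.zeroʳ ζ)))
      by-cases (no w≢j) = ≃ᶜ-trans (P₀-other j (vector ζ (spread v j)) w w≢j)
        (*ᶜ-congˡ ζ (*ᶜ-congˡ (fromℝ (scale v j)) (≡⇒≃ᶜ (same w≢j))))

    failure : ∀ ζ → normSq ζ ≃ 1ℝ → ∀ v j k → toℕ k ≡ suc (toℕ j) →
      Normalises (P 0F j *ᵛ vector ζ (spread v j)) (vector (ζ *ᶜ 1ᶜ) (spread v k))
    failure ζ ∣ζ∣≡1 v j k k≡1+j = normalises {P 0F j *ᵛ vector ζ (spread v j)} {vector (ζ *ᶜ 1ᶜ) (spread v k)} (scale v j * root v k) (0≲* (0≲scale v j) (0≲root v k)) norm entries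
      where
      norm : scale v j * root v k * (scale v j * root v k) ≃ ‖ P 0F j *ᵛ vector ζ (spread v j) ‖²
      norm = ≃-sym (begin
        ‖ P 0F j *ᵛ vector ζ (spread v j) ‖²
          ≈⟨ ‖‖²-cong (failure-entries ζ v j k k≡1+j) ⟩
        ‖ (λ w → ζ *ᶜ (fromℝ (scale v j) *ᶜ truncate k (image v) w)) ‖²
          ≈⟨ ‖‖²-* ζ (λ w → fromℝ (scale v j) *ᶜ truncate k (image v) w) ⟩
        normSq ζ * ‖ (λ w → fromℝ (scale v j) *ᶜ truncate k (image v) w) ‖²
          ≈⟨ *-cong ∣ζ∣≡1 (≃-trans (‖‖²-* (fromℝ (scale v j)) (truncate k (image v))) (*-cong (normSq-fromℝ (scale v j)) (≃-sym (root² v k)))) ⟩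
        1ℝ * (scale v j * scale v j * (root v k * root v k))
          ≈⟨ solve 2 (λ s r → con 1ℚ :* (s :* s :* (r :* r)) := s :* r :* (s :* r)) ≃-refl (scale v j) (root v k) ⟩
        scale v j * root v k * (scale v j * root v k) ∎)
        where open ≃-Reasoning
      entries : ∀ w → fromℝ (scale v j * root v k) *ᶜ ((ζ *ᶜ 1ᶜ) *ᶜ (fromℝ (scale v k) *ᶜ truncate k (image v) w)) ≃ᶜ (P 0F j *ᵛ vector ζ (spread v j)) w
      entries w = begin
        fromℝ (scale v j * root v k) *ᶜ ((ζ *ᶜ 1ᶜ) *ᶜ (fromℝ (scale v k) *ᶜ τ))
          ≈⟨ *ᶜ-cong (fromℝ-* (scale v j) (root v k)) (ζ*1 ζ (fromℝ (scale v k) *ᶜ τ)) ⟩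
        (fromℝ (scale v j) *ᶜ fromℝ (root v k)) *ᶜ (ζ *ᶜ (fromℝ (scale v k) *ᶜ τ))
          ≈⟨ ℂ-Identities.rescale (fromℝ (scale v j)) (fromℝ (root v k)) ζ (fromℝ (scale v k)) τ ⟩
        (fromℝ (root v k) *ᶜ fromℝ (scale v k)) *ᶜ (ζ *ᶜ (fromℝ (scale v j) *ᶜ τ))
          ≈⟨ *ᶜ-congʳ (ζ *ᶜ (fromℝ (scale v j) *ᶜ τ)) (≃ᶜ-trans (≃ᶜ-sym (fromℝ-* (root v k) (scale v k))) (fromℝ-cong (root*scale v k))) ⟩
        1ᶜ *ᶜ (ζ *ᶜ (fromℝ (scale v j) *ᶜ τ))
          ≈⟨ ℂ-Ring.*-identityˡ (ζ *ᶜ (fromℝ (scale v j) *ᶜ τ)) ⟩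
        ζ *ᶜ (fromℝ (scale v j) *ᶜ τ)
          ≈⟨ failure-entries ζ v j k k≡1+j w ⟨
        (P 0F j *ᵛ vector ζ (spread v j)) w ∎
        where
        open ≃ᶜ-Reasoning
        τ : ℂ
        τ = truncate k (image v) w

  abstract
    P₀-last : ∀ ζ v j → after j ≡ nothing → ∀ w → (P 0F j *ᵛ vector ζ (spread v j)) w ≃ᶜ 0ᶜ
    P₀-last ζ v j eq w = by-cases (w Fin.≟ j)
      where
      w<j : w ≢ j → toℕ w ℕ.< toℕ j
      w<j w≢j = ℕ.≤∧≢⇒< (subst (toℕ w ℕ.≤_) (≡.sym (after-nothing j eq)) (Fin.toℕ≤pred[n] w)) (w≢j ∘ Fin.toℕ-injective)
      by-cases : Dec (w ≡ j) → (P 0F j *ᵛ vector ζ (spread v j)) w ≃ᶜ 0ᶜ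
      by-cases (yes refl) = P₀-same j (vector ζ (spread v j))
      by-cases (no w≢j) = ≃ᶜ-trans (P₀-other j (vector ζ (spread v j)) w w≢j)
        (≃ᶜ-trans (*ᶜ-congˡ ζ (≃ᶜ-trans (*ᶜ-congˡ (fromℝ (scale v j)) (≡⇒≃ᶜ (truncate-> j (image v) w (w<j w≢j)))) (ℂ-Ring.zeroʳ (fromℝ (scale v j))))) (ℂ-Ring.zeroʳ ζ))

    ‖P₀-last‖² : ∀ ζ v j → after j ≡ nothing → ‖ P 0F j *ᵛ vector ζ (spread v j) ‖² ≃ 0ℝ
    ‖P₀-last‖² ζ v j eq = ≃-trans (sum-cong (λ w → normSq-0 (P₀-last ζ v j eq w))) (≃-trans (sum-const N 0ℝ) (ℝ-Ring.zeroʳ (fromℚ (ι N))))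

    transition′ : ∀ ζ → normSq ζ ≃ 1ℝ → ∀ x s →
      Transition H (act s) x (vector ζ s) (vector (ζ *ᶜ phase-change x s) (next x s))
    transition′ ζ h evolved (at zero) = U , exponential , λ w →
      un≃ᶜ (≃ᶜ-trans (ζ*1 ζ (U w zero)) (≃ᶜ-sym (U*vector ζ zero w)))
    transition′ ζ h evolved (at (suc k)) = U , exponential , λ w → un≃ᶜ (begin
      (ζ *ᶜ 1ᶜ) *ᶜ (fromℝ (scale (suc k) zero) *ᶜ U w (suc k))
        ≈⟨ ζ*1 ζ (fromℝ (scale (suc k) zero) *ᶜ U w (suc k)) ⟩
      ζ *ᶜ (fromℝ (scale (suc k) zero) *ᶜ U w (suc k))
        ≈⟨ *ᶜ-congˡ ζ (*ᶜ-congʳ (U w (suc k)) (≡⇒≃ᶜ (cong fromℝ (scale-zero (suc k))))) ⟩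
      ζ *ᶜ (1ᶜ *ᶜ U w (suc k))
        ≈⟨ *ᶜ-congˡ ζ (ℂ-Ring.*-identityˡ (U w (suc k))) ⟩
      ζ *ᶜ U w (suc k)
        ≈⟨ U*vector ζ (suc k) w ⟨
      (U *ᵛ vector ζ (at (suc k))) w ∎)
      where open ≃ᶜ-Reasoning
    transition′ ζ h (outcome 0F) (at v) = tt
    transition′ ζ h (outcome 1F) (at v) = tt
    transition′ ζ h evolved (spread v j) = tt
    transition′ ζ h (outcome 1F) (spread v j) = success ζ h v j
    transition′ ζ h (outcome 0F) (spread v j) = by-cases (after j) refl
      where
      by-cases : ∀ k → after j ≡ k → Normalises (P 0F j *ᵛ vector ζ (spread v j)) (vector (ζ *ᶜ 1ᶜ) (continue v k))
      by-cases (just k) eq = failure ζ h v j k (after-just j eq)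
      -- The projected vector is 0, so the norm r = 0 is compatible with any state, here the dummy
      -- one of `dead`.
      by-cases nothing  eq = normalises {P 0F j *ᵛ vector ζ (spread v j)} {vector (ζ *ᶜ 1ᶜ) dead} 0ℝ ≲-refl (≃-trans (ℝ-Ring.zeroˡ 0ℝ) (≃-sym (‖P₀-last‖² ζ v j eq)))
        (λ w → ≃ᶜ-trans (ℂ-Ring.zeroˡ (vector (ζ *ᶜ 1ᶜ) dead w)) (≃ᶜ-sym (P₀-last ζ v j eq w)))
    transition′ ζ h evolved      done = tt
    transition′ ζ h (outcome _)  done = tt
    transition′ ζ h evolved      dead = tt
    transition′ ζ h (outcome _)  dead = tt

  module Start (u : Fin N) where

    protocol : Protocol N
    protocol h = act (stage u h)

    ζ : History → ℂ
    ζ []      = 1ᶜ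
    ζ (x ∷ h) = ζ h *ᶜ phase-change x (stage u h)

    normSq-ζ : ∀ h → normSq (ζ h) ≃ 1ℝ
    normSq-ζ []      = ≃-trans (normSq-fromℝ 1ℝ) (ℝ-Ring.*-identityˡ 1ℝ)
    normSq-ζ (x ∷ h) = ≃-trans (normSq-* (ζ h) (phase-change x (stage u h)))
      (≃-trans (*-cong (normSq-ζ h) (normSq-phase-change x (stage u h))) (ℝ-Ring.*-identityˡ 1ℝ))

    run : Run H protocol u
    run = record
      { state      = λ h → vector (ζ h) (stage u h)
      ; isState    = λ h → un≃ (‖vector‖² (normSq-ζ h) (stage u h))
      ; start      = λ v → un≃ᶜ (ℂ-Ring.*-identityˡ (e u v))
      ; transition = λ x h → transition′ (ζ h) (normSq-ζ h) x (stage u h)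
      }

-- Sums over histories and telescoping series.

module Histories where

  sumHistories-cong : ∀ k {f g : History → ℝ} → (∀ h → f h ≃ g h) → sumHistories k f ≃ sumHistories k g
  sumHistories-cong zero    h = h []
  sumHistories-cong (suc k) h = sumHistories-cong k (λ l → +-cong (+-cong (h _) (h _)) (h _))

  sumHistories-mono : ∀ k {f g : History → ℝ} → (∀ h → length h ≡ k → f h ≲ g h) → sumHistories k f ≲ sumHistories k g
  sumHistories-mono zero    h = h [] refl
  sumHistories-mono (suc k) h = sumHistories-mono k
    (λ l eq → +-mono (+-mono (h (evolved ∷ l) (cong suc eq)) (h (outcome 0F ∷ l) (cong suc eq))) (h (outcome 1F ∷ l) (cong suc eq)))

  sumHistories-+ : ∀ k (f g : History → ℝ) → sumHistories k (λ h → f h + g h) ≃ sumHistories k f + sumHistories k g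
  sumHistories-+ zero    f g = ≃-refl
  sumHistories-+ (suc k) f g = ≃-trans (sumHistories-cong k (λ h →
      solve 6 (λ a b c d e f → (a :+ b) :+ (c :+ d) :+ (e :+ f) := (a :+ c :+ e) :+ (b :+ d :+ f)) ≃-refl
        (f (evolved ∷ h)) (g (evolved ∷ h)) (f (outcome 0F ∷ h)) (g (outcome 0F ∷ h)) (f (outcome 1F ∷ h)) (g (outcome 1F ∷ h))))
    (sumHistories-+ k (λ h → f (evolved ∷ h) + f (outcome 0F ∷ h) + f (outcome 1F ∷ h))
                      (λ h → g (evolved ∷ h) + g (outcome 0F ∷ h) + g (outcome 1F ∷ h)))

  sumHistories-* : ∀ k c (f : History → ℝ) → sumHistories k (λ h → c * f h) ≃ c * sumHistories k f
  sumHistories-* zero    c f = ≃-refl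
  sumHistories-* (suc k) c f = ≃-trans (sumHistories-cong k (λ h →
      solve 4 (λ c a b d → c :* a :+ c :* b :+ c :* d := c :* (a :+ b :+ d)) ≃-refl
        c (f (evolved ∷ h)) (f (outcome 0F ∷ h)) (f (outcome 1F ∷ h))))
    (sumHistories-* k c (λ h → f (evolved ∷ h) + f (outcome 0F ∷ h) + f (outcome 1F ∷ h)))

  0≲sumHistories : ∀ k {f : History → ℝ} → (∀ h → 0ℝ ≲ f h) → 0ℝ ≲ sumHistories k f
  0≲sumHistories zero    h = h []
  0≲sumHistories (suc k) h = 0≲sumHistories k (λ l → 0≲+ (0≲+ (h (evolved ∷ l)) (h (outcome 0F ∷ l))) (h (outcome 1F ∷ l)))

  telescope : ∀ (f g : ℕ → ℝ) → (∀ k → f k + g (suc k) ≃ g k) → ∀ m → series f m + g m ≃ g 0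
  telescope f g h zero    = ℝ-Ring.+-identityˡ (g 0)
  telescope f g h (suc m) = ≃-trans (ℝ-Ring.+-assoc (f 0) (series (f ∘ suc) m) (g (suc m)))
    (≃-trans (+-cong (≃-refl {f 0}) (telescope (f ∘ suc) (g ∘ suc) (h ∘ suc) m)) (h 0))

  telescope-⇝ : ∀ (f g : ℕ → ℝ) → (∀ k → f k + g (suc k) ≃ g k) → (∀ k → 0ℝ ≲ g k) →
    (∀ ε → 0ℚ ℚ.< ε → ∃[ N ] (∀ k → N ℕ.≤ k → g k ≲ fromℚ ε)) → series f ⇝ g 0
  telescope-⇝ f g h 0≲g small = mk⇝ λ ε 0<ε → let N , hN = small ε 0<ε in
    N , λ k N≤k →
      ≲-trans (≲-from {series f k} (g k) (0≲g k) (telescope f g h k))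
        (≲-from {g 0} (fromℚ ε) (fromℚ-mono (ℚ.<⇒≤ 0<ε)) ≃-refl) ,
      ≲-trans (≃⇒≲ (≃-sym (telescope f g h k))) (+-mono (≲-refl {series f k}) (hN k N≤k))

  module _ {N} {H : Matrix N} {π : Protocol N} {u : Fin N} (ρ : Run H π u) where
    open Run ρ

    stopProb-stop : ∀ h → π h ≡ stop → stopProb h ≡ prob h
    stopProb-stop h eq with π h
    stopProb-stop h refl | stop = refl

    stopProb-evolve : ∀ h {t p} → π h ≡ evolve t p → stopProb h ≡ 0ℝ
    stopProb-evolve h eq with π h
    stopProb-evolve h refl | evolve _ _ = refl

    stopProb-measure : ∀ h {a} → π h ≡ measure a → stopProb h ≡ 0ℝ
    stopProb-measure h eq with π h
    stopProb-measure h refl | measure _ = refl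

open Histories

≡⇒≃ : ∀ {x y : ℝ} → x ≡ y → x ≃ y
≡⇒≃ refl = ≃-refl

-- Stopping probability and expected time, by potential functions.

module Expectation {m : ℕ} .{{_ : NonZero m}} {H : Matrix (suc m)} {t : ℝ} {U : Matrix (suc m)} (step : IsMixingStep m H t U) where
  open IsMixingStep step
  open Walk step
  open Measurement

  private
    N : ℕ
    N = suc m

  ∑ₑ : (Event → ℝ) → ℝ
  ∑ₑ f = f evolved + f (outcome 0F) + f (outcome 1F)

  abstract
    -- An opaque copy of `eventProb`, so that the norms inside do not unfold in the calculations
    -- with probabilities.
    p : ℂ → Stage N → Event → ℝ
    p ζ s x = eventProb (act s) (vector ζ s) x

    p≡ : ∀ ζ s x → eventProb (act s) (vector ζ s) x ≡ p ζ s x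
    p≡ ζ s x = refl

    ∑ₑ-at : ∀ ζ v (f : Event → ℝ) → ∑ₑ (λ x → p ζ (at v) x * f x) ≃ f evolved
    ∑ₑ-at ζ v f = solve 3 (λ a b c → con 1ℚ :* a :+ con 0ℚ :* b :+ con 0ℚ :* c := a) ≃-refl (f evolved) (f (outcome 0F)) (f (outcome 1F))

    ∑ₑ-done : ∀ ζ (f : Event → ℝ) → ∑ₑ (λ x → p ζ done x * f x) ≃ 0ℝ
    ∑ₑ-done ζ f = solve 3 (λ a b c → con 0ℚ :* a :+ con 0ℚ :* b :+ con 0ℚ :* c := con 0ℚ) ≃-refl (f evolved) (f (outcome 0F)) (f (outcome 1F))

    ∑ₑ-dead : ∀ ζ (f : Event → ℝ) → ∑ₑ (λ x → p ζ dead x * f x) ≃ 0ℝ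
    ∑ₑ-dead ζ f = solve 3 (λ a b c → con 0ℚ :* a :+ con 0ℚ :* b :+ con 0ℚ :* c := con 0ℚ) ≃-refl (f evolved) (f (outcome 0F)) (f (outcome 1F))

    private
      drop-first : ∀ x y → 0ℝ * x + y ≃ y
      drop-first = solve 2 (λ x y → con 0ℚ :* x :+ y := y) ≃-refl

    ∑ₑ-spread : ∀ ζ v j (f : Event → ℝ) → ∑ₑ (λ x → p ζ (spread v j) x * f x)
      ≃ p ζ (spread v j) (outcome 0F) * f (outcome 0F) + p ζ (spread v j) (outcome 1F) * f (outcome 1F)
    ∑ₑ-spread ζ v j f = +-cong (drop-first (f evolved) (p ζ (spread v j) (outcome 0F) * f (outcome 0F))) ≃-refl

    0≲p : ∀ ζ s x → 0ℝ ≲ p ζ s x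
    0≲p ζ (at v)       evolved      = fromℚ-mono (ℚ.nonNegative⁻¹ 1ℚ)
    0≲p ζ (at v)       (outcome j)  = ≲-refl
    0≲p ζ (spread v j) evolved      = ≲-refl
    0≲p ζ (spread v j) (outcome i)  = 0≲‖‖² (P i j *ᵛ vector ζ (spread v j))
    0≲p ζ done         evolved      = ≲-refl
    0≲p ζ done         (outcome j)  = ≲-refl
    0≲p ζ dead         evolved      = ≲-refl
    0≲p ζ dead         (outcome j)  = ≲-refl

    p-spread : ∀ ζ v j i → p ζ (spread v j) (outcome i) ≡ ‖ P i j *ᵛ vector ζ (spread v j) ‖²
    p-spread ζ v j i = refl

    p-measure : ∀ ζ → normSq ζ ≃ 1ℝ → ∀ v j → p ζ (spread v j) (outcome 0F) + p ζ (spread v j) (outcome 1F) ≃ 1ℝ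
    p-measure ζ h v j = ≃-trans (≡⇒≃ (cong₂ _+_ (p-spread ζ v j 0F) (p-spread ζ v j 1F)))
      (≃-trans (‖P₀‖²+‖P₁‖² j (vector ζ (spread v j))) (‖vector‖² h (spread v j)))

    p-zero : ∀ ζ → normSq ζ ≃ 1ℝ → ∀ v → p ζ (spread v zero) (outcome 1F) ≃ recip N
    p-zero ζ h v = ≃-trans (‖P₁‖² zero (vector ζ (spread v zero)))
      (≃-trans (normSq-* ζ (fromℝ (scale v zero) *ᶜ U zero v)) (≃-trans (*-cong h
        (≃-trans (normSq-cong (≃ᶜ-trans (*ᶜ-congʳ (U zero v) (≡⇒≃ᶜ (cong fromℝ (scale-zero v)))) (ℂ-Ring.*-identityˡ (U zero v)))) (row-0 v)))
        (ℝ-Ring.*-identityˡ (recip N))))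

    p-last : ∀ ζ v j → after j ≡ nothing → p ζ (spread v j) (outcome 0F) ≃ 0ℝ
    p-last = ‖P₀-last‖²

    p-dead : ∀ ζ s x → next x s ≡ dead → p ζ s x ≃ 0ℝ
    p-dead ζ (at v)       (outcome j)  eq = ≃-refl
    p-dead ζ (at zero)    evolved      ()
    p-dead ζ (at (suc v)) evolved      ()
    p-dead ζ (spread v j) evolved      eq = ≃-refl
    p-dead ζ (spread v j) (outcome 0F) eq = p-last ζ v j (last (after j) eq)
      where
      last : ∀ k → continue v k ≡ dead → k ≡ nothing
      last nothing eq = refl
    p-dead ζ (spread v j) (outcome 1F) ()
    p-dead ζ done         evolved      eq = ≃-refl
    p-dead ζ done         (outcome j)  eq = ≃-refl
    p-dead ζ dead         evolved      eq = ≃-refl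
    p-dead ζ dead         (outcome j)  eq = ≃-refl

  running : Stage N → ℝ → ℝ
  running (at _)       q = 0ℝ
  running (spread _ _) q = 0ℝ
  running done         q = q
  running dead         q = q

  -- Determined by the balance at the measurement of vertex 0: (1 - 1/n)(r₀ + m) + 2/n = r₀ - 2
  -- amounts to r₀ + m - 2 = n (m + 2), that is, r₀ = n² + 3.
  r₀ : ℚ
  r₀ = ι N ℚ.* ι N ℚ.+ (1ℚ ℚ.+ 1ℚ ℚ.+ 1ℚ)

  -- Bounds the expected number of remaining steps.
  steps : Stage N → ℚ
  steps (at zero)          = 1ℚ ℚ.+ 1ℚ
  steps (at (suc _))       = r₀
  steps (spread _ zero)    = r₀ ℚ.- 1ℚ
  steps (spread _ (suc j)) = r₀ ℚ.+ (ι m ℚ.- ι (toℕ j))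
  steps done               = 1ℚ
  steps dead               = 1ℚ

  private
    3≤r₀ : 1ℚ ℚ.+ 1ℚ ℚ.+ 1ℚ ℚ.≤ r₀
    3≤r₀ = R.≤-from {1ℚ ℚ.+ 1ℚ ℚ.+ 1ℚ} {r₀} (ι N ℚ.* ι N) (R.0≤sq (ι N)) (ℚ.+-comm (1ℚ ℚ.+ 1ℚ ℚ.+ 1ℚ) (ι N ℚ.* ι N))

    1+j≤m : ∀ (j : Fin m) → 1ℚ ℚ.+ ι (toℕ j) ℚ.≤ ι m
    1+j≤m j = subst (ℚ._≤ ι m) (R.ι-suc (toℕ j)) (R.ι-mono (Fin.toℕ<n j))

    rmax : ℚ
    rmax = r₀ ℚ.+ ι m

    steps≤ : ∀ s → steps s ℚ.≤ rmax
    steps≤ (at zero)          = R.≤-from {1ℚ ℚ.+ 1ℚ} {rmax} ((r₀ ℚ.- (1ℚ ℚ.+ 1ℚ ℚ.+ 1ℚ)) ℚ.+ (1ℚ ℚ.+ ι m))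
      (R.0≤+ (R.≤⇒0≤- 3≤r₀) (R.0≤+ (ℚ.nonNegative⁻¹ 1ℚ) (R.0≤ι m)))
      (Q.solve 2 (λ r m → Q.con (1ℚ ℚ.+ 1ℚ) Q.:+ ((r Q.:- Q.con (1ℚ ℚ.+ 1ℚ ℚ.+ 1ℚ)) Q.:+ (Q.con 1ℚ Q.:+ m)) Q.:= r Q.:+ m) refl r₀ (ι m))
    steps≤ (at (suc _))       = R.≤-from {r₀} {rmax} (ι m) (R.0≤ι m) refl
    steps≤ (spread _ zero)    = R.≤-from {r₀ ℚ.- 1ℚ} {rmax} (1ℚ ℚ.+ ι m) (R.0≤+ (ℚ.nonNegative⁻¹ 1ℚ) (R.0≤ι m))
      (Q.solve 2 (λ r m → r Q.:- Q.con 1ℚ Q.:+ (Q.con 1ℚ Q.:+ m) Q.:= r Q.:+ m) refl r₀ (ι m))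
    steps≤ (spread _ (suc j)) = R.≤-from {r₀ ℚ.+ (ι m ℚ.- ι (toℕ j))} {rmax} (ι (toℕ j)) (R.0≤ι (toℕ j))
      (Q.solve 3 (λ r m j → r Q.:+ (m Q.:- j) Q.:+ j Q.:= r Q.:+ m) refl r₀ (ι m) (ι (toℕ j)))
    steps≤ done               = R.≤-from {1ℚ} {rmax} ((r₀ ℚ.- (1ℚ ℚ.+ 1ℚ ℚ.+ 1ℚ)) ℚ.+ (1ℚ ℚ.+ 1ℚ ℚ.+ ι m))
      (R.0≤+ (R.≤⇒0≤- 3≤r₀) (R.0≤+ (ℚ.nonNegative⁻¹ (1ℚ ℚ.+ 1ℚ)) (R.0≤ι m)))
      (Q.solve 2 (λ r m → Q.con 1ℚ Q.:+ ((r Q.:- Q.con (1ℚ ℚ.+ 1ℚ ℚ.+ 1ℚ)) Q.:+ (Q.con 1ℚ Q.:+ Q.con 1ℚ Q.:+ m)) Q.:= r Q.:+ m) refl r₀ (ι m))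
    steps≤ dead               = steps≤ done

    1≤steps : ∀ s → 1ℚ ℚ.≤ steps s
    1≤steps (at zero)          = ℚ.≤ᵇ⇒≤ _
    1≤steps (at (suc _))       = ℚ.≤-trans (ℚ.≤ᵇ⇒≤ _) 3≤r₀
    1≤steps (spread _ zero)    = R.≤-from {1ℚ} {r₀ ℚ.- 1ℚ} ((r₀ ℚ.- (1ℚ ℚ.+ 1ℚ ℚ.+ 1ℚ)) ℚ.+ 1ℚ)
      (R.0≤+ (R.≤⇒0≤- 3≤r₀) (ℚ.nonNegative⁻¹ 1ℚ))
      (Q.solve 1 (λ r → Q.con 1ℚ Q.:+ ((r Q.:- Q.con (1ℚ ℚ.+ 1ℚ ℚ.+ 1ℚ)) Q.:+ Q.con 1ℚ) Q.:= r Q.:- Q.con 1ℚ) refl r₀)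
    1≤steps (spread _ (suc j)) = R.≤-from {1ℚ} {r₀ ℚ.+ (ι m ℚ.- ι (toℕ j))} ((r₀ ℚ.- (1ℚ ℚ.+ 1ℚ ℚ.+ 1ℚ)) ℚ.+ ((ι m ℚ.- (1ℚ ℚ.+ ι (toℕ j))) ℚ.+ (1ℚ ℚ.+ 1ℚ ℚ.+ 1ℚ)))
      (R.0≤+ (R.≤⇒0≤- 3≤r₀) (R.0≤+ (R.≤⇒0≤- (1+j≤m j)) (ℚ.nonNegative⁻¹ (1ℚ ℚ.+ 1ℚ ℚ.+ 1ℚ))))
      (Q.solve 3 (λ r m j → Q.con 1ℚ Q.:+ ((r Q.:- Q.con (1ℚ ℚ.+ 1ℚ ℚ.+ 1ℚ)) Q.:+ ((m Q.:- (Q.con 1ℚ Q.:+ j)) Q.:+ Q.con (1ℚ ℚ.+ 1ℚ ℚ.+ 1ℚ))) Q.:= r Q.:+ (m Q.:- j))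
        refl r₀ (ι m) (ι (toℕ j)))
    1≤steps done               = ℚ.≤-refl
    1≤steps dead               = ℚ.≤-refl

    convex : ∀ {x y a b c} → 0ℝ ≲ x → 0ℝ ≲ y → x + y ≃ 1ℝ → a ≲ c → b ≲ c → x * a + y * b ≲ c
    convex {x} {y} {a} {b} {c} 0≲x 0≲y h a≲c b≲c = ≲-trans (+-mono (*-monoˡ 0≲x a≲c) (*-monoˡ 0≲y b≲c))
      (≃⇒≲ (≃-trans (≃-sym (ℝ-Ring.distribʳ c x y)) (≃-trans (*-cong h ≃-refl) (ℝ-Ring.*-identityˡ c))))

    N*recip : fromℚ (ι N) * recip N ≃ 1ℝ
    N*recip = ≃-trans (*-congˡ {fromℚ (ι N)} (recip≃ N)) (pointwise λ _ → ≡.trans (ℚ.*-comm (ι N) (inv N)) (R.inv-inverse N))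

    after-zero : ∃[ j ] (after (zero {m}) ≡ just (suc j) × toℕ j ≡ 0)
    after-zero = first m
      where
      first : ∀ m .{{_ : NonZero m}} → ∃[ j ] (after (zero {m}) ≡ just (suc j) × toℕ j ≡ 0)
      first (suc m) = zero , refl , refl

    -- With probability 1/n the remaining number of steps drops to 2.
    steps-first : ∀ x y → x + y ≃ 1ℝ → y ≃ recip N → x * fromℚ (r₀ ℚ.+ ι m) + y * fromℚ (1ℚ ℚ.+ 1ℚ) ≃ fromℚ (r₀ ℚ.- 1ℚ ℚ.- 1ℚ)
    steps-first x y h k = begin
      x * fromℚ (r₀ ℚ.+ ι m) + y * fromℚ 2ℚ
        ≈⟨ solve 4 (λ x y a b → x :* a :+ y :* b := (x :+ y) :* a :- y :* (a :- b)) ≃-refl x y (fromℚ (r₀ ℚ.+ ι m)) (fromℚ 2ℚ) ⟩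
      (x + y) * fromℚ (r₀ ℚ.+ ι m) - y * (fromℚ (r₀ ℚ.+ ι m) - fromℚ 2ℚ)
        ≈⟨ +-cong (*-cong h ≃-refl) (-‿cong (*-cong (≃-trans k (recip≃ N)) ≃-refl)) ⟩
      1ℝ * fromℚ (r₀ ℚ.+ ι m) - fromℚ (inv N) * (fromℚ (r₀ ℚ.+ ι m) - fromℚ 2ℚ)
        ≈⟨ pointwise (λ _ → arithmetic) ⟩
      fromℚ (r₀ ℚ.- 1ℚ ℚ.- 1ℚ) ∎
      where
      open ≃-Reasoning
      2ℚ : ℚ
      2ℚ = 1ℚ ℚ.+ 1ℚ
      arithmetic : 1ℚ ℚ.* (r₀ ℚ.+ ι m) ℚ.- inv N ℚ.* (r₀ ℚ.+ ι m ℚ.- 2ℚ) ≡ r₀ ℚ.- 1ℚ ℚ.- 1ℚ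
      arithmetic = ≡.trans (cong (λ n → 1ℚ ℚ.* (n ℚ.* n ℚ.+ (1ℚ ℚ.+ 1ℚ ℚ.+ 1ℚ) ℚ.+ ι m) ℚ.- inv N ℚ.* (n ℚ.* n ℚ.+ (1ℚ ℚ.+ 1ℚ ℚ.+ 1ℚ) ℚ.+ ι m ℚ.- 2ℚ)) (R.ι-suc m))
        (≡.trans (Q.solve 2 (λ m i → let n = Q.con 1ℚ Q.:+ m; r = n Q.:* n Q.:+ (Q.con 1ℚ Q.:+ Q.con 1ℚ Q.:+ Q.con 1ℚ) in
            Q.con 1ℚ Q.:* (r Q.:+ m) Q.:- i Q.:* (r Q.:+ m Q.:- Q.con 2ℚ)
            Q.:= (r Q.:+ m) Q.:- (i Q.:* n) Q.:* (m Q.:+ Q.con 2ℚ)) refl (ι m) (inv N))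
          (≡.trans (cong (λ z → ((1ℚ ℚ.+ ι m) ℚ.* (1ℚ ℚ.+ ι m) ℚ.+ (1ℚ ℚ.+ 1ℚ ℚ.+ 1ℚ) ℚ.+ ι m) ℚ.- z ℚ.* (ι m ℚ.+ 2ℚ))
              (≡.trans (cong (inv N ℚ.*_) (≡.sym (R.ι-suc m))) (R.inv-inverse N)))
            (≡.trans (Q.solve 1 (λ m → let n = Q.con 1ℚ Q.:+ m; r = n Q.:* n Q.:+ (Q.con 1ℚ Q.:+ Q.con 1ℚ Q.:+ Q.con 1ℚ) in
                (r Q.:+ m) Q.:- Q.con 1ℚ Q.:* (m Q.:+ Q.con 2ℚ) Q.:= r Q.:- Q.con 1ℚ Q.:- Q.con 1ℚ) refl (ι m))
              (cong (λ n → n ℚ.* n ℚ.+ (1ℚ ℚ.+ 1ℚ ℚ.+ 1ℚ) ℚ.- 1ℚ ℚ.- 1ℚ) (≡.sym (R.ι-suc m))))))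

    steps-decrease : ∀ ζ → normSq ζ ≃ 1ℝ → ∀ s → ∑ₑ (λ x → p ζ s x * fromℚ (steps (next x s))) ≲ fromℚ (steps s ℚ.- 1ℚ)
    steps-decrease ζ h (at zero)    = ≲-trans (≃⇒≲ (∑ₑ-at ζ zero (λ x → fromℚ (steps (next x (at zero)))))) (fromℚ-mono (ℚ.≤ᵇ⇒≤ _))
    steps-decrease ζ h (at (suc k)) = ≃⇒≲ (∑ₑ-at ζ (suc k) (λ x → fromℚ (steps (next x (at (suc k))))))
    steps-decrease ζ h (spread v zero) = ≲-trans (≃⇒≲ (∑ₑ-spread ζ v zero (λ x → fromℚ (steps (next x (spread v zero)))))) (≃⇒≲ (by-cases (after zero) after-zero))
      where
      by-cases : ∀ k → ∃[ j ] (k ≡ just (suc j) × toℕ j ≡ 0) →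
        p ζ (spread v zero) (outcome 0F) * fromℚ (steps (continue v k)) + p ζ (spread v zero) (outcome 1F) * fromℚ (1ℚ ℚ.+ 1ℚ) ≃ fromℚ (r₀ ℚ.- 1ℚ ℚ.- 1ℚ)
      by-cases (just (suc j)) (j , refl , j≡0) = ≃-trans
        (+-cong (*-congˡ {p ζ (spread v zero) (outcome 0F)} (pointwise λ _ → ≡.trans (cong (λ i → r₀ ℚ.+ (ι m ℚ.- ι i)) j≡0)
          (≡.trans (cong (λ z → r₀ ℚ.+ (ι m ℚ.- z)) R.ι-0) (cong (r₀ ℚ.+_) (ℚ.+-identityʳ (ι m)))))) ≃-refl)
        (steps-first (p ζ (spread v zero) (outcome 0F)) (p ζ (spread v zero) (outcome 1F)) (p-measure ζ h v zero) (p-zero ζ h v))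
    steps-decrease ζ h (spread v (suc j)) = ≲-trans (≃⇒≲ (∑ₑ-spread ζ v (suc j) (λ x → fromℚ (steps (next x (spread v (suc j)))))))
      (convex (0≲p ζ (spread v (suc j)) (outcome 0F)) (0≲p ζ (spread v (suc j)) (outcome 1F)) (p-measure ζ h v (suc j))
        (fromℚ-mono (failure (after (suc j)) refl)) (fromℚ-mono success))
      where
      S : ℚ
      S = r₀ ℚ.+ (ι m ℚ.- ι (toℕ j))
      success : r₀ ℚ.≤ S ℚ.- 1ℚ
      success = R.≤-from {r₀} {S ℚ.- 1ℚ} (ι m ℚ.- (1ℚ ℚ.+ ι (toℕ j))) (R.≤⇒0≤- (1+j≤m j))
        (Q.solve 3 (λ r m j → r Q.:+ (m Q.:- (Q.con 1ℚ Q.:+ j)) Q.:= r Q.:+ (m Q.:- j) Q.:- Q.con 1ℚ) refl r₀ (ι m) (ι (toℕ j)))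
      failure : ∀ k → after (suc j) ≡ k → steps (continue v k) ℚ.≤ S ℚ.- 1ℚ
      failure nothing        eq = ℚ.≤-trans (ℚ.≤-trans (ℚ.≤ᵇ⇒≤ _) 3≤r₀) success
      failure (just zero)    eq with () ← after-just (suc j) eq
      failure (just (suc k)) eq = ℚ.≤-reflexive (≡.trans
        (cong (λ i → r₀ ℚ.+ (ι m ℚ.- i)) (≡.trans (cong ι (ℕ.suc-injective (after-just (suc j) eq))) (R.ι-suc (toℕ j))))
        (Q.solve 3 (λ r m j → r Q.:+ (m Q.:- (Q.con 1ℚ Q.:+ j)) Q.:= r Q.:+ (m Q.:- j) Q.:- Q.con 1ℚ) refl r₀ (ι m) (ι (toℕ j))))
    steps-decrease ζ h done = ≃⇒≲ (∑ₑ-done ζ (λ x → fromℚ (steps (next x done))))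
    steps-decrease ζ h dead = ≃⇒≲ (∑ₑ-dead ζ (λ x → fromℚ (steps (next x dead))))

    0<rmax : 0ℚ ℚ.< rmax
    0<rmax = ℚ.<-≤-trans (ℚ.positive⁻¹ 1ℚ) (ℚ.≤-trans (1≤steps done) (steps≤ done))

    abstract
      rmax⁻¹ : ∃[ r ] (0ℚ ℚ.< r × rmax ℚ.* r ≡ 1ℚ)
      rmax⁻¹ = R.reciprocal rmax 0<rmax

    x₀ γ′ : ℚ
    x₀ = proj₁ rmax⁻¹
    γ′ = 1ℚ ℚ.- x₀

    0<x₀ : 0ℚ ℚ.< x₀
    0<x₀ = proj₁ (proj₂ rmax⁻¹)

    x₀≤1 : x₀ ℚ.≤ 1ℚ
    x₀≤1 = ℚ.≤-trans (ℚ.≤-trans (ℚ.≤-reflexive (≡.sym (ℚ.*-identityˡ x₀))) (R.*-monoʳ (ℚ.<⇒≤ 0<x₀) (ℚ.≤-trans (1≤steps done) (steps≤ done))))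
      (ℚ.≤-reflexive (proj₂ (proj₂ rmax⁻¹)))

    0≤γ′ : 0ℚ ℚ.≤ γ′
    0≤γ′ = R.≤⇒0≤- x₀≤1

    γ′-contracts : γ′ ℚ.* (1ℚ ℚ.+ x₀) ℚ.≤ 1ℚ
    γ′-contracts = R.≤-from {γ′ ℚ.* (1ℚ ℚ.+ x₀)} (x₀ ℚ.* x₀) (R.0≤sq x₀)
      (Q.solve 1 (λ x → (Q.con 1ℚ Q.:- x) Q.:* (Q.con 1ℚ Q.:+ x) Q.:+ x Q.:* x Q.:= Q.con 1ℚ) refl x₀)

    -- Since no stage has more than `rmax` steps left on this count, a decrease by 1 is a decrease
    -- by at least the fraction 1/`rmax`. An additive drift thus becomes a geometric one.
    steps-1≤ : ∀ s → steps s ℚ.- 1ℚ ℚ.≤ γ′ ℚ.* steps s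
    steps-1≤ s = R.≤-from {steps s ℚ.- 1ℚ} {γ′ ℚ.* steps s} ((rmax ℚ.- steps s) ℚ.* x₀) (R.0≤* (R.≤⇒0≤- (steps≤ s)) (ℚ.<⇒≤ 0<x₀))
      (≡.trans (Q.solve 3 (λ s r x → s Q.:- Q.con 1ℚ Q.:+ (r Q.:- s) Q.:* x Q.:= (Q.con 1ℚ Q.:- x) Q.:* s Q.:+ (r Q.:* x Q.:- Q.con 1ℚ)) refl (steps s) rmax x₀)
        (≡.trans (cong (λ z → γ′ ℚ.* steps s ℚ.+ (z ℚ.- 1ℚ)) (proj₂ (proj₂ rmax⁻¹))) (ℚ.+-identityʳ (γ′ ℚ.* steps s))))

  module From (u : Fin N) where
    open Start u
    open Run run using (prob; stopProb)

    private
      q : History → Event → ℝ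
      q h x = p (ζ h) (stage u h) x

      prob-∷ : ∀ x h → prob (x ∷ h) ≃ prob h * q h x
      prob-∷ x h = *-congˡ {prob h} (≡⇒≃ (p≡ (ζ h) (stage u h) x))

    0≲prob : ∀ h → 0ℝ ≲ prob h
    0≲prob []      = fromℚ-mono (ℚ.nonNegative⁻¹ 1ℚ)
    0≲prob (x ∷ h) = ≲-trans (0≲* (0≲prob h) (0≲p (ζ h) (stage u h) x)) (≃⇒≲ (≃-sym (prob-∷ x h)))

    stopProb≃ : ∀ h → stopProb h ≃ running (stage u h) (prob h)
    stopProb≃ h = by-stage (stage u h) refl
      where
      by-stage : ∀ s → stage u h ≡ s → stopProb h ≃ running s (prob h)
      by-stage (at v)       eq = ≡⇒≃ (stopProb-evolve run h (cong act eq))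
      by-stage (spread v j) eq = ≡⇒≃ (stopProb-measure run h (cong act eq))
      by-stage done         eq = ≡⇒≃ (stopProb-stop run h (cong act eq))
      by-stage dead         eq = ≡⇒≃ (stopProb-stop run h (cong act eq))

    private
      extend : ∀ (f : History → ℝ) h → prob (evolved ∷ h) * f (evolved ∷ h) + prob (outcome 0F ∷ h) * f (outcome 0F ∷ h) + prob (outcome 1F ∷ h) * f (outcome 1F ∷ h)
        ≃ prob h * ∑ₑ (λ x → q h x * f (x ∷ h))
      extend f h = ≃-trans (+-cong (+-cong (term evolved) (term (outcome 0F))) (term (outcome 1F))) (solve 7 (λ p a b c x y z → p :* a :* x :+ p :* b :* y :+ p :* c :* z := p :* (a :* x :+ b :* y :+ c :* z)) ≃-refl
        (prob h) (q h evolved) (q h (outcome 0F)) (q h (outcome 1F)) (f (evolved ∷ h)) (f (outcome 0F ∷ h)) (f (outcome 1F ∷ h)))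
        where
        term : ∀ x → prob (x ∷ h) * f (x ∷ h) ≃ prob h * q h x * f (x ∷ h)
        term x = *-cong (prob-∷ x h) (≃-refl {f (x ∷ h)})

      remaining : ℕ → ℝ
      remaining k = sumHistories k (λ h → prob h * fromℚ (steps (stage u h)))

      remaining-suc : ∀ k → remaining (suc k) ≲ fromℚ γ′ * remaining k
      remaining-suc k = ≲-trans (sumHistories-mono k (λ h _ → ≲-trans (≃⇒≲ (extend (λ h → fromℚ (steps (stage u h))) h))
          (≲-trans (*-monoˡ (0≲prob h) (≲-trans (steps-decrease (ζ h) (normSq-ζ h) (stage u h)) (pointwise-≲ {y = fromℚ γ′ * fromℚ (steps (stage u h))} λ _ → steps-1≤ (stage u h))))
            (≃⇒≲ (solve 3 (λ p g s → p :* (g :* s) := g :* (p :* s)) ≃-refl (prob h) (fromℚ γ′) (fromℚ (steps (stage u h))))))))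
        (≃⇒≲ (sumHistories-* k (fromℚ γ′) (λ h → prob h * fromℚ (steps (stage u h)))))

      remaining≲ : ∀ k → remaining k ≲ fromℚ (γ′ R.^ k ℚ.* rmax)
      remaining≲ zero    = ≲-trans (≃⇒≲ (ℝ-Ring.*-identityˡ (fromℚ (steps (at u))))) (pointwise-≲ λ _ →
        ℚ.≤-trans (steps≤ (at u)) (ℚ.≤-reflexive (≡.sym (ℚ.*-identityˡ rmax))))
      remaining≲ (suc k) = ≲-trans (remaining-suc k) (≲-trans (*-monoˡ (fromℚ-mono 0≤γ′) (remaining≲ k))
        (≃⇒≲ (pointwise λ _ → ≡.sym (ℚ.*-assoc γ′ (γ′ R.^ k) rmax))))

      alive : ℕ → ℝ
      alive k = sumHistories k prob

      -- Every stage has `1 ≤ steps`, so the probability of the histories of length k is dominated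
      -- by `remaining k`.
      alive≲ : ∀ k → alive k ≲ fromℚ (γ′ R.^ k ℚ.* rmax)
      alive≲ k = ≲-trans (sumHistories-mono k (λ h _ → ≲-trans (≃⇒≲ (≃-sym (ℝ-Ring.*-identityʳ (prob h))))
        (*-monoˡ (0≲prob h) (fromℚ-mono (1≤steps (stage u h)))))) (remaining≲ k)

    -- A martingale argument: the expectation of X at the stopping time is the initial value of X + V.
    module Potential (X : History → ℝ) (c V : Stage N → ℝ)
      (X-step : ∀ x h → X (x ∷ h) ≃ X h + c (stage u h))
      (V-done : V done ≃ 0ℝ) (V-dead : V dead ≃ 0ℝ)
      (V-at : ∀ v → c (at v) + V (next evolved (at v)) ≃ V (at v))
      (V-spread : ∀ ζ → normSq ζ ≃ 1ℝ → ∀ v j →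
        p ζ (spread v j) (outcome 0F) * (c (spread v j) + V (continue v (after j)))
          + p ζ (spread v j) (outcome 1F) * (c (spread v j) + V (at j)) ≃ V (spread v j))
      (0≲X : ∀ h → 0ℝ ≲ X h) (0≲V : ∀ s → 0ℝ ≲ V s)
      (a b : ℚ) (0≤a : 0ℚ ℚ.≤ a) (0≤b : 0ℚ ℚ.≤ b)
      (X+V≲ : ∀ h → X h + V (stage u h) ≲ fromℚ (a ℚ.+ b ℚ.* ι (length h))) where

      private
        stopped : ∀ w Z {y z} → y ≃ 0ℝ → z ≃ 0ℝ → w * Z + w * z ≃ w * (Z + y)
        stopped w Z y≃0 z≃0 = ≃-trans (+-cong (≃-refl {w * Z}) (*-congˡ {w} (≃-trans z≃0 (≃-sym y≃0)))) (≃-sym (ℝ-Ring.distribˡ w Z _))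

        balance : ∀ ζ → normSq ζ ≃ 1ℝ → ∀ s w Z → running s w * Z + w * ∑ₑ (λ x → p ζ s x * (Z + c s + V (next x s))) ≃ w * (Z + V s)
        balance ζ h (at v) w Z = ≃-trans
          (+-cong (≃-refl {0ℝ * Z}) (*-congˡ {w} (∑ₑ-at ζ v (λ x → Z + c (at v) + V (next x (at v))))))
          (≃-trans (solve 4 (λ w z c v → con 0ℚ :* z :+ w :* (z :+ c :+ v) := w :* (z :+ (c :+ v))) ≃-refl w Z (c (at v)) (V (next evolved (at v))))
            (*-congˡ {w} (+-cong (≃-refl {Z}) (V-at v))))
        balance ζ h (spread v j) w Z = begin
          0ℝ * Z + w * ∑ₑ (λ x → p ζ (spread v j) x * (Z + C + V (next x (spread v j))))
            ≈⟨ +-cong (≃-refl {0ℝ * Z}) (*-congˡ {w} (∑ₑ-spread ζ v j (λ x → Z + C + V (next x (spread v j))))) ⟩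
          0ℝ * Z + w * (p₀ * (Z + C + V₀) + p₁ * (Z + C + V₁))
            ≈⟨ solve 7 (λ w z x y c d e → con 0ℚ :* z :+ w :* (x :* (z :+ c :+ d) :+ y :* (z :+ c :+ e))
                 := w :* ((x :+ y) :* z :+ (x :* (c :+ d) :+ y :* (c :+ e)))) ≃-refl w Z p₀ p₁ C V₀ V₁ ⟩
          w * ((p₀ + p₁) * Z + (p₀ * (C + V₀) + p₁ * (C + V₁)))
            ≈⟨ *-congˡ {w} (+-cong (≃-trans (*-cong (p-measure ζ h v j) ≃-refl) (ℝ-Ring.*-identityˡ Z)) (V-spread ζ h v j)) ⟩
          w * (Z + V (spread v j)) ∎
          where
          open ≃-Reasoning
          C p₀ p₁ V₀ V₁ : ℝ
          C = c (spread v j)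
          p₀ = p ζ (spread v j) (outcome 0F)
          p₁ = p ζ (spread v j) (outcome 1F)
          V₀ = V (continue v (after j))
          V₁ = V (at j)
        balance ζ h done w Z = stopped w Z V-done (∑ₑ-done ζ (λ x → Z + c done + V dead))
        balance ζ h dead w Z = stopped w Z V-dead (∑ₑ-dead ζ (λ x → Z + c dead + V dead))

        Ψ : History → ℝ
        Ψ h = X h + V (stage u h)

        f g : ℕ → ℝ
        f k = sumHistories k (λ h → stopProb h * X h)
        g k = sumHistories k (λ h → prob h * Ψ h)

        one-step : ∀ h → stopProb h * X h + (prob (evolved ∷ h) * Ψ (evolved ∷ h) + prob (outcome 0F ∷ h) * Ψ (outcome 0F ∷ h) + prob (outcome 1F ∷ h) * Ψ (outcome 1F ∷ h))
          ≃ prob h * Ψ h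
        one-step h = ≃-trans (+-cong (*-cong (stopProb≃ h) (≃-refl {X h})) (≃-trans (extend Ψ h)
            (*-congˡ {prob h} (+-cong (+-cong (term evolved) (term (outcome 0F))) (term (outcome 1F))))))
          (balance (ζ h) (normSq-ζ h) (stage u h) (prob h) (X h))
          where
          term : ∀ x → q h x * Ψ (x ∷ h) ≃ q h x * (X h + c (stage u h) + V (next x (stage u h)))
          term x = *-congˡ {q h x} (+-cong (X-step x h) ≃-refl)

        f+g : ∀ k → f k + g (suc k) ≃ g k
        f+g k = ≃-trans (≃-sym (sumHistories-+ k (λ h → stopProb h * X h)
            (λ h → prob (evolved ∷ h) * Ψ (evolved ∷ h) + prob (outcome 0F ∷ h) * Ψ (outcome 0F ∷ h) + prob (outcome 1F ∷ h) * Ψ (outcome 1F ∷ h))))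
          (sumHistories-cong k one-step)

        0≲g : ∀ k → 0ℝ ≲ g k
        0≲g k = 0≲sumHistories k (λ h → 0≲* (0≲prob h) (0≲+ (0≲X h) (0≲V (stage u h))))

        -- The potential grows at most linearly with the number of steps, while the probability of
        -- reaching that length decays geometrically.
        g≲ : ∀ k → g k ≲ fromℚ ((a ℚ.* rmax ℚ.+ b ℚ.* rmax ℚ.* ι k) ℚ.* γ′ R.^ k)
        g≲ k = ≲-trans (sumHistories-mono k (λ h len → ≲-trans (*-monoˡ (0≲prob h) (subst (λ l → Ψ h ≲ fromℚ (a ℚ.+ b ℚ.* ι l)) len (X+V≲ h)))
            (≃⇒≲ (*-comm (prob h) (fromℚ (a ℚ.+ b ℚ.* ι k))))))
          (≲-trans (≃⇒≲ (sumHistories-* k (fromℚ (a ℚ.+ b ℚ.* ι k)) prob))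
            (≲-trans (*-monoˡ (fromℚ-mono (R.0≤+ 0≤a (R.0≤* 0≤b (R.0≤ι k)))) (alive≲ k))
              (≃⇒≲ (pointwise λ _ → Q.solve 5 (λ a b k g r → (a Q.:+ b Q.:* k) Q.:* (g Q.:* r) Q.:= (a Q.:* r Q.:+ b Q.:* r Q.:* k) Q.:* g)
                refl a b (ι k) (γ′ R.^ k) rmax))))

        g-small : ∀ ε → 0ℚ ℚ.< ε → ∃[ K ] (∀ k → K ℕ.≤ k → g k ≲ fromℚ ε)
        g-small ε 0<ε = proj₁ small , λ k K≤k → ≲-trans (g≲ k) (fromℚ-mono (proj₂ small k K≤k))
          where
          small : ∃[ K ] (∀ k → K ℕ.≤ k → (a ℚ.* rmax ℚ.+ b ℚ.* rmax ℚ.* ι k) ℚ.* γ′ R.^ k ℚ.≤ ε)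
          small = R.affine*γ^k-small 0≤γ′ 0<x₀ x₀≤1 γ′-contracts (a ℚ.* rmax) (b ℚ.* rmax)
            (R.0≤* 0≤a (ℚ.<⇒≤ 0<rmax)) (R.0≤* 0≤b (ℚ.<⇒≤ 0<rmax)) ε 0<ε

      abstract
        expectation : ∀ {s} → X [] + V (at u) ≃ s → HasExpectation run X s
        expectation h = ⇝⇒⟶ (⇝-cong (λ _ → ≃-refl) (≃-trans (ℝ-Ring.*-identityˡ (X [] + V (at u))) h) (telescope-⇝ f g f+g 0≲g g-small))

    abstract
      -- The potential argument with X constantly 1 and V = 0: no probability escapes to infinity.
      stops-almost-surely : StopsAlmostSurely run
      stops-almost-surely = Potential.expectation (λ _ → 1ℝ) (λ _ → 0ℝ) (λ _ → 0ℝ)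
        (λ _ _ → ≃-sym (ℝ-Ring.+-identityʳ 1ℝ)) ≃-refl ≃-refl (λ _ → ℝ-Ring.+-identityˡ 0ℝ)
        (λ ζ h v j → solve 2 (λ x y → x :* (con 0ℚ :+ con 0ℚ) :+ y :* (con 0ℚ :+ con 0ℚ) := con 0ℚ) ≃-refl (p ζ (spread v j) (outcome 0F)) (p ζ (spread v j) (outcome 1F)))
        (λ _ → fromℚ-mono (ℚ.nonNegative⁻¹ 1ℚ)) (λ _ → ≲-refl) 1ℚ 0ℚ (ℚ.nonNegative⁻¹ 1ℚ) ℚ.≤-refl
        (λ h → pointwise-≲ λ _ → ℚ.≤-reflexive (cong (1ℚ ℚ.+_) (≡.sym (ℚ.*-zeroˡ (ι (length h))))))
        (ℝ-Ring.+-identityʳ 1ℝ)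

      -- The protocol stops at `done`, where the state is column 0 of U up to a phase, and at
      -- `dead`, which is reached with probability 0.
      stops-uniformly : StopsUniformly run
      stops-uniformly h stopProb≉0 = by-stage (stage u h) refl
        where
        prob-dead : ∀ h → stage u h ≡ dead → prob h ≃ 0ℝ
        prob-dead (x ∷ h) eq = ≃-trans (prob-∷ x h) (≃-trans (*-congˡ {prob h} (p-dead (ζ h) (stage u h) x eq)) (ℝ-Ring.zeroʳ (prob h)))
        by-stage : ∀ s → stage u h ≡ s → IsUniform (Run.state run h)
        by-stage (at v)       eq = ⊥-elim (stopProb≉0 (un≃ (≡⇒≃ (stopProb-evolve run h (cong act eq)))))
        by-stage (spread v j) eq = ⊥-elim (stopProb≉0 (un≃ (≡⇒≃ (stopProb-measure run h (cong act eq)))))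
        by-stage dead         eq = ⊥-elim (stopProb≉0 (un≃ (≃-trans (≡⇒≃ (stopProb-stop run h (cong act eq))) (prob-dead h eq))))
        by-stage done         eq = λ w → subst (λ s → normSq (vector (ζ h) s w) ≈ recip N) (≡.sym eq)
          (un≃ (≃-trans (normSq-* (ζ h) (U w zero)) (≃-trans (*-cong (normSq-ζ h) (column-0 w)) (ℝ-Ring.*-identityˡ (recip N)))))

    private
      cost : Stage N → ℝ
      cost s = duration (act s)

      n : ℝ
      n = fromℚ (ι N)

      -- The exact expected remaining time, apart from the dummy value at `dead`. For T at a vertex
      -- other than 0 it solves T = t + (1 - 1/n) T + t/n, hence T = (n + 1) t. Once the measurement
      -- of vertex 0 has failed, the next collapse is onto another vertex, so the full T is due
      -- again.
      time : Stage N → ℝ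
      time (at zero)          = t
      time (at (suc _))       = (n + 1ℝ) * t
      time (spread _ zero)    = n * t
      time (spread _ (suc _)) = (n + 1ℝ) * t
      time done               = 0ℝ
      time dead               = 0ℝ

      0≲n : 0ℝ ≲ n
      0≲n = fromℚ-mono (R.0≤ι N)

      0≲n+1 : 0ℝ ≲ n + 1ℝ
      0≲n+1 = 0≲+ 0≲n (fromℚ-mono (ℚ.nonNegative⁻¹ 1ℚ))

      0≲time : ∀ s → 0ℝ ≲ time s
      0≲time (at zero)          = 0≲t
      0≲time (at (suc _))       = 0≲* 0≲n+1 0≲t
      0≲time (spread _ zero)    = 0≲* 0≲n 0≲t
      0≲time (spread _ (suc _)) = 0≲* 0≲n+1 0≲t
      0≲time done               = ≲-refl
      0≲time dead               = ≲-refl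

      time≲ : ∀ s → time s ≲ (n + 1ℝ) * t
      time≲ (at zero)          = ≲-from {t} (n * t) (0≲* 0≲n 0≲t) (solve 2 (λ n t → t :+ n :* t := (n :+ con 1ℚ) :* t) ≃-refl n t)
      time≲ (at (suc _))       = ≲-refl
      time≲ (spread _ zero)    = ≲-from {n * t} t 0≲t (solve 2 (λ n t → n :* t :+ t := (n :+ con 1ℚ) :* t) ≃-refl n t)
      time≲ (spread _ (suc _)) = ≲-refl
      time≲ done               = 0≲* 0≲n+1 0≲t
      time≲ dead               = 0≲* 0≲n+1 0≲t

      time-at : ∀ v → cost (at v) + time (next evolved (at v)) ≃ time (at v)
      time-at zero    = ℝ-Ring.+-identityʳ t
      time-at (suc v) = solve 2 (λ n t → t :+ n :* t := (n :+ con 1ℚ) :* t) ≃-refl n t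

      time-spread : ∀ ζ → normSq ζ ≃ 1ℝ → ∀ v j →
        p ζ (spread v j) (outcome 0F) * (0ℝ + time (continue v (after j))) + p ζ (spread v j) (outcome 1F) * (0ℝ + time (at j)) ≃ time (spread v j)
      time-spread ζ h v zero = by-cases (after zero) after-zero
        where
        open ≃-Reasoning
        p₀ p₁ : ℝ
        p₀ = p ζ (spread v zero) (outcome 0F)
        p₁ = p ζ (spread v zero) (outcome 1F)
        by-cases : ∀ k → ∃[ j ] (k ≡ just (suc j) × toℕ j ≡ 0) → p₀ * (0ℝ + time (continue v k)) + p₁ * (0ℝ + t) ≃ n * t
        by-cases (just (suc j)) (j , refl , _) = begin
          p₀ * (0ℝ + (n + 1ℝ) * t) + p₁ * (0ℝ + t)
            ≈⟨ solve 4 (λ x y n t → x :* (con 0ℚ :+ (n :+ con 1ℚ) :* t) :+ y :* (con 0ℚ :+ t) := (x :+ y) :* ((n :+ con 1ℚ) :* t) :- (n :* y) :* t) ≃-refl p₀ p₁ n t ⟩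
          (p₀ + p₁) * ((n + 1ℝ) * t) - (n * p₁) * t
            ≈⟨ +-cong (*-cong (p-measure ζ h v zero) ≃-refl) (-‿cong (*-cong (≃-trans (*-congˡ {n} (p-zero ζ h v)) N*recip) (≃-refl {t}))) ⟩
          1ℝ * ((n + 1ℝ) * t) - 1ℝ * t
            ≈⟨ solve 2 (λ n t → con 1ℚ :* ((n :+ con 1ℚ) :* t) :- con 1ℚ :* t := n :* t) ≃-refl n t ⟩
          n * t ∎
      time-spread ζ h v (suc j) = by-cases (after (suc j)) refl
        where
        p₀ p₁ full : ℝ
        p₀ = p ζ (spread v (suc j)) (outcome 0F)
        p₁ = p ζ (spread v (suc j)) (outcome 1F)
        full = (n + 1ℝ) * t
        total : p₀ * (0ℝ + full) + p₁ * (0ℝ + full) ≃ full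
        total = ≃-trans (solve 3 (λ x y t → x :* (con 0ℚ :+ t) :+ y :* (con 0ℚ :+ t) := (x :+ y) :* t) ≃-refl p₀ p₁ full)
          (≃-trans (*-cong (p-measure ζ h v (suc j)) ≃-refl) (ℝ-Ring.*-identityˡ full))
        by-cases : ∀ k → after (suc j) ≡ k → p₀ * (0ℝ + time (continue v k)) + p₁ * (0ℝ + full) ≃ full
        by-cases (just (suc k)) eq = total
        by-cases (just zero)    eq with () ← after-just (suc j) eq
        -- Failure at the last vertex has probability 0, so the value 0 at `dead` may be exchanged
        -- for `full`, as in the other cases.
        by-cases nothing        eq = ≃-trans (+-cong (≃-trans (*-cong p₀≃0 ≃-refl) (≃-trans (ℝ-Ring.zeroˡ (0ℝ + 0ℝ))
          (≃-sym (≃-trans (*-cong p₀≃0 ≃-refl) (ℝ-Ring.zeroˡ (0ℝ + full)))))) ≃-refl) total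
          where
          p₀≃0 : p₀ ≃ 0ℝ
          p₀≃0 = p-last ζ v (suc j) eq

      τ : ∃[ τ ] (0ℚ ℚ.< τ × t ≲ fromℚ τ)
      τ = let B , 0<B , K , h = bounded t in
        B , 0<B , eventually-≲ K (λ k K≤k → ℚ.≤-trans (R.p≤∣p∣ (seq t k)) (h k K≤k))

      0≲elapsed : ∀ h → 0ℝ ≲ elapsed protocol h
      0≲elapsed []      = ≲-refl
      0≲elapsed (x ∷ h) = 0≲+ (0≲elapsed h) (0≲duration (stage u h))
        where
        0≲duration : ∀ s → 0ℝ ≲ cost s
        0≲duration (at v)       = 0≲t
        0≲duration (spread v j) = ≲-refl
        0≲duration done         = ≲-refl
        0≲duration dead         = ≲-refl

      0≤τ : 0ℚ ℚ.≤ proj₁ τ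
      0≤τ = ℚ.<⇒≤ (proj₁ (proj₂ τ))

      elapsed≲ : ∀ h → elapsed protocol h ≲ fromℚ (proj₁ τ ℚ.* ι (length h))
      elapsed≲ []      = pointwise-≲ λ _ → R.0≤* 0≤τ (R.0≤ι 0)
      elapsed≲ (x ∷ h) = ≲-trans (+-mono (elapsed≲ h) (duration≲ (stage u h))) (pointwise-≲ λ _ → ℚ.≤-reflexive
          (≡.trans (Q.solve 2 (λ t l → t Q.:* l Q.:+ t Q.:= t Q.:* (Q.con 1ℚ Q.:+ l)) refl (proj₁ τ) (ι (length h)))
            (cong (proj₁ τ ℚ.*_) (≡.sym (R.ι-suc (length h))))))
        where
        duration≲ : ∀ s → cost s ≲ fromℚ (proj₁ τ)
        duration≲ (at v)       = proj₂ (proj₂ τ)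
        duration≲ (spread v j) = fromℚ-mono 0≤τ
        duration≲ done         = fromℚ-mono 0≤τ
        duration≲ dead         = fromℚ-mono 0≤τ

    abstract
      expected-time : ∀ {b} → (fromℚ (ι N) + 1ℝ) * t ≲ b → ExpectedTimeAtMost run b
      expected-time {b} h = time (at u) , Potential.expectation (elapsed protocol) cost time
          (λ _ _ → ≃-refl) ≃-refl ≃-refl time-at time-spread 0≲elapsed 0≲time
          ((ι N ℚ.+ 1ℚ) ℚ.* proj₁ τ) (proj₁ τ) (R.0≤* (R.0≤+ (R.0≤ι N) (ℚ.nonNegative⁻¹ 1ℚ)) 0≤τ) 0≤τ
          (λ h → ≲-trans (+-mono (elapsed≲ h) (≲-trans (time≲ (stage u h)) (*-monoˡ 0≲n+1 (proj₂ (proj₂ τ)))))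
            (pointwise-≲ λ _ → ℚ.≤-reflexive (ℚ.+-comm (proj₁ τ ℚ.* ι (length h)) ((ι N ℚ.+ 1ℚ) ℚ.* proj₁ τ))))
          (ℝ-Ring.+-identityˡ (time (at u)))
        , un≲ (≲-trans (time≲ (at u)) h)

  mixing : ∀ {b} → (fromℚ (ι N) + 1ℝ) * t ≲ b → LasVegasUniformMixing H b
  mixing h u = Start.protocol u , Start.run u , From.stops-almost-surely u , From.stops-uniformly u , From.expected-time u h

-- The choice of the vector `v` and the final bound.

module Theorem (m : ℕ) .{{m≢0 : NonZero m}} (4≤m : 4 ℕ.≤ m) where
  open NonVanishing m 4≤m
  open Angle m using (t₀; √n; √n²; 0≲√n; t₀≲10√n)

  private
    N : ℕ
    N = suc m

    5ℚ 20ℚ : ℚ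
    5ℚ = 1ℚ ℚ.+ 1ℚ ℚ.+ (1ℚ ℚ.+ 1ℚ) ℚ.+ 1ℚ
    20ℚ = (1ℚ ℚ.+ 1ℚ) ℚ.* (5ℚ ℚ.+ 5ℚ)

  root-n³ : ℝ
  root-n³ = fromℚ (ι N) * √n

  isSqrt-n³ : IsSqrt (fromℕ (N ℕ.^ 3)) root-n³
  isSqrt-n³ = un≲ {0ℝ} {root-n³} (0≲* (fromℚ-mono (R.0≤ι N)) 0≲√n) , un≃ {root-n³ * root-n³} {fromℕ (N ℕ.^ 3)} (≃-trans
    (solve 2 (λ n w → n :* w :* (n :* w) := n :* n :* (w :* w)) ≃-refl (fromℚ (ι N)) √n)
    (≃-trans (*-congˡ {fromℚ (ι N) * fromℚ (ι N)} √n²) (pointwise λ _ → begin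
      ι N ℚ.* ι N ℚ.* ι N                    ≡⟨ cong₂ ℚ._*_ (≡.sym (R.ι-* N N)) (cong ι (≡.sym (ℕ.*-identityʳ N))) ⟩
      ι (N ℕ.* N) ℚ.* ι (N ℕ.* 1)            ≡⟨ ≡.sym (R.ι-* (N ℕ.* N) (N ℕ.* 1)) ⟩
      ι (N ℕ.* N ℕ.* (N ℕ.* 1))              ≡⟨ cong ι (ℕ.*-assoc N N (N ℕ.* 1)) ⟩
      ι (N ℕ.^ 3)                            ≡⟨ R.ι≡ (N ℕ.^ 3) ⟩
      seq (fromℕ (N ℕ.^ 3)) 0 ∎)))
    where open ≡.≡-Reasoning

  private
    time-bound : (fromℚ (ι N) + 1ℝ) * t₀ ≲ fromℚ 20ℚ * root-n³
    -- From n + 1 ≤ 2n and t₀ ≤ 10√n, which gives the constant 20.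
    time-bound = ≲-trans (*-monoˡ (0≲+ (fromℚ-mono (R.0≤ι N)) (fromℚ-mono (ℚ.nonNegative⁻¹ 1ℚ))) t₀≲10√n)
      (≲-trans (*-monoʳ (0≲* (fromℚ-mono (ℚ.nonNegative⁻¹ (5ℚ ℚ.+ 5ℚ))) 0≲√n)
        (+-mono (≲-refl {fromℚ (ι N)}) (pointwise-≲ {1ℝ} {fromℚ (ι N)} λ _ → ℚ.≤-trans (ℚ.≤-reflexive (≡.sym R.ι-1)) (R.ι-mono {1} {N} (s≤s z≤n)))))
        (≃⇒≲ (solve 2 (λ n w → (n :+ n) :* (con (5ℚ ℚ.+ 5ℚ) :* w) := con 20ℚ :* (n :* w)) ≃-refl (fromℚ (ι N)) √n)))

  HasFastSigning : Set
  HasFastSigning = Σ (UnitarySigning (K N)) λ σ → LasVegasUniformMixing (scaledAdjacency σ) (fromℚ 20ℚ * root-n³)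

  module _ (v : Fin m → ℂ) (∣v∣≡1 : ∀ k → normSq (v k) ≃ 1ℝ) (∑v≡0 : sumᶜ v ≃ᶜ 0ᶜ)
    (nonvanishing : ∀ i u → Positive (normSq (Phases.Y m +ᶜ Phases.X m *ᶜ (v i *ᶜ conj (v u))))) where
    private
      module C = Columns m 4≤m v ∣v∣≡1 ∑v≡0 (λ i u _ → nonvanishing i u)

      step : IsMixingStep m C.H t₀ C.U
      step = record
        { 0≲t = Angle.0≲t₀ m ; exponential = C.U-exp ; column = C.U-column ; nonzero = C.positive-U
        ; row-0 = λ { zero → C.U-00 ; (suc u) → C.U-0suc u }
        ; column-0 = λ { zero → C.U-00 ; (suc i) → C.U-suc0 i } }

    fast-signing : HasFastSigning
    fast-signing = C.signing , Expectation.mixing step time-bound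

  -- The values of v: 1, -1 and a conjugate pair z, z̄ with real part c.
  data Value : Set where
    one neg up down : Value

  alternate : Value → Value → ℕ → Value
  alternate x y zero    = x
  alternate x y (suc k) = alternate y x k

  alternate-elim : ∀ (P : Value → Set) {x y} → P x → P y → ∀ k → P (alternate x y k)
  alternate-elim P px py zero    = px
  alternate-elim P px py (suc k) = alternate-elim P py px k

  double : ℕ → ℕ
  double zero    = zero
  double (suc p) = suc (suc (double p))

  half : ∀ m → ∃[ p ] (m ≡ double p ⊎ m ≡ suc (double p))
  half zero          = zero , inj₁ refl
  half (suc zero)    = zero , inj₂ refl
  half (suc (suc m)) with half m
  ... | p , inj₁ eq = suc p , inj₁ (cong (λ k → suc (suc k)) eq)
  ... | p , inj₂ eq = suc p , inj₂ (cong (λ k → suc (suc k)) eq)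

  module Design (c : ℚ) (c²≤1 : c ℚ.* c ℚ.≤ 1ℚ) where

    private
      s : ℝ
      s = sqrt (fromℚ (1ℚ ℚ.- c ℚ.* c))

      s² : s * s ≃ 1ℝ - fromℚ c * fromℚ c
      s² = ≃-trans (sqrt² (fromℚ-mono (R.≤⇒0≤- c²≤1))) (pointwise λ _ → refl)

    val : Value → ℂ
    val one  = 1ℝ +i 0ℝ
    val neg  = fromℚ (ℚ.- 1ℚ) +i 0ℝ
    val up   = fromℚ c +i s
    val down = fromℚ c +i (- s)

    -- The real part of the ratio of two values, tabulated in ℚ because `form` takes rational
    -- arguments. For the pair z, z̄ it is Re z² = 2c² - 1.
    cosine : Value → Value → ℚ
    cosine one  one  = 1ℚ
    cosine one  neg  = ℚ.- 1ℚ
    cosine one  up   = c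
    cosine one  down = c
    cosine neg  one  = ℚ.- 1ℚ
    cosine neg  neg  = 1ℚ
    cosine neg  up   = ℚ.- c
    cosine neg  down = ℚ.- c
    cosine up   one  = c
    cosine up   neg  = ℚ.- c
    cosine up   up   = 1ℚ
    cosine up   down = c ℚ.* c ℚ.+ c ℚ.* c ℚ.- 1ℚ
    cosine down one  = c
    cosine down neg  = ℚ.- c
    cosine down up   = c ℚ.* c ℚ.+ c ℚ.* c ℚ.- 1ℚ
    cosine down down = 1ℚ

    private
      cᵣ : ℝ
      cᵣ = fromℚ c

      mod-s² : ∀ x y z → x ≃ y + z * (s * s) → x ≃ y + z * (1ℝ - cᵣ * cᵣ)
      mod-s² x y z h = ≃-trans h (+-cong ≃-refl (*-congˡ {z} s²))

      cosine-same : ∀ x → x ≃ cᵣ * cᵣ + 1ℝ * (s * s) → x ≃ fromℚ 1ℚ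
      cosine-same x h = ≃-trans (mod-s² x (cᵣ * cᵣ) 1ℝ h) (solve 1 (λ c → c :* c :+ con 1ℚ :* (con 1ℚ :- c :* c) := con 1ℚ) ≃-refl cᵣ)

      cosine-opposite : ∀ x → x ≃ cᵣ * cᵣ + (- 1ℝ) * (s * s) → x ≃ fromℚ (c ℚ.* c ℚ.+ c ℚ.* c ℚ.- 1ℚ)
      cosine-opposite x h = ≃-trans (mod-s² x (cᵣ * cᵣ) (- 1ℝ) h)
        (≃-trans (solve 1 (λ c → c :* c :+ (:- con 1ℚ) :* (con 1ℚ :- c :* c) := c :* c :+ c :* c :- con 1ℚ) ≃-refl cᵣ) (pointwise λ _ → refl))

      cosine≃ : ∀ x y → re (val x *ᶜ conj (val y)) ≃ fromℚ (cosine x y)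
      cosine≃ one  one  = solve 0 (con 1ℚ :* con 1ℚ :- con 0ℚ :* (:- con 0ℚ) := con 1ℚ) ≃-refl
      cosine≃ one  neg  = solve 0 (con 1ℚ :* con (ℚ.- 1ℚ) :- con 0ℚ :* (:- con 0ℚ) := con (ℚ.- 1ℚ)) ≃-refl
      cosine≃ one  up   = solve 2 (λ c s → con 1ℚ :* c :- con 0ℚ :* (:- s) := c) ≃-refl cᵣ s
      cosine≃ one  down = solve 2 (λ c s → con 1ℚ :* c :- con 0ℚ :* (:- :- s) := c) ≃-refl cᵣ s
      cosine≃ neg  one  = solve 0 (con (ℚ.- 1ℚ) :* con 1ℚ :- con 0ℚ :* (:- con 0ℚ) := con (ℚ.- 1ℚ)) ≃-refl
      cosine≃ neg  neg  = solve 0 (con (ℚ.- 1ℚ) :* con (ℚ.- 1ℚ) :- con 0ℚ :* (:- con 0ℚ) := con 1ℚ) ≃-refl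
      cosine≃ neg  up   = ≃-trans (solve 2 (λ c s → con (ℚ.- 1ℚ) :* c :- con 0ℚ :* (:- s) := :- c) ≃-refl cᵣ s) (pointwise λ _ → refl)
      cosine≃ neg  down = ≃-trans (solve 2 (λ c s → con (ℚ.- 1ℚ) :* c :- con 0ℚ :* (:- :- s) := :- c) ≃-refl cᵣ s) (pointwise λ _ → refl)
      cosine≃ up   one  = solve 2 (λ c s → c :* con 1ℚ :- s :* (:- con 0ℚ) := c) ≃-refl cᵣ s
      cosine≃ up   neg  = ≃-trans (solve 2 (λ c s → c :* con (ℚ.- 1ℚ) :- s :* (:- con 0ℚ) := :- c) ≃-refl cᵣ s) (pointwise λ _ → refl)
      cosine≃ up   up   = cosine-same (re (val up *ᶜ conj (val up))) (solve 2 (λ c s → c :* c :- s :* (:- s) := c :* c :+ con 1ℚ :* (s :* s)) ≃-refl cᵣ s)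
      cosine≃ up   down = cosine-opposite (re (val up *ᶜ conj (val down))) (solve 2 (λ c s → c :* c :- s :* (:- :- s) := c :* c :+ (:- con 1ℚ) :* (s :* s)) ≃-refl cᵣ s)
      cosine≃ down one  = solve 2 (λ c s → c :* con 1ℚ :- (:- s) :* (:- con 0ℚ) := c) ≃-refl cᵣ s
      cosine≃ down neg  = ≃-trans (solve 2 (λ c s → c :* con (ℚ.- 1ℚ) :- (:- s) :* (:- con 0ℚ) := :- c) ≃-refl cᵣ s) (pointwise λ _ → refl)
      cosine≃ down up   = cosine-opposite (re (val down *ᶜ conj (val up))) (solve 2 (λ c s → c :* c :- (:- s) :* (:- s) := c :* c :+ (:- con 1ℚ) :* (s :* s)) ≃-refl cᵣ s)
      cosine≃ down down = cosine-same (re (val down *ᶜ conj (val down))) (solve 2 (λ c s → c :* c :- (:- s) :* (:- :- s) := c :* c :+ con 1ℚ :* (s :* s)) ≃-refl cᵣ s)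

      cosine-diagonal : ∀ x → cosine x x ≡ 1ℚ
      cosine-diagonal one  = refl
      cosine-diagonal neg  = refl
      cosine-diagonal up   = refl
      cosine-diagonal down = refl

      ∣val∣≡1 : ∀ x → normSq (val x) ≃ 1ℝ
      ∣val∣≡1 x = ≃-trans (≃-sym (re≃ (z*conj (val x)))) (≃-trans (cosine≃ x x) (pointwise λ _ → cosine-diagonal x))

      normSq-θ : ∀ x y → normSq (val x *ᶜ conj (val y)) ≃ 1ℝ
      normSq-θ x y = ≃-trans (normSq-* (val x) (conj (val y))) (≃-trans (*-cong (∣val∣≡1 x)
        (≃-trans (solve 2 (λ a b → a :* a :+ (:- b) :* (:- b) := a :* a :+ b :* b) ≃-refl (re (val y)) (im (val y))) (∣val∣≡1 y)))
        (ℝ-Ring.*-identityˡ 1ℝ))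

    signing-from : (value : ℕ → Value) → sumᶜ {m} (λ k → val (value (toℕ k))) ≃ᶜ 0ᶜ →
      (∀ i j → Positive (normSq (form (cosine (value i) (value j))))) → HasFastSigning
    signing-from value ∑≡0 h = fast-signing (λ k → val (value (toℕ k))) (λ k → ∣val∣≡1 (value (toℕ k))) ∑≡0 (λ i u →
      positive-entry (val (value (toℕ i)) *ᶜ conj (val (value (toℕ u)))) (cosine (value (toℕ i)) (value (toℕ u)))
        (normSq-θ (value (toℕ i)) (value (toℕ u))) (cosine≃ (value (toℕ i)) (value (toℕ u))) (h (toℕ i) (toℕ u)))

    sum-alternate : ∀ x y p → sumᶜ {double p} (λ k → val (alternate x y (toℕ k))) ≃ᶜ fromℚᶜ (ι p) *ᶜ (val x +ᶜ val y)
    sum-alternate x y zero    = ≃ᶜ-sym (≃ᶜ-trans (*ᶜ-congʳ (val x +ᶜ val y) (fromℚᶜ-cong R.ι-0)) (ℂ-Ring.zeroˡ (val x +ᶜ val y)))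
    sum-alternate x y (suc p) = ≃ᶜ-trans (≃ᶜ-sym (ℂ-Ring.+-assoc (val x) (val y) (sumᶜ {double p} (λ k → val (alternate x y (toℕ k))))))
      (≃ᶜ-trans (+ᶜ-cong (≃ᶜ-refl {val x +ᶜ val y}) (sum-alternate x y p))
        (≃ᶜ-trans (ℂ-Identities.suc-lemma (val x +ᶜ val y) (fromℚᶜ (ι p)))
          (*ᶜ-congʳ (val x +ᶜ val y) (≃ᶜ-trans (≃ᶜ-sym (fromℚᶜ-+ 1ℚ (ι p))) (fromℚᶜ-cong (≡.sym (R.ι-suc p)))))))

    one+neg : val one +ᶜ val neg ≃ᶜ 0ᶜ
    one+neg = mk≃ᶜ (solve 0 (con 1ℚ :+ con (ℚ.- 1ℚ) := con 0ℚ) ≃-refl) (ℝ-Ring.+-identityˡ 0ℝ)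

    up+down : val up +ᶜ val down ≃ᶜ fromℚᶜ (c ℚ.+ c)
    up+down = mk≃ᶜ (pointwise λ _ → refl) (ℝ-Ring.-‿inverseʳ s)

  private
    sum-length : ∀ {l l′} → l ≡ l′ → (f : ℕ → ℂ) → ∀ {z} → sumᶜ {l′} (λ k → f (toℕ k)) ≃ᶜ z → sumᶜ {l} (λ k → f (toℕ k)) ≃ᶜ z
    sum-length refl f h = h

    signs : ∀ x y → (x ≡ one ⊎ x ≡ neg) → (y ≡ one ⊎ y ≡ neg) → ∀ c c²≤1 → Positive (normSq (form (Design.cosine c c²≤1 x y)))
    signs _ _ (inj₁ refl) (inj₁ refl) c h = positive-form-1
    signs _ _ (inj₁ refl) (inj₂ refl) c h = positive-form-−1
    signs _ _ (inj₂ refl) (inj₁ refl) c h = positive-form-−1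
    signs _ _ (inj₂ refl) (inj₂ refl) c h = positive-form-1

  even-case : ∀ p → m ≡ double p → HasFastSigning
  even-case p eq = signing-from (alternate one neg)
      (sum-length eq (λ k → val (alternate one neg k)) (≃ᶜ-trans (sum-alternate one neg p) (≃ᶜ-trans (*ᶜ-congˡ (fromℚᶜ (ι p)) one+neg) (ℂ-Ring.zeroʳ (fromℚᶜ (ι p))))))
      (λ i j → signs _ _ (sign i) (sign j) 0ℚ (ℚ.nonNegative⁻¹ 1ℚ))
    where
    open Design 0ℚ (ℚ.nonNegative⁻¹ 1ℚ)
    sign : ∀ i → alternate one neg i ≡ one ⊎ alternate one neg i ≡ neg
    sign = alternate-elim (λ x → x ≡ one ⊎ x ≡ neg) (inj₁ refl) (inj₂ refl)

  -- v = (1, z, z̄, z, z̄, …), where 1 + 2 p c = 0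
  module First (p : ℕ) .{{_ : NonZero p}} (eq : m ≡ suc (double p)) (2≤p : 2 ℕ.≤ p) where
    c d : ℚ
    c = ℚ.- ½ ℚ.* inv p
    d = c ℚ.* c ℚ.+ c ℚ.* c ℚ.- 1ℚ

    private
      invp≤½ : inv p ℚ.≤ ½
      invp≤½ = ℚ.≤-trans (R.inv-anti 2 p 2≤p) (ℚ.≤-reflexive (R.inv≡ 2))

      -c≤¼ : ½ ℚ.* inv p ℚ.≤ ½ ℚ.* ½
      -c≤¼ = R.*-monoˡ (ℚ.nonNegative⁻¹ ½) invp≤½

      c²≤ : c ℚ.* c ℚ.≤ (½ ℚ.* ½) ℚ.* (½ ℚ.* ½)
      c²≤ = ℚ.≤-trans (ℚ.≤-reflexive (Q.solve 1 (λ i → (Q.:- Q.con ½ Q.:* i) Q.:* (Q.:- Q.con ½ Q.:* i) Q.:= (Q.con ½ Q.:* i) Q.:* (Q.con ½ Q.:* i)) refl (inv p)))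
        (R.*-mono 0≤ -c≤¼ 0≤ -c≤¼)
        where
        0≤ : 0ℚ ℚ.≤ ½ ℚ.* inv p
        0≤ = R.0≤* (ℚ.nonNegative⁻¹ ½) (R.0≤inv p)

    c²≤1 : c ℚ.* c ℚ.≤ 1ℚ
    c²≤1 = ℚ.≤-trans c²≤ (ℚ.≤ᵇ⇒≤ _)

    -- For p ≥ 2 one has -¼ ≤ c ≤ 0 and therefore d ≤ 1/8 - 1. This and the next three inequalities
    -- separate the cosines c and d of this vector from the cosines ±½ of the other candidate.
    -½<c : ℚ.- ½ ℚ.< c
    -½<c = ℚ.<-≤-trans (ℚ.neg-antimono-< {½ ℚ.* ½} {½} (from-yes (½ ℚ.* ½ ℚ.<? ½)))
      (ℚ.≤-trans (ℚ.neg-antimono-≤ -c≤¼) (ℚ.≤-reflexive (ℚ.neg-distribˡ-* ½ (inv p))))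

    c<½ : c ℚ.< ½
    c<½ = ℚ.≤-<-trans (R.≤-from {c} {0ℚ} (½ ℚ.* inv p) (R.0≤* (ℚ.nonNegative⁻¹ ½) (R.0≤inv p))
      (Q.solve 1 (λ i → (Q.:- Q.con ½) Q.:* i Q.:+ Q.con ½ Q.:* i Q.:= Q.con 0ℚ) refl (inv p))) (ℚ.positive⁻¹ ½)

    d<-½ : d ℚ.< ℚ.- ½
    d<-½ = ℚ.≤-<-trans (ℚ.+-monoˡ-≤ (ℚ.- 1ℚ) (ℚ.+-mono-≤ c²≤ c²≤)) (from-yes ((½ ℚ.* ½) ℚ.* (½ ℚ.* ½) ℚ.+ (½ ℚ.* ½) ℚ.* (½ ℚ.* ½) ℚ.- 1ℚ ℚ.<? ℚ.- ½))

    d<½ : d ℚ.< ½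
    d<½ = ℚ.<-trans d<-½ (ℚ.neg<pos (ℚ.- ½) ½)

    open Design c c²≤1

    private
      value : ℕ → Value
      value zero    = one
      value (suc k) = alternate up down k

      unit-value : ∀ i → value i ≡ one ⊎ value i ≡ up ⊎ value i ≡ down
      unit-value zero    = inj₁ refl
      unit-value (suc k) = inj₂ (alternate-elim (λ x → x ≡ up ⊎ x ≡ down) (inj₁ refl) (inj₂ refl) k)

      ∑ : sumᶜ {suc (double p)} (λ k → val (value (toℕ k))) ≃ᶜ 0ᶜ
      ∑ = ≃ᶜ-trans (+ᶜ-cong (≃ᶜ-refl {val one}) (≃ᶜ-trans (sum-alternate up down p) (*ᶜ-congˡ (fromℚᶜ (ι p)) up+down)))
        (≃ᶜ-trans (+ᶜ-cong (≃ᶜ-refl {val one}) (≃ᶜ-sym (fromℝ-* (fromℚ (ι p)) (fromℚ (c ℚ.+ c)))))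
          (mk≃ᶜ (pointwise λ _ → arithmetic) (ℝ-Ring.+-identityˡ 0ℝ)))
        where
        arithmetic : 1ℚ ℚ.+ ι p ℚ.* (c ℚ.+ c) ≡ 0ℚ
        arithmetic = ≡.trans (Q.solve 2 (λ n i → Q.con 1ℚ Q.:+ n Q.:* ((Q.:- Q.con ½) Q.:* i Q.:+ (Q.:- Q.con ½) Q.:* i) Q.:= Q.con 1ℚ Q.:- i Q.:* n) refl (ι p) (inv p))
          (≡.trans (cong (λ x → 1ℚ ℚ.- x) (R.inv-inverse p)) (ℚ.+-inverseʳ 1ℚ))

    first-signing : Positive (normSq (form c)) → Positive (normSq (form d)) → HasFastSigning
    first-signing hc hd = signing-from value (sum-length eq (λ k → val (value k)) ∑) (λ i j → pairs (unit-value i) (unit-value j))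
      where
      pairs : ∀ {x y} → x ≡ one ⊎ x ≡ up ⊎ x ≡ down → y ≡ one ⊎ y ≡ up ⊎ y ≡ down → Positive (normSq (form (cosine x y)))
      pairs (inj₁ refl)        (inj₁ refl)        = positive-form-1
      pairs (inj₁ refl)        (inj₂ (inj₁ refl)) = hc
      pairs (inj₁ refl)        (inj₂ (inj₂ refl)) = hc
      pairs (inj₂ (inj₁ refl)) (inj₁ refl)        = hc
      pairs (inj₂ (inj₁ refl)) (inj₂ (inj₁ refl)) = positive-form-1
      pairs (inj₂ (inj₁ refl)) (inj₂ (inj₂ refl)) = hd
      pairs (inj₂ (inj₂ refl)) (inj₁ refl)        = hc
      pairs (inj₂ (inj₂ refl)) (inj₂ (inj₁ refl)) = hd
      pairs (inj₂ (inj₂ refl)) (inj₂ (inj₂ refl)) = positive-form-1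

  -- v = (1, ω, ω̄, 1, -1, 1, -1, …) with ω a primitive cube root of unity
  module Second (p : ℕ) (eq : m ≡ suc (suc (suc (double p)))) where
    open Design (ℚ.- ½) (ℚ.≤ᵇ⇒≤ _)

    private
      value : ℕ → Value
      value 0                   = one
      value 1                   = up
      value 2                   = down
      value (suc (suc (suc k))) = alternate one neg k

      ∑ : sumᶜ {suc (suc (suc (double p)))} (λ k → val (value (toℕ k))) ≃ᶜ 0ᶜ
      ∑ = ≃ᶜ-trans (+ᶜ-cong (≃ᶜ-refl {val one}) (≃ᶜ-trans (≃ᶜ-sym (ℂ-Ring.+-assoc (val up) (val down) rest))
          (+ᶜ-cong up+down (≃ᶜ-trans (sum-alternate one neg p) (≃ᶜ-trans (*ᶜ-congˡ (fromℚᶜ (ι p)) one+neg) (ℂ-Ring.zeroʳ (fromℚᶜ (ι p))))))))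
        (mk≃ᶜ (solve 0 (con 1ℚ :+ (con (ℚ.- ½ ℚ.+ ℚ.- ½) :+ con 0ℚ) := con 0ℚ) ≃-refl) (solve 0 (con 0ℚ :+ (con 0ℚ :+ con 0ℚ) := con 0ℚ) ≃-refl))
        where
        rest : ℂ
        rest = sumᶜ {double p} (λ k → val (alternate one neg (toℕ k)))

    second-signing : Positive (normSq (form (ℚ.- ½))) → Positive (normSq (form ½)) → HasFastSigning
    second-signing h₋ h₊ = signing-from value (sum-length eq (λ k → val (value k)) ∑) (λ i j → pairs (value i) (value j))
      where
      pairs : ∀ x y → Positive (normSq (form (cosine x y)))
      pairs one  one  = positive-form-1
      pairs one  neg  = positive-form-−1
      pairs one  up   = h₋
      pairs one  down = h₋
      pairs neg  one  = positive-form-−1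
      pairs neg  neg  = positive-form-1
      pairs neg  up   = h₊
      pairs neg  down = h₊
      pairs up   one  = h₋
      pairs up   neg  = h₊
      pairs up   up   = positive-form-1
      pairs up   down = h₋
      pairs down one  = h₋
      pairs down neg  = h₊
      pairs down up   = h₋
      pairs down down = positive-form-1

  -- A quadratic form that is bad for one of the two signings is good for the other.
  odd-case : ∀ p → m ≡ suc (double (suc (suc p))) → HasFastSigning
  odd-case p eq = choose (form-separates c (ℚ.- ½) -½<c) (form-separates ½ c c<½) (form-separates (ℚ.- ½) d d<-½) (form-separates ½ d d<½)
    where
    open First (suc (suc p)) eq (s≤s (s≤s z≤n))
    open Second (suc p) eq
    Good : ℚ → Set
    Good c = Positive (normSq (form c))
    choose : Good c ⊎ Good (ℚ.- ½) → Good ½ ⊎ Good c → Good (ℚ.- ½) ⊎ Good d → Good ½ ⊎ Good d → HasFastSigning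
    choose-d : Good c → Good (ℚ.- ½) ⊎ Good d → Good ½ ⊎ Good d → HasFastSigning
    choose (inj₁ hc) _         h₃ h₄ = choose-d hc h₃ h₄
    choose (inj₂ _)  (inj₂ hc) h₃ h₄ = choose-d hc h₃ h₄
    choose (inj₂ h₋) (inj₁ h₊) _  _  = second-signing h₋ h₊
    choose-d hc (inj₂ hd) _         = first-signing hc hd
    choose-d hc (inj₁ _)  (inj₂ hd) = first-signing hc hd
    choose-d hc (inj₁ h₋) (inj₁ h₊) = second-signing h₋ h₊

  theorem : HasFastSigning
  theorem = by-parity (half m)
    where
    by-parity : ∃[ p ] (m ≡ double p ⊎ m ≡ suc (double p)) → HasFastSigning
    by-parity (p , inj₁ eq) = even-case p eq
    by-parity (zero , inj₂ eq) = ⊥-elim (ℕ.<⇒≱ (s≤s (s≤s z≤n)) (subst (4 ℕ.≤_) eq 4≤m))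
    by-parity (suc zero , inj₂ eq) = ⊥-elim (ℕ.<⇒≱ (s≤s (s≤s (s≤s (s≤s z≤n)))) (subst (4 ℕ.≤_) eq 4≤m))
    by-parity (suc (suc p) , inj₂ eq) = odd-case p eq

corollary1 : ∃[ C ] (0ℝ < C ×
    (∀ (n : ℕ) → .{{_ : NonZero n}} → 5 ℕ.≤ n →
    Σ (UnitarySigning (K n)) λ σ →
    ∃[ r ] (IsSqrt (fromℕ (n ℕ.^ 3)) r ×
    LasVegasUniformMixing (scaledAdjacency σ) (C * r))))
corollary1 = fromℚ 20ℚ , (20ℚ , ℚ.positive⁻¹ 20ℚ , 0 , λ _ _ → ℚ.≤-reflexive (ℚ.+-identityˡ 20ℚ)) , λ where
    (suc m) (s≤s 4≤m) → let instance m≢0 = ℕ.>-nonZero (ℕ.≤-trans (s≤s z≤n) 4≤m)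
                            σ , mixes = Theorem.theorem m 4≤m
                        in σ , Theorem.root-n³ m 4≤m , Theorem.isSqrt-n³ m 4≤m , mixes
  where
  5ℚ 20ℚ : ℚ
  5ℚ = 1ℚ ℚ.+ 1ℚ ℚ.+ (1ℚ ℚ.+ 1ℚ) ℚ.+ 1ℚ
  20ℚ = (1ℚ ℚ.+ 1ℚ) ℚ.* (5ℚ ℚ.+ 5ℚ)
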